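{- Let $G$ be a finite group. Then $G$ has exactly $11$ cyclic subgroups if and only if $G$ is isomorphic to one of the following groups: $\mathbb{Z}_{p^{10}}$ for some prime $p$; $\mathbb{Z}_{27}\times\mathbb{Z}_3$; $\mathbb{Z}_{27}\rtimes\mathbb{Z}_3$; $Dic_7$; $\mathbb{Z}_7\rtimes\mathbb{Z}_9$; $\mathbb{Z}_3\times S_3$; $\mathbb{Z}_5\rtimes\mathbb{Z}_8$; $\mathbb{Z}_3\rtimes\mathbb{Z}_{16}$.
   Context: $\mathbb{Z}_n$ denotes the cyclic group of order $n$, and $S_3$ the symmetric group of degree $3$. $Dic_n$ denotes the dicyclic group of order $4n$, $\langle x,y \mid x^{2n}=1,\ y^2=x^n,\ yxy^{ -1}=x^{ -1}\rangle$; so $Dic_7$ has order $28$. A semidirect product $\mathbb{Z}_m\rtimes\mathbb{Z}_k$ denotes a non-abelian (nontrivial action) semidirect product with normal subgroup $\mathbb{Z}_m$: $\mathbb{Z}_{27}\rtimes\mathbb{Z}_3=\langle a,b\mid a^{27}=b^3=1,\ bab^{ -1}=a^{10}\rangle$ (the modular group of order $81$); $\mathbb{Z}_7\rtimes\mathbb{Z}_9$ is the group of order $63$ in which a generator of $\mathbb{Z}_9$ acts on $\mathbb{Z}_7$ by an automorphism of order $3$; $\mathbb{Z}_3\rtimes\mathbb{Z}_{16}$ is the group of order $48$ in which a generator of $\mathbb{Z}_{16}$ inverts $\mathbb{Z}_3$; $\mathbb{Z}_5\rtimes\mathbb{Z}_8=\langle a,b\mid a^5=b^8=1,\ bab^{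 -1}=a^{ -1}\rangle$ (order $40$). -}

module Defs where

open import Level using (Level; _⊔_; 0ℓ)
open import Data.Nat using (ℕ; zero; suc; _+_; _*_; _^_; _∸_)
open import Data.Nat.DivMod using (_%_; _/_; m%n<n)
open import Data.Integer using (ℤ; +_; -[1+_])
open import Data.Fin using (Fin; toℕ; fromℕ<)
open import Data.Fin.Permutation using (Permutation′; _∘ₚ_; _⟨$⟩ʳ_)
open import Data.Product using (Σ; ∃; _×_; _,_)
open import Function.Bundles using (Inverse)
open import Relation.Binary.PropositionalEquality using (_≡_)
import Relation.Binary.PropositionalEquality as ≡
open import Algebra.Bundles using (Group)
open import Algebra.Bundles.Raw using (RawMagma)
open import Algebra.Morphism.Structures using (module MagmaMorphisms)
import Algebra.Construct.DirectProduct as DP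

module _ {c ℓ : Level} (G : Group c ℓ) where
  open Group G

  IsFiniteGroup : Set (c ⊔ ℓ)
  IsFiniteGroup = Σ ℕ λ n → Inverse (≡.setoid (Fin n)) setoid

  powℕ : Carrier → ℕ → Carrier
  powℕ g zero    = ε
  powℕ g (suc n) = g ∙ powℕ g n

  powℤ : Carrier → ℤ → Carrier
  powℤ g (+ n)     = powℕ g n
  powℤ g -[1+ n ]  = (powℕ g (suc n)) ⁻¹

  _∈⟨_⟩ : Carrier → Carrier → Set ℓ
  h ∈⟨ g ⟩ = Σ ℤ λ z → h ≈ powℤ g z

  SameCyclic : Carrier → Carrier → Set (c ⊔ ℓ)
  SameCyclic g g' = ∀ h → ((h ∈⟨ g ⟩ → h ∈⟨ g' ⟩) × (h ∈⟨ g' ⟩ → h ∈⟨ g ⟩))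

  HasExactlyCyclicSubgroups : ℕ → Set (c ⊔ ℓ)
  HasExactlyCyclicSubgroups n =
    Σ (Fin n → Carrier) λ gen →
      (∀ i j → SameCyclic (gen i) (gen j) → i ≡ j) ×
      (∀ g → Σ (Fin n) λ i → SameCyclic g (gen i))

-- G is isomorphic to the (multiplication table) M: a bijective
-- multiplicative map, in the library's sense of magma isomorphism.
-- (Since G is a group, any such M is a group and this is a group isomorphism.)
_≅_ : ∀ {c ℓ a ℓ'} → Group c ℓ → RawMagma a ℓ' → Set (c ⊔ ℓ ⊔ a ⊔ ℓ')
G ≅ M = Σ (Group.Carrier G → RawMagma.Carrier M) λ f →
  MagmaMorphisms.IsMagmaIsomorphism (Group.rawMagma G) M f

modF : ∀ n → ℕ → Fin (suc n)
modF n x = fromℕ< (m%n<n x (suc n))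

cycOp : ∀ n → Fin n → Fin n → Fin n
cycOp (suc n) a b = modF n (toℕ a + toℕ b)

ℤ/ : ℕ → RawMagma 0ℓ 0ℓ
ℤ/ n = record { Carrier = Fin n ; _≈_ = _≡_ ; _∙_ = cycOp n }

-- The metacyclic group ⟨ x , y ∣ x^m = 1 , y^k = x^s , y x y⁻¹ = x^r ⟩,
-- with element (a , i) standing for x^a y^i (0 ≤ a < m, 0 ≤ i < k):
--   x^a y^i · x^c y^j = x^(a + r^i c + s·⌊(i+j)/k⌋) y^((i+j) mod k).
metaOp : ∀ m k (r s : ℕ) → Fin m × Fin k → Fin m × Fin k → Fin m × Fin k
metaOp (suc m) (suc k) r s (a , i) (c , j) =
  ( modF m (toℕ a + r ^ toℕ i * toℕ c + s * ((toℕ i + toℕ j) / suc k))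
  , modF k (toℕ i + toℕ j) )

Metacyclic : (m k r s : ℕ) → RawMagma 0ℓ 0ℓ
Metacyclic m k r s =
  record { Carrier = Fin m × Fin k ; _≈_ = _≡_ ; _∙_ = metaOp m k r s }

Semidirect : (m k r : ℕ) → RawMagma 0ℓ 0ℓ
Semidirect m k r = Metacyclic m k r 0

-- Dic_n = ⟨ x , y ∣ x^(2n) = 1 , y^2 = x^n , y x y⁻¹ = x⁻¹ ⟩ (order 4n)
Dic : ℕ → RawMagma 0ℓ 0ℓ
Dic n = Metacyclic (2 * n) 2 (2 * n ∸ 1) n   -- x⁻¹ = x^(2n-1)

S₃ : RawMagma 0ℓ 0ℓ
S₃ = record
  { Carrier = Permutation′ 3
  ; _≈_     = λ π σ → ∀ i → π ⟨$⟩ʳ i ≡ σ ⟨$⟩ʳ i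
  ; _∙_     = _∘ₚ_
  }

_×ᴹ_ : RawMagma 0ℓ 0ℓ → RawMagma 0ℓ 0ℓ → RawMagma 0ℓ 0ℓ
M ×ᴹ N = DP.rawMagma M N

{-# OPTIONS --safe #-}
module Submission where

open import Defs
open import Level using (Level; 0ℓ)
open import Algebra.Bundles using (Group)
open import Algebra.Bundles.Raw using (RawMagma)
open import Algebra.Core using (Op₁; Op₂)
import Algebra.Morphism.Construct.Composition as Composition
open import Algebra.Morphism.Structures using (module GroupMorphisms; module MagmaMorphisms)
import Algebra.Properties.Group
open import Algebra.Structures using (IsGroup; IsMagma)
open import Data.Bool as Bool using (Bool; true; false; not; _∧_; _∨_)
open import Data.Bool.Properties using (T?; ∨-zeroʳ)
open import Data.Empty using (⊥; ⊥-elim)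
open import Data.Fin as Fin using (Fin; toℕ; fromℕ<)
open import Data.Fin.Permutation as Perm using (Permutation′; _⟨$⟩ʳ_; _⟨$⟩ˡ_; _∘ₚ_; transpose)
import Data.Fin.Properties as Fin
import Data.Integer as ℤ
open import Data.List as List using (List; []; _∷_; _++_; allFin; cartesianProduct; cartesianProductWith; concatMap; filter; filterᵇ; length; map; replicate; upTo)
open import Data.List.Membership.Propositional using (_∈_; lose)
open import Data.List.Membership.Propositional.Properties
  using (∈-allFin; ∈-cartesianProduct⁺; ∈-cartesianProduct⁻; ∈-cartesianProductWith⁺; ∈-cartesianProductWith⁻; ∈-concatMap⁺; ∈-filter⁺; ∈-filter⁻; ∈-lookup; ∈-map⁺; ∈-map⁻; ∈-upTo⁺; ∈-upTo⁻)
import Data.List.Properties as List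
open import Data.List.Properties using (length-++; length-map)
open import Data.List.Relation.Unary.All as All using (All; []; _∷_)
import Data.List.Relation.Unary.All.Properties as All
open import Data.List.Relation.Unary.AllPairs using ([]; _∷_)
open import Data.List.Relation.Unary.Any as Any using (Any; here; there)
open import Data.List.Relation.Unary.Any.Properties using (lookup-index)
open import Data.List.Relation.Unary.Unique.Propositional using (Unique)
import Data.List.Relation.Unary.Unique.Propositional.Properties as Unique
open import Data.Nat hiding (_⊔_; _⊓_)
open import Data.Nat.Coprimality as Cop using (Coprime)
open import Data.Nat.DivMod
open import Data.Nat.Divisibility
open import Data.Nat.GCD using (module Bézout)
open import Data.Nat.Induction using (<-wellFounded)
open import Data.Nat.ListAction using (sum; product)
open import Data.Nat.Primality
open import Data.Nat.Primality.Factorisation using (factorise)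
open import Data.Nat.Properties
open import Data.Nat.Solver using (module +-*-Solver)
open import Data.Product using (Σ; ∃; ∃₂; _×_; _,_; proj₁; proj₂)
open import Data.Sum using (_⊎_; inj₁; inj₂; [_,_]′)
open import Data.Unit using (⊤; tt)
open import Data.Vec as Vec using (Vec; []; _∷_)
open import Function using (_∘_; case_of_; id)
open import Function.Bundles using (_⇔_; mk⇔; module Inverse)
open import Induction.WellFounded using (Acc; acc)
open import Relation.Binary.Definitions using (DecidableEquality; tri<; tri≈; tri>)
open import Relation.Binary.PropositionalEquality hiding ([_])
open import Relation.Nullary using (¬_; Dec; yes; no; contradiction; ¬?; _×-dec_; _→-dec_; _⊎-dec_)
open import Relation.Nullary.Decidable using (from-yes; map′; toWitness)
open import Relation.Unary using (Decidable)

-- All counts are of cyclic subgroups, that is of classes of elements that generate each other. If every p-element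
-- commuted with every p′-element, the number of cyclic subgroups would be the product of the numbers for the p- and the
-- p′-elements; so the primality of 11 provides noncommuting pairs unless G is a p-group. A subgroup ⟨z⟩ of prime order p
-- is either the only one of its order or accompanied by p others. When some unique ⟨z⟩ is not central, the conjugates
-- of a q-element moving z use up so many of the 11 subgroups that G = ⟨z⟩ ⋊ ⟨y⟩ with ord y = q ^ b and p + 2 b = 11;
-- when none is unique, only the primes 2 and 3 fit and G is ℤ₃ × S₃. In a p-group with n_i subgroups of order p ^ i,
-- the order 1 + (p - 1) Σ p ^ (i - 1) n_i must be a power of p while Σ n_i = 10, which leaves the cyclic group and a few
-- profiles for p = 2, 3. Conversely each metacyclic table is counted by evaluation.

-- The argument stays with elements, containment of cyclic subgroups and conjugation; neither Sylow
-- subgroups nor quotient groups occur. Two counts take their place. Conjugation by g permutes the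
-- cyclic subgroups; if g ^ p acts trivially, the orbits have length 1 or p, so a family without a
-- subgroup normalised by g has size divisible by p. And if ⟨z⟩ is the only subgroup of order p,
-- multiplication by z pairs the p′-subgroups of its centraliser with those whose p-part is ⟨z⟩. For
-- central z this reads 11 = 2 u + w, where w counts orders divisible by p²; a noncommuting pair
-- forces w ≥ 2, hence u ≤ 4. What remains is settled by adding up subgroups of distinct orders
-- until 11 is exceeded. In a p-group, uniqueness climbs: n_(k+1), if not zero, is 1 modulo p, so
-- one subgroup of order p ^ (k + 1) is normal, and a commutator computation puts every other one
-- inside it. The obstacle is p = 2, where this starts only at k = 2: groups with one involution but
-- several subgroups of order 4 have to be excluded by a separate count.

module _ where

  -- Duplicate-free lists and counting in `Fin n`.

  private variable
    A B : Set
    P Q : A → Set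

  remove : ∀ {x : A} {ys} → x ∈ ys → List A
  remove {ys = _ ∷ ys} (here _)  = ys
  remove {ys = y ∷ _}  (there p) = y ∷ remove p

  length-remove : ∀ {x : A} {ys} (p : x ∈ ys) → length ys ≡ suc (length (remove p))
  length-remove (here _)  = refl
  length-remove (there p) = cong suc (length-remove p)

  ∈-remove : ∀ {x y : A} {ys} (p : x ∈ ys) → y ∈ ys → y ≢ x → y ∈ remove p
  ∈-remove (here refl) (here eq) ne = contradiction eq ne
  ∈-remove (here _)    (there q) ne = q
  ∈-remove (there p)   (here eq) ne = here eq
  ∈-remove (there p)   (there q) ne = there (∈-remove p q ne)

  length-⊆ : ∀ {xs ys : List A} → Unique xs → (∀ {x} → x ∈ xs → x ∈ ys) → length xs ≤ length ys
  length-⊆ []         sub = z≤n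
  length-⊆ {xs = x ∷ xs} (px ∷ u) sub rewrite length-remove (sub (here refl)) =
    s≤s (length-⊆ u λ q → ∈-remove (sub (here refl)) (sub (there q)) λ { refl → All.lookup px q refl })

  -- A missed y could be put in front of xs, giving a duplicate-free list inside ys that is longer
  -- than ys.
  length-⊆-complete : DecidableEquality A → ∀ {xs ys : List A} → Unique xs → (∀ {x} → x ∈ xs → x ∈ ys) →
                      length ys ≤ length xs → ∀ {y} → y ∈ ys → y ∈ xs
  length-⊆-complete _≟A_ {xs} u sub le {y} q with Any.any? (y ≟A_) xs
  ... | yes p = p
  ... | no ¬p = contradiction (length-⊆ (All.tabulate (λ x∈ e → ¬p (subst (_∈ xs) (sym e) x∈)) ∷ u) sub′) (<⇒≱ (s≤s le))
    where
    sub′ : ∀ {x} → x ∈ y ∷ xs → x ∈ _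
    sub′ (here refl) = q
    sub′ (there x∈)  = sub x∈

  Unique-map⁺ : (f : A → B) {xs : List A} → (∀ {x y} → x ∈ xs → y ∈ xs → f x ≡ f y → x ≡ y) →
                Unique xs → Unique (map f xs)
  Unique-map⁺ f inj [] = []
  Unique-map⁺ f inj (px ∷ u) =
    All.map⁺ (All.tabulate λ q e → All.lookup px q (inj (here refl) (there q) e))
    ∷ Unique-map⁺ f (λ p q → inj (there p) (there q)) u

  length-inj : (f : A → B) {xs : List A} {ys : List B} → Unique xs →
               (∀ {x y} → x ∈ xs → y ∈ xs → f x ≡ f y → x ≡ y) →
               (∀ {x} → x ∈ xs → f x ∈ ys) → length xs ≤ length ys
  length-inj f {xs} u inj mem = subst (_≤ _) (length-map f xs)
    (length-⊆ (Unique-map⁺ f inj u) λ q → let (x , x∈ , e) = ∈-map⁻ f q in subst (_∈ _) (sym e) (mem x∈))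

  length-filter-split : {P : A → Set} (P? : Decidable P) (xs : List A) →
    length xs ≡ length (filter P? xs) + length (filter (¬? ∘ P?) xs)
  length-filter-split P? [] = refl
  length-filter-split P? (x ∷ xs) with P? x
  ... | yes _ = cong suc (length-filter-split P? xs)
  ... | no  _ = trans (cong suc (length-filter-split P? xs)) (sym (+-suc _ _))

  count : ∀ {n} {P : Fin n → Set} → Decidable P → ℕ
  count {n} P? = length (filter P? (allFin n))

  allFin-length : ∀ n → length (allFin n) ≡ n
  allFin-length n = List.length-tabulate id

  module _ {n} {P : Fin n → Set} (P? : Decidable P) where
    ∈-count⁺ : ∀ {i} → P i → i ∈ filter P? (allFin n)
    ∈-count⁺ {i} = ∈-filter⁺ P? (∈-allFin i)

    ∈-count⁻ : ∀ {i} → i ∈ filter P? (allFin n) → P i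
    ∈-count⁻ q = proj₂ (∈-filter⁻ P? {xs = allFin n} q)

    Unique-count : Unique (filter P? (allFin n))
    Unique-count = Unique.filter⁺ P? (Unique.allFin⁺ n)

    count≤ : count P? ≤ n
    count≤ = subst (count P? ≤_) (allFin-length n) (length-⊆ Unique-count λ _ → ∈-allFin _)

    count-≥ : {xs : List A} (f : A → Fin n) → Unique xs →
              (∀ {x y} → x ∈ xs → y ∈ xs → f x ≡ f y → x ≡ y) → (∀ {x} → x ∈ xs → P (f x)) → length xs ≤ count P?
    count-≥ f u inj h = length-inj f u inj (∈-count⁺ ∘ h)

    count-≤ : {ys : List (Fin n)} → (∀ i → P i → i ∈ ys) → count P? ≤ length ys
    count-≤ h = length-⊆ Unique-count λ q → h _ (∈-count⁻ q)

    count≡0 : (∀ i → ¬ P i) → count P? ≡ 0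
    count≡0 h = n≤0⇒n≡0 (count-≤ {ys = []} λ i p → contradiction p (h i))

    count≢0 : ∀ i → P i → 1 ≤ count P?
    count≢0 i p = count-≥ {xs = i ∷ []} id ([] ∷ []) (λ { (here refl) (here refl) _ → refl }) λ { (here refl) → p }

    count-pos : 1 ≤ count P? → ∃ P
    count-pos le with filter P? (allFin n) in eq
    ... | x ∷ _ = x , ∈-count⁻ (subst (x ∈_) (sym eq) (here refl))

    count≡1 : count P? ≡ 1 → ∀ i j → P i → P j → i ≡ j
    count≡1 e i j p q with i Fin.≟ j
    ... | yes i≡j = i≡j
    ... | no  i≢j = contradiction
      (subst (2 ≤_) e (count-≥ {xs = i ∷ j ∷ []} id ((i≢j ∷ []) ∷ ([] ∷ []))
         (λ _ _ eq → eq) λ { (here refl) → p ; (there (here refl)) → q })) λ { (s≤s ()) }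

  module _ {m n} {P : Fin m → Set} {Q : Fin n → Set} (P? : Decidable P) (Q? : Decidable Q) where
    count-mono : (f : Fin m → Fin n) → (∀ {i j} → P i → P j → f i ≡ f j → i ≡ j) → (∀ {i} → P i → Q (f i)) →
                 count P? ≤ count Q?
    count-mono f inj h = count-≥ Q? f (Unique-count P?)
      (λ p q → inj (∈-count⁻ P? p) (∈-count⁻ P? q)) (h ∘ ∈-count⁻ P?)

  module _ {n} {P Q : Fin n → Set} (P? : Decidable P) (Q? : Decidable Q) where
    count-⊆ : (∀ {i} → P i → Q i) → count P? ≤ count Q?
    count-⊆ h = count-mono P? Q? id (λ _ _ e → e) h

    filter-filter : ∀ (xs : List (Fin n)) → filter Q? (filter P? xs) ≡ filter (λ i → P? i ×-dec Q? i) xs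
    filter-filter [] = refl
    filter-filter (x ∷ xs) with P? x
    ... | no _ = filter-filter xs
    ... | yes _ with Q? x
    ...   | yes _ = cong (x ∷_) (filter-filter xs)
    ...   | no _  = filter-filter xs

  module _ {n} {P Q : Fin n → Set} (P? : Decidable P) (Q? : Decidable Q) where
    count-ext : (∀ {i} → P i → Q i) → (∀ {i} → Q i → P i) → count P? ≡ count Q?
    count-ext f g = ≤-antisym (count-⊆ P? Q? f) (count-⊆ Q? P? g)

    count-split : count P? ≡ count (λ i → P? i ×-dec Q? i) + count (λ i → P? i ×-dec ¬? (Q? i))
    count-split = trans (length-filter-split Q? (filter P? (allFin n)))
      (cong₂ (λ a b → length a + length b) (filter-filter P? Q? (allFin n)) (filter-filter P? (¬? ∘ Q?) (allFin n)))

  count-compl : ∀ {n} {P : Fin n → Set} (P? : Decidable P) → n ≡ count P? + count (¬? ∘ P?)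
  count-compl {n} P? = trans (sym (allFin-length n)) (length-filter-split P? (allFin n))


  filter-⊆-≡ : {P Q : A → Set} (P? : Decidable P) (Q? : Decidable Q) (xs : List A) →
               (∀ {x} → x ∈ xs → (P x → Q x) × (Q x → P x)) → filter P? xs ≡ filter Q? xs
  filter-⊆-≡ P? Q? [] h = refl
  filter-⊆-≡ P? Q? (x ∷ xs) h with P? x | Q? x
  ... | yes _ | yes _ = cong (x ∷_) (filter-⊆-≡ P? Q? xs (h ∘ there))
  ... | no _  | no _  = filter-⊆-≡ P? Q? xs (h ∘ there)
  ... | yes p | no ¬q = contradiction (proj₁ (h (here refl)) p) ¬q
  ... | no ¬p | yes q = contradiction (proj₂ (h (here refl)) q) ¬p

  filter-comm : {P Q : A → Set} (P? : Decidable P) (Q? : Decidable Q) (xs : List A) →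
                filter P? (filter Q? xs) ≡ filter Q? (filter P? xs)
  filter-comm P? Q? [] = refl
  filter-comm P? Q? (x ∷ xs) with P? x in eqp | Q? x in eqq
  ... | yes p | yes q rewrite eqp | eqq = cong (x ∷_) (filter-comm P? Q? xs)
  ... | yes p | no ¬q rewrite eqq = filter-comm P? Q? xs
  ... | no ¬p | yes q rewrite eqp = filter-comm P? Q? xs
  ... | no ¬p | no ¬q = filter-comm P? Q? xs

  module _ {A : Set} {R : A → A → Set} (R? : ∀ x y → Dec (R x y))
           (R-refl : ∀ x → R x x) (R-sym : ∀ {x y} → R x y → R y x) (R-trans : ∀ {x y z} → R x y → R y z → R x z)
           {S : A → Set} (S? : Decidable S) (M : ℕ) where

    -- Whole R-classes are removed: an element of S is alone in its class and counts once, every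
    -- other class has a size divisible by M. The same count serves the orbits of a map of prime
    -- period and the conjugation orbits in a p-group.
    length-mod : ∀ (xs : List A) → Unique xs → (∀ {x} → x ∈ xs → S x → ∀ {y} → y ∈ xs → R x y → x ≡ y) →
      (∀ {x y} → R x y → S x → S y) →
      (∀ {x} → x ∈ xs → ¬ S x → M ∣ length (filter (R? x) xs)) →
      ∃ λ k → length xs ≡ length (filter S? xs) + k * M
    length-mod xs = go xs (<-wellFounded _)
      where
      go : ∀ (xs : List A) → Acc _<_ (length xs) → Unique xs → (∀ {x} → x ∈ xs → S x → ∀ {y} → y ∈ xs → R x y → x ≡ y) →
        (∀ {x y} → R x y → S x → S y) →
        (∀ {x} → x ∈ xs → ¬ S x → M ∣ length (filter (R? x) xs)) →
        ∃ λ k → length xs ≡ length (filter S? xs) + k * M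
      go [] _ _ _ _ _ = 0 , refl
      go xs₀@(x ∷ xs) (acc rs) (px ∷ u) alone inv cls with S? x
      ... | yes s = let k , e = go xs (rs ≤-refl) u (λ p s q → alone (there p) s (there q)) inv cls′ in k , cong suc e
        where
        cls′ : ∀ {y} → y ∈ xs → ¬ S y → M ∣ length (filter (R? y) xs)
        cls′ {y} q ¬s with cls (there q) ¬s
        ... | d with R? y x
        ...   | no _ = d
        ...   | yes r = contradiction (inv (R-sym r) s) ¬s
      ... | no ¬s = let k , e = rec in
          k + _∣_.quotient class , trans split (trans (cong₂ _+_ (_∣_.equality class) e) (trans (cong (λ v → _∣_.quotient class * M + (v + k * M)) fixeq) (arith (_∣_.quotient class) k (length (filter S? xs)))))
        where
        open +-*-Solver
        class = cls (here refl) ¬s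
        rest = filter (¬? ∘ R? x) (x ∷ xs)
        split : length xs₀ ≡ length (filter (R? x) xs₀) + length rest
        split = length-filter-split (R? x) xs₀
        arith : ∀ c k l → c * M + (l + k * M) ≡ l + (k + c) * M
        arith c k l = solve 4 (λ c k l m → c :* m :+ (l :+ k :* m) := l :+ (k :+ c) :* m) refl c k l M
        small : length rest < length xs₀
        small = subst (length rest <_) (sym split)
          (+-monoˡ-< (length rest) {0} (filt (R-refl x)))
          where
          filt : R x x → 0 < length (filter (R? x) xs₀)
          filt r with R? x x
          ... | yes _ = s≤s z≤n
          ... | no ¬r = contradiction r ¬r
        mem : ∀ {y} → y ∈ rest → y ∈ xs₀
        mem q = proj₁ (∈-filter⁻ (¬? ∘ R? x) {xs = xs₀} q)
        nr : ∀ {y} → y ∈ rest → ¬ R x y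
        nr q = proj₂ (∈-filter⁻ (¬? ∘ R? x) {xs = xs₀} q)
        fixeq : length (filter S? rest) ≡ length (filter S? xs)
        fixeq = cong length (trans (filter-comm S? (¬? ∘ R? x) xs₀) (trans (lem) refl))
          where
          lem : filter (¬? ∘ R? x) (filter S? xs₀) ≡ filter S? xs
          lem with S? x
          ... | yes s = contradiction s ¬s
          ... | no _ = trans (filter-⊆-≡ (¬? ∘ R? x) S? (filter S? xs)
               (λ q → (λ _ → proj₂ (∈-filter⁻ S? {xs = xs} q)) ,
                  λ s r → ¬s (inv (R-sym r) s))) (idem xs)
            where
            idem : ∀ xs → filter S? (filter S? xs) ≡ filter S? xs
            idem [] = refl
            idem (y ∷ ys) with S? y in eq
            ... | no _ = idem ys
            ... | yes _ rewrite eq = cong (y ∷_) (idem ys)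
        rec : ∃ λ k → length rest ≡ length (filter S? rest) + k * M
        rec = go rest (rs small) (Unique.filter⁺ (¬? ∘ R? x) (px ∷ u))
          (λ p s q → alone (mem p) s (mem q)) inv
          λ {y} q ¬sy → subst (λ l → M ∣ length l)
            (trans (sym (filter-⊆-≡ (λ v → R? y v) (R? y) xs₀ (λ _ → id , id)))
              (sym (trans (filter-comm (R? y) (¬? ∘ R? x) xs₀)
                (trans (filter-⊆-≡ (¬? ∘ R? x) (R? y) (filter (R? y) xs₀)
                  (λ w → (λ _ → proj₂ (∈-filter⁻ (R? y) {xs = xs₀} w)) , λ r r′ → nr q (R-trans r′ (R-sym r))))
                  (idem y xs₀)))))
            (cls (mem q) ¬sy)
          where
          idem : ∀ y xs → filter (R? y) (filter (R? y) xs) ≡ filter (R? y) xs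
          idem y [] = refl
          idem y (v ∷ vs) with R? y v in eq
          ... | no _ = idem y vs
          ... | yes _ rewrite eq = cong (v ∷_) (idem y vs)

-- Coprimality and maps of prime period.

prime∤⇒coprime : ∀ {p n} → Prime p → ¬ p ∣ n → Coprime p n
prime∤⇒coprime {p} pr p∤n {d} (d∣p , d∣n) with prime⇒irreducible pr d∣p
... | inj₁ d≡1 = d≡1
... | inj₂ refl = contradiction d∣n p∤n

prime>1 : ∀ {p} → Prime p → 1 < p
prime>1 pr = nonTrivial⇒n>1 _ {{prime⇒nonTrivial pr}}

prime>0 : ∀ {p} → Prime p → 0 < p
prime>0 pr = <-trans z<s (prime>1 pr)

module Iterate {X : Set} (σ : X → X) where
  iter : ℕ → X → X
  iter zero    x = x
  iter (suc k) x = σ (iter k x)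

  iter-+ : ∀ m n x → iter (m + n) x ≡ iter m (iter n x)
  iter-+ zero    n x = refl
  iter-+ (suc m) n x = cong σ (iter-+ m n x)

  iter-* : ∀ a {x} → iter a x ≡ x → ∀ m → iter (m * a) x ≡ x
  iter-* a e zero    = refl
  iter-* a e (suc m) = trans (iter-+ a (m * a) _) (trans (cong (iter a) (iter-* a e m)) e)

  -- By Bézout some multiples of the periods a and b differ by one, and both lead from x back to x;
  -- the extra step is σ.
  iter-coprime : ∀ {a b x} → Coprime a b → iter a x ≡ x → iter b x ≡ x → σ x ≡ x
  iter-coprime {a} {b} {x} c ea eb with Cop.coprime-Bézout c
  ... | Bézout.+- u v eq = trans (cong σ (sym (iter-* b eb v))) (trans (cong (λ k → iter k x) eq) (iter-* a ea u))
  ... | Bézout.-+ u v eq = trans (cong σ (sym (iter-* a ea u))) (trans (cong (λ k → iter k x) eq) (iter-* b eb v))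

  iter-distinct : ∀ {p x} → Prime p → iter p x ≡ x → σ x ≢ x → ∀ {i j} → i < j → j < p → iter i x ≢ iter j x
  iter-distinct {p} {x} pr per ne {i} {j} i<j j<p e = ne (iter-coprime cop per fix)
    where
    -- Instead of cancelling i steps, both sides run on by p ∸ i steps, to where x returns.
    fix : iter (j ∸ i) x ≡ x
    fix = begin
      iter (j ∸ i) x                      ≡⟨ cong (iter (j ∸ i)) (per) ⟨
      iter (j ∸ i) (iter p x)             ≡⟨ iter-+ (j ∸ i) p x ⟨
      iter (j ∸ i + p) x                  ≡⟨ cong (λ v → iter v x) (trans (+-comm (j ∸ i) p) (lem)) ⟩
      iter (p ∸ i + j) x                  ≡⟨ iter-+ (p ∸ i) j x ⟩
      iter (p ∸ i) (iter j x)             ≡⟨ cong (iter (p ∸ i)) e ⟨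
      iter (p ∸ i) (iter i x)             ≡⟨ iter-+ (p ∸ i) i x ⟨
      iter (p ∸ i + i) x                  ≡⟨ cong (λ v → iter v x) (m∸n+n≡m (<⇒≤ (<-trans i<j j<p))) ⟩
      iter p x                            ≡⟨ per ⟩
      x ∎
      where
      open ≡-Reasoning
      lem : p + (j ∸ i) ≡ p ∸ i + j
      lem = trans (sym (+-∸-assoc p (<⇒≤ i<j))) (trans (cong (_∸ i) (+-comm p j))
         (trans (+-∸-assoc j (<⇒≤ (<-trans i<j j<p))) (+-comm j (p ∸ i))))
    cop : Coprime p (j ∸ i)
    cop = Cop.prime⇒coprime pr {{>-nonZero (m<n⇒0<n∸m i<j)}} (≤-<-trans (m∸n≤m j i) j<p)

  iter-injective : ∀ {p x} → Prime p → iter p x ≡ x → σ x ≢ x → ∀ {i j : Fin p} → iter (toℕ i) x ≡ iter (toℕ j) x → i ≡ j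
  iter-injective pr per ne {i} {j} e with <-cmp (toℕ i) (toℕ j)
  ... | tri< lt _ _ = contradiction e (iter-distinct pr per ne lt (Fin.toℕ<n j))
  ... | tri≈ _ eq _ = Fin.toℕ-injective eq
  ... | tri> _ _ gt = contradiction (sym e) (iter-distinct pr per ne gt (Fin.toℕ<n i))

  module Periodic (_≟X_ : DecidableEquality X) (p : ℕ) (pr : Prime p) (per : ∀ x → iter p x ≡ x) where
    instance _ = prime⇒nonZero pr

    iter-% : ∀ k x → iter k x ≡ iter (k % p) x
    iter-% k x = trans (cong (λ v → iter v x) (m≡m%n+[m/n]*n k p))
      (trans (iter-+ (k % p) (k / p * p) x) (cong (iter (k % p)) (iter-* p (per x) (k / p))))

    R : X → X → Set
    R x y = ∃ λ (k : Fin p) → iter (toℕ k) x ≡ y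

    R? : ∀ x y → Dec (R x y)
    R? x y = Fin.any? λ k → iter (toℕ k) x ≟X y

    R-iter : ∀ k x → R x (iter k x)
    R-iter k x = fromℕ< (m%n<n k p) , trans (cong (λ v → iter v x) (Fin.toℕ-fromℕ< (m%n<n k p))) (sym (iter-% k x))

    R-refl : ∀ x → R x x
    R-refl x = R-iter 0 x

    R-trans : ∀ {x y z} → R x y → R y z → R x z
    R-trans {x} (k , refl) (l , refl) = subst (R x) (iter-+ (toℕ l) (toℕ k) x) (R-iter (toℕ l + toℕ k) x)

    R-sym : ∀ {x y} → R x y → R y x
    R-sym {x} (k , refl) = subst (R _)
      (trans (sym (iter-+ (p ∸ toℕ k) (toℕ k) x)) (trans (cong (λ v → iter v x) (m∸n+n≡m (<⇒≤ (Fin.toℕ<n k)))) (per x)))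
      (R-iter (p ∸ toℕ k) (iter (toℕ k) x))

    orbit-length : ∀ {x} → σ x ≢ x → (xs : List X) → Unique xs → (∀ {y} → y ∈ xs → σ y ∈ xs) → x ∈ xs →
                   length (filter (R? x) xs) ≡ p
    orbit-length {x} ne xs u cl x∈ = ≤-antisym
      (subst (length (filter (R? x) xs) ≤_) (trans (length-map it (allFin p)) (allFin-length p))
        (length-⊆ (Unique.filter⁺ (R? x) u) λ q → case proj₂ (∈-filter⁻ (R? x) {xs = xs} q) of λ { (k , refl) → ∈-map⁺ it (∈-allFin k) }))
      (subst (_≤ length (filter (R? x) xs)) (allFin-length p) (length-inj it (Unique.allFin⁺ p) (λ _ _ → iter-injective pr (per x) ne)
        λ {k} _ → ∈-filter⁺ (R? x) (mem (toℕ k)) (k , refl)))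
      where
      it : Fin p → X
      it k = iter (toℕ k) x
      mem : ∀ k → iter k x ∈ xs
      mem zero    = x∈
      mem (suc k) = cl (mem k)

    fixed? : Decidable (λ x → σ x ≡ x)
    fixed? x = σ x ≟X x

    σ-fixed : ∀ {x} → σ x ≡ x → ∀ k → iter k x ≡ x
    σ-fixed e zero = refl
    σ-fixed e (suc k) = trans (cong σ (σ-fixed e k)) e

    length≡fixed : (xs : List X) → Unique xs → (∀ {y} → y ∈ xs → σ y ∈ xs) →
                   ∃ λ k → length xs ≡ length (filter fixed? xs) + k * p
    length≡fixed xs u cl = length-mod R? R-refl R-sym R-trans fixed? p xs u
      (λ { _ e _ (k , refl) → sym (σ-fixed e (toℕ k)) })
      (λ { {x} (k , refl) e → trans (cong σ (σ-fixed e (toℕ k))) (trans e (sym (σ-fixed e (toℕ k)))) })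
      λ x∈ ne → ∣-reflexive (sym (orbit-length ne xs u cl x∈))

-- Finite groups on `Fin N` and free reduction of group words.

record FinGroup : Set where
  infixl 7 _∙_
  infix 9 _⁻¹
  field
    N       : ℕ
    _∙_     : Op₂ (Fin N)
    ε       : Fin N
    _⁻¹     : Op₁ (Fin N)
    isGroup : IsGroup _≡_ _∙_ ε _⁻¹

  group : Group 0ℓ 0ℓ
  group = record { isGroup = isGroup }

-- Equality of group words is decided by free reduction.
module GroupWord (𝔾 : FinGroup) where
  open FinGroup 𝔾
  open IsGroup isGroup using (assoc; identityˡ; identityʳ; inverseˡ; inverseʳ; ∙-congˡ; ∙-congʳ)
  open ≡-Reasoning
  private Carrier = Fin N

  infixl 7 _:∙_
  data Word (n : ℕ) : Set where
    var  : Fin n → Word n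
    _:∙_ : Word n → Word n → Word n
    neg  : Word n → Word n
    one  : Word n

  ⟦_⟧ : ∀ {n} → Word n → Vec Carrier n → Carrier
  ⟦ var i ⟧  ρ = Vec.lookup ρ i
  ⟦ a :∙ b ⟧ ρ = ⟦ a ⟧ ρ ∙ ⟦ b ⟧ ρ
  ⟦ neg a ⟧  ρ = ⟦ a ⟧ ρ ⁻¹
  ⟦ one ⟧    ρ = ε

  private
    Letter : ℕ → Set
    Letter n = Bool × Fin n

    letter : ∀ {n} → Letter n → Vec Carrier n → Carrier
    letter (true  , i) ρ = Vec.lookup ρ i
    letter (false , i) ρ = Vec.lookup ρ i ⁻¹

    letters : ∀ {n} → List (Letter n) → Vec Carrier n → Carrier
    letters []       ρ = ε
    letters (l ∷ ls) ρ = letter l ρ ∙ letters ls ρ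

    push : ∀ {n} → Letter n → List (Letter n) → List (Letter n)
    push l [] = l ∷ []
    push (b , i) ((c , j) ∷ ls) with i Fin.≟ j | b | c
    ... | yes _ | true  | false = ls
    ... | yes _ | false | true  = ls
    ... | _     | _     | _     = (b , i) ∷ (c , j) ∷ ls

    push-sound : ∀ {n} l (ls : List (Letter n)) ρ → letters (push l ls) ρ ≡ letter l ρ ∙ letters ls ρ
    push-sound l [] ρ = refl
    push-sound (b , i) ((c , j) ∷ ls) ρ with i Fin.≟ j | b | c
    ... | yes refl | true  | false = begin
      letters ls ρ                                          ≡⟨ identityˡ _ ⟨
      ε ∙ letters ls ρ                                      ≡⟨ ∙-congʳ (inverseʳ _) ⟨
      (Vec.lookup ρ i ∙ Vec.lookup ρ i ⁻¹) ∙ letters ls ρ   ≡⟨ assoc _ _ _ ⟩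
      Vec.lookup ρ i ∙ (Vec.lookup ρ i ⁻¹ ∙ letters ls ρ)   ∎
    ... | yes refl | false | true  = begin
      letters ls ρ                                          ≡⟨ identityˡ _ ⟨
      ε ∙ letters ls ρ                                      ≡⟨ ∙-congʳ (inverseˡ _) ⟨
      (Vec.lookup ρ i ⁻¹ ∙ Vec.lookup ρ i) ∙ letters ls ρ   ≡⟨ assoc _ _ _ ⟩
      Vec.lookup ρ i ⁻¹ ∙ (Vec.lookup ρ i ∙ letters ls ρ)   ∎
    ... | yes refl | true  | true  = refl
    ... | yes refl | false | false = refl
    ... | no _       | true  | true  = refl
    ... | no _       | true  | false = refl
    ... | no _       | false | true  = refl
    ... | no _       | false | false = refl

    -- run s a k appends a, or its inverse when s is false, in front of k.
    run : ∀ {n} → Bool → Word n → List (Letter n) → List (Letter n)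
    run s     (var i)  k = push (s , i) k
    run true  (a :∙ b) k = run true a (run true b k)
    run false (a :∙ b) k = run false b (run false a k)
    run true  (neg a)  k = run false a k
    run false (neg a)  k = run true a k
    run s     one      k = k

    signed : Bool → Carrier → Carrier
    signed true  x = x
    signed false x = x ⁻¹

    open Algebra.Properties.Group group using (⁻¹-anti-homo-∙; ⁻¹-involutive; ε⁻¹≈ε)

    run-sound : ∀ {n} s (a : Word n) k ρ → letters (run s a k) ρ ≡ signed s (⟦ a ⟧ ρ) ∙ letters k ρ
    run-sound true  (var i) k ρ = push-sound (true , i) k ρ
    run-sound false (var i) k ρ = push-sound (false , i) k ρ
    run-sound true  (a :∙ b) k ρ = begin
      letters (run true a (run true b k)) ρ      ≡⟨ run-sound true a _ ρ ⟩
      ⟦ a ⟧ ρ ∙ letters (run true b k) ρ         ≡⟨ ∙-congˡ (run-sound true b k ρ) ⟩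
      ⟦ a ⟧ ρ ∙ (⟦ b ⟧ ρ ∙ letters k ρ)          ≡⟨ assoc _ _ _ ⟨
      ⟦ a ⟧ ρ ∙ ⟦ b ⟧ ρ ∙ letters k ρ            ∎
    run-sound false (a :∙ b) k ρ = begin
      letters (run false b (run false a k)) ρ        ≡⟨ run-sound false b _ ρ ⟩
      ⟦ b ⟧ ρ ⁻¹ ∙ letters (run false a k) ρ         ≡⟨ ∙-congˡ (run-sound false a k ρ) ⟩
      ⟦ b ⟧ ρ ⁻¹ ∙ (⟦ a ⟧ ρ ⁻¹ ∙ letters k ρ)        ≡⟨ assoc _ _ _ ⟨
      ⟦ b ⟧ ρ ⁻¹ ∙ ⟦ a ⟧ ρ ⁻¹ ∙ letters k ρ          ≡⟨ ∙-congʳ (⁻¹-anti-homo-∙ _ _) ⟨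
      (⟦ a ⟧ ρ ∙ ⟦ b ⟧ ρ) ⁻¹ ∙ letters k ρ           ∎
    run-sound true  (neg a) k ρ = run-sound false a k ρ
    run-sound false (neg a) k ρ = begin
      letters (run true a k) ρ            ≡⟨ run-sound true a k ρ ⟩
      ⟦ a ⟧ ρ ∙ letters k ρ               ≡⟨ ∙-congʳ (⁻¹-involutive _) ⟨
      ⟦ a ⟧ ρ ⁻¹ ⁻¹ ∙ letters k ρ         ∎
    run-sound true  one k ρ = sym (identityˡ _)
    run-sound false one k ρ = begin
      letters k ρ            ≡⟨ identityˡ _ ⟨
      ε ∙ letters k ρ        ≡⟨ ∙-congʳ ε⁻¹≈ε ⟨
      ε ⁻¹ ∙ letters k ρ     ∎

  -- Both words reduce to the same list of letters whatever ρ is, so every use supplies `refl`.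
  word : ∀ {n} (a b : Word n) (ρ : Vec Carrier n) → run true a [] ≡ run true b [] → ⟦ a ⟧ ρ ≡ ⟦ b ⟧ ρ
  word a b ρ e = begin
    ⟦ a ⟧ ρ                    ≡⟨ identityʳ _ ⟨
    ⟦ a ⟧ ρ ∙ ε                ≡⟨ run-sound true a [] ρ ⟨
    letters (run true a []) ρ  ≡⟨ cong (λ l → letters l ρ) e ⟩
    letters (run true b []) ρ  ≡⟨ run-sound true b [] ρ ⟩
    ⟦ b ⟧ ρ ∙ ε                ≡⟨ identityʳ _ ⟩
    ⟦ b ⟧ ρ                    ∎

least : {P : ℕ → Set} → Decidable P → ∀ n → P n → ∃ λ m → P m × (∀ {k} → k < m → ¬ P k)
least {P} P? n p with P? 0
... | yes p₀ = 0 , p₀ , λ ()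
least {P} P? zero    p | no ¬p₀ = contradiction p ¬p₀
least {P} P? (suc n) p | no ¬p₀ with least (P? ∘ suc) n p
... | m , pm , min = suc m , pm , λ { {zero} _ → ¬p₀ ; {suc k} (s≤s lt) → min lt }

-- Bézout's identity with the negative term moved across, so that no subtraction occurs
coprime-bezout : ∀ {a b} → Coprime a b → ∃₂ λ u v → u * a ≡ 1 + v * b ⊎ 1 + u * a ≡ v * b
coprime-bezout c with Cop.coprime-Bézout c
... | Bézout.+- u v eq = u , v , inj₁ (sym eq)
... | Bézout.-+ u v eq = u , v , inj₂ eq

-- Powers, orders and containment of cyclic subgroups.

module Powers (𝔾 : FinGroup) where
  open FinGroup 𝔾 public
  open IsGroup isGroup public using (assoc; identityˡ; identityʳ; inverseˡ; inverseʳ)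
  open Algebra.Properties.Group group public using (∙-cancelˡ; ∙-cancelʳ; inverseʳ-unique; inverseˡ-unique; ⁻¹-involutive; ⁻¹-anti-homo-∙)
  open GroupWord 𝔾 public

  G : Set
  G = Fin N

  infixr 8 _↑_
  _↑_ : G → ℕ → G
  x ↑ n = powℕ group x n

  Commute : G → G → Set
  Commute x y = x ∙ y ≡ y ∙ x

  commute? : ∀ x y → Dec (Commute x y)
  commute? x y = (x ∙ y) Fin.≟ (y ∙ x)

  conj : G → G → G
  conj g x = g ∙ x ∙ g ⁻¹

  w0 w1 w2 : ∀ {n} → Word (3 + n)
  w0 = var Fin.zero
  w1 = var (Fin.suc Fin.zero)
  w2 = var (Fin.suc (Fin.suc Fin.zero))

  x↑1 : ∀ x → x ↑ 1 ≡ x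
  x↑1 = identityʳ

  ε↑ : ∀ n → ε ↑ n ≡ ε
  ε↑ zero = refl
  ε↑ (suc n) = trans (identityˡ _) (ε↑ n)

  ↑-+ : ∀ x m n → x ↑ (m + n) ≡ x ↑ m ∙ x ↑ n
  ↑-+ x zero n = sym (identityˡ _)
  ↑-+ x (suc m) n = trans (cong (x ∙_) (↑-+ x m n)) (sym (assoc _ _ _))

  ↑-* : ∀ x m n → x ↑ (m * n) ≡ (x ↑ n) ↑ m
  ↑-* x zero n = refl
  ↑-* x (suc m) n = trans (↑-+ x n (m * n)) (cong (x ↑ n ∙_) (↑-* x m n))

  ↑-*′ : ∀ x m n → x ↑ (m * n) ≡ (x ↑ m) ↑ n
  ↑-*′ x m n = trans (cong (x ↑_) (*-comm m n)) (↑-* x n m)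

  ↑-↑ : ∀ x m n → (x ↑ m) ↑ n ≡ (x ↑ n) ↑ m
  ↑-↑ x m n = trans (sym (↑-*′ x m n)) (↑-* x m n)

  commute-sym : ∀ {x y} → Commute x y → Commute y x
  commute-sym = sym

  commute-ε : ∀ {x} → Commute x ε
  commute-ε {x} = trans (identityʳ x) (sym (identityˡ x))

  commute-∙ : ∀ {x y z} → Commute x y → Commute x z → Commute x (y ∙ z)
  commute-∙ {x} {y} {z} p q = begin
    x ∙ (y ∙ z) ≡⟨ assoc x y z ⟨
    x ∙ y ∙ z   ≡⟨ cong (_∙ z) p ⟩
    y ∙ x ∙ z   ≡⟨ assoc y x z ⟩
    y ∙ (x ∙ z) ≡⟨ cong (y ∙_) q ⟩
    y ∙ (z ∙ x) ≡⟨ assoc y z x ⟨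
    y ∙ z ∙ x   ∎
    where open ≡-Reasoning

  commute-↑ : ∀ {x y} n → Commute x y → Commute x (y ↑ n)
  commute-↑ zero    c = commute-ε
  commute-↑ (suc n) c = commute-∙ c (commute-↑ n c)

  commute-↑↑ : ∀ {x y} m n → Commute x y → Commute (x ↑ m) (y ↑ n)
  commute-↑↑ m n c = commute-↑ n (commute-sym (commute-↑ m (commute-sym c)))

  commute-self : ∀ x m n → Commute (x ↑ m) (x ↑ n)
  commute-self x m n = commute-↑↑ m n refl

  commute-⁻¹ : ∀ {x y} → Commute x y → Commute x (y ⁻¹)
  commute-⁻¹ {x} {y} c = ∙-cancelˡ y _ _ (begin
    y ∙ (x ∙ y ⁻¹)   ≡⟨ assoc y x (y ⁻¹) ⟨
    y ∙ x ∙ y ⁻¹     ≡⟨ cong (_∙ y ⁻¹) c ⟨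
    x ∙ y ∙ y ⁻¹     ≡⟨ word (w0 :∙ w1 :∙ neg w1) (w1 :∙ (neg w1 :∙ w0)) (x ∷ y ∷ ε ∷ []) refl ⟩
    y ∙ (y ⁻¹ ∙ x)   ∎)
    where open ≡-Reasoning

  ∙-↑ : ∀ {x y} n → Commute x y → (x ∙ y) ↑ n ≡ x ↑ n ∙ y ↑ n
  ∙-↑ zero c = sym (identityˡ ε)
  ∙-↑ {x} {y} (suc n) c = begin
    x ∙ y ∙ (x ∙ y) ↑ n        ≡⟨ cong (x ∙ y ∙_) (∙-↑ n c) ⟩
    x ∙ y ∙ (x ↑ n ∙ y ↑ n)    ≡⟨ lem₁ ⟩
    x ∙ (y ∙ x ↑ n) ∙ y ↑ n    ≡⟨ cong (λ v → x ∙ v ∙ y ↑ n) (commute-↑ n (commute-sym c)) ⟩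
    x ∙ (x ↑ n ∙ y) ∙ y ↑ n    ≡⟨ lem₂ ⟩
    x ∙ x ↑ n ∙ (y ∙ y ↑ n)    ∎
    where
    open ≡-Reasoning
    lem₁ = trans (sym (assoc _ _ _)) (cong (_∙ y ↑ n) (assoc _ _ _))
    lem₂ = trans (cong (_∙ y ↑ n) (sym (assoc _ _ _))) (assoc _ _ _)

  conj-∙ : ∀ g x y → conj g (x ∙ y) ≡ conj g x ∙ conj g y
  conj-∙ g x y = word (w0 :∙ (w1 :∙ w2) :∙ neg w0) ((w0 :∙ w1 :∙ neg w0) :∙ (w0 :∙ w2 :∙ neg w0)) (g ∷ x ∷ y ∷ []) refl

  conj-ε : ∀ g → conj g ε ≡ ε
  conj-ε g = word (w0 :∙ one :∙ neg w0) one (g ∷ ε ∷ ε ∷ []) refl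

  conj-↑ : ∀ g x n → conj g (x ↑ n) ≡ conj g x ↑ n
  conj-↑ g x zero = conj-ε g
  conj-↑ g x (suc n) = trans (conj-∙ g x (x ↑ n)) (cong (conj g x ∙_) (conj-↑ g x n))

  conj-conj : ∀ g h x → conj g (conj h x) ≡ conj (g ∙ h) x
  conj-conj g h x = word (w0 :∙ (w1 :∙ w2 :∙ neg w1) :∙ neg w0) (w0 :∙ w1 :∙ w2 :∙ neg (w0 :∙ w1)) (g ∷ h ∷ x ∷ []) refl

  conj-by-ε : ∀ x → conj ε x ≡ x
  conj-by-ε x = word (one :∙ w0 :∙ neg one) w0 (x ∷ x ∷ x ∷ []) refl

  conj-commute : ∀ {g x} → Commute g x → conj g x ≡ x
  conj-commute {g} {x} c = trans (cong (_∙ g ⁻¹) c) (word (w1 :∙ w0 :∙ neg w0) w1 (g ∷ x ∷ x ∷ []) refl)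

  conj≡⇒commute : ∀ {g x} → conj g x ≡ x → Commute g x
  conj≡⇒commute {g} {x} e = trans (word (w0 :∙ w1) (w0 :∙ w1 :∙ neg w0 :∙ w0) (g ∷ x ∷ x ∷ []) refl) (cong (_∙ g) e)

  conj-injective : ∀ g {x y} → conj g x ≡ conj g y → x ≡ y
  conj-injective g e = ∙-cancelˡ g _ _ (∙-cancelʳ (g ⁻¹) _ _ e)

  conj-⁻¹ˡ : ∀ g x → conj (g ⁻¹) (conj g x) ≡ x
  conj-⁻¹ˡ g x = word (neg w0 :∙ (w0 :∙ w1 :∙ neg w0) :∙ neg (neg w0)) w1 (g ∷ x ∷ x ∷ []) refl

  commute-conj : ∀ g {x y} → Commute x y → Commute (conj g x) (conj g y)
  commute-conj g c = trans (sym (conj-∙ g _ _)) (trans (cong (conj g) c) (conj-∙ g _ _))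

  private
    -- Two of the powers with exponents 0, ..., N agree, and their quotient is a positive power
    -- equal to ε.
    period : ∀ x → ∃ λ n → x ↑ suc n ≡ ε
    period x with Fin.pigeonhole (n<1+n N) (λ (i : Fin (suc N)) → x ↑ toℕ i)
    ... | i , j , i<j , e = pred (toℕ j ∸ toℕ i) , trans (cong (x ↑_) (suc-pred (toℕ j ∸ toℕ i) {{>-nonZero (m<n⇒0<n∸m i<j)}}))
      (∙-cancelˡ (x ↑ toℕ i) _ _ (trans (sym (↑-+ x (toℕ i) _)) (trans (cong (x ↑_) (m+[n∸m]≡n (<⇒≤ i<j))) (trans (sym e) (sym (identityʳ _))))))

    leastPeriod : ∀ x → ∃ λ m → x ↑ suc m ≡ ε × (∀ {k} → k < m → x ↑ suc k ≢ ε)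
    leastPeriod x = least (λ k → x ↑ suc k Fin.≟ ε) (proj₁ (period x)) (proj₂ (period x))

  abstract
    -- Abstract, so that comparing terms never unfolds the search for the least period; later proofs
    -- see only the facts of this block.
    ord : G → ℕ
    ord x = suc (proj₁ (leastPeriod x))

    instance
      ord-nonZero : ∀ {x} → NonZero (ord x)
      ord-nonZero = _

    ↑-ord : ∀ x → x ↑ ord x ≡ ε
    ↑-ord x = proj₁ (proj₂ (leastPeriod x))

    ord-min : ∀ x {k} → 0 < k → k < ord x → x ↑ k ≢ ε
    ord-min x {suc k} _ (s≤s lt) = proj₂ (proj₂ (leastPeriod x)) lt

  ord>0 : ∀ {x} → 0 < ord x
  ord>0 = >-nonZero⁻¹ _

  ∣⇒↑≡ε : ∀ {x n} → ord x ∣ n → x ↑ n ≡ ε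
  ∣⇒↑≡ε {x} (divides q refl) = trans (↑-* x q (ord x)) (trans (cong (_↑ q) (↑-ord x)) (ε↑ q))

  ↑-% : ∀ x n → x ↑ n ≡ x ↑ (n % ord x)
  ↑-% x n = begin
    x ↑ n                                        ≡⟨ cong (x ↑_) (m≡m%n+[m/n]*n n (ord x)) ⟩
    x ↑ (n % ord x + n / ord x * ord x)          ≡⟨ ↑-+ x (n % ord x) _ ⟩
    x ↑ (n % ord x) ∙ x ↑ (n / ord x * ord x)    ≡⟨ cong (x ↑ (n % ord x) ∙_) (∣⇒↑≡ε (n∣m*n (n / ord x))) ⟩
    x ↑ (n % ord x) ∙ ε                          ≡⟨ identityʳ _ ⟩
    x ↑ (n % ord x)                              ∎
    where open ≡-Reasoning

  ord-∣ : ∀ {x n} → x ↑ n ≡ ε → ord x ∣ n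
  ord-∣ {x} {n} e with n % ord x in eq | m%n<n n (ord x)
  ... | zero  | _  = m%n≡0⇒n∣m n (ord x) eq
  ... | suc r | lt = contradiction (trans (cong (x ↑_) (sym eq)) (trans (sym (↑-% x n)) e)) (ord-min x z<s lt)

  ↑-≡⇒∣ : ∀ {x m n} → m ≤ n → x ↑ m ≡ x ↑ n → ord x ∣ n ∸ m
  ↑-≡⇒∣ {x} {m} {n} m≤n e = ord-∣ (∙-cancelˡ (x ↑ m) _ _
    (trans (sym (↑-+ x m _)) (trans (cong (x ↑_) (m+[n∸m]≡n m≤n)) (trans (sym e) (sym (identityʳ _))))))

  ↑-injective : ∀ {x m n} → m < ord x → n < ord x → x ↑ m ≡ x ↑ n → m ≡ n
  ↑-injective {x} {m} {n} m< n< e with <-cmp m n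
  ... | tri≈ _ eq _ = eq
  ... | tri< lt _ _ = contradiction (∣⇒≤ {{>-nonZero (m<n⇒0<n∸m lt)}} (↑-≡⇒∣ (<⇒≤ lt) e)) (<⇒≱ (≤-<-trans (m∸n≤m n m) n<))
  ... | tri> _ _ gt = contradiction (∣⇒≤ {{>-nonZero (m<n⇒0<n∸m gt)}} (↑-≡⇒∣ (<⇒≤ gt) (sym e))) (<⇒≱ (≤-<-trans (m∸n≤m m n) m<))

  ord-unique : ∀ {x n} → x ↑ n ≡ ε → (∀ {k} → x ↑ k ≡ ε → n ∣ k) → ord x ≡ n
  ord-unique e h = ∣-antisym (ord-∣ e) (h (↑-ord _))

  ord-ε : ord ε ≡ 1
  ord-ε = ord-unique (ε↑ 1) λ {k} _ → 1∣ k

  ord≡1⇒ε : ∀ {x} → ord x ≡ 1 → x ≡ ε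
  ord≡1⇒ε {x} e = trans (sym (x↑1 x)) (trans (cong (x ↑_) (sym e)) (↑-ord x))

  ⁻¹-↑ : ∀ x → x ⁻¹ ≡ x ↑ (ord x ∸ 1)
  ⁻¹-↑ x = sym (inverseʳ-unique x _ (trans (cong (x ↑_) (m+[n∸m]≡n (ord>0 {x}))) (↑-ord x)))

  ord-conj : ∀ g x → ord (conj g x) ≡ ord x
  ord-conj g x = ord-unique (trans (sym (conj-↑ g x (ord x))) (trans (cong (conj g) (↑-ord x)) (conj-ε g)))
    λ {k} e → ord-∣ (conj-injective g (trans (conj-↑ g x k) (trans e (sym (conj-ε g)))))

  ord-↑ : ∀ {x} m n .{{_ : NonZero m}} → ord x ≡ m * n → ord (x ↑ m) ≡ n
  ord-↑ {x} m n e = ord-unique (trans (sym (↑-*′ x m n)) (∣⇒↑≡ε (∣-reflexive e)))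
    λ {k} f → *-cancelˡ-∣ m (subst (_∣ m * k) e (ord-∣ (trans (↑-*′ x m k) f)))

  ord-prime : ∀ {p x} → Prime p → x ↑ p ≡ ε → x ≢ ε → ord x ≡ p
  ord-prime pr e ne with prime⇒irreducible pr (ord-∣ e)
  ... | inj₁ o≡1 = contradiction (ord≡1⇒ε o≡1) ne
  ... | inj₂ o≡p = o≡p

  infix 4 _⊑_ _∼_
  -- Membership of y in ⟨x⟩, which is the same as ⟨y⟩ ≤ ⟨x⟩. Natural exponents suffice because
  -- orders are finite.
  _⊑_ : G → G → Set
  y ⊑ x = ∃ λ k → x ↑ k ≡ y

  ⊑? : ∀ y x → Dec (y ⊑ x)
  ⊑? y x = map′ (λ (k , e) → toℕ k , e)
    (λ (k , e) → fromℕ< (m%n<n k (ord x)) , trans (cong (x ↑_) (Fin.toℕ-fromℕ< (m%n<n k (ord x)))) (trans (sym (↑-% x k)) e))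
    (Fin.any? λ (k : Fin (ord x)) → x ↑ toℕ k Fin.≟ y)

  ⊑-refl : ∀ {x} → x ⊑ x
  ⊑-refl = 1 , x↑1 _

  ⊑-trans : ∀ {x y z} → x ⊑ y → y ⊑ z → x ⊑ z
  ⊑-trans {z = z} (k , refl) (l , refl) = k * l , ↑-* z k l

  ⊑-↑ : ∀ {x} k → x ↑ k ⊑ x
  ⊑-↑ k = k , refl

  ⊑-∙ : ∀ {x y z} → x ⊑ z → y ⊑ z → x ∙ y ⊑ z
  ⊑-∙ {z = z} (k , refl) (l , refl) = k + l , ↑-+ z k l

  ⊑-⁻¹ : ∀ {x y} → x ⊑ y → x ⁻¹ ⊑ y
  ⊑-⁻¹ {x} s = ⊑-trans (ord x ∸ 1 , sym (⁻¹-↑ x)) s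

  ε⊑ : ∀ {x} → ε ⊑ x
  ε⊑ = 0 , refl

  _∼_ : G → G → Set
  x ∼ y = x ⊑ y × y ⊑ x

  ∼-refl : ∀ {x} → x ∼ x
  ∼-refl = ⊑-refl , ⊑-refl

  ∼-sym : ∀ {x y} → x ∼ y → y ∼ x
  ∼-sym (p , q) = q , p

  ∼-trans : ∀ {x y z} → x ∼ y → y ∼ z → x ∼ z
  ∼-trans (p , q) (r , s) = ⊑-trans p r , ⊑-trans s q

  ⊑-conj : ∀ g {x y} → x ⊑ y → conj g x ⊑ conj g y
  ⊑-conj g {y = y} (k , refl) = k , sym (conj-↑ g y k)

  ∼-conj : ∀ g {x y} → x ∼ y → conj g x ∼ conj g y
  ∼-conj g (p , q) = ⊑-conj g p , ⊑-conj g q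

  commute-⊑ : ∀ {x y z} → Commute x z → y ⊑ z → Commute x y
  commute-⊑ c (k , refl) = commute-↑ k c

  commute-within : ∀ {x y z} → x ⊑ z → y ⊑ z → Commute x y
  commute-within {z = z} (k , refl) (l , refl) = commute-self z k l

  ⊑-ord : ∀ {x y} → x ⊑ y → ord x ∣ ord y
  ⊑-ord {y = y} (k , refl) = ord-∣ (trans (↑-↑ y k (ord y)) (trans (cong (_↑ k) (↑-ord y)) (ε↑ k)))

  ∼-ord : ∀ {x y} → x ∼ y → ord x ≡ ord y
  ∼-ord (p , q) = ∣-antisym (⊑-ord p) (⊑-ord q)

  -- Bézout makes x, or its inverse, a power of x ↑ a.
  ⊑-coprime : ∀ {x a b} → Coprime a b → x ↑ b ≡ ε → x ⊑ x ↑ a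
  ⊑-coprime {x} {a} {b} c e with coprime-bezout c
  ... | u , v , inj₁ eq = u , (begin
    (x ↑ a) ↑ u           ≡⟨ ↑-* x u a ⟨
    x ↑ (u * a)           ≡⟨ cong (x ↑_) eq ⟩
    x ∙ x ↑ (v * b)       ≡⟨ cong (x ∙_) (trans (↑-* x v b) (trans (cong (_↑ v) e) (ε↑ v))) ⟩
    x ∙ ε                 ≡⟨ identityʳ x ⟩
    x                     ∎)
    where open ≡-Reasoning
  ... | u , v , inj₂ eq = subst (_⊑ x ↑ a)
    (sym (inverseˡ-unique x _ (trans (cong (x ↑_) eq) (trans (↑-* x v b) (trans (cong (_↑ v) e) (ε↑ v))))))
    (⊑-⁻¹ (u , sym (↑-* x u a)))

  -- Let x = y ↑ k. If c divides k and ord y = r c, then x ↑ r = ε; as x has order ord y, this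
  -- forces c = 1. Hence k is invertible modulo ord y.
  ⊑∧ord≡⇒∼ : ∀ {x y} → x ⊑ y → ord x ≡ ord y → x ∼ y
  ⊑∧ord≡⇒∼ {x} {y} s@(k , refl) e = s , ⊑-coprime cop (↑-ord y)
    where
    cop : Coprime k (ord y)
    cop {c} (divides q refl , divides r eq) = ∣1⇒≡1 (*-cancelˡ-∣ (ord y) (divides r′ lem))
      where
      r∣ : ord y ∣ r
      r∣ = subst (_∣ r) e (ord-∣ (begin
        (y ↑ (q * c)) ↑ r    ≡⟨ ↑-*′ y (q * c) r ⟨
        y ↑ (q * c * r)      ≡⟨ cong (y ↑_) (trans (*-assoc q c r) (cong (q *_) (trans (*-comm c r) (sym eq)))) ⟩
        y ↑ (q * ord y)      ≡⟨ ∣⇒↑≡ε (n∣m*n q) ⟩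
        ε                    ∎))
        where open ≡-Reasoning
      r′ = _∣_.quotient r∣
      lem : ord y * 1 ≡ r′ * (ord y * c)
      lem = trans (*-identityʳ _) (trans eq (trans (cong (_* c) (_∣_.equality r∣)) (*-assoc r′ (ord y) c)))

  -- In the cyclic group ⟨z⟩ both elements lie in the subgroup of w = z ↑ (ord z / ord y), and y
  -- generates it because the orders agree.
  ⊑-unique : ∀ {x y z} → x ⊑ z → y ⊑ z → ord x ∣ ord y → x ⊑ y
  ⊑-unique {x} {y} {z} (a , refl) y⊑@(b , refl) d = ⊑-trans (within a (∣⇒↑≡ε d)) (proj₂ (⊑∧ord≡⇒∼ (within b (↑-ord y)) (sym ordw)))
    where
    n∣ = ⊑-ord y⊑
    e = _∣_.quotient n∣
    w = z ↑ e
    eq : ord z ≡ e * ord y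
    eq = _∣_.equality n∣
    instance _ = m*n≢0⇒m≢0 e {{subst NonZero eq ord-nonZero}}
    ordw : ord w ≡ ord y
    ordw = ord-↑ e (ord y) eq
    within : ∀ a → (z ↑ a) ↑ ord y ≡ ε → z ↑ a ⊑ w
    within a f = by e∣a
      where
      e∣a : e ∣ a
      e∣a = *-cancelʳ-∣ (ord y) (subst (_∣ a * ord y) eq (ord-∣ (trans (↑-*′ z a (ord y)) f)))
      by : ∀ {a} → e ∣ a → z ↑ a ⊑ w
      by (divides q refl) = q , sym (↑-* z q e)

  ⊑-unique-∼ : ∀ {x y z} → x ⊑ z → y ⊑ z → ord x ≡ ord y → x ∼ y
  ⊑-unique-∼ p q e = ⊑-unique p q (∣-reflexive e) , ⊑-unique q p (∣-reflexive (sym e))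

  module _ {x y} (c : Commute x y) (cop : Coprime (ord x) (ord y)) where
    ⊑-∙ˡ : x ⊑ x ∙ y
    ⊑-∙ˡ = ⊑-trans (⊑-coprime (Cop.sym cop) (↑-ord x))
      (ord y , trans (∙-↑ (ord y) c) (trans (cong (x ↑ ord y ∙_) (↑-ord y)) (identityʳ _)))

    ⊑-∙ʳ : y ⊑ x ∙ y
    ⊑-∙ʳ = ⊑-trans (⊑-coprime cop (↑-ord y))
      (ord x , trans (∙-↑ (ord x) c) (trans (cong (_∙ y ↑ ord x) (↑-ord x)) (identityˡ _)))

    ord-∙ : ord (x ∙ y) ≡ ord x * ord y
    ord-∙ = ord-unique
      (trans (∙-↑ (ord x * ord y) c) (trans (cong₂ _∙_ (∣⇒↑≡ε (m∣m*n (ord y))) (∣⇒↑≡ε (n∣m*n (ord x)))) (identityˡ ε)))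
      λ {k} e → coprime-*-∣ (∣-trans (⊑-ord ⊑-∙ˡ) (ord-∣ e)) (∣-trans (⊑-ord ⊑-∙ʳ) (ord-∣ e))
      where
      coprime-*-∣ : ∀ {k} → ord x ∣ k → ord y ∣ k → ord x * ord y ∣ k
      coprime-*-∣ (divides q refl) d = subst (ord x * ord y ∣_) (*-comm (ord x) q)
        (*-monoʳ-∣ (ord x) (Cop.coprime-divisor (Cop.sym cop) (subst (ord y ∣_) (*-comm q (ord x)) d)))

  -- Raising to the power ord z removes z from the product and does not shrink ⟨x⟩.
  ⊑-part : ∀ {x y z} → Commute y z → Coprime (ord x) (ord z) → x ⊑ y ∙ z → x ⊑ y
  ⊑-part {x} {y} {z} c cop (k , refl) = ⊑-trans (⊑-coprime (Cop.sym cop) (↑-ord _))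
    (k * ord z , sym (begin
      ((y ∙ z) ↑ k) ↑ ord z           ≡⟨ ↑-*′ (y ∙ z) k (ord z) ⟨
      (y ∙ z) ↑ (k * ord z)           ≡⟨ ∙-↑ (k * ord z) c ⟩
      y ↑ (k * ord z) ∙ z ↑ (k * ord z) ≡⟨ cong (y ↑ (k * ord z) ∙_) (∣⇒↑≡ε (n∣m*n k)) ⟩
      y ↑ (k * ord z) ∙ ε             ≡⟨ identityʳ _ ⟩
      y ↑ (k * ord z)                 ∎))
    where open ≡-Reasoning

-- Prime factors and prime powers.

primeDivisor : ∀ n → 1 < n → ∃ λ q → Prime q × q ∣ n
primeDivisor n@(suc _) 1<n with factorise n
... | record { factors = [] ; isFactorisation = eq } = contradiction (sym eq) (<⇒≢ 1<n)
... | record { factors = q ∷ qs ; isFactorisation = eq ; factorsPrime = pr ∷ _ } =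
  q , pr , divides (product qs) (trans eq (*-comm q (product qs)))

prime∣prime : ∀ {p q} → Prime p → Prime q → p ∣ q → p ≡ q
prime∣prime pp pq d with prime⇒irreducible pq d
... | inj₁ refl = contradiction pp ¬prime[1]
... | inj₂ eq   = eq

prime∣^ : ∀ {p} q k → Prime p → p ∣ q ^ k → p ∣ q
prime∣^ q zero    pr d = contradiction (subst Prime (∣1⇒≡1 d) pr) ¬prime[1]
prime∣^ q (suc k) pr d with euclidsLemma q (q ^ k) pr d
... | inj₁ d′ = d′
... | inj₂ d′ = prime∣^ q k pr d′

only-prime⇒power : ∀ p n .{{_ : NonZero n}} → (∀ {q} → Prime q → q ∣ n → q ≡ p) → ∃ λ k → n ≡ p ^ k
only-prime⇒power p n h with factorise n
... | record { factors = qs ; isFactorisation = refl ; factorsPrime = prs } = go qs prs h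
  where
  go : ∀ qs → All Prime qs → (∀ {q} → Prime q → q ∣ product qs → q ≡ p) → ∃ λ k → product qs ≡ p ^ k
  go [] _ _ = 0 , refl
  go (q ∷ qs) (pr ∷ prs) h with h pr (m∣m*n (product qs)) | go qs prs (λ pr′ d → h pr′ (∣n⇒∣m*n q d))
  ... | refl | k , e = suc k , cong (p *_) e

module _ {p} (pr : Prime p) where
  private instance _ = prime⇒nonZero pr

  p^≢0 : ∀ k → NonZero (p ^ k)
  p^≢0 k = m^n≢0 p k

  ^-injective : ∀ {m n} → p ^ m ≡ p ^ n → m ≡ n
  ^-injective {m} {n} e with <-cmp m n
  ... | tri< lt _ _ = contradiction e (<⇒≢ (^-monoʳ-< p (prime>1 pr) lt))
  ... | tri≈ _ eq _ = eq
  ... | tri> _ _ gt = contradiction (sym e) (<⇒≢ (^-monoʳ-< p (prime>1 pr) gt))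

  ∣p^⇒ : ∀ {d} k → d ∣ p ^ k → ∃ λ j → d ≡ p ^ j
  ∣p^⇒ {d} k d∣ = only-prime⇒power p d {{nz}} λ {q} pq q∣ → prime∣prime pq pr (prime∣^ p k pq (∣-trans q∣ d∣))
    where
    nz : NonZero d
    nz = ≢-nonZero λ eq → contradiction (0∣⇒≡0 (subst (_∣ p ^ k) eq d∣)) (≢-nonZero⁻¹ _ {{p^≢0 k}})

  coprime-^ : ∀ {m} k → ¬ p ∣ m → Coprime (p ^ k) m
  coprime-^ k p∤m {d} (d∣ , d∣m) with ∣p^⇒ k d∣
  ... | zero  , refl = refl
  ... | suc j , refl = contradiction (∣-trans (m∣m*n (p ^ j)) d∣m) p∤m

  strip : ∀ n .{{_ : NonZero n}} → ∃₂ λ k m → n ≡ p ^ k * m × ¬ p ∣ m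
  strip n = go n (<-wellFounded n)
    where
    go : ∀ n → Acc _<_ n → .{{_ : NonZero n}} → ∃₂ λ k m → n ≡ p ^ k * m × ¬ p ∣ m
    go n (acc rs) with p ∣? n
    ... | no p∤n = 0 , n , sym (*-identityˡ n) , p∤n
    ... | yes p∣n@(divides q refl) with go q (rs (quotient-< p∣n {{prime⇒nonTrivial pr}})) {{m*n≢0⇒m≢0 q}}
    ...   | k , m , eq , p∤m = suc k , m , trans (cong (_* p) eq) (trans (*-comm _ p) (sym (*-assoc p (p ^ k) m))) , p∤m

  k<p^k : ∀ k → k < p ^ k
  k<p^k zero = s≤s z≤n
  k<p^k (suc k) = ≤-trans (s≤s (k<p^k k)) (m<n*m (p ^ k) p (>-nonZero⁻¹ _ {{p^≢0 k}}) (prime>1 pr))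
    where
    m<n*m : ∀ m n → 0 < m → 1 < n → m < n * m
    m<n*m m n 0<m 1<n = subst (_< n * m) (*-identityˡ m) (*-monoˡ-< m {{>-nonZero 0<m}} 1<n)

-- The p-part and the p′-part of an element.

module Parts (𝔾 : FinGroup) where
  open Powers 𝔾

  IsPower : ℕ → ℕ → Set
  IsPower p n = ∃ λ k → n ≡ p ^ k

  isPower? : ∀ {p} → Prime p → ∀ n → Dec (IsPower p n)
  isPower? {p} pr n = map′ (λ (k , e) → toℕ k , e)
    (λ (k , e) → let k< = s≤s (<⇒≤ (subst (k <_) (sym e) (k<p^k pr k))) in
        fromℕ< k< , trans e (cong (p ^_) (sym (Fin.toℕ-fromℕ< k<))))
    (Fin.any? λ (k : Fin (suc n)) → n ≟ p ^ toℕ k)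

  power-⊑ : ∀ {p x} → p ∣ ord x → ∃ λ y → y ⊑ x × ord y ≡ p
  power-⊑ {p} {x} (divides m eq) = x ↑ m , ⊑-↑ m , ord-↑ m p {{m*n≢0⇒m≢0 m {{subst NonZero eq ord-nonZero}}}} eq

  ⊑-power : ∀ {p x y} → Prime p → x ⊑ y → IsPower p (ord y) → IsPower p (ord x)
  ⊑-power pr s (k , e) = ∣p^⇒ pr k (subst (_ ∣_) e (⊑-ord s))

  ⊑-∤ : ∀ {p x y} → x ⊑ y → ¬ p ∣ ord y → ¬ p ∣ ord x
  ⊑-∤ s p∤ p∣ = p∤ (∣-trans p∣ (⊑-ord s))

  power-coprime : ∀ {p} → Prime p → ∀ {m n} → IsPower p m → ¬ p ∣ n → Coprime m n
  power-coprime pr (k , refl) p∤ = coprime-^ pr k p∤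

  -- With ord x = p ^ k m, Bézout makes 1 the difference of a multiple of m and a multiple of p ^ k.
  -- The corresponding powers of x are the p-part and the p′-part, one of them inverted.
  decompose : ∀ {p} → Prime p → ∀ x → ∃₂ λ y z → y ⊑ x × z ⊑ x × IsPower p (ord y) × ¬ p ∣ ord z × y ∙ z ≡ x
  decompose {p} pr x with strip pr (ord x)
  ... | k , m , eq , p∤m = build (coprime-bezout (coprime-^ pr k p∤m))
    where
    a = p ^ k
    ppart : ∀ {y} → y ⊑ x ↑ m → IsPower p (ord y)
    ppart s = ∣p^⇒ pr k (∣-trans (⊑-ord s) (ord-∣ (trans (sym (↑-*′ x m a)) (∣⇒↑≡ε (∣-reflexive (trans eq (*-comm a m)))))))
    p′part : ∀ {y} → y ⊑ x ↑ a → ¬ p ∣ ord y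
    p′part s d = p∤m (∣-trans d (∣-trans (⊑-ord s) (ord-∣ (trans (sym (↑-*′ x a m)) (∣⇒↑≡ε (∣-reflexive eq))))))
    build : (∃₂ λ u v → u * a ≡ 1 + v * m ⊎ 1 + u * a ≡ v * m) →
            ∃₂ λ y z → y ⊑ x × z ⊑ x × IsPower p (ord y) × ¬ p ∣ ord z × y ∙ z ≡ x
    build (u , v , inj₁ e) = (x ↑ (v * m)) ⁻¹ , x ↑ (u * a) , ⊑-⁻¹ (⊑-↑ (v * m)) , ⊑-↑ (u * a) ,
      ppart (⊑-⁻¹ (v , sym (↑-* x v m))) , p′part (u , sym (↑-* x u a)) ,
      ∙-cancelˡ (x ↑ (v * m)) _ _ (begin
        x ↑ (v * m) ∙ ((x ↑ (v * m)) ⁻¹ ∙ x ↑ (u * a))   ≡⟨ word (w0 :∙ (neg w0 :∙ w1)) w1 (_ ∷ _ ∷ ε ∷ []) refl ⟩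
        x ↑ (u * a)                                    ≡⟨ cong (x ↑_) (trans e (+-comm 1 (v * m))) ⟩
        x ↑ (v * m + 1)                                ≡⟨ ↑-+ x (v * m) 1 ⟩
        x ↑ (v * m) ∙ x ↑ 1                            ≡⟨ cong (x ↑ (v * m) ∙_) (x↑1 x) ⟩
        x ↑ (v * m) ∙ x                                ∎)
      where open ≡-Reasoning
    build (u , v , inj₂ e) = x ↑ (v * m) , (x ↑ (u * a)) ⁻¹ , ⊑-↑ (v * m) , ⊑-⁻¹ (⊑-↑ (u * a)) ,
      ppart (v , sym (↑-* x v m)) , p′part (⊑-⁻¹ (u , sym (↑-* x u a))) ,
      (begin
        x ↑ (v * m) ∙ (x ↑ (u * a)) ⁻¹                   ≡⟨ cong (λ n → x ↑ n ∙ (x ↑ (u * a)) ⁻¹) (sym e) ⟩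
        x ∙ x ↑ (u * a) ∙ (x ↑ (u * a)) ⁻¹               ≡⟨ word (w0 :∙ w1 :∙ neg w1) w0 (_ ∷ _ ∷ ε ∷ []) refl ⟩
        x                                              ∎)
      where open ≡-Reasoning

  ↑-coprime⇒ε : ∀ {x a b} → Coprime a b → x ↑ a ≡ ε → x ↑ b ≡ ε → x ≡ ε
  ↑-coprime⇒ε c e f = ord≡1⇒ε (c (ord-∣ e , ord-∣ f))

  -- A p′-element y normalising ⟨x⟩ with ord x = p ^ j acts trivially once it fixes the subgroup of order p:
  -- by induction y fixes x ^ p, so y moves x by an element u of order dividing p, and x ^ (y ^ k) = u ^ k x.
  coprime-action : ∀ {p} → Prime p → ∀ {y} → ¬ p ∣ ord y → ∀ j x → ord x ≡ p ^ j → conj y x ⊑ x →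
                   (∀ {z} → z ⊑ x → z ↑ p ≡ ε → Commute y z) → Commute y x
  coprime-action pr p∤ zero x e _ _ = subst (Commute _) (sym (ord≡1⇒ε e)) commute-ε
  coprime-action {p} pr {y} p∤ (suc j) x e s@(t , et) h = conj≡⇒commute (trans ux (trans (cong (_∙ x) u≡ε) (identityˡ x)))
    where
    instance _ = prime⇒nonZero pr
    open ≡-Reasoning
    xp : Commute y (x ↑ p)
    xp = coprime-action pr p∤ j (x ↑ p) (ord-↑ p (p ^ j) e)
      (t , trans (↑-↑ x p t) (trans (cong (_↑ p) et) (sym (conj-↑ y x p))))
      (λ s′ → h (⊑-trans s′ (⊑-↑ p)))
    u = conj y x ∙ x ⁻¹
    ux : conj y x ≡ u ∙ x
    ux = word w0 (w0 :∙ neg w1 :∙ w1) (conj y x ∷ x ∷ x ∷ []) refl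
    u⊑x : u ⊑ x
    u⊑x = ⊑-∙ s (⊑-⁻¹ ⊑-refl)
    up : u ↑ p ≡ ε
    up = ∙-cancelʳ (x ↑ p) _ _ (begin
      u ↑ p ∙ x ↑ p       ≡⟨ ∙-↑ p (commute-within u⊑x ⊑-refl) ⟨
      (u ∙ x) ↑ p         ≡⟨ cong (_↑ p) ux ⟨
      conj y x ↑ p        ≡⟨ conj-↑ y x p ⟨
      conj y (x ↑ p)      ≡⟨ conj-commute xp ⟩
      x ↑ p               ≡⟨ identityˡ _ ⟨
      ε ∙ x ↑ p           ∎)
    cu : Commute y u
    cu = h u⊑x up
    steps : ∀ k → conj (y ↑ k) x ≡ u ↑ k ∙ x
    steps zero = trans (conj-by-ε x) (sym (identityˡ x))
    steps (suc k) = begin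
      conj (y ∙ y ↑ k) x          ≡⟨ conj-conj y (y ↑ k) x ⟨
      conj y (conj (y ↑ k) x)     ≡⟨ cong (conj y) (steps k) ⟩
      conj y (u ↑ k ∙ x)          ≡⟨ conj-∙ y (u ↑ k) x ⟩
      conj y (u ↑ k) ∙ conj y x   ≡⟨ cong₂ _∙_ (conj-commute (commute-↑ k cu)) ux ⟩
      u ↑ k ∙ (u ∙ x)             ≡⟨ assoc _ _ _ ⟨
      u ↑ k ∙ u ∙ x               ≡⟨ cong (_∙ x) (commute-sym (commute-↑ k refl)) ⟩
      u ∙ u ↑ k ∙ x               ∎
    u≡ε : u ≡ ε
    u≡ε = ↑-coprime⇒ε (prime∤⇒coprime pr p∤) up (∙-cancelʳ x _ _ (begin
      u ↑ ord y ∙ x          ≡⟨ steps (ord y) ⟨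
      conj (y ↑ ord y) x     ≡⟨ cong (λ v → conj v x) (↑-ord y) ⟩
      conj ε x               ≡⟨ conj-by-ε x ⟩
      x                      ≡⟨ identityˡ x ⟨
      ε ∙ x                  ∎))

  module _ {K : G → Set} (K? : Decidable K) (K-ε : K ε) (K-∙ : ∀ {x y} → K x → K y → K (x ∙ y)) where
    private
      K-↑ : ∀ {x} n → K x → K (x ↑ n)
      K-↑ zero    k = K-ε
      K-↑ (suc n) k = K-∙ k (K-↑ n k)
      K-⊑ : ∀ {x y} → x ⊑ y → K y → K x
      K-⊑ (n , refl) k = K-↑ n k

    -- Descent on the order: pass from y to y ↑ q as long as that stays outside K. At the end the
    -- q′-part of y is a power of its own q-th power and so lies in K; the q-part must then lie
    -- outside. With K a centraliser this yields an element of prime power order whose q-th power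
    -- already commutes.
    minimal-outside : ∀ y → ¬ K y → ∃₂ λ q y′ → Prime q × y′ ⊑ y × ¬ K y′ × K (y′ ↑ q) × IsPower q (ord y′)
    minimal-outside y = go y (<-wellFounded _)
      where
      go : ∀ y → Acc _<_ (ord y) → ¬ K y → ∃₂ λ q y′ → Prime q × y′ ⊑ y × ¬ K y′ × K (y′ ↑ q) × IsPower q (ord y′)
      go y (acc rs) ¬ky with ord y ≟ 1
      ... | yes o≡1 = contradiction (subst K (sym (ord≡1⇒ε o≡1)) K-ε) ¬ky
      ... | no o≢1 with primeDivisor (ord y) (≤∧≢⇒< ord>0 (o≢1 ∘ sym))
      ...   | q , pr , q∣@(divides m eq) with K? (y ↑ q)
      ...     | no ¬k = let q′ , y′ , pr′ , s , r = go (y ↑ q) (rs lt) ¬k in q′ , y′ , pr′ , ⊑-trans s (⊑-↑ q) , r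
        where
        instance _ = prime⇒nonZero pr
        instance _ = prime⇒nonTrivial pr
        lt : ord (y ↑ q) < ord y
        lt = subst (_< ord y) (sym (ord-↑ q m (trans eq (*-comm m q)))) (quotient-< q∣)
      ...     | yes k with decompose pr y
      ...       | a , b , a⊑y , b⊑y , pa , q∤b , refl = q , a , pr , a⊑y , (λ ka → ¬ky (K-∙ ka kb)) , kq a⊑y , pa
        where
        kq : ∀ {x} → x ⊑ a ∙ b → K (x ↑ q)
        kq (n , refl) = subst K (↑-↑ (a ∙ b) q n) (K-↑ n k)
        kb : K b
        kb = K-⊑ (⊑-coprime (prime∤⇒coprime pr q∤b) (↑-ord b)) (kq b⊑y)

-- Cauchy's theorem and the order of a p-group.

length-cartesianProductWith : ∀ {A B C : Set} (f : A → B → C) xs ys → length (cartesianProductWith f xs ys) ≡ length xs * length ys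
length-cartesianProductWith f [] ys = refl
length-cartesianProductWith f (x ∷ xs) ys = trans (length-++ (map (f x) ys)) (cong₂ _+_ (length-map (f x) ys) (length-cartesianProductWith f xs ys))

length-cartesianProduct : ∀ {A B : Set} (xs : List A) (ys : List B) → length (cartesianProduct xs ys) ≡ length xs * length ys
length-cartesianProduct = length-cartesianProductWith _,_

-- McKay: the cyclic group of order p rotates the p-tuples with product ε.
module Cauchy (𝔾 : FinGroup) where
  open Powers 𝔾

  private
    tuples : ℕ → List (List G)
    tuples zero    = [] ∷ []
    tuples (suc n) = cartesianProductWith _∷_ (allFin N) (tuples n)

    tuples-Unique : ∀ n → Unique (tuples n)
    tuples-Unique zero    = [] ∷ []
    tuples-Unique (suc n) = Unique.cartesianProductWith⁺ _∷_ (λ { refl → refl , refl }) (Unique.allFin⁺ N) (tuples-Unique n)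

    tuples-length : ∀ n → length (tuples n) ≡ N ^ n
    tuples-length zero = refl
    tuples-length (suc n) = trans (length-cartesianProductWith _∷_ (allFin N) (tuples n)) (cong₂ _*_ (allFin-length N) (tuples-length n))

    ∈-tuples⁺ : ∀ l → l ∈ tuples (length l)
    ∈-tuples⁺ [] = here refl
    ∈-tuples⁺ (x ∷ l) = ∈-cartesianProductWith⁺ _∷_ (∈-allFin x) (∈-tuples⁺ l)

    ∈-tuples⁻ : ∀ {n l} → l ∈ tuples n → length l ≡ n
    ∈-tuples⁻ {zero} (here refl) = refl
    ∈-tuples⁻ {suc n} q with ∈-cartesianProductWith⁻ _∷_ (allFin N) (tuples n) q
    ... | _ , _ , _ , q′ , refl = cong suc (∈-tuples⁻ q′)

    prod : List G → G
    prod []      = ε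
    prod (x ∷ l) = x ∙ prod l

    prod-++ : ∀ l m → prod (l ++ m) ≡ prod l ∙ prod m
    prod-++ [] m = sym (identityˡ _)
    prod-++ (x ∷ l) m = trans (cong (x ∙_) (prod-++ l m)) (sym (assoc _ _ _))

  module _ {p} (pr : Prime p) where
    private
      instance _ = prime⇒nonZero pr

      rot : List G → List G
      rot []      = []
      rot (x ∷ l) = l ++ x ∷ []

      rot-length : ∀ l → length (rot l) ≡ length l
      rot-length [] = refl
      rot-length (x ∷ l) = trans (length-++ l) (+-comm (length l) 1)

      -- The identity on lists of other lengths, so that every list has period p, as `Periodic`
      -- requires.
      σ : List G → List G
      σ l with length l ≟ p
      ... | yes _ = rot l
      ... | no _  = l

      σ-rot : ∀ l → length l ≡ p → σ l ≡ rot l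
      σ-rot l e with length l ≟ p
      ... | yes _ = refl
      ... | no ne = contradiction e ne

      open Iterate σ

      iter-rot : ∀ k l m → length (l ++ m) ≡ p → length l ≡ k → iter k (l ++ m) ≡ m ++ l
      iter-rot zero [] m e refl = sym (List.++-identityʳ m)
      iter-rot (suc k) (x ∷ l) m e el = begin
        σ (iter k (x ∷ l ++ m))         ≡⟨ iter-+ 1 k _ ⟨
        iter (1 + k) (x ∷ l ++ m)       ≡⟨ cong (λ j → iter j (x ∷ l ++ m)) (+-comm 1 k) ⟩
        iter (k + 1) (x ∷ l ++ m)       ≡⟨ iter-+ k 1 _ ⟩
        iter k (σ (x ∷ l ++ m))         ≡⟨ cong (iter k) (σ-rot (x ∷ l ++ m) e) ⟩
        iter k ((l ++ m) ++ x ∷ [])     ≡⟨ cong (iter k) (List.++-assoc l m (x ∷ [])) ⟩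
        iter k (l ++ (m ++ x ∷ []))     ≡⟨ iter-rot k l (m ++ x ∷ []) (trans (cong length {l ++ m ++ x ∷ []} (sym (List.++-assoc l m (x ∷ [])))) (trans (rot-length (x ∷ l ++ m)) e)) (suc-injective el) ⟩
        (m ++ x ∷ []) ++ l              ≡⟨ List.++-assoc m (x ∷ []) l ⟩
        m ++ x ∷ l                      ∎
        where open ≡-Reasoning

      periodic : ∀ l → iter p l ≡ l
      periodic l = case length l ≟ p of λ
        { (yes e) → trans (cong (iter p) (sym (List.++-identityʳ l))) (iter-rot p l [] (trans (cong length (List.++-identityʳ l)) e) e)
        ; (no ne) → fix ne p }
        where
        fix : length l ≢ p → ∀ k → iter k l ≡ l
        fix ne zero = refl
        fix ne (suc k) = trans (cong σ (fix ne k)) lem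
          where
          lem : σ l ≡ l
          lem with length l ≟ p
          ... | yes e = contradiction e ne
          ... | no _  = refl

      open Periodic (List.≡-dec Fin._≟_) p pr periodic

      -- A tuple with product ε is determined by its entries after the first, so there are N ^ (p -
      -- 1) of them.
      close : List G → List G
      close l = prod l ⁻¹ ∷ l

      X : List (List G)
      X = map close (tuples (pred p))

      ∈X⁻ : ∀ {l} → l ∈ X → length l ≡ p × prod l ≡ ε
      ∈X⁻ q with ∈-map⁻ close q
      ... | l , l∈ , refl = trans (cong suc (∈-tuples⁻ l∈)) (suc-pred p) , inverseˡ (prod l)

      ∈X⁺ : ∀ l → length l ≡ p → prod l ≡ ε → l ∈ X
      ∈X⁺ [] e _ = contradiction (sym e) (≢-nonZero⁻¹ p)
      ∈X⁺ (x ∷ l) e f = subst (_∈ X) (cong (_∷ l) (sym (inverseˡ-unique x (prod l) f)))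
        (∈-map⁺ close (subst (λ n → l ∈ tuples n) (cong pred e) (∈-tuples⁺ l)))

      X-Unique : Unique X
      X-Unique = Unique-map⁺ close (λ { _ _ refl → refl }) (tuples-Unique (pred p))

      σ-closed : ∀ {l} → l ∈ X → σ l ∈ X
      σ-closed {l} q with ∈X⁻ q
      ... | e , f = subst (_∈ X) (sym (σ-rot l e)) (∈X⁺ (rot l) (trans (rot-length l) e) (rot-prod l f))
        where
        rot-prod : ∀ l → prod l ≡ ε → prod (rot l) ≡ ε
        rot-prod [] f = f
        rot-prod (x ∷ l) f = trans (prod-++ l (x ∷ [])) (trans (cong (prod l ∙_) (identityʳ x))
          (trans (cong (_∙ x) (inverseʳ-unique x (prod l) f)) (inverseˡ x)))

      fixed-const : ∀ x l → rot (x ∷ l) ≡ x ∷ l → l ≡ replicate (length l) x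
      fixed-const x [] e = refl
      fixed-const x (y ∷ l) e with List.∷-injective e
      ... | refl , e′ = cong (x ∷_) (fixed-const x l e′)

      prod-replicate : ∀ n x → prod (replicate n x) ≡ x ↑ n
      prod-replicate zero x = refl
      prod-replicate (suc n) x = cong (x ∙_) (prod-replicate n x)

      rot-replicate : ∀ n (x : G) → replicate n x ++ x ∷ [] ≡ x ∷ replicate n x
      rot-replicate zero x = refl
      rot-replicate (suc n) x = cong (x ∷_) (rot-replicate n x)

      fixed-count : length (filter fixed? X) ≡ count (λ x → x ↑ p Fin.≟ ε)
      fixed-count = ≤-antisym
        (length-inj hd (Unique.filter⁺ fixed? X-Unique)
          (λ {l} {m} q r e → trans (const q) (trans (cong (replicate p) e) (sym (const r))))
          λ {l} q → ∈-count⁺ (λ x → x ↑ p Fin.≟ ε) (trans (sym (prod-replicate p (hd l)))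
             (trans (cong prod (sym (const q))) (proj₂ (∈X⁻ (proj₁ (∈-filter⁻ fixed? {xs = X} q)))))))
        (length-inj (replicate p) (Unique-count (λ x → x ↑ p Fin.≟ ε))
          (λ _ _ e → rep-inj p (>-nonZero⁻¹ p) e)
          λ {x} q → ∈-filter⁺ fixed? (∈X⁺ (replicate p x) (List.length-replicate p) (trans (prod-replicate p x) (∈-count⁻ (λ x → x ↑ p Fin.≟ ε) q)))
             (trans (σ-rot (replicate p x) (List.length-replicate p)) (rr p x)))
        where
        hd : List G → G
        hd [] = ε
        hd (x ∷ _) = x
        const : ∀ {l} → l ∈ filter fixed? X → l ≡ replicate p (hd l)
        const {l} q with ∈-filter⁻ fixed? {xs = X} q
        ... | l∈ , f = aux l (proj₁ (∈X⁻ l∈)) (trans (sym (σ-rot l (proj₁ (∈X⁻ l∈)))) f)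
          where
          aux : ∀ l → length l ≡ p → rot l ≡ l → l ≡ replicate p (hd l)
          aux [] e _ = contradiction (sym e) (≢-nonZero⁻¹ p)
          aux (x ∷ l) e f = trans (cong (x ∷_) (fixed-const x l f)) (cong (λ n → replicate n x) e)
        rep-inj : ∀ n {x y : G} → 0 < n → replicate n x ≡ replicate n y → x ≡ y
        rep-inj (suc n) _ e = proj₁ (List.∷-injective e)
        rr : ∀ n (x : G) → rot (replicate n x) ≡ replicate n x
        rr zero x = refl
        rr (suc n) x = rot-replicate n x

    -- The tuples fixed by rotation are the constant ones. The others come in orbits of length p,
    -- and p divides the number N ^ (p - 1) of all tuples since p - 1 is positive.
    prime∣solutions : p ∣ N → p ∣ count (λ x → x ↑ p Fin.≟ ε)
    prime∣solutions d with length≡fixed X X-Unique σ-closed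
    ... | k , e = ∣m+n∣m⇒∣n {m = k * p} (subst (p ∣_) (trans (sym tot) (trans e (trans (cong (_+ k * p) fixed-count) (+-comm _ (k * p))))) (big (pred p) (s<s⁻¹ (subst (1 <_) (sym (suc-pred p)) (prime>1 pr))))) (n∣m*n k)
      where
      tot : length X ≡ N ^ pred p
      tot = trans (length-map close (tuples (pred p))) (tuples-length (pred p))
      big : ∀ n → 0 < n → p ∣ N ^ n
      big (suc n) _ = ∣m⇒∣m*n (N ^ n) d

    cauchy : p ∣ N → ∃ λ x → ord x ≡ p
    cauchy d = let x , e , ne = found in x , ord-prime pr e ne
      where
      Sol? = λ x → x ↑ p Fin.≟ ε
      found : ∃ λ x → x ↑ p ≡ ε × x ≢ ε
      found with Fin.any? (λ x → (x ↑ p Fin.≟ ε) ×-dec ¬? (x Fin.≟ ε))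
      ... | yes (x , h) = x , h
      ... | no none = contradiction (∣1⇒≡1 (subst (p ∣_) one! (prime∣solutions d))) λ { refl → ¬prime[1] pr }
        where
        one! : count Sol? ≡ 1
        one! = ≤-antisym
          (count-≤ Sol? {ys = ε ∷ []} λ i e → case i Fin.≟ ε of λ { (yes refl) → here refl ; (no ne) → contradiction (i , e , ne) none })
          (count≢0 Sol? ε (ε↑ p))

  p-group-order : ∀ {p} → (∀ x → ∃ λ k → ord x ≡ p ^ k) → Prime p → ∃ λ n → N ≡ p ^ n
  p-group-order {p} h pr = only-prime⇒power p N {{nz}} λ {q} pq q∣ →
    let x , e = cauchy pq q∣ ; k , f = h x in prime∣prime pq pr (prime∣^ p k pq (∣-reflexive (trans (sym e) f)))
    where
    nz : NonZero N
    nz = Fin.nonZeroIndex ε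

-- Counting cyclic subgroups, and conjugation on them.

module Membership (𝔾 : FinGroup) where
  open Powers 𝔾

  ∈⟨⟩⇒⊑ : ∀ {h g} → _∈⟨_⟩ group h g → h ⊑ g
  ∈⟨⟩⇒⊑ (ℤ.+ n , e)     = n , sym e
  ∈⟨⟩⇒⊑ (ℤ.-[1+ n ] , e) = subst (_⊑ _) (sym e) (⊑-⁻¹ (⊑-↑ (suc n)))

  ⊑⇒∈⟨⟩ : ∀ {h g} → h ⊑ g → _∈⟨_⟩ group h g
  ⊑⇒∈⟨⟩ (n , e) = ℤ.+ n , sym e

  SameCyclic⇒∼ : ∀ {g h} → SameCyclic group g h → g ∼ h
  SameCyclic⇒∼ s = ∈⟨⟩⇒⊑ (proj₁ (s _) (⊑⇒∈⟨⟩ ⊑-refl)) , ∈⟨⟩⇒⊑ (proj₂ (s _) (⊑⇒∈⟨⟩ ⊑-refl))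

  ∼⇒SameCyclic : ∀ {g h} → g ∼ h → SameCyclic group g h
  ∼⇒SameCyclic (p , q) k = (λ m → ⊑⇒∈⟨⟩ (⊑-trans (∈⟨⟩⇒⊑ m) p)) , (λ m → ⊑⇒∈⟨⟩ (⊑-trans (∈⟨⟩⇒⊑ m) q))

module Classes (𝔾 : FinGroup) {c} (H : HasExactlyCyclicSubgroups (FinGroup.group 𝔾) c) where
  open Powers 𝔾 public
  open Parts 𝔾 public
  open Cauchy 𝔾 public
  open Membership 𝔾

  gen : Fin c → G
  gen = proj₁ H

  idx : G → Fin c
  idx g = proj₁ (proj₂ (proj₂ H) g)

  gen-injective : ∀ {i j} → gen i ∼ gen j → i ≡ j
  gen-injective s = proj₁ (proj₂ H) _ _ (∼⇒SameCyclic s)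

  ∼-idx : ∀ g → g ∼ gen (idx g)
  ∼-idx g = SameCyclic⇒∼ (proj₂ (proj₂ (proj₂ H) g))

  idx-∼ : ∀ {g h} → idx g ≡ idx h → g ∼ h
  idx-∼ {g} {h} e = ∼-trans (∼-idx g) (subst (λ i → gen i ∼ h) (sym e) (∼-sym (∼-idx h)))

  ∼⇒idx≡ : ∀ {g h} → g ∼ h → idx g ≡ idx h
  ∼⇒idx≡ s = gen-injective (∼-trans (∼-sym (∼-idx _)) (∼-trans s (∼-idx _)))

  idx-gen : ∀ i → idx (gen i) ≡ i
  idx-gen i = gen-injective (∼-sym (∼-idx (gen i)))

  ∼? : ∀ g h → Dec (g ∼ h)
  ∼? g h = map′ idx-∼ ∼⇒idx≡ (idx g Fin.≟ idx h)

  -- κ tests P at the chosen generators only; invariance under ∼ turns this into a test of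
  -- subgroups.
  Invariant : (G → Set) → Set
  Invariant P = ∀ {x y} → x ∼ y → P x → P y

  ord-Invariant : (P : ℕ → Set) → Invariant (P ∘ ord)
  ord-Invariant P s = subst P (∼-ord s)

  -- the number of cyclic subgroups whose generators satisfy P
  κ : {P : G → Set} → Decidable P → ℕ
  κ P? = count (P? ∘ gen)

  module _ {P : G → Set} (P? : Decidable P) (inv : Invariant P) where
    κ-≥ : ∀ {A : Set} {xs : List A} (f : A → G) → Unique xs →
          (∀ {x y} → x ∈ xs → y ∈ xs → f x ∼ f y → x ≡ y) → (∀ {x} → x ∈ xs → P (f x)) → length xs ≤ κ P?
    κ-≥ f u inj h = count-≥ (P? ∘ gen) (idx ∘ f) u (λ p q e → inj p q (idx-∼ e)) (inv (∼-idx _) ∘ h)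

    κ-≥-Fin : ∀ {n} (f : Fin n → G) → (∀ {i j} → f i ∼ f j → i ≡ j) → (∀ i → P (f i)) → n ≤ κ P?
    κ-≥-Fin {n} f inj h = subst (_≤ κ P?) (allFin-length n)
      (κ-≥ f (Unique.allFin⁺ n) (λ _ _ → inj) λ {i} _ → h i)

    κ-≥1 : ∀ {x} → P x → 1 ≤ κ P?
    κ-≥1 {x} p = count≢0 (P? ∘ gen) (idx x) (inv (∼-idx x) p)

    κ-≥2 : ∀ {x y} → P x → P y → ¬ x ∼ y → 2 ≤ κ P?
    κ-≥2 {x} {y} p q ne = κ-≥ {xs = x ∷ y ∷ []} id (((λ { refl → ne ∼-refl }) ∷ []) ∷ ([] ∷ []))
      (λ { (here refl) (here refl) _ → refl ; (here refl) (there (here refl)) s → contradiction s ne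
         ; (there (here refl)) (here refl) s → contradiction (∼-sym s) ne ; (there (here refl)) (there (here refl)) _ → refl })
      λ { (here refl) → p ; (there (here refl)) → q }

    κ-≤ : ∀ (ys : List G) → (∀ x → P x → ∃ λ y → y ∈ ys × x ∼ y) → κ P? ≤ length ys
    κ-≤ ys h = subst (κ P? ≤_) (length-map idx ys) (count-≤ (P? ∘ gen) λ i p →
      let y , y∈ , s = h (gen i) p in subst (_∈ map idx ys) (trans (∼⇒idx≡ (∼-sym s)) (idx-gen i)) (∈-map⁺ idx y∈))

    κ-complete : ∀ {n} (f : Fin n → G) → (∀ {i j} → f i ∼ f j → i ≡ j) → (∀ i → P (f i)) → κ P? ≤ n →
                 ∀ {x} → P x → ∃ λ i → x ∼ f i
    κ-complete {n} f inj h le {x} p with ∈-map⁻ (idx ∘ f) (length-⊆-complete Fin._≟_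
        (Unique-map⁺ (idx ∘ f) (λ _ _ e → inj (idx-∼ e)) (Unique.allFin⁺ n))
        (λ q → let (i , _ , e) = ∈-map⁻ (idx ∘ f) q in ∈-count⁺ (P? ∘ gen) (subst (P ∘ gen) (sym e) (inv (∼-idx (f i)) (h i))))
        (subst (κ P? ≤_) (sym (trans (length-map (idx ∘ f) (allFin n)) (allFin-length n))) le)
        (∈-count⁺ (P? ∘ gen) (inv (∼-idx x) p)))
    ... | i , _ , e = i , idx-∼ e

    κ≡1 : κ P? ≡ 1 → ∀ {x y} → P x → P y → x ∼ y
    κ≡1 e p q = idx-∼ (count≡1 (P? ∘ gen) e _ _ (inv (∼-idx _) p) (inv (∼-idx _) q))

    κ-pos : 1 ≤ κ P? → ∃ P
    κ-pos le = let i , p = count-pos (P? ∘ gen) le in gen i , p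

    κ≡0 : κ P? ≡ 0 → ∀ {x} → ¬ P x
    κ≡0 e p = contradiction (κ-≥1 p) (<⇒≱ (subst (_< 1) (sym e) (s≤s z≤n)))

    κ-none : (∀ x → ¬ P x) → κ P? ≡ 0
    κ-none h = count≡0 (P? ∘ gen) (h ∘ gen)

  module _ {P Q : G → Set} (P? : Decidable P) (Q? : Decidable Q) where
    κ-⊆ : (∀ {x} → P x → Q x) → κ P? ≤ κ Q?
    κ-⊆ h = count-⊆ (P? ∘ gen) (Q? ∘ gen) h

    κ-ext : (∀ {x} → P x → Q x) → (∀ {x} → Q x → P x) → κ P? ≡ κ Q?
    κ-ext f g = ≤-antisym (count-⊆ (P? ∘ gen) (Q? ∘ gen) f) (count-⊆ (Q? ∘ gen) (P? ∘ gen) g)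

    κ-split : κ P? ≡ κ (λ x → P? x ×-dec Q? x) + κ (λ x → P? x ×-dec ¬? (Q? x))
    κ-split = count-split (P? ∘ gen) (Q? ∘ gen)

    κ-map : Invariant Q → (f : G → G) → (∀ {x y} → P x → P y → f x ∼ f y → x ∼ y) → (∀ {x} → P x → Q (f x)) → κ P? ≤ κ Q?
    κ-map inv f inj h = count-mono (P? ∘ gen) (Q? ∘ gen) (idx ∘ f ∘ gen)
      (λ p q e → gen-injective (inj p q (idx-∼ e))) (inv (∼-idx _) ∘ h)

    κ-+ : (∀ {x} → P x → ¬ Q x) → κ P? + κ Q? ≤ κ (λ x → P? x ⊎-dec Q? x)
    κ-+ excl = ≤-reflexive (sym (trans (count-split (λ i → P? (gen i) ⊎-dec Q? (gen i)) (P? ∘ gen))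
      (cong₂ _+_ (count-ext (λ i → (P? (gen i) ⊎-dec Q? (gen i)) ×-dec P? (gen i)) (P? ∘ gen) proj₂ λ p → inj₁ p , p)
        (count-ext (λ i → (P? (gen i) ⊎-dec Q? (gen i)) ×-dec ¬? (P? (gen i))) (Q? ∘ gen)
          (λ { (inj₁ p , ¬p) → contradiction p ¬p ; (inj₂ q , _) → q }) λ q → inj₂ q , λ p → excl p q))))

  κ≤c : {P : G → Set} (P? : Decidable P) → κ P? ≤ c
  κ≤c P? = count≤ (P? ∘ gen)

  κ-compl : {P : G → Set} (P? : Decidable P) → c ≡ κ P? + κ (¬? ∘ P?)
  κ-compl P? = count-compl (P? ∘ gen)

  act : G → Fin c → Fin c
  act g i = idx (conj g (gen i))

  act-idx : ∀ g x → act g (idx x) ≡ idx (conj g x)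
  act-idx g x = ∼⇒idx≡ (∼-conj g (∼-sym (∼-idx x)))

  module _ (g : G) where
    open Iterate (act g)

    iter-act : ∀ k x → iter k (idx x) ≡ idx (conj (g ↑ k) x)
    iter-act zero x = cong idx (sym (conj-by-ε x))
    iter-act (suc k) x = trans (cong (act g) (iter-act k x)) (trans (act-idx g _) (cong idx (conj-conj g (g ↑ k) x)))

    module _ {p} (pr : Prime p) where
      -- The subgroup ⟨x⟩ returns after p conjugations but not after one, so its orbit has the prime
      -- length p.
      conj-distinct : ∀ {x} → conj (g ↑ p) x ∼ x → ¬ conj g x ∼ x →
                      ∀ {i j : Fin p} → conj (g ↑ toℕ i) x ∼ conj (g ↑ toℕ j) x → i ≡ j
      conj-distinct {x} per ne {i} {j} s = iter-injective {p} {idx x} pr (trans (iter-act p x) (∼⇒idx≡ per))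
        (λ e → ne (idx-∼ (trans (sym (act-idx g x)) e)))
        (trans (iter-act (toℕ i) x) (trans (∼⇒idx≡ s) (sym (iter-act (toℕ j) x))))

      -- Conjugation by g permutes the subgroups in P, with orbits of length 1 and p.
      κ-fixed : (∀ x → conj (g ↑ p) x ∼ x) → {P : G → Set} (P? : Decidable P) → Invariant P → (∀ {x} → P x → P (conj g x)) →
                ∃ λ k → κ P? ≡ κ (λ x → P? x ×-dec ∼? (conj g x) x) + k * p
      κ-fixed per {P} P? inv cl = let k , e = length≡fixed xs (Unique-count (P? ∘ gen)) closed in
          k , trans e (cong (λ v → v + k * p) (trans (cong length (filter-filter (P? ∘ gen) fixed? (allFin c)))
            (count-ext (λ i → P? (gen i) ×-dec fixed? i) (λ i → P? (gen i) ×-dec ∼? (conj g (gen i)) (gen i))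
              (λ { (p , e) → p , idx-∼ (trans e (sym (idx-gen _))) }) λ { (p , s) → p , trans (∼⇒idx≡ s) (idx-gen _) })))
        where
        open Periodic Fin._≟_ p pr (λ i → trans (cong (iter p) (sym (idx-gen i))) (trans (iter-act p (gen i)) (trans (∼⇒idx≡ (per (gen i))) (idx-gen i))))
        xs = filter (P? ∘ gen) (allFin c)
        closed : ∀ {i} → i ∈ xs → act g i ∈ xs
        closed q = ∈-count⁺ (P? ∘ gen) (inv (∼-idx _) (cl (∈-count⁻ (P? ∘ gen) q)))

  -- Otherwise the q conjugates of x would be distinct nontrivial elements of ⟨x⟩.
  small-action : ∀ {q} → Prime q → ∀ {x y} → Commute (y ↑ q) x → conj y x ⊑ x → ord x ≤ q → Commute y x
  small-action {q} pr {x} {y} cq s le with commute? y x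
  ... | yes c = c
  ... | no ¬c = contradiction (Fin.injective⇒≤ {f = f} f-inj) (<⇒≱ (s≤s le))
    where
    open Iterate (conj y)
    iter-conj : ∀ k x → iter k x ≡ conj (y ↑ k) x
    iter-conj zero x = sym (conj-by-ε x)
    iter-conj (suc k) x = trans (cong (conj y) (iter-conj k x)) (conj-conj y (y ↑ k) x)
    stays : ∀ k → iter k x ⊑ x
    stays zero = ⊑-refl
    stays (suc k) = ⊑-trans (⊑-conj y (stays k)) s
    it : Fin q → G
    it i = iter (toℕ i) x
    it-inj : ∀ {i j} → it i ≡ it j → i ≡ j
    it-inj = iter-injective pr (trans (iter-conj q x) (conj-commute cq)) (¬c ∘ conj≡⇒commute)
    x≢ε : x ≢ ε
    x≢ε refl = ¬c commute-ε
    it≢ε : ∀ k → iter k x ≢ ε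
    it≢ε zero = x≢ε
    it≢ε (suc k) e = it≢ε k (conj-injective y (trans e (sym (conj-ε y))))
    f : Fin (suc q) → Fin (ord x)
    f Fin.zero = fromℕ< ord>0
    f (Fin.suc i) = fromℕ< (m%n<n (proj₁ (stays (toℕ i))) (ord x))
    f-val : ∀ i → x ↑ toℕ (f (Fin.suc i)) ≡ it i
    f-val i = let k = proj₁ (stays (toℕ i)) in trans (cong (x ↑_) (Fin.toℕ-fromℕ< (m%n<n k (ord x)))) (trans (sym (↑-% x k)) (proj₂ (stays (toℕ i))))
    f-zero : x ↑ toℕ (f Fin.zero) ≡ ε
    f-zero = cong (x ↑_) (Fin.toℕ-fromℕ< (ord>0 {x}))
    f-inj : ∀ {i j} → f i ≡ f j → i ≡ j
    f-inj {Fin.zero} {Fin.zero} _ = refl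
    f-inj {Fin.zero} {Fin.suc j} e = contradiction (trans (sym (f-val j)) (trans (cong (λ v → x ↑ toℕ v) (sym e)) f-zero)) (it≢ε (toℕ j))
    f-inj {Fin.suc i} {Fin.zero} e = contradiction (trans (sym (f-val i)) (trans (cong (λ v → x ↑ toℕ v) e) f-zero)) (it≢ε (toℕ i))
    f-inj {Fin.suc i} {Fin.suc j} e = cong Fin.suc (it-inj (trans (sym (f-val i)) (trans (cong (λ v → x ↑ toℕ v) e) (f-val j))))

-- Subgroups of prime order.

module PrimeOrder (𝔾 : FinGroup) {c} (H : HasExactlyCyclicSubgroups (FinGroup.group 𝔾) c) where
  open Classes 𝔾 H public

  ord≟ : ∀ n (x : G) → Dec (ord x ≡ n)
  ord≟ n x = ord x ≟ n

  ord≟-inv : ∀ n → Invariant (λ x → ord x ≡ n)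
  ord≟-inv n = ord-Invariant (_≡ n)

  ⊑-prime : ∀ {p u z} → Prime p → u ⊑ z → ord z ≡ p → u ≢ ε → u ∼ z
  ⊑-prime pr s e ne with prime⇒irreducible pr (subst (_ ∣_) e (⊑-ord s))
  ... | inj₁ o≡1 = contradiction (ord≡1⇒ε o≡1) ne
  ... | inj₂ o≡p = ⊑∧ord≡⇒∼ s (trans o≡p (sym e))

  ord-prime≢ε : ∀ {p x} → Prime p → ord x ≡ p → x ≢ ε
  ord-prime≢ε pr e refl = ¬prime[1] (subst Prime (trans (sym e) ord-ε) pr)

  prime-power-⊑ : ∀ {p x} → IsPower p (ord x) → x ≢ ε → p ∣ ord x
  prime-power-⊑ (zero , e) ne = contradiction (ord≡1⇒ε e) ne
  prime-power-⊑ {p} (suc k , e) ne = subst (p ∣_) (sym e) (m∣m*n (p ^ k))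

  -- the p + 1 subgroups of order p in ⟨z , x⟩ ≅ ℤ/p × ℤ/p
  module Plane {p z x} (pr : Prime p) (oz : ord z ≡ p) (ox : ord x ≡ p) (x⋢z : ¬ x ⊑ z) (c : Commute z x) where
    f : Fin (suc p) → G
    f Fin.zero    = z
    f (Fin.suc i) = z ↑ toℕ i ∙ x
    z≁ : ∀ i → ¬ f (Fin.suc i) ⊑ z
    z≁ i s = x⋢z (subst (_⊑ z) (word (neg w0 :∙ (w0 :∙ w1)) w1 (z ↑ toℕ i ∷ x ∷ x ∷ []) refl)
      (⊑-∙ (⊑-⁻¹ (⊑-↑ (toℕ i))) s))
    f-ord : ∀ i → ord (f i) ≡ p
    f-ord Fin.zero    = oz
    f-ord (Fin.suc i) = ord-prime pr
      (trans (∙-↑ p (commute-sym (commute-↑ (toℕ i) (commute-sym c))))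
        (trans (cong₂ _∙_ (trans (↑-↑ z (toℕ i) p) (trans (cong (_↑ toℕ i) (zp)) (ε↑ (toℕ i)))) xp) (identityˡ ε)))
      λ e → z≁ i (subst (_⊑ z) (sym e) ε⊑)
      where
      zp = trans (cong (z ↑_) (sym oz)) (↑-ord z)
      xp = trans (cong (x ↑_) (sym ox)) (↑-ord x)
    f-inj : ∀ {i j} → f i ∼ f j → i ≡ j
    f-inj {Fin.zero}  {Fin.zero}  _ = refl
    f-inj {Fin.zero}  {Fin.suc j} s = contradiction (proj₂ s) (z≁ j)
    f-inj {Fin.suc i} {Fin.zero}  s = contradiction (proj₁ s) (z≁ i)
    -- The quotient u of two generators of one subgroup lies in that subgroup, and also in ⟨z⟩. If u
    -- ≠ ε, both subgroups of order p equal ⟨u⟩, against `z≁`.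
    f-inj {Fin.suc i} {Fin.suc j} s with u Fin.≟ ε
      where u = f (Fin.suc i) ∙ f (Fin.suc j) ⁻¹
    ... | yes u≡ε = cong Fin.suc (Fin.toℕ-injective (↑-injective {z} (lt i) (lt j)
            (∙-cancelʳ x _ _ (∙-cancelʳ (f (Fin.suc j) ⁻¹) _ _ (trans u≡ε (sym (inverseʳ _)))))))
      where
      lt : ∀ (i : Fin p) → toℕ i < ord z
      lt i = subst (toℕ i <_) (sym oz) (Fin.toℕ<n i)
    ... | no u≢ε = contradiction (⊑-trans (proj₂ (⊑-prime pr u⊑w (f-ord (Fin.suc j)) u≢ε)) u⊑z) (z≁ j)
      where
      u⊑w = ⊑-∙ (proj₁ s) (⊑-⁻¹ ⊑-refl)
      u⊑z = subst (_⊑ z) (word (w0 :∙ neg w1) (w0 :∙ w2 :∙ neg (w1 :∙ w2)) (z ↑ toℕ i ∷ z ↑ toℕ j ∷ x ∷ []) refl)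
              (⊑-∙ (⊑-↑ (toℕ i)) (⊑-⁻¹ (⊑-↑ (toℕ j))))

  -- Besides ⟨z⟩ these are the conjugates of ⟨x⟩ under z if x and z do not commute, and the other subgroups of ⟨z , x⟩ if they do.
  nonunique : ∀ {p z x} → Prime p → ord z ≡ p → ord x ≡ p → ¬ x ⊑ z → suc p ≤ κ (ord≟ p)
  nonunique {p} {z} {x} pr oz ox x⋢z with commute? z x
  ... | no ¬c = κ-≥-Fin (ord≟ p) (ord≟-inv p) f (λ {i} {j} → f-inj {i} {j}) f-ord
    where
    zp = trans (cong (z ↑_) (sym oz)) (↑-ord z)
    f : Fin (suc p) → G
    f Fin.zero    = z
    f (Fin.suc i) = conj (z ↑ toℕ i) x
    f-ord : ∀ i → ord (f i) ≡ p
    f-ord Fin.zero    = oz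
    f-ord (Fin.suc i) = trans (ord-conj _ x) ox
    z≁ : ∀ i → ¬ conj (z ↑ toℕ i) x ⊑ z
    z≁ i s = x⋢z (subst₂ _⊑_ (conj-⁻¹ˡ g x) (conj-commute (commute-sym (commute-⁻¹ (commute-↑ (toℕ i) refl)))) (⊑-conj (g ⁻¹) s))
      where g = z ↑ toℕ i
    f-inj : ∀ {i j} → f i ∼ f j → i ≡ j
    f-inj {Fin.zero}  {Fin.zero}  _ = refl
    f-inj {Fin.zero}  {Fin.suc j} s = contradiction (proj₂ s) (z≁ j)
    f-inj {Fin.suc i} {Fin.zero}  s = contradiction (proj₁ s) (z≁ i)
    f-inj {Fin.suc i} {Fin.suc j} s = cong Fin.suc (conj-distinct z pr
      (subst (_∼ x) (sym (trans (cong (λ g → conj g x) zp) (conj-by-ε x))) ∼-refl)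
      (λ t → ¬c (small-action pr (subst (λ g → Commute g x) (sym zp) (commute-sym commute-ε)) (proj₁ t) (≤-reflexive ox))) s)
  ... | yes c = κ-≥-Fin (ord≟ p) (ord≟-inv p) f (λ {i} {j} → f-inj {i} {j}) f-ord
    where open Plane pr oz ox x⋢z c

  -- If all p-elements commute with all p′-elements, a cyclic subgroup is the product of its p-part and its p′-part.
  split : Prime c → ∀ {p} → Prime p → ∀ {a b} → IsPower p (ord a) → a ≢ ε → ¬ p ∣ ord b → b ≢ ε →
          ∃₂ λ x y → IsPower p (ord x) × ¬ p ∣ ord y × ¬ Commute x y
  split cpr {p} pr {a} {b} pa a≢ε p′b b≢ε
    with Fin.any? (λ x → Fin.any? λ y → isPower? pr (ord x) ×-dec ¬? (p ∣? ord y) ×-dec ¬? (commute? x y))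
  ... | yes (x , y , h) = x , y , h
  ... | no none = contradiction prod λ e → case prime⇒irreducible cpr (divides κ₂ (trans e (*-comm κ₁ κ₂))) of λ
        { (inj₁ κ₁≡1) → two₁ κ₁≡1
        ; (inj₂ κ₁≡c) → two₂ (*-cancelˡ-≡ κ₂ 1 c {{prime⇒nonZero cpr}} (trans (cong (_* κ₂) (sym κ₁≡c)) (trans (sym e) (sym (*-identityʳ c))))) }
    where
    P? = isPower? pr ∘ ord
    Q? = λ x → ¬? (p ∣? ord x)
    P-inv = ord-Invariant (IsPower p)
    Q-inv = ord-Invariant (λ n → ¬ p ∣ n)
    κ₁ = κ P?
    κ₂ = κ Q?
    comm : ∀ {x y} → IsPower p (ord x) → ¬ p ∣ ord y → Commute x y
    comm {x} {y} px qy with commute? x y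
    ... | yes cm = cm
    ... | no ¬cm = contradiction (x , y , px , qy , ¬cm) none
    two₁ : κ₁ ≢ 1
    two₁ e = a≢ε (ord≡1⇒ε (trans (∼-ord (κ≡1 P? P-inv e pa (0 , ord-ε))) ord-ε))
    two₂ : κ₂ ≢ 1
    two₂ e = b≢ε (ord≡1⇒ε (trans (∼-ord (κ≡1 Q? Q-inv e p′b λ d → ¬prime[1] (subst Prime (∣1⇒≡1 (subst (p ∣_) ord-ε d)) pr))) ord-ε))
    Ps = filter (P? ∘ gen) (allFin c)
    Qs = filter (Q? ∘ gen) (allFin c)
    f : Fin c × Fin c → Fin c
    f (i , j) = idx (gen i ∙ gen j)
    pairs = cartesianProduct Ps Qs
    pairs⁻ : ∀ {i j} → (i , j) ∈ pairs → IsPower p (ord (gen i)) × ¬ p ∣ ord (gen j)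
    pairs⁻ q = let i∈ , j∈ = ∈-cartesianProduct⁻ Ps Qs q in ∈-count⁻ (P? ∘ gen) i∈ , ∈-count⁻ (Q? ∘ gen) j∈
    -- Each factor is recovered from the product, so distinct pairs of subgroups have distinct
    -- products.
    left : ∀ {x y x′ y′} → IsPower p (ord x) → ¬ p ∣ ord y → IsPower p (ord x′) → ¬ p ∣ ord y′ →
           x ∙ y ∼ x′ ∙ y′ → x ⊑ x′ × y ⊑ y′
    left px qy px′ qy′ s =
      ⊑-part (comm px′ qy′) (power-coprime pr px qy′) (⊑-trans (⊑-∙ˡ (comm px qy) (power-coprime pr px qy)) (proj₁ s)) ,
      ⊑-part (commute-sym (comm px′ qy′)) (Cop.sym (power-coprime pr px′ qy))
        (subst (_ ⊑_) (comm px′ qy′) (⊑-trans (⊑-∙ʳ (comm px qy) (power-coprime pr px qy)) (proj₁ s)))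
    inj : ∀ {u v} → u ∈ pairs → v ∈ pairs → f u ≡ f v → u ≡ v
    inj q r e with pairs⁻ q | pairs⁻ r
    ... | px , qy | px′ , qy′ = let s₁ , s₂ = left px qy px′ qy′ (idx-∼ e) ; t₁ , t₂ = left px′ qy′ px qy (∼-sym (idx-∼ e)) in
      cong₂ _,_ (gen-injective (s₁ , t₁)) (gen-injective (s₂ , t₂))
    surj : ∀ {i} → i ∈ allFin c → i ∈ map f pairs
    surj {i} _ with decompose pr (gen i)
    ... | x , y , x⊑ , y⊑ , px , qy , e = subst (_∈ map f pairs) (trans (∼⇒idx≡ s) (idx-gen i))
        (∈-map⁺ f (∈-cartesianProduct⁺ (∈-count⁺ (P? ∘ gen) (P-inv (∼-idx x) px)) (∈-count⁺ (Q? ∘ gen) (Q-inv (∼-idx y) qy))))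
      where
      x′ = gen (idx x)
      y′ = gen (idx y)
      px′ = P-inv (∼-idx x) px
      qy′ = Q-inv (∼-idx y) qy
      s : x′ ∙ y′ ∼ gen i
      s = ⊑-∙ (⊑-trans (proj₂ (∼-idx x)) x⊑) (⊑-trans (proj₂ (∼-idx y)) y⊑) ,
          subst (_⊑ x′ ∙ y′) e (⊑-∙ (⊑-trans (proj₁ (∼-idx x)) (⊑-∙ˡ (comm px′ qy′) (power-coprime pr px′ qy′)))
                                    (⊑-trans (proj₁ (∼-idx y)) (⊑-∙ʳ (comm px′ qy′) (power-coprime pr px′ qy′))))
    prod : c ≡ κ₁ * κ₂
    prod = trans (≤-antisym
      (subst₂ _≤_ (allFin-length c) (length-map f pairs) (length-⊆ (Unique.allFin⁺ c) surj))
      (subst₂ _≤_ (length-map f pairs) (allFin-length c) (length-⊆ (Unique-map⁺ f inj (Unique.cartesianProduct⁺ (Unique-count (P? ∘ gen)) (Unique-count (Q? ∘ gen)))) λ _ → ∈-allFin _)))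
      (length-cartesianProduct Ps Qs)

  -- When ⟨z⟩ is the only subgroup of order p, X ↦ X⟨z⟩ matches the p′-subgroups centralising z
  -- with those whose p-part is ⟨z⟩.
  module Unique-prime {p z} (pr : Prime p) (oz : ord z ≡ p) (unique : ∀ {x} → ord x ≡ p → x ⊑ z) where
    private instance _ = prime⇒nonZero pr

    C? : Decidable (Commute z)
    C? = commute? z

    -- The elements centralising z are sorted by the power of p in their order: none for `A?`,
    -- exactly one for `B?`, at least two for `W?`.
    A? : Decidable (λ x → Commute z x × ¬ p ∣ ord x)
    A? x = C? x ×-dec ¬? (p ∣? ord x)

    B? : Decidable (λ x → Commute z x × p ∣ ord x × ¬ p * p ∣ ord x)
    B? x = C? x ×-dec (p ∣? ord x) ×-dec ¬? (p * p ∣? ord x)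

    W? : Decidable (λ x → Commute z x × p * p ∣ ord x)
    W? x = C? x ×-dec (p * p ∣? ord x)

    C-inv : Invariant (Commute z)
    C-inv s h = commute-⊑ h (proj₂ s)

    A-inv : Invariant (λ x → Commute z x × ¬ p ∣ ord x)
    A-inv s (h , n) = C-inv s h , ord-Invariant (λ n → ¬ p ∣ n) s n

    B-inv : Invariant (λ x → Commute z x × p ∣ ord x × ¬ p * p ∣ ord x)
    B-inv s (h , n) = C-inv s h , ord-Invariant (λ n → p ∣ n × ¬ p * p ∣ n) s n

    W-inv : Invariant (λ x → Commute z x × p * p ∣ ord x)
    W-inv s (h , n) = C-inv s h , ord-Invariant (λ n → p * p ∣ n) s n

    z⊑ : ∀ {x} → p ∣ ord x → z ⊑ x
    z⊑ d = let y , y⊑x , oy = power-⊑ d in ⊑-trans (proj₂ (⊑∧ord≡⇒∼ (unique oy) (trans oy (sym oz)))) y⊑x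

    private
      p′ : G → G
      p′ x = proj₁ (proj₂ (decompose pr x))

      A≤B : κ A? ≤ κ B?
      A≤B = κ-map A? B? B-inv (_∙ z)
        (λ (cx , nx) (cy , ny) s → half cx nx cy ny s , half cy ny cx nx (∼-sym s))
        λ {x} (cx , nx) → let o = trans (ord-∙ (commute-sym cx) (cop nx)) (cong (ord x *_) oz) in
          commute-∙ cx refl , subst (p ∣_) (sym o) (n∣m*n (ord x)) , λ d → nx (*-cancelʳ-∣ p (subst (p * p ∣_) o d))
        where
        cop : ∀ {x} → ¬ p ∣ ord x → Coprime (ord x) (ord z)
        cop {x} n = subst (Coprime (ord x)) (sym oz) (Cop.sym (prime∤⇒coprime pr n))
        half : ∀ {x y} → Commute z x → ¬ p ∣ ord x → Commute z y → ¬ p ∣ ord y → x ∙ z ∼ y ∙ z → x ⊑ y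
        half cx nx cy ny s = ⊑-part (commute-sym cy) (cop nx) (⊑-trans (⊑-∙ˡ (commute-sym cx) (cop nx)) (proj₁ s))

      B≤A : κ B? ≤ κ A?
      B≤A = κ-map B? A? A-inv p′ (λ h h′ s → half h h′ (proj₁ s) , half h′ h (proj₂ s))
        λ {x} (cx , _) → let _ , _ , _ , b⊑ , _ , n , _ = decompose pr x in commute-⊑ cx b⊑ , n
        where
        half : ∀ {x y} → Commute z x × p ∣ ord x × ¬ p * p ∣ ord x → Commute z y × p ∣ ord y × ¬ p * p ∣ ord y →
               p′ x ⊑ p′ y → x ⊑ y
        half {x} {y} (_ , d , nd) (_ , d′ , _) s with decompose pr x | decompose pr y
        ... | a , b , a⊑ , b⊑ , (k , ea) , nb , refl | _ , _ , _ , b′⊑ , _ = ⊑-∙ (⊑-trans (a⊑z k ea) (z⊑ d′)) (⊑-trans s b′⊑)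
          where
          a⊑z : ∀ k → ord a ≡ p ^ k → a ⊑ z
          a⊑z zero e = subst (_⊑ z) (sym (ord≡1⇒ε e)) ε⊑
          a⊑z (suc zero) e = unique (trans e (*-identityʳ p))
          a⊑z (suc (suc k)) e = contradiction (∣-trans (subst (p * p ∣_) (trans (*-assoc p p (p ^ k)) (sym e)) (m∣m*n (p ^ k))) (⊑-ord a⊑)) nd

    -- The p-part of a subgroup centralising z is trivial, is ⟨z⟩, or has order divisible by p²; the
    -- first two kinds are equally many.
    doubling : κ C? ≡ κ A? + κ A? + κ W?
    doubling = begin
      κ C?                                  ≡⟨ κ-split C? (λ x → p ∣? ord x) ⟩
      κ D? + κ A?                           ≡⟨ cong (_+ κ A?) (κ-split D? (λ x → p * p ∣? ord x)) ⟩
      κ DW? + κ DB? + κ A?                  ≡⟨ cong₂ (λ u v → u + v + κ A?)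
                                                 (κ-ext DW? W? (λ ((cx , _) , d) → cx , d) λ (cx , d) → (cx , ∣-trans (m∣m*n p) d) , d)
                                                 (trans (κ-ext DB? B? (λ ((cx , d) , n) → cx , d , n) λ (cx , d , n) → (cx , d) , n) (≤-antisym B≤A A≤B)) ⟩
      κ W? + κ A? + κ A?                    ≡⟨ solve 2 (λ w a → w :+ a :+ a := a :+ a :+ w) refl (κ W?) (κ A?) ⟩
      κ A? + κ A? + κ W?                    ∎
      where
      open ≡-Reasoning
      open +-*-Solver
      D? = λ x → C? x ×-dec (p ∣? ord x)
      DW? = λ x → D? x ×-dec (p * p ∣? ord x)
      DB? = λ x → D? x ×-dec ¬? (p * p ∣? ord x)

    p²∣ : ∀ {x} → IsPower p (ord x) → ¬ x ⊑ z → p * p ∣ ord x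
    p²∣ (zero , e) n = contradiction (subst (_⊑ z) (sym (ord≡1⇒ε e)) ε⊑) n
    p²∣ (suc zero , e) n = contradiction (unique (trans e (*-identityʳ p))) n
    p²∣ {x} (suc (suc k) , e) _ = subst (p * p ∣_) (trans (*-assoc p p (p ^ k)) (sym e)) (m∣m*n (p ^ k))

    order-p⊑z : ∀ {v} → v ↑ p ≡ ε → v ⊑ z
    order-p⊑z {v} e with v Fin.≟ ε
    ... | yes refl = ε⊑
    ... | no ne    = unique (ord-prime pr e ne)

    module Central (central : ∀ x → Commute z x) where
      A′? : Decidable (λ x → ¬ p ∣ ord x)
      A′? x = ¬? (p ∣? ord x)

      W′? : Decidable (λ x → p * p ∣ ord x)
      W′? x = p * p ∣? ord x

      doubling′ : c ≡ κ A′? + κ A′? + κ W′?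
      doubling′ = begin
        c                         ≡⟨ κ-compl C? ⟩
        κ C? + κ (¬? ∘ C?)        ≡⟨ cong₂ _+_ doubling (κ-none (¬? ∘ C?) (λ s n h → n (C-inv (∼-sym s) h)) λ x n → n (central x)) ⟩
        κ A? + κ A? + κ W? + 0    ≡⟨ +-identityʳ _ ⟩
        κ A? + κ A? + κ W?        ≡⟨ cong₂ (λ a w → a + a + w) (κ-ext A? A′? proj₂ (central _ ,_)) (κ-ext W? W′? proj₂ (central _ ,_)) ⟩
        κ A′? + κ A′? + κ W′?     ∎
        where open ≡-Reasoning

      -- The elements of order p in ⟨x⟩ lie in the central ⟨z⟩, which is what `coprime-action` asks
      -- for.
      normalises⇒commute : ∀ {x y} → IsPower p (ord x) → ¬ p ∣ ord y → conj y x ⊑ x → Commute y x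
      normalises⇒commute {x} {y} (k , e) n s = coprime-action pr n k x e s λ {v} _ vp → commute-⊑ (commute-sym (central y)) (order-p⊑z vp)

      -- x lies outside the central ⟨z⟩, so p² divides its order; y cannot normalise ⟨x⟩, so the
      -- conjugate of ⟨x⟩ is a second subgroup counted by `W′?`.
      module Noncommuting {x y} (px : IsPower p (ord x)) (qy : ¬ p ∣ ord y) (¬c : ¬ Commute x y) where
        p²∣x : p * p ∣ ord x
        p²∣x = p²∣ px λ s → ¬c (commute-sym (commute-⊑ (commute-sym (central y)) s))

        moves : ¬ conj y x ∼ x
        moves s = ¬c (commute-sym (normalises⇒commute px qy (proj₁ s)))

        W≥2 : 2 ≤ κ W′?
        W≥2 = κ-≥2 W′? (ord-Invariant (p * p ∣_)) p²∣x (subst (p * p ∣_) (sym (ord-conj y x)) p²∣x) (moves ∘ ∼-sym)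

-- A unique but noncentral subgroup of prime order.

even-or-odd : ∀ k → (∃ λ m → k ≡ m * 2) ⊎ (∃ λ m → k ≡ 1 + m * 2)
even-or-odd zero = inj₁ (0 , refl)
even-or-odd (suc k) with even-or-odd k
... | inj₁ (m , refl) = inj₂ (m , refl)
... | inj₂ (m , refl) = inj₁ (suc m , refl)

module _ (𝔾 : FinGroup) where
  open Powers 𝔾

  -- The field `subgroups` adds the p conjugates of ⟨y⟩, which are all that lies outside the
  -- centraliser of z, to the subgroups inside it: each of the b proper subgroups of ⟨y⟩ occurs
  -- there with and without the factor ⟨z⟩.
  record SplitMetacyclic : Set where
    field
      {p q b r}     : ℕ
      {z y}         : G
      p-prime       : Prime p
      q-prime       : Prime q
      ord-z         : ord z ≡ p
      ord-y         : ord y ≡ q ^ b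
      p∤ord-y       : ¬ p ∣ ord y
      noncommuting  : ¬ Commute z y
      conj-yq       : Commute z (y ↑ q)
      conj-r        : conj y z ≡ z ↑ r
      r<p           : r < p
      generate      : ∀ g → ∃₂ λ i j → g ≡ z ↑ i ∙ y ↑ j
      subgroups     : 11 ≡ p + (b + b)
      p≥3           : 3 ≤ p

module Noncentral (𝔾 : FinGroup) (H : HasExactlyCyclicSubgroups (FinGroup.group 𝔾) 11)
  {p} (pr : Prime p) where
  open PrimeOrder 𝔾 H

  module _ {z} (oz : ord z ≡ p) (unique : ∀ {x} → ord x ≡ p → x ⊑ z) {g₀} (¬c₀ : ¬ Commute z g₀) where
    private instance _ = prime⇒nonZero pr
    open Unique-prime pr oz unique

    Out? : Decidable (λ x → ¬ Commute z x)
    Out? = ¬? ∘ C?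

    Out-inv : Invariant (λ x → ¬ Commute z x)
    Out-inv s n h = n (C-inv (∼-sym s) h)

    z-normal : ∀ g → conj g z ⊑ z
    z-normal g = unique (trans (ord-conj g z) oz)

    zp : z ↑ p ≡ ε
    zp = trans (cong (z ↑_) (sym oz)) (↑-ord z)

    -- If z normalised ⟨w⟩, the commutator of z and w would lie in ⟨z⟩ and in ⟨w⟩. If it is not ε it
    -- generates ⟨z⟩, so z lies in ⟨w⟩; either way z and w commute.
    ¬normalises : ∀ {w} → ¬ Commute z w → ¬ conj z w ⊑ w
    ¬normalises {w} n s = case (conj z w ∙ w ⁻¹) Fin.≟ ε of λ
      { (yes e) → n (conj≡⇒commute (∙-cancelʳ (w ⁻¹) _ _ (trans e (sym (inverseʳ w)))))
      ; (no ne) → n (commute-within (⊑-trans (proj₂ (⊑-prime pr u⊑z oz ne)) u⊑w) ⊑-refl) }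
      where
      u⊑w = ⊑-∙ s (⊑-⁻¹ ⊑-refl)
      u⊑z = subst (_⊑ z) (word (w0 :∙ neg (w1 :∙ w0 :∙ neg w1)) (w0 :∙ w1 :∙ neg w0 :∙ neg w1) (z ∷ w ∷ w ∷ []) refl)
              (⊑-∙ (⊑-refl {z}) (⊑-⁻¹ (z-normal w)))

    p∤outside : ∀ {w} → ¬ Commute z w → ¬ p ∣ ord w
    p∤outside n d = n (commute-within (z⊑ d) ⊑-refl)

    -- Conjugation by z fixes none of the subgroups outside the centraliser, so they fall into
    -- orbits of length p.
    κOut : ∃ λ k → κ Out? ≡ k * p
    κOut = let k , e = κ-fixed z pr (λ x → subst (_∼ x) (sym (trans (cong (λ g → conj g x) zp) (conj-by-ε x))) ∼-refl) Out? Out-inv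
                         (λ {x} n h → n (conj≡⇒commute (conj-injective z (conj-commute h)))) in
      k , trans e (cong (_+ k * p) (κ-none (λ x → Out? x ×-dec ∼? (conj z x) x)
          (λ s (n , t) → Out-inv s n , ∼-trans (∼-conj z (∼-sym s)) (∼-trans t s))
          λ x (n , t) → ¬normalises n (proj₁ t)))

    residue : ∀ {g} → ¬ Commute z g → ∃ λ r → conj g z ≡ z ↑ r × r < p × 2 ≤ r
    residue {g} n = r , e , subst (r <_) oz (m%n<n k (ord z)) , r≥2 r e
      where
      k = proj₁ (z-normal g)
      r = k % ord z
      e : conj g z ≡ z ↑ r
      e = trans (sym (proj₂ (z-normal g))) (↑-% z k)
      r≥2 : ∀ r → conj g z ≡ z ↑ r → 2 ≤ r
      r≥2 zero e = contradiction (conj-injective g (trans e (sym (conj-ε g)))) (ord-prime≢ε pr oz)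
      r≥2 (suc zero) e = contradiction (commute-sym (conj≡⇒commute (trans e (x↑1 z)))) n
      r≥2 (suc (suc r)) e = s≤s (s≤s z≤n)

    -- A nontrivial action z ↦ z ↑ r has 2 ≤ r < p.
    p≥3 : 3 ≤ p
    p≥3 = let r , _ , r<p , r≥2 = residue ¬c₀ in ≤-trans (s≤s r≥2) r<p

    κC≥2 : 2 ≤ κ C?
    κC≥2 = κ-≥2 C? C-inv commute-ε refl λ s → ord-prime≢ε pr oz (ord≡1⇒ε (trans (sym (∼-ord s)) ord-ε))

    total : 11 ≡ κ C? + κ Out?
    total = κ-compl C?

    C-normal : ∀ g {x} → Commute z x → Commute z (conj g x)
    C-normal g {x} h = subst₂ Commute (conj-⁻¹ˡ (g ⁻¹) z) refl (subst (λ v → Commute (conj (g ⁻¹ ⁻¹) (conj (g ⁻¹) z)) (conj v x)) (⁻¹-involutive g)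
      (commute-conj (g ⁻¹ ⁻¹) (commute-sym (commute-⊑ (commute-sym h) (z-normal (g ⁻¹))))))

    module Outside {q y} (q-prime : Prime q) (y-out : ¬ Commute z y) (yq : Commute z (y ↑ q)) (y-power : IsPower q (ord y)) where
      -- One conjugacy class of outside subgroups: every element outside C, hence every element, is in ⟨z⟩⟨y⟩.
      one-class : κ Out? ≡ p → SplitMetacyclic 𝔾
      one-class κout = record
        { p-prime = pr ; q-prime = q-prime ; ord-z = oz ; b = proj₁ y-power ; ord-y = proj₂ y-power ; p∤ord-y = p∤outside y-out
        ; noncommuting = y-out ; conj-yq = yq ; conj-r = proj₁ (proj₂ (residue y-out)) ; r<p = proj₁ (proj₂ (proj₂ (residue y-out)))
        ; generate = generate
        ; subgroups = trans total (trans (+-comm (κ C?) (κ Out?)) (cong₂ _+_ κout (trans doubling (trans (cong₂ (λ a w → a + a + w) κA κW) (+-identityʳ (proj₁ y-power + proj₁ y-power))))))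
        ; p≥3 = p≥3 }
        where
        b = proj₁ y-power
        oy : ord y ≡ q ^ b
        oy = proj₂ y-power
        conjugate : ∀ {w} → ¬ Commute z w → ∃ λ i → w ∼ conj (z ↑ toℕ {p} i) y
        conjugate = κ-complete Out? Out-inv (λ i → conj (z ↑ toℕ i) y)
          (conj-distinct z pr (subst (_∼ y) (sym (trans (cong (λ g → conj g y) zp) (conj-by-ε y))) ∼-refl) λ s → ¬normalises y-out (proj₁ s))
          (λ i h → let g = z ↑ toℕ i in y-out (subst₂ Commute
              (conj-commute (commute-sym (commute-⁻¹ (commute-↑ (toℕ i) refl)))) (conj-⁻¹ˡ g y) (commute-conj (g ⁻¹) h)))
          (≤-reflexive κout)
        Form : G → Set
        Form g = ∃₂ λ i j → g ≡ z ↑ i ∙ y ↑ j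
        outside : ∀ {w} → ¬ Commute z w → Form w
        outside {w} n = via (conjugate n)
          where
          open ≡-Reasoning
          via : (∃ λ i → w ∼ conj (z ↑ toℕ {p} i) y) → Form w
          via (i , (t , e) , _) = proj₁ s , t , (begin
            w                                   ≡⟨ e ⟨
            conj zi y ↑ t                       ≡⟨ conj-↑ zi y t ⟨
            conj zi (y ↑ t)                     ≡⟨ word (w0 :∙ w1 :∙ neg w0) (w0 :∙ neg (w1 :∙ w0 :∙ neg w1) :∙ w1) (zi ∷ y ↑ t ∷ zi ∷ []) refl ⟩
            zi ∙ conj (y ↑ t) zi ⁻¹ ∙ y ↑ t     ≡⟨ cong (_∙ y ↑ t) (sym (proj₂ s)) ⟩
            z ↑ proj₁ s ∙ y ↑ t                 ∎)
            where
            zi = z ↑ toℕ i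
            s : zi ∙ conj (y ↑ t) zi ⁻¹ ⊑ z
            s = ⊑-∙ (⊑-↑ (toℕ i)) (⊑-⁻¹ (⊑-trans (⊑-conj (y ↑ t) (⊑-↑ (toℕ i))) (z-normal (y ↑ t))))
        generate : ∀ g → Form g
        generate g with C? g
        ... | no n  = outside n
        -- Multiplication by y leads out of the centraliser, so `outside` applies to y ∙ g.
        ... | yes h = via (outside {y ∙ g} (λ h′ → y-out (subst (Commute z) (word (w0 :∙ w1 :∙ neg w1) w0 (y ∷ g ∷ g ∷ []) refl) (commute-∙ h′ (commute-⁻¹ h)))))
          where
          open ≡-Reasoning
          via : Form (y ∙ g) → Form g
          via (i , j , e) = proj₁ s , proj₁ s′ , (begin
            g                                          ≡⟨ word w1 (neg w0 :∙ (w0 :∙ w1)) (y ∷ g ∷ g ∷ []) refl ⟩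
            y ⁻¹ ∙ (y ∙ g)                             ≡⟨ cong (y ⁻¹ ∙_) e ⟩
            y ⁻¹ ∙ (z ↑ i ∙ y ↑ j)                     ≡⟨ word (neg w0 :∙ (w1 :∙ w2)) ((neg w0 :∙ w1 :∙ neg (neg w0)) :∙ (neg w0 :∙ w2)) (y ∷ z ↑ i ∷ y ↑ j ∷ []) refl ⟩
            conj (y ⁻¹) (z ↑ i) ∙ (y ⁻¹ ∙ y ↑ j)       ≡⟨ cong₂ _∙_ (sym (proj₂ s)) (sym (proj₂ s′)) ⟩
            z ↑ proj₁ s ∙ y ↑ proj₁ s′                 ∎)
            where
            s : conj (y ⁻¹) (z ↑ i) ⊑ z
            s = ⊑-trans (⊑-conj (y ⁻¹) (⊑-↑ i)) (z-normal (y ⁻¹))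
            s′ : y ⁻¹ ∙ y ↑ j ⊑ y
            s′ = ⊑-∙ (⊑-⁻¹ ⊑-refl) (⊑-↑ j)
        instance _ = prime⇒nonZero q-prime
        inC : ∀ {i j} → Commute z (z ↑ i ∙ y ↑ j) → Commute z (y ↑ j)
        inC {i} h = subst (Commute z) (word (neg w0 :∙ (w0 :∙ w1)) w1 (z ↑ i ∷ _ ∷ z ∷ []) refl) (commute-∙ (commute-⁻¹ (commute-↑ i refl)) h)
        ord-yq : ∀ t s → s + t ≡ b → ord (y ↑ (q ^ s)) ≡ q ^ t
        ord-yq t s e = ord-↑ (q ^ s) (q ^ t) {{p^≢0 q-prime s}} (trans oy (trans (cong (q ^_) (sym e)) (^-distribˡ-+-* q s t)))
        -- The exponents start at q ^ 1, since y itself does not centralise z.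
        f : Fin b → G
        f i = y ↑ (q ^ suc (toℕ i))
        ord-f : ∀ i → ord (f i) ≡ q ^ (b ∸ suc (toℕ i))
        ord-f i = ord-yq (b ∸ suc (toℕ i)) (suc (toℕ i)) (m+[n∸m]≡n (Fin.toℕ<n i))
        f-inj : ∀ {i j} → f i ∼ f j → i ≡ j
        f-inj {i} {j} s = Fin.toℕ-injective (suc-injective (∸-cancelˡ-≡ (Fin.toℕ<n i) (Fin.toℕ<n j)
          (^-injective q-prime (trans (sym (ord-f i)) (trans (∼-ord s) (ord-f j))))))
        fC : ∀ i → Commute z (f i) × ¬ p ∣ ord (f i)
        fC i = subst (Commute z) (sym (↑-*′ y q (q ^ toℕ i))) (commute-↑ (q ^ toℕ i) yq) , ⊑-∤ (⊑-↑ (q ^ suc (toℕ i))) (p∤outside y-out)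
        κA : κ A? ≡ b
        κA = ≤-antisym (subst (κ A? ≤_) (trans (length-map f (allFin b)) (allFin-length b)) (κ-≤ A? A-inv (map f (allFin b)) cover))
                       (κ-≥-Fin A? A-inv f f-inj fC)
          where
          cover : ∀ x → Commute z x × ¬ p ∣ ord x → ∃ λ w → w ∈ map f (allFin b) × x ∼ w
          cover x hn = via x hn (generate x)
            where
            via : ∀ x → Commute z x × ¬ p ∣ ord x → Form x → ∃ λ w → w ∈ map f (allFin b) × x ∼ w
            via x (h , n) (i , j , refl) = f k , ∈-map⁺ f (∈-allFin k) , ⊑-unique-∼ x⊑y (⊑-↑ (q ^ suc (toℕ k))) (trans et (sym (trans (ord-f k) (cong (q ^_) b-k))))
              where
              cw   : Commute (y ↑ j) (z ↑ i)
              cw = commute-sym (commute-sym (commute-↑ i (commute-sym (inC {i} {j} h))))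
              x⊑y : x ⊑ y
              x⊑y = ⊑-trans (⊑-part cw (λ (d , d′) → prime∤⇒coprime pr n (subst (_ ∣_) oz (∣-trans d′ (⊑-ord (⊑-↑ i))) , d))
                      (subst (x ⊑_) (commute-sym cw) ⊑-refl)) (⊑-↑ j)
              t = proj₁ (∣p^⇒ q-prime b (subst (ord x ∣_) oy (⊑-ord x⊑y)))
              et : ord x ≡ q ^ t
              et = proj₂ (∣p^⇒ q-prime b (subst (ord x ∣_) oy (⊑-ord x⊑y)))
              t<b : t < b
              t<b = ≰⇒> λ b≤t → y-out (C-inv (⊑∧ord≡⇒∼ x⊑y (∣-antisym (⊑-ord x⊑y)
                      (subst₂ _∣_ (sym oy) (trans (sym (^-distribˡ-+-* q b (t ∸ b))) (trans (cong (q ^_) (m+[n∸m]≡n b≤t)) (sym et))) (m∣m*n (q ^ (t ∸ b)))))) h)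
              k : Fin b
              k = fromℕ< (∸-monoʳ-< {b} {suc t} {0} z<s t<b)
              b-k : b ∸ suc (toℕ k) ≡ t
              b-k = trans (cong (λ v → b ∸ suc v) (Fin.toℕ-fromℕ< (∸-monoʳ-< {b} {suc t} {0} z<s t<b)))
                      (trans (cong (b ∸_) (sym (+-∸-assoc 1 t<b))) (m∸[m∸n]≡n (<⇒≤ t<b)))
        -- An element z ↑ i ∙ y ↑ j of the centraliser has order dividing p times ord (y ↑ j), and p
        -- does not divide the latter.
        κW : κ W? ≡ 0
        κW = κ-none W? W-inv λ x (h , d) → absurd x h d (generate x)
          where
          absurd : ∀ x → Commute z x → p * p ∣ ord x → Form x → ⊥
          absurd x h d (i , j , refl) = p∤outside y-out (∣-trans (*-cancelˡ-∣ p (∣-trans d (ord-∣ xpw))) (⊑-ord (⊑-↑ j)))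
            where
            xpw : (z ↑ i ∙ y ↑ j) ↑ (p * ord (y ↑ j)) ≡ ε
            xpw = trans (∙-↑ (p * ord (y ↑ j)) (commute-sym (commute-↑ i (commute-sym (inC {i} {j} h)))))
              (trans (cong₂ _∙_ (∣⇒↑≡ε (∣-trans (subst (ord (z ↑ i) ∣_) oz (⊑-ord (⊑-↑ i))) (m∣m*n (ord (y ↑ j))))) (∣⇒↑≡ε (n∣m*n p))) (identityˡ ε))


      -- For p = 3 every outside element inverts z. So the square of an outside element, and the
      -- quotient of two of them, centralise z.
      module Three (p≡3 : p ≡ 3) where
        inverts : ∀ {g} → ¬ Commute z g → conj g z ≡ z ↑ 2
        inverts n = let r , e , r<p , r≥2 = residue n in trans e (cong (z ↑_) (≤-antisym (s≤s⁻¹ (subst (r <_) p≡3 r<p)) r≥2))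

        quotient∈C : ∀ {g h} → ¬ Commute z g → ¬ Commute z h → Commute z (g ⁻¹ ∙ h)
        quotient∈C {g} {h} n m = commute-sym (conj≡⇒commute (conj-injective g (trans
          (word (w0 :∙ (neg w0 :∙ w1 :∙ w2 :∙ neg (neg w0 :∙ w1)) :∙ neg w0) (w1 :∙ w2 :∙ neg w1) (g ∷ h ∷ z ∷ []) refl)
          (trans (inverts m) (sym (inverts n))))))

        square∈C : ∀ {w} → ¬ Commute z w → Commute z (w ↑ 2)
        square∈C {w} n = commute-sym (conj≡⇒commute (begin
          conj (w ↑ 2) z               ≡⟨ cong (λ v → conj v z) (cong (w ∙_) (identityʳ w)) ⟩
          conj (w ∙ w) z               ≡⟨ conj-conj w w z ⟨
          conj w (conj w z)            ≡⟨ cong (conj w) (inverts n) ⟩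
          conj w (z ↑ 2)               ≡⟨ conj-↑ w z 2 ⟩
          conj w z ↑ 2                 ≡⟨ cong (_↑ 2) (inverts n) ⟩
          (z ↑ 2) ↑ 2                  ≡⟨ ↑-* z 2 2 ⟨
          z ∙ z ↑ 3                    ≡⟨ cong (z ∙_) (trans (cong (z ↑_) (sym p≡3)) zp) ⟩
          z ∙ ε                        ≡⟨ identityʳ z ⟩
          z                            ∎))
          where open ≡-Reasoning

        y∙C : ∀ {c} → Commute z c → ¬ Commute z (y ∙ c)
        y∙C {c} h n = y-out (subst (Commute z) (word (w0 :∙ w1 :∙ neg w1) w0 (y ∷ c ∷ c ∷ []) refl) (commute-∙ n (commute-⁻¹ h)))

        -- Nine outside subgroups leave two inside, ⟨ε⟩ and ⟨z⟩. The centraliser is then ⟨z⟩, and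
        -- its other coset has only three elements.
        three-classes : κ Out? ≢ 9
        three-classes e = contradiction (subst (_≤ 3) e out≤3) λ { (s≤s (s≤s (s≤s ()))) }
          where
          κC : κ C? ≡ 2
          κC = +-cancelʳ-≡ 9 (κ C?) 2 (trans (cong (κ C? +_) (sym e)) (sym total))
          pick : Fin 2 → G
          pick Fin.zero    = ε
          pick (Fin.suc _) = z
          C⊑z : ∀ {c} → Commute z c → c ⊑ z
          C⊑z h = case κ-complete C? C-inv pick (λ { {Fin.zero} {Fin.zero} _ → refl ; {Fin.zero} {Fin.suc Fin.zero} s → contradiction (ord≡1⇒ε (trans (sym (∼-ord s)) ord-ε)) (ord-prime≢ε pr oz)
                ; {Fin.suc Fin.zero} {Fin.zero} s → contradiction (ord≡1⇒ε (trans (∼-ord s) ord-ε)) (ord-prime≢ε pr oz) ; {Fin.suc Fin.zero} {Fin.suc Fin.zero} _ → refl })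
                (λ { Fin.zero → commute-ε ; (Fin.suc _) → refl }) (≤-reflexive κC) h of λ
              { (Fin.zero , s) → ⊑-trans (proj₁ s) ε⊑ ; (Fin.suc _ , s) → proj₁ s }
          list = map (λ i → y ∙ z ↑ toℕ i) (allFin 3)
          out≤3 : κ Out? ≤ 3
          out≤3 = κ-≤ Out? Out-inv list λ x n →
            let k , ek = C⊑z (quotient∈C y-out n)
                r = k % ord z
                r< = subst (r <_) (trans oz p≡3) (m%n<n k (ord z)) in
            x , subst (_∈ list) (begin
              y ∙ z ↑ toℕ (fromℕ< r<)    ≡⟨ cong (λ v → y ∙ z ↑ v) (Fin.toℕ-fromℕ< r<) ⟩
              y ∙ z ↑ r                  ≡⟨ cong (y ∙_) (trans (sym (↑-% z k)) ek) ⟩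
              y ∙ (y ⁻¹ ∙ x)             ≡⟨ word (w0 :∙ (neg w0 :∙ w1)) w1 (y ∷ x ∷ x ∷ []) refl ⟩
              x                          ∎) (∈-map⁺ (λ i → y ∙ z ↑ toℕ i) (∈-allFin (fromℕ< r<))) , ∼-refl
            where open ≡-Reasoning

        module _ {x} (cx : Commute z x) (ox : ord x ≡ 9) where
          lt9 : ∀ (i : Fin 9) → toℕ i < ord x
          lt9 i = subst (toℕ i <_) (sym ox) (Fin.toℕ<n i)

          ↑-injective₉ : ∀ {i j : Fin 9} → x ↑ toℕ i ≡ x ↑ toℕ j → i ≡ j
          ↑-injective₉ {i} {j} e = Fin.toℕ-injective (↑-injective {x} (lt9 i) (lt9 j) e)

          -- The nine conjugates of ⟨y⟩ under powers of x are distinct: if a power v of x normalises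
          -- ⟨y⟩, the commutator of v and y lies in ⟨x⟩ and in ⟨y⟩, whose orders are coprime. So v
          -- commutes with y, and v ≠ ε would put z into ⟨v⟩.
          normalised : conj y x ⊑ x → 9 ≤ κ Out?
          normalised s = κ-≥-Fin Out? Out-inv (λ i → conj (x ↑ toℕ i) y) (λ {i} {j} → inj {i} {j}) λ i h →
              y-out (subst (Commute z) (conj-⁻¹ˡ (x ↑ toℕ i) y) (C-normal _ h))
            where
            inj : ∀ {i j : Fin 9} → conj (x ↑ toℕ i) y ∼ conj (x ↑ toℕ j) y → i ≡ j
            inj {i} {j} t = ↑-injective₉ (sym (∙-cancelˡ (h ⁻¹) _ _ (trans (inverseˡ h) (sym v≡ε))))
              where
              h = x ↑ toℕ j
              v = h ⁻¹ ∙ x ↑ toℕ i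
              v⊑x : v ⊑ x
              v⊑x = ⊑-∙ (⊑-⁻¹ (⊑-↑ (toℕ j))) (⊑-↑ (toℕ i))
              vy : conj v y ⊑ y
              vy = subst₂ _⊑_ (conj-conj (h ⁻¹) (x ↑ toℕ i) y) (conj-⁻¹ˡ h y) (⊑-conj (h ⁻¹) (proj₁ t))
              u = conj v y ∙ y ⁻¹
              u⊑y : u ⊑ y
              u⊑y = ⊑-∙ vy (⊑-⁻¹ ⊑-refl)
              u⊑x : u ⊑ x
              u⊑x = subst (_⊑ x) (word (w0 :∙ neg (w1 :∙ w0 :∙ neg w1)) (w0 :∙ w1 :∙ neg w0 :∙ neg w1) (v ∷ y ∷ y ∷ []) refl)
                (⊑-∙ v⊑x (⊑-⁻¹ (⊑-trans (⊑-conj y v⊑x) s)))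
              u≡ε : u ≡ ε
              u≡ε = ord≡1⇒ε (power-coprime pr (2 , trans ox (cong (_^ 2) (sym p≡3))) (p∤outside y-out) (⊑-ord u⊑x , ⊑-ord u⊑y))
              v≡ε : v ≡ ε
              v≡ε with v Fin.≟ ε
              ... | yes e = e
              ... | no ne = contradiction (commute-⊑ (commute-sym (conj≡⇒commute (∙-cancelʳ (y ⁻¹) _ _ (trans u≡ε (sym (inverseʳ y)))))) (z⊑ p∣v)) (y-out ∘ commute-sym)
                where
                p∣v : p ∣ ord v
                p∣v = prime-power-⊑ (⊑-power pr v⊑x (2 , trans ox (cong (_^ 2) (sym p≡3)))) ne

          -- if every outside element is an involution, the coset y⟨x⟩ provides nine of them
          involutions : (∀ {w} → ¬ Commute z w → w ↑ 2 ≡ ε) → 9 ≤ κ Out?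
          involutions invol = κ-≥-Fin Out? Out-inv f (λ {i} {j} s → ↑-injective₉ (∙-cancelˡ y _ _ (same (out i) (out j) s))) out
            where
            f : Fin 9 → G
            f i = y ∙ x ↑ toℕ i
            out : ∀ i → ¬ Commute z (f i)
            out i = y∙C (commute-↑ (toℕ i) cx)
            same : ∀ {v w} → ¬ Commute z v → ¬ Commute z w → v ∼ w → v ≡ w
            same {v} {w} n m ((k , e) , _) with even-or-odd k
            ... | inj₁ (t , refl) = contradiction (subst (Commute z) (trans (sym (trans (↑-* w t 2) (trans (cong (_↑ t) (invol m)) (ε↑ t)))) e) commute-ε) n
            ... | inj₂ (t , refl) = trans (sym e) (trans (cong (w ∙_) (trans (↑-* w t 2) (trans (cong (_↑ t) (invol m)) (ε↑ t)))) (identityʳ w))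

        -- Six outside subgroups leave 5 = 2 a + w inside, so (a, w) is (1, 3) or (2, 1), and w > 0
        -- gives an element x of order 9. If a = 1, squares of outside elements are trivial; if w =
        -- 1, y normalises ⟨x⟩. Either way there are nine outside subgroups.
        two-classes : κ Out? ≢ 6
        two-classes e = go (κ A?) (κ W?) refl refl (trans (sym doubling) κC)
          where
          κC : κ C? ≡ 5
          κC = +-cancelʳ-≡ 6 (κ C?) 5 (trans (cong (κ C? +_) (sym e)) (sym total))
          not9 : ¬ 9 ≤ κ Out?
          not9 le = contradiction (subst (9 ≤_) e le) λ { (s≤s (s≤s (s≤s (s≤s (s≤s (s≤s ())))))) }
          9∣W : ∀ {x} → p * p ∣ ord x → 9 ∣ ord x
          9∣W {x} = subst (λ v → v * v ∣ ord x) p≡3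
          nine : 1 ≤ κ W? → ∃ λ x → Commute z x × ord x ≡ 9
          nine le = let w , h , d = κ-pos W? W-inv le ; x , x⊑w , ox = power-⊑ (9∣W d) in x , commute-⊑ h x⊑w , ox
          κA≥1 : κ A? ≢ 0
          κA≥1 e = κ≡0 A? A-inv e {ε} (commute-ε , λ d → ¬prime[1] (subst Prime (∣1⇒≡1 (subst (p ∣_) ord-ε d)) pr))
          go : ∀ a w → κ A? ≡ a → κ W? ≡ w → a + a + w ≡ 5 → ⊥
          go 0 w ea ew _ = κA≥1 ea
          go 1 w ea ew s = let x , cx , ox = nine (subst (1 ≤_) (sym (trans ew (suc-injective (suc-injective s)))) (s≤s z≤n)) in
            not9 (involutions cx ox λ {v} n → ord≡1⇒ε (trans (∼-ord (κ≡1 A? A-inv ea (square∈C n , ⊑-∤ (⊑-↑ 2) (p∤outside n))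
               (commute-ε , λ d → ¬prime[1] (subst Prime (∣1⇒≡1 (subst (p ∣_) ord-ε d)) pr)))) ord-ε))
          go 2 w ea ew s = let x , cx , ox = nine (subst (1 ≤_) (sym (trans ew (suc-injective (suc-injective (suc-injective (suc-injective s)))))) (s≤s z≤n)) ; d = subst₂ (λ v o → v * v ∣ o) (sym p≡3) (sym ox) ∣-refl in
            not9 (normalised cx ox (proj₁ (κ≡1 W? W-inv (trans ew (suc-injective (suc-injective (suc-injective (suc-injective s)))))
               (C-normal y cx , subst (p * p ∣_) (sym (ord-conj y x)) d) (cx , d))))
          go (suc (suc (suc a))) w ea ew s = contradiction (subst (6 ≤_) s (+-mono-≤ {6} {a3 + a3} {0} {w} (+-mono-≤ {3} {a3} {3} {a3} (s≤s (s≤s (s≤s z≤n))) (s≤s (s≤s (s≤s z≤n)))) z≤n))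
             λ { (s≤s (s≤s (s≤s (s≤s (s≤s ()))))) }
            where a3 = suc (suc (suc a))


    split-metacyclic : SplitMetacyclic 𝔾
    split-metacyclic = via κOut (minimal-outside C? commute-ε commute-∙ g₀ ¬c₀)
      where
      via : (∃ λ k → κ Out? ≡ k * p) → (∃₂ λ q y → Prime q × y ⊑ g₀ × ¬ Commute z y × Commute z (y ↑ q) × IsPower q (ord y)) → SplitMetacyclic 𝔾
      via (zero , e) _ = contradiction (κ-≥1 Out? Out-inv ¬c₀) (<⇒≱ (subst (_< 1) (sym e) (s≤s z≤n)))
      via (suc zero , e) (q , y , q-prime , _ , y-out , yq , y-power) = Outside.one-class q-prime y-out yq y-power (trans e (*-identityˡ p))
      -- At least two subgroups lie inside, hence at most nine outside. A multiple of p that is at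
      -- least 2 p, with p ≥ 3, can then only be 6 or 9, with p = 3.
      via (suc (suc k) , e) (q , y , q-prime , _ , y-out , yq , y-power) = contradiction p≡3 λ p≡3 → absurd k p≡3 (trans e (cong (suc (suc k) *_) p≡3))
        where
        kp≤9 : suc (suc k) * p ≤ 9
        kp≤9 = +-cancelˡ-≤ 2 _ 9 (subst (2 + suc (suc k) * p ≤_) (sym (trans total (cong (κ C? +_) e))) (+-monoˡ-≤ (suc (suc k) * p) κC≥2))
        p≤4 : p < 5
        p≤4 = ≰⇒> λ 5≤p → contradiction (≤-trans (*-mono-≤ {2} {suc (suc k)} {5} {p} (s≤s (s≤s z≤n)) 5≤p) kp≤9) λ { (s≤s (s≤s (s≤s (s≤s (s≤s (s≤s (s≤s (s≤s (s≤s ()))))))))) }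
        p≡3 : p ≡ 3
        p≡3 with ≤∧≢⇒< (s≤s⁻¹ p≤4) (λ e → contradiction (subst Prime e pr) λ pr4 → case prime⇒irreducible {4} pr4 {2} (divides 2 refl) of λ { (inj₁ ()) ; (inj₂ ()) })
        ... | p<4 = ≤-antisym (s≤s⁻¹ p<4) p≥3
        absurd : ∀ k → p ≡ 3 → κ Out? ≡ suc (suc k) * 3 → ⊥
        absurd 0 eq e = Outside.Three.two-classes q-prime y-out yq y-power eq e
        absurd 1 eq e = Outside.Three.three-classes q-prime y-out yq y-power eq e
        absurd (suc (suc k)) eq e = contradiction (≤-trans (+-mono-≤ κC≥2 (subst (12 ≤_) (sym e) (m≤m+n 12 (k * 3)))) (≤-reflexive (sym total)))
          λ { (s≤s (s≤s (s≤s (s≤s (s≤s (s≤s (s≤s (s≤s (s≤s (s≤s (s≤s ()))))))))))) }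

-- Groups with at most three involutions.

third : ∀ (i j : Fin 3) → i ≢ j → ∃ λ k → k ≢ i × k ≢ j × (∀ l → l ≢ i → l ≢ j → l ≡ k)
third = from-yes (Fin.all? λ (i : Fin 3) → Fin.all? λ (j : Fin 3) → ¬? (i Fin.≟ j) →-dec Fin.any? λ (k : Fin 3) →
  ¬? (k Fin.≟ i) ×-dec ¬? (k Fin.≟ j) ×-dec Fin.all? λ (l : Fin 3) → ¬? (l Fin.≟ i) →-dec (¬? (l Fin.≟ j) →-dec (l Fin.≟ k)))

prime[3] : Prime 3
prime[3] = from-yes (prime? 3)

module Involutions (𝔾 : FinGroup) {c} (H : HasExactlyCyclicSubgroups (FinGroup.group 𝔾) c) where
  open PrimeOrder 𝔾 H public

  invol : ∀ {t} → ord t ≡ 2 → t ∙ t ≡ ε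
  invol {t} o = trans (sym (cong (t ∙_) (identityʳ t))) (trans (cong (t ↑_) (sym o)) (↑-ord t))

  invol-⁻¹ : ∀ {t} → ord t ≡ 2 → t ⁻¹ ≡ t
  invol-⁻¹ {t} o = sym (inverseʳ-unique t t (invol o))

  invol-ord : ∀ {t} → t ∙ t ≡ ε → t ≢ ε → ord t ≡ 2
  invol-ord {t} e ne = ord-prime prime[2] (trans (cong (t ∙_) (identityʳ t)) e) ne

  ⊑-invol : ∀ {s t} → ord t ≡ 2 → s ⊑ t → s ≡ ε ⊎ s ≡ t
  ⊑-invol {s} {t} o (k , e) with even-or-odd k
  ... | inj₁ (m , refl) = inj₁ (trans (sym e) (∣⇒↑≡ε (subst (_∣ m * 2) (sym o) (n∣m*n m))))
  ... | inj₂ (m , refl) = inj₂ (trans (sym e) (trans (cong (t ∙_) (∣⇒↑≡ε (subst (_∣ m * 2) (sym o) (n∣m*n m)))) (identityʳ t)))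

  ∼-invol : ∀ {s t} → ord s ≡ 2 → ord t ≡ 2 → s ∼ t → s ≡ t
  ∼-invol os ot (s⊑t , _) = case ⊑-invol ot s⊑t of λ { (inj₁ e) → contradiction e (ord-prime≢ε prime[2] os) ; (inj₂ e) → e }

  record Three (t : Fin 3 → G) : Set where
    field
      t-ord       : ∀ i → ord (t i) ≡ 2
      t-injective : ∀ {i j} → t i ≡ t j → i ≡ j
      t-all       : ∀ {g} → ord g ≡ 2 → ∃ λ i → g ≡ t i

    is-third : ∀ {i j k w} → (∀ l → l ≢ i → l ≢ j → l ≡ k) → ord w ≡ 2 → w ≢ t i → w ≢ t j → w ≡ t k
    is-third others o n m = let l , e = t-all o in
      trans e (cong t (others l (λ p → n (trans e (cong t p))) (λ p → m (trans e (cong t p)))))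

    -- Two of the three involutions generate a four-group or a copy of S₃.
    t-product : ∀ {i j k} → i ≢ j → (∀ l → l ≢ i → l ≢ j → l ≡ k) →
              (Commute (t i) (t j) × t i ∙ t j ≡ t k) ⊎ (conj (t i) (t j) ≡ t k × (t i ∙ t j) ↑ 3 ≡ ε)
    t-product {i} {j} {k} i≢j others = case commute? (t i) (t j) of λ
      { (yes c) → inj₁ (c , is-third others (invol-ord (square c) ne)
          (λ e → t≢ε j (∙-cancelˡ (t i) _ _ (trans e (sym (identityʳ _)))))
          (λ e → t≢ε i (∙-cancelʳ (t j) _ _ (trans e (sym (identityˡ _))))))
      ; (no ¬c) → inj₂ (moved i≢j others ¬c , cube ¬c) }
      where
      t≢ε : ∀ i → t i ≢ ε
      t≢ε i = ord-prime≢ε prime[2] (t-ord i)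
      ne : t i ∙ t j ≢ ε
      ne e = i≢j (t-injective (trans (sym (invol-⁻¹ (t-ord i))) (sym (inverseʳ-unique (t i) (t j) e))))
      square : Commute (t i) (t j) → t i ∙ t j ∙ (t i ∙ t j) ≡ ε
      square c = trans (cong (t i ∙ t j ∙_) c) (trans (word (w0 :∙ w1 :∙ (w1 :∙ w0)) (w0 :∙ (w1 :∙ w1) :∙ w0) (t i ∷ t j ∷ ε ∷ []) refl)
        (trans (cong (λ v → t i ∙ v ∙ t i) (invol (t-ord j))) (trans (cong (_∙ t i) (identityʳ (t i))) (invol (t-ord i)))))
      moved : ∀ {i j k} → i ≢ j → (∀ l → l ≢ i → l ≢ j → l ≡ k) → ¬ Commute (t i) (t j) → conj (t i) (t j) ≡ t k
      moved {i} {j} i≢j others ¬c = is-third others (trans (ord-conj (t i) (t j)) (t-ord j))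
        (λ e → i≢j (t-injective (conj-injective (t i) (trans (conj-commute refl) (sym e)))))
        (λ e → ¬c (conj≡⇒commute e))
      -- For involutions a and b, (ab)³ = (aba)(bab), and both factors are conjugates equal to the
      -- third involution.
      cube : ¬ Commute (t i) (t j) → (t i ∙ t j) ↑ 3 ≡ ε
      cube ¬c = begin
        (a ∙ b) ↑ 3                        ≡⟨ word (w0 :∙ w1 :∙ (w0 :∙ w1 :∙ (w0 :∙ w1 :∙ one))) ((w0 :∙ w1 :∙ w0) :∙ (w1 :∙ w0 :∙ w1)) (a ∷ b ∷ ε ∷ []) refl ⟩
        (a ∙ b ∙ a) ∙ (b ∙ a ∙ b)          ≡⟨ cong₂ (λ u v → (a ∙ b ∙ u) ∙ (b ∙ a ∙ v)) (sym (invol-⁻¹ (t-ord i))) (sym (invol-⁻¹ (t-ord j))) ⟩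
        conj a b ∙ conj b a                ≡⟨ cong₂ _∙_ (moved i≢j others ¬c) (moved (i≢j ∘ sym) (λ l p q → others l q p) (¬c ∘ sym)) ⟩
        t k ∙ t k                          ≡⟨ invol (t-ord k) ⟩
        ε                                  ∎
        where
        open ≡-Reasoning
        a = t i
        b = t j

  -- `odd` expresses that x has odd order: whatever commutes with x ↑ 2 commutes with x. Hence y and
  -- its conjugates by x and x ↑ 2 are distinct, and by κ₂ they are all the involutions.
  module Cycle (κ₂ : κ (ord≟ 2) ≤ 3) {x y} (oy : ord y ≡ 2) (odd : x ⊑ x ↑ 2) (¬c : ¬ Commute x y) where
    t : Fin 3 → G
    t i = conj (x ↑ toℕ i) y

    t-ord′ : ∀ i → ord (t i) ≡ 2
    t-ord′ i = trans (ord-conj _ y) oy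

    private
      shift : ∀ {m n} → conj (x ↑ suc m) y ≡ conj (x ↑ suc n) y → conj (x ↑ m) y ≡ conj (x ↑ n) y
      shift {m} {n} e = conj-injective x (trans (conj-conj x (x ↑ m) y) (trans e (sym (conj-conj x (x ↑ n) y))))
      d₁ : conj (x ↑ 0) y ≢ conj (x ↑ 1) y
      d₁ e = ¬c (conj≡⇒commute (trans (trans (cong (λ g → conj g y) (sym (x↑1 x))) (sym e)) (conj-by-ε y)))
      d₂ : conj (x ↑ 0) y ≢ conj (x ↑ 2) y
      d₂ e = ¬c (commute-sym (commute-⊑ (commute-sym (conj≡⇒commute (trans (sym e) (conj-by-ε y)))) odd))

    t-injective′ : ∀ {i j} → t i ≡ t j → i ≡ j
    t-injective′ {Fin.zero} {Fin.zero} _ = refl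
    t-injective′ {Fin.zero} {Fin.suc Fin.zero} e = contradiction e d₁
    t-injective′ {Fin.zero} {Fin.suc (Fin.suc Fin.zero)} e = contradiction e d₂
    t-injective′ {Fin.suc Fin.zero} {Fin.zero} e = contradiction (sym e) d₁
    t-injective′ {Fin.suc Fin.zero} {Fin.suc Fin.zero} _ = refl
    t-injective′ {Fin.suc Fin.zero} {Fin.suc (Fin.suc Fin.zero)} e = contradiction (shift {0} {1} e) d₁
    t-injective′ {Fin.suc (Fin.suc Fin.zero)} {Fin.zero} e = contradiction (sym e) d₂
    t-injective′ {Fin.suc (Fin.suc Fin.zero)} {Fin.suc Fin.zero} e = contradiction (shift {0} {1} (sym e)) d₁
    t-injective′ {Fin.suc (Fin.suc Fin.zero)} {Fin.suc (Fin.suc Fin.zero)} _ = refl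

    three : Three t
    three = record
      { t-ord = t-ord′ ; t-injective = t-injective′
      ; t-all = λ {g} o → let i , s = κ-complete (ord≟ 2) (ord≟-inv 2) t (λ {i} {j} s → t-injective′ (∼-invol (t-ord′ i) (t-ord′ j) s)) t-ord′ κ₂ o in
          i , ∼-invol o (t-ord′ i) s }

    -- Conjugation by x ↑ 3 takes y to one of the three involutions; the second or third would,
    -- conjugated back by powers of x, coincide with an earlier one.
    x³-commutes : Commute (x ↑ 3) y
    x³-commutes = conj≡⇒commute (via (Three.t-all three (trans (ord-conj (x ↑ 3) y) oy)))
      where
      via : (∃ λ i → conj (x ↑ 3) y ≡ t i) → conj (x ↑ 3) y ≡ y
      via (Fin.zero , e) = trans e (conj-by-ε y)
      via (Fin.suc Fin.zero , e) = contradiction (sym (shift {2} {0} e)) d₂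
      via (Fin.suc (Fin.suc Fin.zero) , e) = contradiction (sym (shift {1} {0} (shift {2} {1} e))) d₁

-- A unique and central subgroup of prime order in a group of mixed order.

module CentralCase (𝔾 : FinGroup) (H : HasExactlyCyclicSubgroups (FinGroup.group 𝔾) 11) where
  open Involutions 𝔾 H public

  prime[11] : Prime 11
  prime[11] = from-yes (prime? 11)

  p∤ε : ∀ {p} → Prime p → ¬ p ∣ ord ε
  p∤ε pr d = ¬prime[1] (subst Prime (∣1⇒≡1 (subst (_ ∣_) ord-ε d)) pr)

  -- Applied to `doubling′`, with u the number of p′-subgroups: 5 + 5 + 2 exceeds 11.
  bound : ∀ {u w} → 11 ≡ u + u + w → 2 ≤ w → u ≤ 4
  bound {u} {w} e w≥2 = ≮⇒≥ λ 5≤u → contradiction (subst (12 ≤_) (sym e) (+-mono-≤ (+-mono-≤ 5≤u 5≤u) w≥2)) (<⇒≱ (n<1+n 11))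

  module _ {p z} (pr : Prime p) (oz : ord z ≡ p) (unique : ∀ {x} → ord x ≡ p → x ⊑ z) (central : ∀ x → Commute z x)
           {b} (p′b : ¬ p ∣ ord b) (b≢ε : b ≢ ε) where
    open Unique-prime pr oz unique
    open Central central

    z-power : IsPower p (ord z)
    z-power = 1 , trans oz (sym (*-identityʳ p))

    A′-inv : Invariant (λ x → ¬ p ∣ ord x)
    A′-inv = ord-Invariant (λ n → ¬ p ∣ n)

    pair : ∃₂ λ x y → IsPower p (ord x) × ¬ p ∣ ord y × ¬ Commute x y
    pair = split prime[11] pr z-power (ord-prime≢ε pr oz) p′b b≢ε

    -- ⟨ε⟩ and q + 1 subgroups of order q are p′-subgroups, of which there are at most 4. So q = 2,
    -- every p′-element has order 1 or 2, and w = 3. But the three involutions move a p-subgroup ⟨x⟩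
    -- to three further subgroups counted by w.
    not-both : ∀ {q} → Prime q → q ≢ p → suc q ≤ κ (ord≟ q) → ⊥
    not-both {q} qr q≢p many = via pair
      where
      via : (∃₂ λ x y → IsPower p (ord x) × ¬ p ∣ ord y × ¬ Commute x y) → ⊥
      via (x , y , px , p′y , ¬c) = 4-classes
        where
        open Noncommuting px p′y ¬c
        D? = λ x → ord≟ 1 x ⊎-dec ord≟ q x
        D⇒A : ∀ {x} → ord x ≡ 1 ⊎ ord x ≡ q → ¬ p ∣ ord x
        D⇒A (inj₁ e) d = ¬prime[1] (subst Prime (∣1⇒≡1 (subst (p ∣_) e d)) pr)
        D⇒A (inj₂ e) d = q≢p (sym (prime∣prime pr qr (subst (p ∣_) e d)))
        1+κ≤D : suc (κ (ord≟ q)) ≤ κ D?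
        1+κ≤D = ≤-trans (+-monoˡ-≤ (κ (ord≟ q)) (κ-≥1 (ord≟ 1) (ord≟-inv 1) ord-ε))
          (κ-+ (ord≟ 1) (ord≟ q) λ e f → ¬prime[1] (subst Prime (trans (sym f) e) qr))
        u≤4 : κ A′? ≤ 4
        u≤4 = bound doubling′ W≥2
        D≤A : κ D? ≤ κ A′?
        D≤A = κ-⊆ D? A′? D⇒A
        κq≤3 : κ (ord≟ q) ≤ 3
        κq≤3 = s≤s⁻¹ (≤-trans 1+κ≤D (≤-trans D≤A u≤4))
        q≡2 : q ≡ 2
        q≡2 = ≤-antisym (s≤s⁻¹ (≤-trans many κq≤3)) (prime>1 qr)
        D≥4 : 4 ≤ κ D?
        D≥4 = ≤-trans (s≤s (subst (λ v → suc v ≤ κ (ord≟ q)) q≡2 many)) 1+κ≤D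
        u≡4 : κ A′? ≡ 4
        u≡4 = ≤-antisym u≤4 (≤-trans D≥4 D≤A)
        w≡3 : κ W′? ≡ 3
        w≡3 = sym (+-cancelˡ-≡ 8 _ _ (trans doubling′ (cong (λ u → u + u + κ W′?) u≡4)))
        κ₂≤3 : κ (ord≟ 2) ≤ 3
        κ₂≤3 = subst (λ q → κ (ord≟ q) ≤ 3) q≡2 κq≤3
        AD? = λ x → A′? x ×-dec D? x
        A¬D? = λ x → A′? x ×-dec ¬? (D? x)
        none : κ A¬D? ≡ 0
        none = n≤0⇒n≡0 (+-cancelˡ-≤ 4 _ 0 (≤-trans (+-monoˡ-≤ (κ A¬D?) (≤-trans D≥4 (κ-⊆ D? AD? λ d → D⇒A d , d)))
                 (≤-reflexive (trans (sym (κ-split A′? D?)) u≡4))))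
        oy : ord y ≡ 2
        oy = case D? y of λ
          { (yes (inj₁ e)) → contradiction (subst (Commute x) (sym (ord≡1⇒ε e)) commute-ε) ¬c
          ; (yes (inj₂ e)) → trans e q≡2
          ; (no n) → contradiction (p′y , n) (κ≡0 A¬D? (ord-Invariant (λ n → ¬ p ∣ n × ¬ (n ≡ 1 ⊎ n ≡ q))) none) }
        prime-coprime : ∀ {r} → Prime r → r ≢ p → x ⊑ x ↑ r
        prime-coprime rr ne = ⊑-coprime (Cop.sym (power-coprime pr px λ d → ne (sym (prime∣prime pr rr d)))) (↑-ord x)
        open Cycle κ₂≤3 oy (prime-coprime prime[2] (λ e → q≢p (trans q≡2 e))) ¬c
        open Three three
        -- x ↑ 3 commutes with y, and for p ≠ 3 it would generate ⟨x⟩.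
        p≡3 : p ≡ 3
        p≡3 = case 3 ≟ p of λ { (yes e) → sym e ; (no ne) → contradiction (commute-sym (commute-⊑ (commute-sym x³-commutes) (prime-coprime prime[3] ne))) ¬c }
        moves-x : ∀ i → ¬ conj (t i) x ∼ x
        moves-x i s = ¬c (commute-sym (subst₂ Commute (conj-⁻¹ˡ g y) (conj-commute (commute-sym (commute-⁻¹ (commute-↑ (toℕ i) refl))))
            (commute-conj (g ⁻¹) (normalises⇒commute px (λ d → q≢p (trans q≡2 (sym (prime∣prime pr prime[2] (subst (p ∣_) (t-ord i) d))))) (proj₁ s)))))
          where g = x ↑ toℕ i
        f : Fin 4 → G
        f Fin.zero    = x
        f (Fin.suc i) = conj (t i) x
        fW : ∀ i → p * p ∣ ord (f i)
        fW Fin.zero    = p²∣x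
        fW (Fin.suc i) = subst (p * p ∣_) (sym (ord-conj (t i) x)) p²∣x
        -- Equal conjugates make d = t j ∙ t i normalise ⟨x⟩. Either d is the third involution,
        -- which moves ⟨x⟩, or d³ = ε, and then d lies in the central ⟨z⟩ and commutes with t j.
        clash : ∀ i j → i ≢ j → ¬ conj (t i) x ∼ conj (t j) x
        clash i j i≢j s = by (third j i (i≢j ∘ sym))
          where
          d = t j ∙ t i
          d∼ : conj d x ∼ x
          d∼ = subst₂ _∼_ (conj-conj (t j) (t i) x) (trans (cong (λ v → conj v (conj (t j) x)) (sym (invol-⁻¹ (t-ord j)))) (conj-⁻¹ˡ (t j) x)) (∼-conj (t j) s)
          by : (∃ λ k → k ≢ j × k ≢ i × (∀ l → l ≢ j → l ≢ i → l ≡ k)) → ⊥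
          by (k , _ , k≢i , others) = case t-product {j} {i} {k} (i≢j ∘ sym) others of λ
            { (inj₁ (_ , e)) → moves-x k (subst (λ v → conj v x ∼ x) e d∼)
            ; (inj₂ (e , d³)) → let cd = commute-⊑ (commute-sym (central (t j))) (order-p⊑z (trans (cong (d ↑_) p≡3) d³)) in
                k≢i (t-injective (trans (sym e) (∙-cancelˡ (t j) _ _
                  (trans (cong (_∙ conj (t j) (t i)) (sym (conj-commute refl))) (trans (sym (conj-∙ (t j) (t j) (t i))) (conj-commute cd)))))) }
        4-classes : ⊥
        4-classes = contradiction (subst (4 ≤_) w≡3 (κ-≥-Fin W′? (ord-Invariant (p * p ∣_)) f (λ {i} {j} → f-inj {i} {j}) fW)) (<⇒≱ (n<1+n 3))
          where
          f-inj : ∀ {i j} → f i ∼ f j → i ≡ j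
          f-inj {Fin.zero}  {Fin.zero}  _ = refl
          f-inj {Fin.zero}  {Fin.suc j} s = contradiction (∼-sym s) (moves-x j)
          f-inj {Fin.suc i} {Fin.zero}  s = contradiction s (moves-x i)
          f-inj {Fin.suc i} {Fin.suc j} s = case i Fin.≟ j of λ { (yes e) → cong Fin.suc e ; (no ne) → contradiction s (clash i j ne) }

    -- If the other primes are central too, the q′-subgroups include ⟨ε⟩, a central one, and p conjugates.
    not-all-central : 3 ≤ p → (∀ {q v} → Prime q → ord v ≡ q → (∀ {x} → ord x ≡ q → x ⊑ v) × (∀ x → Commute v x)) → ⊥
    not-all-central p≥3 all = start pair
      where
      start : (∃₂ λ x y → IsPower p (ord x) × ¬ p ∣ ord y × ¬ Commute x y) → ⊥
      start (x₀ , y₀ , px₀ , p′y₀ , ¬c₀) = next (minimal-outside (commute? x₀) commute-ε commute-∙ y₀ ¬c₀)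
        where
        next : (∃₂ λ q y → Prime q × y ⊑ y₀ × ¬ Commute x₀ y × Commute x₀ (y ↑ q) × IsPower q (ord y)) → ⊥
        -- The second descent, on the side of x₀, makes x ↑ p commute with y, so that ⟨y⟩ has
        -- exactly p conjugates under powers of x.
        next (q , y , qr , y⊑ , ¬c₁ , _ , qy) = last (minimal-outside (commute? y) commute-ε commute-∙ x₀ (¬c₁ ∘ commute-sym))
          where
          p′y : ¬ p ∣ ord y
          p′y = ⊑-∤ y⊑ p′y₀
          last : (∃₂ λ r x → Prime r × x ⊑ x₀ × ¬ Commute y x × Commute y (x ↑ r) × IsPower r (ord x)) → ⊥
          last (r , x , rr , x⊑ , ¬c , cxr , rx) = contradiction (≤-trans (+-monoʳ-≤ 2 p≥3) many) (<⇒≱ (s≤s (bound doubling′ W≥2)))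
            where
            px : IsPower p (ord x)
            px = ⊑-power pr x⊑ px₀
            open Noncommuting px p′y (¬c ∘ commute-sym)
            x≢ε : x ≢ ε
            x≢ε e = ¬c (subst (Commute y) (sym e) commute-ε)
            r≡p : r ≡ p
            r≡p = prime∣prime rr pr (prime∣^ p (proj₁ px) rr (subst (r ∣_) (proj₂ px) (prime-power-⊑ rx x≢ε)))
            y≢ε : y ≢ ε
            y≢ε e = ¬c (subst (λ v → Commute v x) (sym e) (commute-sym commute-ε))
            sub : ∃ λ v → v ⊑ y × ord v ≡ q
            sub = power-⊑ (prime-power-⊑ qy y≢ε)
            v = proj₁ sub
            ov = proj₂ (proj₂ sub)
            module Q = Unique-prime qr ov (proj₁ (all qr ov))
            q≢p : q ≢ p
            q≢p e = p′y (subst (_∣ ord y) e (prime-power-⊑ qy y≢ε))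
            q∤x : ¬ q ∣ ord x
            q∤x d = q≢p (prime∣prime qr pr (prime∣^ p (proj₁ px) qr (subst (q ∣_) (proj₂ px) d)))
            moves-y : ¬ conj x y ∼ y
            moves-y s = ¬c (commute-sym (Q.Central.normalises⇒commute (proj₂ (all qr ov)) qy q∤x (proj₁ s)))
            q²∣y : q * q ∣ ord y
            q²∣y = Q.p²∣ qy λ s → ¬c (commute-sym (commute-⊑ (commute-sym (proj₂ (all qr ov) x)) s))
            f : Fin (2 + p) → G
            f Fin.zero                = ε
            f (Fin.suc Fin.zero)      = v
            f (Fin.suc (Fin.suc i))   = conj (x ↑ toℕ i) y
            f-ord : ∀ i → ord (f (Fin.suc (Fin.suc i))) ≡ ord y
            f-ord i = ord-conj _ y
            fA : ∀ i → ¬ p ∣ ord (f i)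
            fA Fin.zero = p∤ε pr
            fA (Fin.suc Fin.zero) d = q≢p (sym (prime∣prime pr qr (subst (p ∣_) ov d)))
            fA (Fin.suc (Fin.suc i)) d = p′y (subst (p ∣_) (f-ord i) d)
            ε≁v : ¬ ε ∼ v
            ε≁v s = ord-prime≢ε qr ov (ord≡1⇒ε (trans (sym (∼-ord s)) ord-ε))
            ε≁y : ∀ i → ¬ ε ∼ f (Fin.suc (Fin.suc i))
            ε≁y i s = y≢ε (ord≡1⇒ε (trans (sym (f-ord i)) (trans (sym (∼-ord s)) ord-ε)))
            v≁y : ∀ i → ¬ v ∼ f (Fin.suc (Fin.suc i))
            v≁y i s = contradiction (∣⇒≤ {{prime⇒nonZero qr}} (subst (q * q ∣_) (trans (sym (f-ord i)) (trans (sym (∼-ord s)) ov)) q²∣y))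
              (<⇒≱ (m<m*n q q {{prime⇒nonZero qr}} (prime>1 qr)))
            f-inj : ∀ {i j} → f i ∼ f j → i ≡ j
            f-inj {Fin.zero} {Fin.zero} _ = refl
            f-inj {Fin.zero} {Fin.suc Fin.zero} s = contradiction s ε≁v
            f-inj {Fin.zero} {Fin.suc (Fin.suc j)} s = contradiction s (ε≁y j)
            f-inj {Fin.suc Fin.zero} {Fin.zero} s = contradiction (∼-sym s) ε≁v
            f-inj {Fin.suc Fin.zero} {Fin.suc Fin.zero} s = refl
            f-inj {Fin.suc Fin.zero} {Fin.suc (Fin.suc j)} s = contradiction s (v≁y j)
            f-inj {Fin.suc (Fin.suc i)} {Fin.zero} s = contradiction (∼-sym s) (ε≁y i)
            f-inj {Fin.suc (Fin.suc i)} {Fin.suc Fin.zero} s = contradiction (∼-sym s) (v≁y i)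
            f-inj {Fin.suc (Fin.suc i)} {Fin.suc (Fin.suc j)} s = cong (Fin.suc ∘ Fin.suc)
              (conj-distinct x pr (subst (_∼ y) (sym (conj-commute (commute-sym (subst (λ r → Commute y (x ↑ r)) r≡p cxr)))) ∼-refl) moves-y s)
            many : 2 + p ≤ κ A′?
            many = κ-≥-Fin A′? A′-inv f (λ {i} {j} → f-inj {i} {j}) fA

-- Multiplication in ⟨z⟩⟨y⟩, and the data of ℤ₃ × S₃.

module Twist (𝔾 : FinGroup) where
  open Powers 𝔾

  module _ {z y r} (conj-r : conj y z ≡ z ↑ r) where
    conj-twist : ∀ i → conj (y ↑ i) z ≡ z ↑ (r ^ i)
    conj-twist zero = trans (conj-by-ε z) (sym (x↑1 z))
    conj-twist (suc i) = begin
      conj (y ∙ y ↑ i) z          ≡⟨ conj-conj y (y ↑ i) z ⟨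
      conj y (conj (y ↑ i) z)     ≡⟨ cong (conj y) (conj-twist i) ⟩
      conj y (z ↑ (r ^ i))        ≡⟨ conj-↑ y z (r ^ i) ⟩
      conj y z ↑ (r ^ i)          ≡⟨ cong (_↑ (r ^ i)) conj-r ⟩
      (z ↑ r) ↑ (r ^ i)           ≡⟨ ↑-*′ z r (r ^ i) ⟨
      z ↑ (r * r ^ i)             ∎
      where open ≡-Reasoning

    -- The rule of `metaOp` before the exponents are reduced.
    twist : ∀ a i c j → (z ↑ a ∙ y ↑ i) ∙ (z ↑ c ∙ y ↑ j) ≡ z ↑ (a + r ^ i * c) ∙ y ↑ (i + j)
    twist a i c j = begin
      (z ↑ a ∙ y ↑ i) ∙ (z ↑ c ∙ y ↑ j)            ≡⟨ lem (z ↑ a) (y ↑ i) (z ↑ c) (y ↑ j) ⟩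
      z ↑ a ∙ conj (y ↑ i) (z ↑ c) ∙ (y ↑ i ∙ y ↑ j) ≡⟨ cong₂ (λ u v → z ↑ a ∙ u ∙ v) (trans (conj-↑ (y ↑ i) z c) (trans (cong (_↑ c) (conj-twist i)) (sym (↑-*′ z (r ^ i) c)))) (sym (↑-+ y i j)) ⟩
      z ↑ a ∙ z ↑ (r ^ i * c) ∙ y ↑ (i + j)        ≡⟨ cong (_∙ y ↑ (i + j)) (sym (↑-+ z a (r ^ i * c))) ⟩
      z ↑ (a + r ^ i * c) ∙ y ↑ (i + j)            ∎
      where
      open ≡-Reasoning
      lem : ∀ a b c d → (a ∙ b) ∙ (c ∙ d) ≡ a ∙ (b ∙ c ∙ b ⁻¹) ∙ (b ∙ d)
      lem a b c d = word (w0 :∙ w1 :∙ (w2 :∙ w3)) (w0 :∙ (w1 :∙ w2 :∙ neg w1) :∙ (w1 :∙ w3)) (a ∷ b ∷ c ∷ d ∷ []) refl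
        where w3 = var (Fin.suc (Fin.suc (Fin.suc Fin.zero)))

module _ (𝔾 : FinGroup) where
  open Powers 𝔾

  -- s generates the direct factor of order 3, while d and t generate S₃; `independent` keeps the
  -- two subgroups of order 3 apart.
  record ℤ₃×S₃ : Set where
    field
      {s d t}     : G
      ord-s       : ord s ≡ 3
      ord-d       : ord d ≡ 3
      ord-t       : ord t ≡ 2
      s-d         : Commute s d
      s-t         : Commute s t
      inverted    : conj t d ≡ d ↑ 2
      independent : ¬ s ⊑ d
      generate    : ∀ g → ∃ λ i → ∃₂ λ j k → g ≡ s ↑ i ∙ (d ↑ j ∙ t ↑ k)

-- No unique subgroup of prime order: the primes are 2 and 3.

∣4 : ∀ n → n ∣ 4 → n ≡ 1 ⊎ n ≡ 2 ⊎ n ≡ 4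
∣4 0 d = contradiction (0∣⇒≡0 d) λ ()
∣4 1 d = inj₁ refl
∣4 2 d = inj₂ (inj₁ refl)
∣4 3 d = contradiction d (from-yes (¬? (3 ∣? 4)))
∣4 4 d = inj₂ (inj₂ refl)
∣4 (suc (suc (suc (suc (suc n))))) d = contradiction (∣⇒≤ d) λ { (s≤s (s≤s (s≤s (s≤s ())))) }

module ManySubgroups (𝔾 : FinGroup) (H : HasExactlyCyclicSubgroups (FinGroup.group 𝔾) 11) where
  open Involutions 𝔾 H
  open Twist 𝔾

  infix 4 _∈?_
  _∈?_ : ∀ (n : ℕ) ns → Dec (n ∈ ns)
  n ∈? ns = Any.any? (n ≟_) ns

  κ-sum : ∀ ns → Unique ns → sum (map (λ n → κ (ord≟ n)) ns) ≤ κ (λ x → ord x ∈? ns)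
  κ-sum [] _ = z≤n
  κ-sum (n ∷ ns) (px ∷ u) = ≤-trans (+-monoʳ-≤ (κ (ord≟ n)) (κ-sum ns u))
    (≤-trans (κ-+ (ord≟ n) (λ x → ord x ∈? ns) λ { refl q → All.lookup px q refl })
      (κ-⊆ (λ x → ord≟ n x ⊎-dec (ord x ∈? ns)) (λ x → ord x ∈? (n ∷ ns)) λ { (inj₁ e) → here e ; (inj₂ q) → there q }))

  κ-sum≤11 : ∀ ns → Unique ns → sum (map (λ n → κ (ord≟ n)) ns) ≤ 11
  κ-sum≤11 ns u = ≤-trans (κ-sum ns u) (κ≤c (λ x → ord x ∈? ns))

  κ-sum-all : ∀ ns → Unique ns → 11 ≤ sum (map (λ n → κ (ord≟ n)) ns) → ∀ x → ord x ∈ ns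
  κ-sum-all ns u le x = case ord x ∈? ns of λ
    { (yes q) → q
    ; (no ¬q) → contradiction ¬q (κ≡0 (¬? ∘ λ x → ord x ∈? ns) (ord-Invariant λ n → ¬ n ∈ ns)
        (n≤0⇒n≡0 (+-cancelˡ-≤ 11 _ 0 (≤-trans (+-monoˡ-≤ _ (≤-trans le (κ-sum ns u))) (≤-reflexive (sym (κ-compl λ x → ord x ∈? ns))))))) }

  κ₁ : 1 ≤ κ (ord≟ 1)
  κ₁ = κ-≥1 (ord≟ 1) (ord≟-inv 1) ord-ε

  -- McKay's count of the solutions of x ^ 2 = ε, each of which generates its own subgroup.
  odd-involutions : ∀ {t} → ord t ≡ 2 → 2 ∣ 1 + κ (ord≟ 2)
  odd-involutions {t} ot = subst (2 ∣_) Sol≡ (prime∣solutions prime[2] 2∣N)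
    where
    Sol? = λ x → x ↑ 2 Fin.≟ ε
    D? = λ x → ord≟ 1 x ⊎-dec ord≟ 2 x
    D-inv : Invariant (λ x → ord x ≡ 1 ⊎ ord x ≡ 2)
    D-inv = ord-Invariant (λ n → n ≡ 1 ⊎ n ≡ 2)
    -- Left multiplication by t pairs off the elements, so N is even and McKay's count applies.
    open Iterate (t ∙_)
    tt′ : ∀ x → t ∙ (t ∙ x) ≡ x
    tt′ x = trans (sym (assoc t t x)) (trans (cong (_∙ x) (invol ot)) (identityˡ x))
    open Periodic Fin._≟_ 2 prime[2] tt′
    2∣N : 2 ∣ N
    2∣N = via (length≡fixed (allFin N) (Unique.allFin⁺ N) (λ _ → ∈-allFin _))
      where
      via : (∃ λ k → length (allFin N) ≡ length (filter fixed? (allFin N)) + k * 2) → 2 ∣ N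
      via (k , e) = divides k (trans (sym (allFin-length N)) (trans e (cong (_+ k * 2) (count≡0 fixed? λ x f →
        ord-prime≢ε prime[2] ot (∙-cancelʳ x _ _ (trans f (sym (identityˡ x))))))))
    sol⇒D : ∀ {x} → x ↑ 2 ≡ ε → ord x ≡ 1 ⊎ ord x ≡ 2
    sol⇒D {x} e = case x Fin.≟ ε of λ { (yes refl) → inj₁ ord-ε ; (no ne) → inj₂ (ord-prime prime[2] e ne) }
    D⇒sol : ∀ {x} → ord x ≡ 1 ⊎ ord x ≡ 2 → x ↑ 2 ≡ ε
    D⇒sol (inj₁ e) = ∣⇒↑≡ε (subst (_∣ 2) (sym e) (1∣ 2))
    D⇒sol (inj₂ e) = ∣⇒↑≡ε (∣-reflexive e)
    ∼⇒≡ : ∀ {x y} → x ↑ 2 ≡ ε → y ↑ 2 ≡ ε → x ∼ y → x ≡ y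
    ∼⇒≡ ex ey s = case (sol⇒D ex , sol⇒D ey) of λ
      { (inj₁ a , _) → trans (ord≡1⇒ε a) (sym (ord≡1⇒ε (trans (sym (∼-ord s)) a)))
      ; (inj₂ a , inj₁ b) → trans (ord≡1⇒ε (trans (∼-ord s) b)) (sym (ord≡1⇒ε b))
      ; (inj₂ a , inj₂ b) → ∼-invol a b s }
    κD : κ D? ≡ 1 + κ (ord≟ 2)
    κD = ≤-antisym
      (subst (_≤ 1 + κ (ord≟ 2)) (sym (κ-split D? (ord≟ 1))) (+-mono-≤
        (κ-≤ (λ x → D? x ×-dec ord≟ 1 x) (ord-Invariant (λ n → (n ≡ 1 ⊎ n ≡ 2) × n ≡ 1)) (ε ∷ []) λ x (_ , e) → ε , here refl , subst (_∼ ε) (sym (ord≡1⇒ε e)) ∼-refl)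
        (κ-⊆ (λ x → D? x ×-dec ¬? (ord≟ 1 x)) (ord≟ 2) λ { (inj₁ e , n) → contradiction e n ; (inj₂ e , _) → e })))
      (≤-trans (+-monoˡ-≤ (κ (ord≟ 2)) κ₁) (κ-+ (ord≟ 1) (ord≟ 2) λ e f → contradiction (trans (sym e) f) λ ()))
    Sol≡ : count Sol? ≡ 1 + κ (ord≟ 2)
    Sol≡ = trans (≤-antisym
      (count-mono Sol? (D? ∘ gen) idx (λ p q e → ∼⇒≡ p q (idx-∼ e)) λ {x} p → D-inv (∼-idx x) (sol⇒D p))
      (count-mono (D? ∘ gen) Sol? gen (λ _ _ e → gen-injective (subst (gen _ ∼_) e ∼-refl)) D⇒sol)) κD

  module _ (many : ∀ {r v} → Prime r → ord v ≡ r → suc r ≤ κ (ord≟ r)) where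

    module Pair {p q} (pr : Prime p) (qr : Prime q) (p<q : p < q) {a b} (oa : ord a ≡ p) (ob : ord b ≡ q) where
      private
        instance
          _ = prime⇒nonZero pr
          _ = prime⇒nonZero qr
        1<p = prime>1 pr
        1<q = prime>1 qr
        pair? : ∀ y → Dec (∃ λ x → ord x ≡ p × Commute y x)
        pair? y = Fin.any? λ x → ord≟ p x ×-dec commute? y x
        pick : G → G
        pick y with pair? y
        ... | yes (x , _) = x
        ... | no _        = ε
        pick-ok : ∀ {y} → (∃ λ x → ord x ≡ p × Commute y x) → ord (pick y) ≡ p × Commute y (pick y)
        pick-ok {y} h with pair? y
        ... | yes (x , h′) = h′
        ... | no n         = contradiction h n
        coprime : Coprime q p
        coprime = prime∤⇒coprime qr λ d → <⇒≢ p<q (sym (prime∣prime qr pr d))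

        -- Conjugation by y must fix a subgroup of order p, and on a group of order p < q an action
        -- of prime order q is trivial.
        commuting : ¬ q ∣ κ (ord≟ p) → ∀ {y} → ord y ≡ q → ∃ λ x → ord x ≡ p × Commute y x
        commuting ndiv {y} oy = via (κ-fixed y qr (λ x → subst (_∼ x) (sym (trans (cong (λ g → conj g x) yq) (conj-by-ε x))) ∼-refl)
                                  (ord≟ p) (ord≟-inv p) λ {x} e → trans (ord-conj y x) e)
          where
          yq = trans (cong (y ↑_) (sym oy)) (↑-ord y)
          F? = λ x → ord≟ p x ×-dec ∼? (conj y x) x
          via : (∃ λ k → κ (ord≟ p) ≡ κ F? + k * q) → ∃ λ x → ord x ≡ p × Commute y x
          via (k , e) = case κ F? ≟ 0 of λ
            { (yes z) → contradiction (divides k (trans e (cong (_+ k * q) z))) ndiv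
            ; (no nz) → let x , ox , s = κ-pos F? (λ {x} {y′} s (o , t) → trans (sym (∼-ord s)) o , ∼-trans (∼-conj y (∼-sym s)) (∼-trans t s)) (n≢0⇒n>0 nz) in
                x , ox , small-action qr (subst (λ g → Commute g x) (sym yq) (commute-sym commute-ε)) (proj₁ s) (subst (_≤ q) (sym ox) (<⇒≤ p<q)) }

        -- Each y of order q is multiplied by a commuting element of order p; ⟨y⟩ is recovered as
        -- the q-part of the product.
        κq≤κpq : ¬ q ∣ κ (ord≟ p) → κ (ord≟ q) ≤ κ (ord≟ (q * p))
        κq≤κpq ndiv = κ-map (ord≟ q) (ord≟ (q * p)) (ord≟-inv (q * p)) (λ y → y ∙ pick y)
          (λ ox oy s → half ox oy (proj₁ s) , half oy ox (proj₂ s))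
          λ {y} oy → let ox , c = pick-ok (commuting ndiv oy) in trans (ord-∙ c (cop oy ox)) (cong₂ _*_ oy ox)
          where
          cop : ∀ {x y} → ord x ≡ q → ord y ≡ p → Coprime (ord x) (ord y)
          cop ox oy = subst₂ Coprime (sym ox) (sym oy) coprime
          half : ∀ {x y} → ord x ≡ q → ord y ≡ q → x ∙ pick x ⊑ y ∙ pick y → x ⊑ y
          half {x} {y} ox oy s = via (pick-ok (commuting ndiv ox)) (pick-ok (commuting ndiv oy))
            where
            via : ord (pick x) ≡ p × Commute x (pick x) → ord (pick y) ≡ p × Commute y (pick y) → x ⊑ y
            via (ox′ , c) (oy′ , c′) = ⊑-part c′ (cop ox oy′) (⊑-trans (⊑-∙ˡ c (cop ox ox′)) s)

      -- Otherwise the orders 1, p, q and q p contribute at least 1 + 3 + 4 + 4 = 12 subgroups.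
      q∣κp : q ∣ κ (ord≟ p)
      q∣κp = case q ∣? κ (ord≟ p) of λ
        { (yes d) → d
        ; (no nd) → contradiction (≤-trans
            (+-mono-≤ κ₁ (+-mono-≤ (≤-trans (s≤s 1<p) (many pr oa)) (+-mono-≤ κq≥4 (+-mono-≤ (≤-trans κq≥4 (κq≤κpq nd)) z≤n))))
            (κ-sum≤11 (1 ∷ p ∷ q ∷ q * p ∷ []) uniq)) (<⇒≱ (n<1+n 11)) }
        where
        κq≥4 : 4 ≤ κ (ord≟ q)
        κq≥4 = ≤-trans (s≤s (≤-trans (s≤s 1<p) p<q)) (many qr ob)
        q<qp : q < q * p
        q<qp = m<m*n q p 1<p
        uniq : Unique (1 ∷ p ∷ q ∷ q * p ∷ [])
        uniq = ((<⇒≢ 1<p) ∷ (<⇒≢ 1<q) ∷ (<⇒≢ (<-trans 1<q q<qp)) ∷ []) ∷ ((<⇒≢ p<q) ∷ (<⇒≢ (<-trans p<q q<qp)) ∷ []) ∷ ((<⇒≢ q<qp) ∷ []) ∷ [] ∷ []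

      κp+κq≤10 : κ (ord≟ p) + κ (ord≟ q) ≤ 10
      κp+κq≤10 = s≤s⁻¹ (≤-trans (+-mono-≤ κ₁ (≤-reflexive (cong (κ (ord≟ p) +_) (sym (+-identityʳ _)))))
        (κ-sum≤11 (1 ∷ p ∷ q ∷ []) (((<⇒≢ 1<p) ∷ (<⇒≢ 1<q) ∷ []) ∷ ((<⇒≢ p<q) ∷ []) ∷ [] ∷ [])))

      q≤κp : q ≤ κ (ord≟ p)
      q≤κp = ∣⇒≤ {{>-nonZero (≤-trans z<s (many pr oa))}} q∣κp

      -- There are at least q subgroups of order p and q + 1 of order q, together at most 10.
      q<5 : q < 5
      q<5 = ≰⇒> λ 5≤q → contradiction (≤-trans (+-mono-≤ (≤-trans 5≤q q≤κp) (≤-trans (s≤s 5≤q) (many qr ob))) κp+κq≤10) (<⇒≱ (n<1+n 10))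

      q≡3 : q ≡ 3
      q≡3 = ≤-antisym (s≤s⁻¹ (≤∧≢⇒< (s≤s⁻¹ q<5) λ e → from-yes (¬? (prime? 4)) (subst Prime e qr))) (≤-trans (s≤s 1<p) p<q)

      p≡2 : p ≡ 2
      p≡2 = ≤-antisym (s≤s⁻¹ (subst (p <_) q≡3 p<q)) 1<p

      -- This number is odd, a multiple of 3, and at most 10 - 4 = 6.
      κ₂≤3 : κ (ord≟ 2) ≤ 3
      κ₂≤3 = by (κ (ord≟ 2)) (subst₂ (λ q p → q ∣ κ (ord≟ p)) q≡3 p≡2 q∣κp) (odd-involutions (trans oa p≡2))
        (+-cancelʳ-≤ 4 _ 6 (≤-trans (+-monoʳ-≤ (κ (ord≟ 2)) (subst (λ q → suc q ≤ κ (ord≟ q)) q≡3 (many qr ob)))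
           (subst₂ (λ q p → κ (ord≟ p) + κ (ord≟ q) ≤ 10) q≡3 p≡2 κp+κq≤10)))
        where
        by : ∀ k → 3 ∣ k → 2 ∣ 1 + k → k ≤ 6 → k ≤ 3
        by k d e le = case k ≤? 3 of λ { (yes h) → h ; (no n) → contradiction (check k d e le (≰⇒> n)) λ () }
          where
          check : ∀ k → 3 ∣ k → 2 ∣ 1 + k → k ≤ 6 → 4 ≤ k → ⊥
          check 4 d = contradiction d (from-yes (¬? (3 ∣? 4)))
          check 5 d = contradiction d (from-yes (¬? (3 ∣? 5)))
          check 6 _ e = contradiction e (from-yes (¬? (2 ∣? 7)))
          check 0 _ _ _ ()
          check 1 _ _ _ (s≤s ())
          check 2 _ _ _ (s≤s (s≤s ()))
          check 3 _ _ _ (s≤s (s≤s (s≤s ())))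
          check (suc (suc (suc (suc (suc (suc (suc k))))))) _ _ (s≤s (s≤s (s≤s (s≤s (s≤s (s≤s ()))))))

-- The primes 2 and 3 without elements of order 6.

small-number : ∀ n .{{_ : NonZero n}} → (∀ {r} → Prime r → r ∣ n → r ≡ 2 ⊎ r ≡ 3) →
               ¬ 4 ∣ n → ¬ 6 ∣ n → ¬ 9 ∣ n → n ≡ 1 ⊎ n ≡ 2 ⊎ n ≡ 3
small-number n h n4 n6 n9 = case n ≟ 1 of λ { (yes e) → inj₁ e ; (no ne) → inj₂ (first (primeDivisor n (≤∧≢⇒< (>-nonZero⁻¹ n) (ne ∘ sym)))) }
  where
  first : (∃ λ q → Prime q × q ∣ n) → n ≡ 2 ⊎ n ≡ 3
  first (q , qr , q∣@(divides m eq)) = case m ≟ 1 of λ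
    { (yes e) → subst (λ v → v ≡ 2 ⊎ v ≡ 3) (sym (trans eq (trans (cong (_* q) e) (*-identityˡ q)))) (h qr q∣)
    ; (no ne) → contradiction (primeDivisor m (≤∧≢⇒< (>-nonZero⁻¹ m {{m*n≢0⇒m≢0 m {{subst NonZero eq it}}}}) (ne ∘ sym))) second }
    where
    it : NonZero n
    it = >-nonZero (>-nonZero⁻¹ n)
    second : ¬ ∃ λ r → Prime r × r ∣ m
    second (r , rr , r∣) = by (h qr q∣) (h rr (∣-trans r∣ (divides q (trans eq (*-comm m q))))) (subst (r * q ∣_) (sym eq) (*-monoˡ-∣ q r∣))
      where
      by : q ≡ 2 ⊎ q ≡ 3 → r ≡ 2 ⊎ r ≡ 3 → r * q ∣ n → ⊥
      by (inj₁ refl) (inj₁ refl) d = n4 d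
      by (inj₁ refl) (inj₂ refl) d = n6 d
      by (inj₂ refl) (inj₁ refl) d = n6 d
      by (inj₂ refl) (inj₂ refl) d = n9 d

coprime-2-3 : Coprime 2 3
coprime-2-3 = prime∤⇒coprime prime[2] (from-yes (¬? (2 ∣? 3)))

module TwoThree (𝔾 : FinGroup) (H : HasExactlyCyclicSubgroups (FinGroup.group 𝔾) 11) where
  open Involutions 𝔾 H
  open ManySubgroups 𝔾 H

  module _ (many : ∀ {r v} → Prime r → ord v ≡ r → suc r ≤ κ (ord≟ r)) (κ₂≤3 : κ (ord≟ 2) ≤ 3)
           {t₀ x₀} (ot₀ : ord t₀ ≡ 2) (ox₀ : ord x₀ ≡ 3) where

    κ₂≥3 : 3 ≤ κ (ord≟ 2)
    κ₂≥3 = many prime[2] ot₀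

    κ₃≥4 : 4 ≤ κ (ord≟ 3)
    κ₃≥4 = many prime[3] ox₀

    odd₃ : ∀ {x} → ord x ≡ 3 → x ⊑ x ↑ 2
    odd₃ {x} o = ⊑-coprime coprime-2-3 (∣⇒↑≡ε (∣-reflexive o))

    -- A further prime r has at least 5 subgroups of order r, and 1 + 3 + 4 + 5 exceeds 11.
    primes : ∀ g {r} → Prime r → r ∣ ord g → r ≡ 2 ⊎ r ≡ 3
    primes g {r} rr d with r ≟ 2 | r ≟ 3
    ... | yes e | _ = inj₁ e
    ... | no _ | yes e = inj₂ e
    ... | no n2 | no n3 = contradiction (≤-trans (+-mono-≤ κ₁ (+-mono-≤ κ₂≥3 (+-mono-≤ κ₃≥4 (+-mono-≤ (≤-trans (s≤s (r≥4 n2 n3)) (many rr (proj₂ (proj₂ (power-⊑ d))))) z≤n))))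
          (κ-sum≤11 (1 ∷ 2 ∷ 3 ∷ r ∷ []) (((λ ()) ∷ (λ ()) ∷ (<⇒≢ (prime>1 rr)) ∷ []) ∷ ((λ ()) ∷ (n2 ∘ sym) ∷ []) ∷ ((n3 ∘ sym) ∷ []) ∷ [] ∷ []))) (<⇒≱ (m≤m+n 12 1))
      where
      r≥4 : r ≢ 2 → r ≢ 3 → 4 ≤ r
      r≥4 n2 n3 = ≤∧≢⇒< (≤∧≢⇒< (prime>1 rr) (n2 ∘ sym)) (n3 ∘ sym)

    -- x of order 3 permutes the three involutions cyclically; if they commute they form a four-group.
    module Moved {x t} (ox : ord x ≡ 3) (ot : ord t ≡ 2) (¬c : ¬ Commute x t) where
      open Cycle κ₂≤3 ot (odd₃ ox) ¬c public renaming (t to T)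
      open Three three public

      0F 1F 2F : Fin 3
      0F = Fin.zero
      1F = Fin.suc Fin.zero
      2F = Fin.suc (Fin.suc Fin.zero)

      others₀₁ : ∀ l → l ≢ 0F → l ≢ 1F → l ≡ 2F
      others₀₁ Fin.zero n _ = contradiction refl n
      others₀₁ (Fin.suc Fin.zero) _ n = contradiction refl n
      others₀₁ (Fin.suc (Fin.suc Fin.zero)) _ _ = refl

      T₀ : T 0F ≡ t
      T₀ = conj-by-ε t

      T₁ : T 1F ≡ conj x t
      T₁ = cong (λ v → conj v t) (x↑1 x)

      conj-x-T₁ : conj x (T 1F) ≡ T 2F
      conj-x-T₁ = conj-conj x (x ↑ 1) t

      module Klein (c : Commute (T 0F) (T 1F)) where
        c₁₂ : Commute (T 1F) (T 2F)
        c₁₂ = subst₂ Commute (trans (cong (conj x) T₀) (sym T₁)) conj-x-T₁ (commute-conj x c)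

        T₀T₁ : T 0F ∙ T 1F ≡ T 2F
        T₀T₁ = case t-product {0F} {1F} {2F} (λ ()) others₀₁ of λ
          { (inj₁ (_ , e)) → e
          ; (inj₂ (e , _)) → contradiction (t-injective {1F} {2F} (trans (sym (conj-commute c)) e)) λ () }

        c₀₂ : Commute (T 0F) (T 2F)
        c₀₂ = subst (Commute (T 0F)) T₀T₁ (commute-∙ refl c)

        commuting : ∀ i j → Commute (T i) (T j)
        commuting Fin.zero Fin.zero = refl
        commuting Fin.zero (Fin.suc Fin.zero) = c
        commuting Fin.zero (Fin.suc (Fin.suc Fin.zero)) = c₀₂
        commuting (Fin.suc Fin.zero) Fin.zero = sym c
        commuting (Fin.suc Fin.zero) (Fin.suc Fin.zero) = refl
        commuting (Fin.suc Fin.zero) (Fin.suc (Fin.suc Fin.zero)) = c₁₂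
        commuting (Fin.suc (Fin.suc Fin.zero)) Fin.zero = sym c₀₂
        commuting (Fin.suc (Fin.suc Fin.zero)) (Fin.suc Fin.zero) = sym c₁₂
        commuting (Fin.suc (Fin.suc Fin.zero)) (Fin.suc (Fin.suc Fin.zero)) = refl

        square : ∀ i j → (T i ∙ T j) ↑ 2 ≡ ε
        square i j = trans (∙-↑ 2 (commuting i j)) (trans (cong₂ _∙_ (∣⇒↑≡ε (∣-reflexive (t-ord i))) (∣⇒↑≡ε (∣-reflexive (t-ord j)))) (identityˡ ε))

        product-third : ∀ {i j} → i ≢ j → ∃ λ k → T i ∙ T j ≡ T k
        product-third {i} {j} i≢j = let k , _ , k≢j , others = third i j i≢j in k , (case t-product {i} {j} {k} i≢j others of λ
          { (inj₁ (_ , e)) → e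
          ; (inj₂ (e , _)) → contradiction (t-injective (trans (sym e) (conj-commute (commuting i j)))) k≢j })

    -- Without commuting elements of orders 2 and 3 the only orders are 1, 2 and 3, and the counts
    -- 1, 3 and 4 fall short of 11.
    module Frobenius (free : ∀ {x t} → ord x ≡ 3 → ord t ≡ 2 → ¬ Commute x t) where
      no6 : ∀ g → ¬ 6 ∣ ord g
      no6 g d = let a , a⊑ , oa = power-⊑ (∣-trans (divides 2 refl) d) ; b , b⊑ , ob = power-⊑ (∣-trans (divides 3 refl) d) in
        free oa ob (commute-within a⊑ b⊑)

      -- The cube of an element of order 9 has order 3 and, by `Cycle`, commutes with the involution
      -- t₀.
      no9 : ∀ g → ¬ 9 ∣ ord g
      no9 g d = let h , _ , oh = power-⊑ d in free (ord-↑ 3 3 oh) ot₀ (cube oh)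
        where
        cube : ∀ {h} → ord h ≡ 9 → Commute (h ↑ 3) t₀
        cube {h} oh = case commute? h t₀ of λ
          { (yes c) → commute-sym (commute-↑ 3 (commute-sym c))
          ; (no ¬c) → Cycle.x³-commutes κ₂≤3 ot₀ (⊑-coprime (prime∤⇒coprime prime[2] (from-yes (¬? (2 ∣? 9)))) (∣⇒↑≡ε (∣-reflexive oh))) ¬c }

      -- Orders 1, 2 and 3 use 8 subgroups, so at most three have order 4. As x₀ moves τ = g²
      -- through all three involutions, only ⟨g⟩ has generators with square τ. If g commutes with
      -- T₁, then g T₁ has square τ too, and T₁ lies in ⟨g⟩. If g takes T₁ to T₂, the involutions
      -- form a four-group and g T₁ is one of them, so g is a product of two commuting involutions.
      no4 : ∀ g → ¬ 4 ∣ ord g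
      no4 g₀ d = let g , _ , og = power-⊑ d in absurd og
        where
        absurd : ∀ {g} → ord g ≡ 4 → ⊥
        absurd {g} og = last (conj g (T 1F) Fin.≟ T 1F)
          where
          τ = g ↑ 2
          oτ : ord τ ≡ 2
          oτ = ord-↑ 2 2 og
          open Moved ox₀ oτ (free ox₀ oτ)
          gs : Fin 3 → G
          gs i = conj (x₀ ↑ toℕ i) g
          square-gs : ∀ i → gs i ↑ 2 ≡ T i
          square-gs i = sym (conj-↑ (x₀ ↑ toℕ i) g 2)
          T∼ : ∀ {i j} → gs i ∼ gs j → T i ∼ T j
          T∼ {i} {j} (p , q) = subst₂ _∼_ (square-gs i) (square-gs j) (↑2 p , ↑2 q)
            where
            ↑2 : ∀ {a b} → a ⊑ b → a ↑ 2 ⊑ b ↑ 2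
            ↑2 {b = b} (k , refl) = k , ↑-↑ b 2 k
          gs-inj : ∀ {i j} → gs i ∼ gs j → i ≡ j
          gs-inj {i} {j} s = t-injective (∼-invol (t-ord i) (t-ord j) (T∼ {i} {j} s))
          κ₄≤3 : κ (ord≟ 4) ≤ 3
          κ₄≤3 = +-cancelˡ-≤ 8 _ 3 (≤-trans (+-mono-≤ κ₁ (+-mono-≤ κ₂≥3 (+-mono-≤ κ₃≥4 (≤-reflexive (sym (+-identityʳ _))))))
            (κ-sum≤11 (1 ∷ 2 ∷ 3 ∷ 4 ∷ []) (((λ ()) ∷ (λ ()) ∷ (λ ()) ∷ []) ∷ ((λ ()) ∷ (λ ()) ∷ []) ∷ ((λ ()) ∷ []) ∷ [] ∷ [])))
          only-g : ∀ {h} → ord h ≡ 4 → h ↑ 2 ≡ τ → h ∼ g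
          only-g {h} oh e = via (κ-complete (ord≟ 4) (ord≟-inv 4) gs (λ {i} {j} → gs-inj {i} {j}) (λ i → trans (ord-conj _ g) og) κ₄≤3 oh)
            where
            via : (∃ λ i → h ∼ gs i) → h ∼ g
            via (Fin.zero , s) = subst (h ∼_) (conj-by-ε g) s
            via (i@(Fin.suc _) , (p , q)) = contradiction (t-injective {0F} {i} (trans T₀ (∼-invol oτ (t-ord i)
                (subst₂ _∼_ e (square-gs i) (↑2 p , ↑2 q))))) λ ()
              where
              ↑2 : ∀ {a b} → a ⊑ b → a ↑ 2 ⊑ b ↑ 2
              ↑2 {b = b} (k , refl) = k , ↑-↑ b 2 k
          g-τ : conj g (T 0F) ≡ T 0F
          g-τ = trans (cong (conj g) T₀) (trans (conj-commute (commute-↑ 2 refl)) (sym T₀))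
          T₁≢T₀ : T 1F ≢ T 0F
          T₁≢T₀ e = contradiction (t-injective {1F} {0F} e) λ ()
          g≢ : ∀ {u} → u ↑ 2 ≡ ε → g ≢ u
          g≢ e refl = ord-prime≢ε prime[2] oτ e
          T² : ∀ i → T i ↑ 2 ≡ ε
          T² i = ∣⇒↑≡ε (∣-reflexive (t-ord i))
          last : Dec (conj g (T 1F) ≡ T 1F) → ⊥
          last (yes e) = T₁≢T₀ (trans (∼-invol (t-ord 1F) oτ (⊑-unique-∼ T₁⊑g (⊑-↑ 2) (trans (t-ord 1F) (sym oτ)))) (sym T₀))
            where
            c : Commute g (T 1F)
            c = conj≡⇒commute e
            h = g ∙ T 1F
            h² : h ↑ 2 ≡ τ
            h² = trans (∙-↑ 2 c) (trans (cong (τ ∙_) (T² 1F)) (identityʳ τ))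
            oh : ord h ≡ 4
            oh = case ∣4 (ord h) (ord-∣ (trans (↑-* h 2 2) (trans (cong (_↑ 2) h²) (∣⇒↑≡ε (∣-reflexive oτ))))) of λ
              { (inj₁ o) → contradiction (trans (sym h²) (∣⇒↑≡ε (subst (_∣ 2) (sym o) (1∣ 2)))) (ord-prime≢ε prime[2] oτ)
              ; (inj₂ (inj₁ o)) → contradiction (trans (sym h²) (∣⇒↑≡ε (∣-reflexive o))) (ord-prime≢ε prime[2] oτ)
              ; (inj₂ (inj₂ o)) → o }
            T₁⊑g : T 1F ⊑ g
            T₁⊑g = subst (_⊑ g) (word (neg w0 :∙ (w0 :∙ w1)) w1 (g ∷ T 1F ∷ g ∷ []) refl) (⊑-∙ (⊑-⁻¹ ⊑-refl) (proj₁ (only-g oh h²)))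
          last (no ne) = by (t-all (invol-ord gt² λ e → g≢ (T² 1F) (trans (inverseˡ-unique g (T 1F) e) (invol-⁻¹ (t-ord 1F)))))
            where
            e₂ : conj g (T 1F) ≡ T 2F
            e₂ = is-third others₀₁ (trans (ord-conj g (T 1F)) (t-ord 1F))
              (λ e → T₁≢T₀ (conj-injective g (trans e (sym g-τ)))) ne
            τ₁ : conj (T 0F) (T 1F) ≡ T 1F
            τ₁ = case t-all (trans (ord-conj (T 0F) (T 1F)) (t-ord 1F)) of λ
              { (Fin.zero , e) → contradiction (conj-injective (T 0F) (trans e (sym (conj-commute refl)))) T₁≢T₀
              ; (Fin.suc Fin.zero , e) → e
              ; (Fin.suc (Fin.suc Fin.zero) , e) → contradiction (conj-injective g (trans (conj-conj g g (T 1F)) (trans (cong (λ v → conj v (T 1F)) (trans (cong (g ∙_) (sym (identityʳ g))) (sym T₀))) (trans e (sym e₂))))) ne }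
            open Klein (conj≡⇒commute τ₁)
            gt² : g ∙ T 1F ∙ (g ∙ T 1F) ≡ ε
            gt² = begin
              g ∙ T 1F ∙ (g ∙ T 1F)               ≡⟨ word (w0 :∙ w1 :∙ (w0 :∙ w1)) ((w0 :∙ w1 :∙ neg w0) :∙ ((w0 :∙ (w0 :∙ one)) :∙ w1)) (g ∷ T 1F ∷ g ∷ []) refl ⟩
              conj g (T 1F) ∙ (τ ∙ T 1F)          ≡⟨ cong₂ (λ u v → u ∙ (v ∙ T 1F)) e₂ (sym T₀) ⟩
              T 2F ∙ (T 0F ∙ T 1F)                ≡⟨ cong (T 2F ∙_) T₀T₁ ⟩
              T 2F ∙ T 2F                         ≡⟨ invol (t-ord 2F) ⟩
              ε                                   ∎
              where open ≡-Reasoning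
            by : (∃ λ i → g ∙ T 1F ≡ T i) → ⊥
            by (i , e) = g≢ (square i 1F) (∙-cancelʳ (T 1F) _ _ (trans e (trans (sym (identityʳ (T i)))
              (trans (cong (T i ∙_) (sym (invol (t-ord 1F)))) (sym (assoc _ _ _))))))

      orders : ∀ g → ord g ≡ 1 ⊎ ord g ≡ 2 ⊎ ord g ≡ 3
      orders g = small-number (ord g) (primes g) (no4 g) (no6 g) (no9 g)

      contradictory : ⊥
      contradictory = contradiction (≤-trans all≤ (+-mono-≤ κ₁≤1 (+-mono-≤ κ₂≤3 κ₃≤4))) (<⇒≱ (m≤m+n 9 2))
        where
        open Moved ox₀ ot₀ (free ox₀ ot₀)
        κ₁≤1 : κ (ord≟ 1) ≤ 1
        κ₁≤1 = κ-≤ (ord≟ 1) (ord≟-inv 1) (ε ∷ []) λ x e → ε , here refl , subst (_∼ ε) (sym (ord≡1⇒ε e)) ∼-refl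
        all≤ : 11 ≤ κ (ord≟ 1) + (κ (ord≟ 2) + κ (ord≟ 3))
        all≤ = ≤-trans (≤-reflexive (κ-compl (ord≟ 1))) (+-monoʳ-≤ (κ (ord≟ 1)) (≤-trans (≤-reflexive (κ-split N1? (ord≟ 2)))
           (+-mono-≤ (κ-⊆ (λ x → N1? x ×-dec ord≟ 2 x) (ord≟ 2) proj₂) (κ-⊆ (λ x → N1? x ×-dec ¬? (ord≟ 2 x)) (ord≟ 3)
              λ {x} (n1 , n2) → case orders x of λ { (inj₁ e) → contradiction e n1 ; (inj₂ (inj₁ e)) → contradiction e n2 ; (inj₂ (inj₂ e)) → e }))))
          where N1? = λ x → ¬? (ord≟ 1 x)
        list : List G
        list = x₀ ∙ ε ∷ x₀ ∙ T 0F ∷ x₀ ∙ T 1F ∷ x₀ ∙ T 2F ∷ []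
        T∈ : ∀ i → x₀ ∙ T i ∈ list
        T∈ Fin.zero = there (here refl)
        T∈ (Fin.suc Fin.zero) = there (there (here refl))
        T∈ (Fin.suc (Fin.suc Fin.zero)) = there (there (there (here refl)))
        -- x₀⁻¹ y centralises T₀, hence does not have order 3; it is ε or one of the involutions.
        same : ∀ {y} → conj y (T 0F) ≡ T 1F → y ∈ list
        same {y} e = subst (_∈ list) (word (w0 :∙ (neg w0 :∙ w1)) w1 (x₀ ∷ y ∷ y ∷ []) refl) (by (orders k))
          where
          k = x₀ ⁻¹ ∙ y
          ck : Commute k (T 0F)
          ck = conj≡⇒commute (trans (sym (conj-conj (x₀ ⁻¹) y (T 0F))) (trans (cong (conj (x₀ ⁻¹)) (trans e (trans T₁ (cong (conj x₀) (sym T₀))))) (conj-⁻¹ˡ x₀ (T 0F))))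
          by : ord k ≡ 1 ⊎ ord k ≡ 2 ⊎ ord k ≡ 3 → x₀ ∙ k ∈ list
          by (inj₁ o) = here (cong (x₀ ∙_) (ord≡1⇒ε o))
          by (inj₂ (inj₁ o)) = let i , e = t-all o in subst (_∈ list) (cong (x₀ ∙_) (sym e)) (T∈ i)
          by (inj₂ (inj₂ o)) = contradiction ck (free o (t-ord 0F))
        -- Every subgroup of order 3 has a generator, y or y², that takes T₀ to T₁.
        κ₃≤4 : κ (ord≟ 3) ≤ 4
        κ₃≤4 = κ-≤ (ord≟ 3) (ord≟-inv 3) list λ y oy → via y oy (t-all (trans (ord-conj y (T 0F)) (t-ord 0F)))
          where
          via : ∀ y → ord y ≡ 3 → (∃ λ i → conj y (T 0F) ≡ T i) → ∃ λ w → w ∈ list × y ∼ w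
          via y oy (Fin.zero , e) = contradiction (conj≡⇒commute e) (free oy (t-ord 0F))
          via y oy (Fin.suc Fin.zero , e) = y , same e , ∼-refl
          via y oy (Fin.suc (Fin.suc Fin.zero) , e) = y ↑ 2 , same (y²T₀ (t-all (trans (ord-conj y (T 2F)) (t-ord 2F)))) , odd₃ oy , ⊑-↑ 2
            where
            y² : conj (y ↑ 2) (T 0F) ≡ conj y (T 2F)
            y² = trans (sym (trans (conj-conj y y (T 0F)) (cong (λ v → conj (y ∙ v) (T 0F)) (sym (identityʳ y))))) (cong (conj y) e)
            y²T₀ : (∃ λ i → conj y (T 2F) ≡ T i) → conj (y ↑ 2) (T 0F) ≡ T 1F
            y²T₀ (Fin.zero , f) = contradiction (commute-sym (commute-⊑ (commute-sym (conj≡⇒commute (trans y² f))) (odd₃ oy))) (free oy (t-ord 0F))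
            y²T₀ (Fin.suc Fin.zero , f) = trans y² f
            y²T₀ (Fin.suc (Fin.suc Fin.zero) , f) = contradiction (t-injective {0F} {2F} (conj-injective y (trans e (sym f)))) λ ()

-- An element of order 6: the group ℤ₃ × S₃.

module DirectProduct (𝔾 : FinGroup) (H : HasExactlyCyclicSubgroups (FinGroup.group 𝔾) 11) where
  open Involutions 𝔾 H
  open ManySubgroups 𝔾 H
  open TwoThree 𝔾 H using (module Moved)

  module _ (many : ∀ {r v} → Prime r → ord v ≡ r → suc r ≤ κ (ord≟ r)) (κ₂≤3 : κ (ord≟ 2) ≤ 3)
           {s t} (ot : ord t ≡ 2) (os : ord s ≡ 3) (st : Commute s t) where

    private
      κ₂≥3 : 3 ≤ κ (ord≟ 2)
      κ₂≥3 = many prime[2] ot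

      κ₃≥4 : 4 ≤ κ (ord≟ 3)
      κ₃≥4 = many prime[3] os

    -- a permutes at most three involutions in orbits of length 1 and 3. It fixes u, so it fixes all
    -- of them.
    commutes-with-all : ∀ {a u v} → ord a ≡ 3 → ord u ≡ 2 → Commute a u → ord v ≡ 2 → Commute a v
    commutes-with-all {a} {u} {v} oa ou c ov = via (κ-fixed a prime[3]
        (λ x → subst (_∼ x) (sym (trans (cong (λ g → conj g x) (∣⇒↑≡ε (∣-reflexive oa))) (conj-by-ε x))) ∼-refl)
        (ord≟ 2) (ord≟-inv 2) λ {x} e → trans (ord-conj a x) e)
      where
      Fix? = λ x → ∼? (conj a x) x
      F? = λ x → ord≟ 2 x ×-dec Fix? x
      M? = λ x → ord≟ 2 x ×-dec ¬? (Fix? x)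
      Fix-inv : Invariant (λ x → conj a x ∼ x)
      Fix-inv s e = ∼-trans (∼-conj a (∼-sym s)) (∼-trans e s)
      F≥1 : 1 ≤ κ F?
      F≥1 = κ-≥1 F? (λ s (o , e) → trans (sym (∼-ord s)) o , Fix-inv s e) (ou , subst (_∼ u) (sym (conj-commute c)) ∼-refl)
      via : (∃ λ k → κ (ord≟ 2) ≡ κ F? + k * 3) → Commute a v
      via (suc k , e) = contradiction (≤-trans (+-mono-≤ F≥1 (m≤m+n 3 (k * 3))) (≤-trans (≤-reflexive (sym e)) κ₂≤3)) (<⇒≱ (n<1+n 3))
      via (zero , e) = case Fix? v of λ
        { (yes f) → conj≡⇒commute (∼-invol (trans (ord-conj a v) ov) ov f)
        ; (no n) → contradiction (ov , n) (κ≡0 M? (λ s (o , n) → trans (sym (∼-ord s)) o , λ e → n (Fix-inv (∼-sym s) e))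
            (+-cancelˡ-≡ (κ F?) _ 0 (trans (sym (κ-split (ord≟ 2) Fix?)) e))) }

    private
      cop : ∀ {a u} → ord a ≡ 3 → ord u ≡ 2 → Coprime (ord a) (ord u)
      cop oa ou = subst₂ Coprime (sym oa) (sym ou) (Cop.sym coprime-2-3)

      ord-6 : ∀ {a u} → ord a ≡ 3 → ord u ≡ 2 → Commute a u → ord (a ∙ u) ≡ 6
      ord-6 oa ou c = trans (ord-∙ c (cop oa ou)) (cong₂ _*_ oa ou)

      S6? = λ x → ord≟ 6 x ×-dec ⊑? s x
      N6? = λ x → ord≟ 6 x ×-dec ¬? (⊑? s x)

      S6≥3 : 3 ≤ κ S6?
      S6≥3 = ≤-trans κ₂≥3 (κ-map (ord≟ 2) S6? (λ w (o , e) → trans (sym (∼-ord w)) o , ⊑-trans e (proj₁ w)) (s ∙_)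
        (λ ou ov w → half ou ov (proj₁ w) , half ov ou (proj₂ w))
        λ ou → ord-6 os ou (all ou) , ⊑-∙ˡ (all ou) (cop os ou))
        where
        all : ∀ {u} → ord u ≡ 2 → Commute s u
        all = commutes-with-all os ot st
        half : ∀ {u v} → ord u ≡ 2 → ord v ≡ 2 → s ∙ u ⊑ s ∙ v → u ⊑ v
        half {u} {v} ou ov w = ⊑-part (commute-sym (all ov)) (Cop.sym (cop os ou)) (subst (u ⊑_) (all ov) (⊑-trans (⊑-∙ʳ (all ou) (cop os ou)) w))

      unique-orders : Unique (1 ∷ 2 ∷ 3 ∷ 6 ∷ [])
      unique-orders = ((λ ()) ∷ (λ ()) ∷ (λ ()) ∷ []) ∷ ((λ ()) ∷ (λ ()) ∷ []) ∷ ((λ ()) ∷ []) ∷ [] ∷ []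

    -- The three involutions give three subgroups of order 6 that contain s. An a outside ⟨s⟩ would
    -- add a fourth of order 6, and 1 + 3 + 4 + 4 exceeds 11.
    only-s : ∀ {a u} → ord a ≡ 3 → ord u ≡ 2 → Commute a u → a ∼ s
    only-s {a} {u} oa ou c = case ⊑? s a of λ
      { (yes e) → ∼-sym (⊑∧ord≡⇒∼ e (trans os (sym oa)))
      ; (no n) → contradiction (≤-trans (+-mono-≤ κ₁ (+-mono-≤ κ₂≥3 (+-mono-≤ κ₃≥4 (+-mono-≤
           (≤-trans (+-mono-≤ S6≥3 (κ-≥1 N6? (λ w (o , m) → trans (sym (∼-ord w)) o , λ e → m (⊑-trans e (proj₂ w)))
              (ord-6 oa ou c , λ e → n (⊑-part c (cop os ou) e)))) (≤-reflexive (sym (κ-split (ord≟ 6) (⊑? s)))))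
           z≤n)))) (κ-sum≤11 _ unique-orders)) (<⇒≱ (n<1+n 11)) }

    κ₆≥3 : 3 ≤ κ (ord≟ 6)
    κ₆≥3 = ≤-trans S6≥3 (κ-⊆ S6? (ord≟ 6) proj₁)

    κ₃≤4 : κ (ord≟ 3) ≤ 4
    κ₃≤4 = +-cancelʳ-≤ 7 _ 4 (≤-trans (≤-trans (+-monoʳ-≤ (κ (ord≟ 3)) (+-mono-≤ (+-mono-≤ κ₁ κ₂≥3) κ₆≥3))
       (≤-reflexive (solve 4 (λ a b c d → c :+ (a :+ b :+ d) := a :+ (b :+ (c :+ (d :+ con 0)))) refl (κ (ord≟ 1)) (κ (ord≟ 2)) (κ (ord≟ 3)) (κ (ord≟ 6)))))
       (κ-sum≤11 _ unique-orders))
      where open +-*-Solver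

    -- The lower bounds 1, 3, 4 and 3 for these orders already add up to 11.
    orders : ∀ g → ord g ∈ (1 ∷ 2 ∷ 3 ∷ 6 ∷ [])
    orders = κ-sum-all _ unique-orders (+-mono-≤ κ₁ (+-mono-≤ κ₂≥3 (+-mono-≤ κ₃≥4 (+-mono-≤ κ₆≥3 z≤n))))

    another : ∃ λ x → ord x ≡ 3 × ¬ x ⊑ s
    another with Fin.any? (λ x → ord≟ 3 x ×-dec ¬? (⊑? x s))
    ... | yes h = h
    ... | no none = contradiction (≤-trans κ₃≥4 (κ-≤ (ord≟ 3) (ord≟-inv 3) (s ∷ []) λ x ox → s , here refl ,
            (case ⊑? x s of λ { (yes e) → ⊑∧ord≡⇒∼ e (trans ox (sym os)) ; (no n) → contradiction (x , ox , n) none }))) λ { (s≤s ()) }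

    module WithX {x} (ox : ord x ≡ 3) (x⋢s : ¬ x ⊑ s) where
      free : ∀ {u} → ord u ≡ 2 → ¬ Commute x u
      free ou c = x⋢s (proj₁ (only-s ox ou c))

      open Moved many κ₂≤3 ot ox ox ot (free ot)

      s-T : ∀ i → Commute s (T i)
      s-T i = commutes-with-all os ot st (t-ord i)

      -- A four-group leads to five subgroups of order 3: ⟨s⟩, ⟨x⟩ and its conjugates under the
      -- three involutions. No T i normalises ⟨x⟩, because its commutator with x is a product of two
      -- commuting involutions and has square ε.
      module FourGroup (c : Commute (T 0F) (T 1F)) where
        open Klein c

        not-normalised : ∀ i → ¬ conj (T i) x ⊑ x
        not-normalised i e = free (t-ord i) (commute-sym (conj≡⇒commute (∙-cancelʳ (x ⁻¹) _ _ (trans u≡ε (sym (inverseʳ x))))))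
          where
          u = conj (T i) x ∙ x ⁻¹
          u⊑x : u ⊑ x
          u⊑x = ⊑-∙ e (⊑-⁻¹ ⊑-refl)
          via : (∃ λ j → conj x (T i) ≡ T j) → u ↑ 2 ≡ ε
          via (j , f) = trans (cong (_↑ 2) (trans (word (w0 :∙ w1 :∙ neg w0 :∙ neg w1) (w0 :∙ neg (w1 :∙ w0 :∙ neg w1)) (T i ∷ x ∷ x ∷ []) refl)
            (cong (T i ∙_) (trans (cong _⁻¹ f) (invol-⁻¹ (t-ord j)))))) (square i j)
          u≡ε : u ≡ ε
          u≡ε = ↑-coprime⇒ε coprime-2-3 (via (t-all (trans (ord-conj x (T i)) (t-ord i))))
            (∣⇒↑≡ε (subst (ord u ∣_) ox (⊑-ord u⊑x)))

        f : Fin 5 → G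
        f Fin.zero              = s
        f (Fin.suc Fin.zero)    = x
        f (Fin.suc (Fin.suc i)) = conj (T i) x

        f-ord : ∀ i → ord (f i) ≡ 3
        f-ord Fin.zero              = os
        f-ord (Fin.suc Fin.zero)    = ox
        f-ord (Fin.suc (Fin.suc i)) = trans (ord-conj (T i) x) ox

        s≁ : ∀ i → ¬ conj (T i) x ⊑ s
        s≁ i e = x⋢s (subst₂ _⊑_ (conj-⁻¹ˡ (T i) x) (conj-commute (commute-sym (commute-⁻¹ (s-T i)))) (⊑-conj (T i ⁻¹) e))

        clash : ∀ {i j} → i ≢ j → ¬ conj (T i) x ∼ conj (T j) x
        clash {i} {j} i≢j e = via (product-third {j} {i} (i≢j ∘ sym))
          where
          via : (∃ λ k → T j ∙ T i ≡ T k) → ⊥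
          via (k , f) = not-normalised k (subst (_⊑ x) (trans (conj-conj (T j) (T i) x) (cong (λ v → conj v x) f))
            (subst (conj (T j) (conj (T i) x) ⊑_) (trans (cong (λ v → conj v (conj (T j) x)) (sym (invol-⁻¹ (t-ord j)))) (conj-⁻¹ˡ (T j) x)) (⊑-conj (T j) (proj₁ e))))

        f-inj : ∀ {i j} → f i ∼ f j → i ≡ j
        f-inj {Fin.zero} {Fin.zero} _ = refl
        f-inj {Fin.zero} {Fin.suc Fin.zero} e = contradiction (proj₂ e) x⋢s
        f-inj {Fin.zero} {Fin.suc (Fin.suc j)} e = contradiction (proj₂ e) (s≁ j)
        f-inj {Fin.suc Fin.zero} {Fin.zero} e = contradiction (proj₁ e) x⋢s
        f-inj {Fin.suc Fin.zero} {Fin.suc Fin.zero} _ = refl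
        f-inj {Fin.suc Fin.zero} {Fin.suc (Fin.suc j)} e = contradiction (proj₂ e) (not-normalised j)
        f-inj {Fin.suc (Fin.suc i)} {Fin.zero} e = contradiction (proj₁ e) (s≁ i)
        f-inj {Fin.suc (Fin.suc i)} {Fin.suc Fin.zero} e = contradiction (proj₁ e) (not-normalised i)
        f-inj {Fin.suc (Fin.suc i)} {Fin.suc (Fin.suc j)} e = case i Fin.≟ j of λ
          { (yes eq) → cong (Fin.suc ∘ Fin.suc) eq ; (no ne) → contradiction e (clash ne) }

        contradictory : ⊥
        contradictory = contradiction (≤-trans (κ-≥-Fin (ord≟ 3) (ord≟-inv 3) f (λ {i} {j} → f-inj {i} {j}) f-ord) κ₃≤4) (<⇒≱ (n<1+n 4))

      module Symmetric (e : conj (T 0F) (T 1F) ≡ T 2F) (d³ : (T 0F ∙ T 1F) ↑ 3 ≡ ε) where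
        d = T 0F ∙ T 1F

        d≢ε : d ≢ ε
        d≢ε f = contradiction (t-injective {1F} {0F} (trans (inverseʳ-unique (T 0F) (T 1F) f) (invol-⁻¹ (t-ord 0F)))) λ ()

        od : ord d ≡ 3
        od = ord-prime prime[3] d³ d≢ε

        s-d : Commute s d
        s-d = commute-∙ (s-T 0F) (s-T 1F)

        inverted : conj (T 0F) d ≡ d ↑ 2
        inverted = begin
          T 0F ∙ (T 0F ∙ T 1F) ∙ T 0F ⁻¹        ≡⟨ cong (_∙ T 0F ⁻¹) (assoc _ _ _) ⟨
          T 0F ∙ T 0F ∙ T 1F ∙ T 0F ⁻¹          ≡⟨ cong (λ v → v ∙ T 1F ∙ T 0F ⁻¹) (invol (t-ord 0F)) ⟩
          ε ∙ T 1F ∙ T 0F ⁻¹                    ≡⟨ cong (_∙ T 0F ⁻¹) (trans (identityˡ _) (sym (invol-⁻¹ (t-ord 1F)))) ⟩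
          T 1F ⁻¹ ∙ T 0F ⁻¹                     ≡⟨ ⁻¹-anti-homo-∙ (T 0F) (T 1F) ⟨
          d ⁻¹                                  ≡⟨ inverseʳ-unique d (d ↑ 2) d³ ⟨
          d ↑ 2                                 ∎
          where open ≡-Reasoning

        independent : ¬ s ⊑ d
        independent f = d≢ε (∙-cancelˡ d _ _ (trans (trans (cong (d ∙_) (sym (identityʳ d))) (trans (sym inverted)
            (conj-commute (commute-⊑ (commute-sym (s-T 0F)) (proj₂ (⊑∧ord≡⇒∼ f (trans os (sym od)))))))) (sym (identityʳ d))))

        Form : G → Set
        Form g = ∃ λ i → ∃₂ λ j k → g ≡ s ↑ i ∙ (d ↑ j ∙ T 0F ↑ k)

        Form-∙ : ∀ {g h} → Form g → Form h → Form (g ∙ h)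
        Form-∙ (i , j , k , refl) (i′ , j′ , k′ , refl) = i + i′ , j + 2 ^ k * j′ , k + k′ ,
          trans (interchange (s ↑ i) u (s ↑ i′) v (commute-↑↑ 1 i′ (commute-sym (commute-∙ (commute-↑ j s-d) (commute-↑ k (s-T 0F))))))
            (cong₂ _∙_ (sym (↑-+ s i i′)) (Twist.twist 𝔾 inverted j k j′ k′))
          where
          u = d ↑ j ∙ T 0F ↑ k
          v = d ↑ j′ ∙ T 0F ↑ k′
          interchange : ∀ a u b v → Commute (u ↑ 1) b → (a ∙ u) ∙ (b ∙ v) ≡ (a ∙ b) ∙ (u ∙ v)
          interchange a u b v c = begin
            (a ∙ u) ∙ (b ∙ v)     ≡⟨ trans (assoc _ _ _) (cong (a ∙_) (sym (assoc _ _ _))) ⟩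
            a ∙ (u ∙ b ∙ v)       ≡⟨ cong (λ w → a ∙ (w ∙ v)) (subst (λ w → Commute w b) (x↑1 u) c) ⟩
            a ∙ (b ∙ u ∙ v)       ≡⟨ trans (cong (a ∙_) (assoc _ _ _)) (sym (assoc _ _ _)) ⟩
            (a ∙ b) ∙ (u ∙ v)     ∎
            where open ≡-Reasoning

        Form-ε : Form ε
        Form-ε = 0 , 0 , 0 , sym (trans (identityˡ _) (identityˡ ε))

        Form-⊑ : ∀ {g h} → g ⊑ h → Form h → Form g
        Form-⊑ {h = h} (n , refl) F = go n
          where
          go : ∀ n → Form (h ↑ n)
          go zero = Form-ε
          go (suc n) = Form-∙ F (go n)

        Form-s : Form s
        Form-s = 1 , 0 , 0 , sym (trans (cong (s ↑ 1 ∙_) (identityˡ ε)) (trans (identityʳ _) (x↑1 s)))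

        Form-d : Form d
        Form-d = 0 , 1 , 0 , sym (trans (identityˡ _) (trans (identityʳ _) (x↑1 d)))

        Form-T₀ : Form (T 0F)
        Form-T₀ = 0 , 0 , 1 , sym (trans (identityˡ _) (trans (identityˡ _) (x↑1 (T 0F))))

        Form-T : ∀ i → Form (T i)
        Form-T Fin.zero = Form-T₀
        Form-T (Fin.suc Fin.zero) = subst Form (trans (sym (assoc _ _ _)) (trans (cong (_∙ T 1F) (invol (t-ord 0F))) (identityˡ _))) (Form-∙ Form-T₀ Form-d)
        Form-T (Fin.suc (Fin.suc Fin.zero)) = subst Form (trans (cong (d ∙_) (sym (invol-⁻¹ (t-ord 0F)))) e) (Form-∙ Form-d Form-T₀)

        Form-2 : ∀ {g} → ord g ≡ 2 → Form g
        Form-2 o = let i , f = t-all o in subst Form (sym f) (Form-T i)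

        -- The four subgroups of order 3 in ⟨d , s⟩ are all there are. By `only-s`, an element of
        -- order 6 is generated by an element of ⟨s⟩ times an involution.
        generate : ∀ g → Form g
        generate g = by (orders g)
          where
          open Plane prime[3] od os independent (commute-sym s-d)
          Form-f : ∀ i → Form (f i)
          Form-f Fin.zero = Form-d
          Form-f (Fin.suc i) = Form-∙ (Form-⊑ (⊑-↑ (toℕ i)) Form-d) Form-s
          by : ord g ∈ (1 ∷ 2 ∷ 3 ∷ 6 ∷ []) → Form g
          by (here o) = subst Form (sym (ord≡1⇒ε o)) Form-ε
          by (there (here o)) = Form-2 o
          by (there (there (here o))) = let i , (g⊑ , _) = κ-complete (ord≟ 3) (ord≟-inv 3) f (λ {i} {j} → f-inj {i} {j}) f-ord κ₃≤4 o in Form-⊑ g⊑ (Form-f i)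
          by (there (there (there (here o)))) = Form-⊑ (proj₂ (⊑∧ord≡⇒∼ (⊑-∙ v⊑ u⊑) (trans (ord-6 ov ou vu) (sym o)))) (Form-∙ (Form-⊑ (proj₁ (only-s ov ou vu)) Form-s) (Form-2 ou))
            where
            U = power-⊑ {2} {g} (subst (2 ∣_) (sym o) (divides 3 refl))
            V = power-⊑ {3} {g} (subst (3 ∣_) (sym o) (divides 2 refl))
            u⊑ = proj₁ (proj₂ U)
            ou = proj₂ (proj₂ U)
            v⊑ = proj₁ (proj₂ V)
            ov = proj₂ (proj₂ V)
            vu = commute-within v⊑ u⊑

        ℤ₃×S₃-data : ℤ₃×S₃ 𝔾
        ℤ₃×S₃-data = record { ord-s = os ; ord-d = od ; ord-t = t-ord 0F ; s-d = s-d ; s-t = s-T 0F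
                        ; inverted = inverted ; independent = independent ; generate = generate }

      ℤ₃×S₃-data : ℤ₃×S₃ 𝔾
      ℤ₃×S₃-data = case t-product {0F} {1F} {2F} (λ ()) others₀₁ of λ
        { (inj₁ (c , _)) → ⊥-elim (FourGroup.contradictory c)
        ; (inj₂ (e , d³)) → Symmetric.ℤ₃×S₃-data e d³ }

    direct-product : ℤ₃×S₃ 𝔾
    direct-product = let x , ox , x⋢s = another in WithX.ℤ₃×S₃-data ox x⋢s

-- Case distinction for groups that are not p-groups.

module NonPGroup (𝔾 : FinGroup) (H : HasExactlyCyclicSubgroups (FinGroup.group 𝔾) 11) where
  open Involutions 𝔾 H

  classify : ∀ {p q a b} → Prime p → Prime q → p < q → ord a ≡ p → ord b ≡ q → SplitMetacyclic 𝔾 ⊎ ℤ₃×S₃ 𝔾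
  classify {p} {q} {a} {b} pr qr p<q oa ob = stage₁ (Fin.any? λ z → prime? (ord z) ×-dec Uniq? z ×-dec ¬? (Fin.all? (commute? z)))
    where
    Uniq : G → Set
    Uniq z = ∀ x → ord x ≡ ord z → x ⊑ z
    Uniq? : ∀ z → Dec (Uniq z)
    Uniq? z = Fin.all? λ x → (ord x ≟ ord z) →-dec ⊑? x z
    stage₁ : Dec (∃ λ z → Prime (ord z) × Uniq z × ¬ (∀ x → Commute z x)) → SplitMetacyclic 𝔾 ⊎ ℤ₃×S₃ 𝔾
    stage₁ (yes (z , zp , uz , nc)) = via (Fin.¬∀⟶∃¬ _ _ (commute? z) nc)
      where
      via : (∃ λ g → ¬ Commute z g) → SplitMetacyclic 𝔾 ⊎ ℤ₃×S₃ 𝔾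
      via (g , n) = inj₁ (Noncentral.split-metacyclic 𝔾 H zp refl (λ {x} → uz x) n)
    stage₁ (no none₁) = stage₂ (Fin.any? λ z → prime? (ord z) ×-dec Uniq? z)
      where
      central : ∀ {z} → Prime (ord z) → Uniq z → ∀ x → Commute z x
      central {z} zp uz x = case commute? z x of λ { (yes c) → c ; (no n) → contradiction (z , zp , uz , λ h → n (h x)) none₁ }
      stage₂ : Dec (∃ λ z → Prime (ord z) × Uniq z) → SplitMetacyclic 𝔾 ⊎ ℤ₃×S₃ 𝔾
      -- Here ⟨z⟩ is central. Either some other prime order has several subgroups, or each has one
      -- central subgroup; both are impossible.
      stage₂ (yes (z , zp , uz)) = ⊥-elim (stage₃ (Fin.any? λ v → prime? (ord v) ×-dec ¬? (Uniq? v)))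
        where
        many : ∀ {v} → Prime (ord v) → ¬ Uniq v → suc (ord v) ≤ κ (ord≟ (ord v))
        many {v} vp n = via (Fin.¬∀⟶∃¬ _ _ (λ x → (ord x ≟ ord v) →-dec ⊑? x v) n)
          where
          via : (∃ λ x → ¬ (ord x ≡ ord v → x ⊑ v)) → suc (ord v) ≤ κ (ord≟ (ord v))
          via (x , m) = case ord x ≟ ord v of λ
            { (yes e) → nonunique vp refl e (λ f → m λ _ → f) ; (no ne) → contradiction (λ e → contradiction e ne) m }
        ≢⇒∤ : ∀ {r s} → Prime r → Prime s → s ≢ r → ¬ r ∣ s
        ≢⇒∤ rp sp n d = n (sym (prime∣prime rp sp d))
        stage₃ : Dec (∃ λ v → Prime (ord v) × ¬ Uniq v) → ⊥
        stage₃ (yes (v , vp , n)) = CentralCase.not-both 𝔾 H zp refl (λ {x} → uz x) (central zp uz) {b = v}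
            (≢⇒∤ zp vp ne) (ord-prime≢ε vp refl) vp ne (many vp n)
          where
          ne : ord v ≢ ord z
          ne e = n λ x ox → ⊑-trans (uz x (trans ox e)) (proj₂ (⊑∧ord≡⇒∼ (uz v e) e))
        -- `not-all-central` is applied to an odd prime: q if p = 2, and p otherwise.
        stage₃ (no none₃) = case p ≟ 2 of λ { (yes p≡2) → fin qr ob (≤-trans (s≤s (prime>1 pr)) p<q) oa (λ e → <⇒≢ p<q e) pr
                                            ; (no p≢2) → fin pr oa (≤∧≢⇒< (prime>1 pr) (p≢2 ∘ sym)) ob (λ e → <⇒≢ p<q (sym e)) qr }
          where
          all : ∀ {r v} → Prime r → ord v ≡ r → (∀ {x} → ord x ≡ r → x ⊑ v) × (∀ x → Commute v x)
          all {r} {v} rp ov = (λ {x} ox → uv x (trans ox (sym ov))) , central rp′ uv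
            where
            rp′ : Prime (ord v)
            rp′ = subst Prime (sym ov) rp
            uv : Uniq v
            uv = case Uniq? v of λ { (yes u) → u ; (no n) → contradiction (v , rp′ , n) none₃ }
          fin : ∀ {r w r′ w′} → Prime r → ord w ≡ r → 3 ≤ r → ord w′ ≡ r′ → r′ ≢ r → Prime r′ → ⊥
          fin {r} {w} {r′} {w′} rp ow r≥3 ow′ ne rp′ = CentralCase.not-all-central 𝔾 H rp ow (proj₁ (all rp ow)) (proj₂ (all rp ow))
            {b = w′} (λ d → ≢⇒∤ rp rp′ ne (subst (r ∣_) ow′ d)) (ord-prime≢ε rp′ ow′) r≥3 all
      stage₂ (no none₂) = inj₂ (stage₄ (Fin.any? λ s → Fin.any? λ t → ord≟ 3 s ×-dec ord≟ 2 t ×-dec commute? s t))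
        where
        many : ∀ {r v} → Prime r → ord v ≡ r → suc r ≤ κ (ord≟ r)
        many {r} {v} rp ov = case Uniq? v of λ
          { (yes u) → contradiction (v , subst Prime (sym ov) rp , u) none₂
          ; (no n) → via (Fin.¬∀⟶∃¬ _ _ (λ x → (ord x ≟ ord v) →-dec ⊑? x v) n) }
          where
          via : (∃ λ x → ¬ (ord x ≡ ord v → x ⊑ v)) → suc r ≤ κ (ord≟ r)
          via (x , m) = case ord x ≟ ord v of λ
            { (yes e) → nonunique rp ov (trans e ov) (λ f → m λ _ → f) ; (no ne) → contradiction (λ e → contradiction e ne) m }
        open ManySubgroups.Pair 𝔾 H many pr qr p<q oa ob
        stage₄ : Dec (∃₂ λ s t → ord s ≡ 3 × ord t ≡ 2 × Commute s t) → ℤ₃×S₃ 𝔾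
        stage₄ (yes (s , t , os , ot , c)) = DirectProduct.direct-product 𝔾 H many κ₂≤3 ot os c
        stage₄ (no none) = ⊥-elim (TwoThree.Frobenius.contradictory 𝔾 H many κ₂≤3 (trans oa p≡2) (trans ob q≡3)
          λ {x} {t} ox ot c → none (x , t , ox , ot , c))

-- Orbits and element counts in a p-group.

horner : ℕ → List ℕ → ℕ
horner p []       = 0
horner p (n ∷ ns) = n + p * horner p ns

module PGroup (𝔾 : FinGroup) {c} (H : HasExactlyCyclicSubgroups (FinGroup.group 𝔾) c)
              {p} (pr : Prime p) (pow : ∀ x → ∃ λ k → Powers.ord 𝔾 x ≡ p ^ k) where
  open Involutions 𝔾 H public

  private
    instance _ = prime⇒nonZero pr

  order : ∃ λ n → N ≡ p ^ n
  order = p-group-order pow pr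

  ^-∣ : ∀ {m n} → m ≤ n → p ^ m ∣ p ^ n
  ^-∣ {m} {n} le = subst (p ^ m ∣_) (trans (sym (^-distribˡ-+-* p m (n ∸ m))) (cong (p ^_) (m+[n∸m]≡n le))) (m∣m*n (p ^ (n ∸ m)))

  subgroup : ∀ {x k} j → ord x ≡ p ^ k → j ≤ k → ∃ λ y → y ⊑ x × ord y ≡ p ^ j
  subgroup j e le = power-⊑ (subst (p ^ j ∣_) (sym e) (^-∣ le))

  -- Orbit–stabiliser for the conjugation action on the cyclic subgroups.
  module _ {P : G → Set} (P? : Decidable P) (P-inv : Invariant P) (P-conj : ∀ g {x} → P x → P (conj g x)) where
    private
      act-∙ : ∀ g h i → act g (act h i) ≡ act (g ∙ h) i
      act-∙ g h i = trans (act-idx g (conj h (gen i))) (cong idx (conj-conj g h (gen i)))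

      act-ε : ∀ i → act ε i ≡ i
      act-ε i = trans (cong idx (conj-by-ε (gen i))) (idx-gen i)

      act-⁻¹ : ∀ g {i j} → act g i ≡ j → act (g ⁻¹) j ≡ i
      act-⁻¹ g {i} refl = trans (act-∙ (g ⁻¹) g i) (trans (cong (λ h → act h i) (inverseˡ g)) (act-ε i))

      R : Fin c → Fin c → Set
      R i j = ∃ λ g → act g i ≡ j

      R? : ∀ i j → Dec (R i j)
      R? i j = Fin.any? λ g → act g i Fin.≟ j

      Fixed : Fin c → Set
      Fixed i = ∀ g → act g i ≡ i

      Fixed? : Decidable Fixed
      Fixed? i = Fin.all? λ g → act g i Fin.≟ i

      xs = filter (P? ∘ gen) (allFin c)

      xs-act : ∀ g {i} → i ∈ xs → act g i ∈ xs
      xs-act g q = ∈-count⁺ (P? ∘ gen) (P-inv (∼-idx _) (P-conj g (∈-count⁻ (P? ∘ gen) q)))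

      module _ {i} (i∈ : i ∈ xs) where
        orbit = filter (R? i) xs
        Stab? = λ g → act g i Fin.≟ i
        stab = filter Stab? (allFin N)
        rep : Fin c → G
        rep j with R? i j
        ... | yes (g , _) = g
        ... | no _        = ε
        rep-ok : ∀ {j} → R i j → act (rep j) i ≡ j
        rep-ok {j} r with R? i j
        ... | yes (g , e) = e
        ... | no n        = contradiction r n
        f : Fin c × G → G
        f (j , s) = rep j ∙ s
        f-act : ∀ {j s} → (j , s) ∈ cartesianProduct orbit stab → act (f (j , s)) i ≡ j
        f-act {j} {s} q = let j∈ , s∈ = ∈-cartesianProduct⁻ orbit stab q in
          trans (sym (act-∙ (rep j) s i)) (trans (cong (act (rep j)) (∈-count⁻ Stab? s∈)) (rep-ok (proj₂ (∈-filter⁻ (R? i) {xs = xs} j∈))))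
        orbit-stabiliser : N ≡ length orbit * length stab
        orbit-stabiliser = trans (≤-antisym
          (subst₂ _≤_ (allFin-length N) (length-map f (cartesianProduct orbit stab)) (length-⊆ (Unique.allFin⁺ N) surj))
          (subst (length (cartesianProduct orbit stab) ≤_) (allFin-length N) (length-inj f
            (Unique.cartesianProduct⁺ (Unique.filter⁺ (R? i) (Unique-count (P? ∘ gen))) (Unique-count Stab?)) inj λ _ → ∈-allFin _)))
          (length-cartesianProduct orbit stab)
          where
          inj : ∀ {u v} → u ∈ cartesianProduct orbit stab → v ∈ cartesianProduct orbit stab → f u ≡ f v → u ≡ v
          inj {j , s} {k , t} q r e = cong₂ _,_ j≡k (∙-cancelˡ (rep j) s t (trans e (cong (λ l → rep l ∙ t) (sym j≡k))))
            where j≡k = trans (sym (f-act q)) (trans (cong (λ g → act g i) e) (f-act r))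
          surj : ∀ {g} → g ∈ allFin N → g ∈ map f (cartesianProduct orbit stab)
          surj {g} _ = subst (_∈ map f (cartesianProduct orbit stab)) (word (w0 :∙ (neg w0 :∙ w1)) w1 (rep j ∷ g ∷ g ∷ []) refl)
            (∈-map⁺ f (∈-cartesianProduct⁺ (∈-filter⁺ (R? i) (xs-act g i∈) (g , refl))
              (∈-count⁺ Stab? (trans (sym (act-∙ (rep j ⁻¹) g i)) (act-⁻¹ (rep j) (rep-ok (g , refl)))))))
            where j = act g i
        orbit-size : ¬ Fixed i → p ∣ length orbit
        orbit-size n = via (∣p^⇒ pr (proj₁ order) (subst (length orbit ∣_) (trans (sym orbit-stabiliser) (proj₂ order)) (m∣m*n (length stab))))
          where
          via : (∃ λ j → length orbit ≡ p ^ j) → p ∣ length orbit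
          via (suc j , e) = subst (p ∣_) (sym e) (m∣m*n (p ^ j))
          via (zero , e) = contradiction (λ g → single (∈-filter⁺ (R? i) (xs-act g i∈) (g , refl)) (∈-filter⁺ (R? i) i∈ (ε , act-ε i)) e) n
            where
            single : ∀ {ys : List (Fin c)} {u v} → u ∈ ys → v ∈ ys → length ys ≡ 1 → u ≡ v
            single {_ ∷ []} (here refl) (here refl) _ = refl

      fixed-count : ∃ λ k → length xs ≡ length (filter Fixed? xs) + k * p
      fixed-count = length-mod R? (λ i → ε , act-ε i) (λ { (g , e) → g ⁻¹ , act-⁻¹ g e })
        (λ { {i} (g , refl) (h , refl) → h ∙ g , sym (act-∙ h g i) }) Fixed? p xs (Unique-count (P? ∘ gen))
        (λ { _ fx _ (g , e) → trans (sym (fx g)) e })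
        (λ { {i} (g , refl) fx h → trans (act-∙ h g i) (trans (fx (h ∙ g)) (sym (fx g))) })
        orbit-size

    -- Orbit sizes divide the order of G and are powers of p, so every orbit but a fixed point has
    -- size divisible by p.
    normal-member : ¬ p ∣ κ P? → ∃ λ x → P x × (∀ g → conj g x ∼ x)
    normal-member n = via fixed-count
      where
      via : (∃ λ k → length xs ≡ length (filter Fixed? xs) + k * p) → ∃ λ x → P x × (∀ g → conj g x ∼ x)
      via (k , e) = pick (filter Fixed? xs) (λ q → ∈-filter⁻ Fixed? {xs = xs} q) e
        where
        pick : ∀ ys → (∀ {i} → i ∈ ys → i ∈ xs × Fixed i) → length xs ≡ length ys + k * p → ∃ λ x → P x × (∀ g → conj g x ∼ x)
        pick [] _ e = contradiction (divides k e) n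
        pick (i ∷ ys) h _ = let i∈ , fx = h (here refl) in gen i , ∈-count⁻ (P? ∘ gen) i∈ , λ g → idx-∼ (trans (fx g) (sym (idx-gen i)))

  -- A cyclic group of order p ^ (e + 1) has (p - 1) p ^ e generators x ^ k, k = (1 + u) + p v.
  module _ (e : ℕ) where
    private
      E? = λ g → ord≟ (p ^ suc e) g
      classes = filter (E? ∘ gen) (allFin c)
      exps = cartesianProduct (allFin (pred p)) (allFin (p ^ e))
      expo : Fin (pred p) × Fin (p ^ e) → ℕ
      expo (u , v) = suc (toℕ u) + toℕ v * p
      f : Fin c × (Fin (pred p) × Fin (p ^ e)) → G
      f (i , uv) = gen i ↑ expo uv
      expo-% : ∀ uv → expo uv % p ≡ suc (toℕ (proj₁ uv))
      expo-% (u , v) = trans ([m+kn]%n≡m%n (suc (toℕ u)) (toℕ v) p) (m<n⇒m%n≡m (subst (suc (toℕ u) <_) (suc-pred p) (s≤s (Fin.toℕ<n u))))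
      expo< : ∀ uv → expo uv < p ^ suc e
      expo< (u , v) = ≤-trans (+-monoˡ-< (toℕ v * p) (subst (suc (toℕ u) <_) (suc-pred p) (s≤s (Fin.toℕ<n u))))
        (≤-trans (*-monoˡ-≤ p (Fin.toℕ<n v)) (≤-reflexive (*-comm (p ^ e) p)))
      p∤expo : ∀ uv → ¬ p ∣ expo uv
      p∤expo uv d = contradiction (trans (sym (expo-% uv)) (n∣m⇒m%n≡0 _ p d)) λ ()
      expo-inj : ∀ {uv wx} → expo uv ≡ expo wx → uv ≡ wx
      expo-inj {u , v} {w , x} eq = cong₂ _,_ (Fin.toℕ-injective (suc-injective uw))
        (Fin.toℕ-injective (*-cancelʳ-≡ (toℕ v) (toℕ x) p (+-cancelˡ-≡ (suc (toℕ u)) _ _ (trans eq (cong (_+ toℕ x * p) (sym uw))))))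
        where uw = trans (sym (expo-% (u , v))) (trans (cong (_% p) eq) (expo-% (w , x)))
      pairs = cartesianProduct classes exps
      gen-ord : ∀ {i uv} → (i , uv) ∈ pairs → ord (gen i) ≡ p ^ suc e
      gen-ord q = ∈-count⁻ (E? ∘ gen) (proj₁ (∈-cartesianProduct⁻ classes exps q))
      f∼ : ∀ {i uv} → ord (gen i) ≡ p ^ suc e → f (i , uv) ∼ gen i
      f∼ {i} {uv} o = ⊑-↑ (expo uv) , ⊑-coprime (Cop.sym (subst (λ m → Coprime m (expo uv)) (sym o) (coprime-^ pr (suc e) (p∤expo uv)))) (↑-ord (gen i))
      inj : ∀ {a b} → a ∈ pairs → b ∈ pairs → f a ≡ f b → a ≡ b
      inj {i , uv} {j , wx} q r eq = same (gen-injective (∼-trans (∼-sym (f∼ {i} {uv} (gen-ord q))) (subst (_∼ gen j) (sym eq) (f∼ {j} {wx} (gen-ord r)))))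
        where
        same : i ≡ j → (i , uv) ≡ (j , wx)
        same refl = cong (i ,_) (expo-inj (↑-injective {gen i} (subst (expo uv <_) (sym (gen-ord q)) (expo< uv)) (subst (expo wx <_) (sym (gen-ord r)) (expo< wx)) eq))
      surj : ∀ {g} → g ∈ filter E? (allFin N) → g ∈ map f pairs
      surj {g} q = via (proj₁ (∼-idx g))
        where
        og : ord g ≡ p ^ suc e
        og = ∈-count⁻ E? q
        i = idx g
        oi : ord (gen i) ≡ p ^ suc e
        oi = trans (sym (∼-ord (∼-idx g))) og
        via : g ⊑ gen i → g ∈ map f pairs
        via (k₀ , ek) = subst (_∈ map f pairs) fk (∈-map⁺ f (∈-cartesianProduct⁺ (∈-count⁺ (E? ∘ gen) oi) (∈-cartesianProduct⁺ (∈-allFin u) (∈-allFin v))))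
          where
          k = k₀ % ord (gen i)
          gk : gen i ↑ k ≡ g
          gk = trans (sym (↑-% (gen i) k₀)) ek
          k< : k < p ^ suc e
          k< = subst (k <_) oi (m%n<n k₀ (ord (gen i)))
          p∤k : ¬ p ∣ k
          p∤k (divides m eq) = contradiction (∣⇒≤ {{p^≢0 pr e}} (subst (_∣ p ^ e) og (ord-∣ {g} (begin
            g ↑ (p ^ e)                     ≡⟨ cong (_↑ (p ^ e)) (sym gk) ⟩
            (gen i ↑ k) ↑ (p ^ e)           ≡⟨ cong (λ n → (gen i ↑ n) ↑ (p ^ e)) eq ⟩
            (gen i ↑ (m * p)) ↑ (p ^ e)     ≡⟨ ↑-*′ (gen i) (m * p) (p ^ e) ⟨
            gen i ↑ (m * p * p ^ e)         ≡⟨ ∣⇒↑≡ε (subst₂ _∣_ (sym oi) (sym (*-assoc m p (p ^ e))) (n∣m*n m)) ⟩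
            ε                               ∎)))) (<⇒≱ (^-monoʳ-< p (prime>1 pr) (n<1+n e)))
            where open ≡-Reasoning
          r≢0 : k % p ≢ 0
          r≢0 z = p∤k (m%n≡0⇒n∣m k p z)
          r>0 = n≢0⇒n>0 r≢0
          r< : pred (k % p) < pred p
          r< = s<s⁻¹ (subst₂ _<_ (sym (suc-pred (k % p) {{>-nonZero r>0}})) (sym (suc-pred p)) (m%n<n k p))
          d< : k / p < p ^ e
          d< = m<n*o⇒m/o<n (subst (k <_) (*-comm p (p ^ e)) k<)
          u = fromℕ< r<
          v = fromℕ< d<
          fk : gen i ↑ expo (u , v) ≡ g
          fk = trans (cong (gen i ↑_) (trans (cong₂ (λ a b → suc a + b * p) (Fin.toℕ-fromℕ< r<) (Fin.toℕ-fromℕ< d<))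
            (trans (cong (_+ k / p * p) (suc-pred (k % p) {{>-nonZero r>0}})) (sym (m≡m%n+[m/n]*n k p))))) gk

    count-ord : count (ord≟ (p ^ suc e)) ≡ κ (ord≟ (p ^ suc e)) * (pred p * p ^ e)
    count-ord = trans (≤-antisym
        (subst (count E? ≤_) (length-map f pairs) (length-⊆ (Unique-count E?) surj))
        (length-inj f (Unique.cartesianProduct⁺ (Unique-count (E? ∘ gen)) (Unique.cartesianProduct⁺ (Unique.allFin⁺ (pred p)) (Unique.allFin⁺ (p ^ e)))) inj
          λ { {i , uv} q → ∈-count⁺ E? (trans (∼-ord (f∼ {i} {uv} (gen-ord q))) (gen-ord q)) }))
      (trans (length-cartesianProduct classes exps) (cong (length classes *_) (trans (length-cartesianProduct (allFin (pred p)) (allFin (p ^ e)))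
        (cong₂ _*_ (allFin-length (pred p)) (allFin-length (p ^ e))))))

  -- κ (ord≟ (p ^ e)), …, κ (ord≟ (p ^ (e + k - 1)))
  profile : ℕ → ℕ → List ℕ
  profile e zero    = []
  profile e (suc k) = κ (ord≟ (p ^ e)) ∷ profile (suc e) k

  ∣-next : ∀ {e} g → p ^ e ∣ ord g → ord g ≢ p ^ e → p ^ suc e ∣ ord g
  ∣-next {e} g d n = up (pow g)
    where
    up : (∃ λ k → ord g ≡ p ^ k) → p ^ suc e ∣ ord g
    up (k , o) = subst (p ^ suc e ∣_) (sym o) (^-∣ {suc e} {k} (≰⇒> λ k≤e → n (trans o (cong (p ^_) (≤-antisym k≤e
        (≮⇒≥ λ k<e → contradiction (∣⇒≤ {{p^≢0 pr k}} (subst (p ^ e ∣_) o d)) (<⇒≱ (^-monoʳ-< p (prime>1 pr) k<e))))))))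

  ∤-next : ∀ {e g} → p ^ suc e ∣ ord g → ord g ≢ p ^ e
  ∤-next {e} {g} d o = contradiction (∣⇒≤ {{p^≢0 pr e}} (subst (p ^ suc e ∣_) o d)) (<⇒≱ (^-monoʳ-< p (prime>1 pr) (n<1+n e)))

  private
    above : ∀ e → ℕ
    above e = count (λ g → p ^ e ∣? ord g)

    above-split : ∀ e → above e ≡ count (ord≟ (p ^ e)) + above (suc e)
    above-split e = trans (count-split (λ g → p ^ e ∣? ord g) (ord≟ (p ^ e)))
      (cong₂ _+_ (count-ext (λ g → (p ^ e ∣? ord g) ×-dec ord≟ (p ^ e) g) (ord≟ (p ^ e)) proj₂ λ o → ∣-reflexive (sym o) , o)
        (count-ext (λ g → (p ^ e ∣? ord g) ×-dec ¬? (ord≟ (p ^ e) g)) (λ g → p ^ suc e ∣? ord g)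
          (λ {g} (d , n) → ∣-next {e} g d n)
          λ {g} d → ∣-trans (^-∣ (n≤1+n e)) d , ∤-next {e} {g} d))

    above-horner : ∀ k e → above (suc e + k) ≡ 0 → above (suc e) ≡ pred p * p ^ e * horner p (profile (suc e) k)
    above-horner zero e z = trans (subst (λ m → above (suc m) ≡ 0) (+-identityʳ e) z) (sym (*-zeroʳ (pred p * p ^ e)))
    above-horner (suc k) e z = begin
      above (suc e)                                                       ≡⟨ above-split (suc e) ⟩
      count (ord≟ (p ^ suc e)) + above (suc (suc e))                      ≡⟨ cong₂ _+_ (count-ord e) (above-horner k (suc e) (subst (λ m → above (suc m) ≡ 0) (+-suc e k) z)) ⟩
      n * (pred p * p ^ e) + pred p * (p * p ^ e) * h                     ≡⟨ solve 5 (λ n q r p h → n :* (q :* r) :+ q :* (p :* r) :* h := q :* r :* (n :+ p :* h)) refl n (pred p) (p ^ e) p h ⟩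
      pred p * p ^ e * (n + p * h)                                        ∎
      where
      open ≡-Reasoning
      open +-*-Solver
      n = κ (ord≟ (p ^ suc e))
      h = horner p (profile (suc (suc e)) k)

  -- ⟨x⟩ contains k + 1 subgroups, one for each order p ^ i with i ≤ k.
  exponent<c : ∀ {x k} → ord x ≡ p ^ k → k < c
  exponent<c {x} {k} o = Fin.injective⇒≤ {f = λ i → idx (y i)} λ {i} {j} e → Fin.toℕ-injective (^-injective pr
      (trans (sym (y-ord i)) (trans (∼-ord (idx-∼ e)) (y-ord j))))
    where
    sub : (i : Fin (suc k)) → ∃ λ y → y ⊑ x × ord y ≡ p ^ toℕ i
    sub i = subgroup (toℕ i) o (s≤s⁻¹ (Fin.toℕ<n i))
    y : Fin (suc k) → G
    y i = proj₁ (sub i)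
    y-ord : ∀ i → ord (y i) ≡ p ^ toℕ i
    y-ord i = proj₂ (proj₂ (sub i))

  -- No exponent exceeds k by `exponent<c`, so a profile of length k accounts for all elements but
  -- ε.
  N-horner : ∀ k → c ≡ suc k → N ≡ 1 + pred p * horner p (profile 1 k)
  N-horner k ec = begin
    N                                               ≡⟨ allFin-length N ⟨
    length (allFin N)                               ≡⟨ cong length (sym (List.filter-all (λ g → 1 ∣? ord g) {xs = allFin N} (All.tabulate λ {x} _ → 1∣ ord x))) ⟩
    above 0                                         ≡⟨ above-split 0 ⟩
    count (ord≟ 1) + above 1                        ≡⟨ cong₂ _+_ single (above-horner k 0 none) ⟩
    1 + pred p * 1 * horner p (profile 1 k)         ≡⟨ cong (λ q → 1 + q * horner p (profile 1 k)) (*-identityʳ (pred p)) ⟩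
    1 + pred p * horner p (profile 1 k)             ∎
    where
    open ≡-Reasoning
    single : count (ord≟ 1) ≡ 1
    single = ≤-antisym (count-≤ (ord≟ 1) {ys = ε ∷ []} λ i o → here (ord≡1⇒ε o)) (count≢0 (ord≟ 1) ε ord-ε)
    none : above (suc k) ≡ 0
    none = count≡0 (λ g → p ^ suc k ∣? ord g) λ g d → absurd g (pow g) d
      where
      absurd : ∀ g → (∃ λ j → ord g ≡ p ^ j) → p ^ suc k ∣ ord g → ⊥
      absurd g (j , o) d = contradiction (∣⇒≤ {{p^≢0 pr j}} (subst (p ^ suc k ∣_) o d))
        (<⇒≱ (^-monoʳ-< p (prime>1 pr) (subst (j <_) ec (exponent<c o))))

-- n (n - 1) / 2, the exponent of the commutator when the n-th power of a product is collected in
-- class two.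
triangle : ℕ → ℕ
triangle zero    = 0
triangle (suc n) = n + triangle n

2*triangle : ∀ n → 2 * triangle n + n ≡ n * n
2*triangle zero = refl
2*triangle (suc n) = begin
  2 * (n + triangle n) + suc n            ≡⟨ solve 2 (λ n t → con 2 :* (n :+ t) :+ (con 1 :+ n) := (con 2 :* t :+ n) :+ (con 1 :+ con 2 :* n)) refl n (triangle n) ⟩
  (2 * triangle n + n) + (1 + 2 * n)      ≡⟨ cong (_+ (1 + 2 * n)) (2*triangle n) ⟩
  n * n + (1 + 2 * n)                     ≡⟨ solve 1 (λ n → n :* n :+ (con 1 :+ con 2 :* n) := (con 1 :+ n) :* (con 1 :+ n)) refl n ⟩
  suc n * suc n                           ∎
  where
  open ≡-Reasoning
  open +-*-Solver

-- Climbing from small orders to a cyclic p-group.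

module CyclicPGroup (𝔾 : FinGroup) (H : HasExactlyCyclicSubgroups (FinGroup.group 𝔾) 11)
                    {p} (pr : Prime p) (pow : ∀ x → ∃ λ k → Powers.ord 𝔾 x ≡ p ^ k) where
  open PGroup 𝔾 H pr pow public

  private
    instance _ = prime⇒nonZero pr
    q = pred p
    p≡ : suc q ≡ p
    p≡ = suc-pred p

  -- The left side is p (1 + q h) + q n, and p divides the right side but not q = p - 1. So the
  -- leading entry of a profile is 1 modulo p.
  p∣suc : ∀ {n h m} → 1 + q * (suc n + p * h) ≡ p ^ m → p ∣ n
  p∣suc {n} {h} {m} e = by (euclidsLemma q n pr (∣m+n∣m⇒∣n {m = p * (1 + q * h)} (subst (p ∣_) (trans (sym e) eq) (p∣p^ m (e))) (m∣m*n (1 + q * h))))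
    where
    open +-*-Solver
    eq : 1 + q * (suc n + p * h) ≡ p * (1 + q * h) + q * n
    eq = trans (solve 4 (λ q n p h → con 1 :+ q :* (con 1 :+ n :+ p :* h) := (con 1 :+ q) :+ p :* (q :* h) :+ q :* n) refl q n p h)
      (trans (cong (λ v → v + p * (q * h) + q * n) p≡) (solve 4 (λ q n p h → p :+ p :* (q :* h) :+ q :* n := p :* (con 1 :+ q :* h) :+ q :* n) refl q n p h))
    p∣p^ : ∀ m → 1 + q * (suc n + p * h) ≡ p ^ m → p ∣ p ^ m
    p∣p^ (suc m) _ = m∣m*n (p ^ m)
    p∣p^ zero e = contradiction (suc-injective e) (≢-nonZero⁻¹ _ {{m*n≢0 q (suc n + p * h) {{>-nonZero (s<s⁻¹ (subst (1 <_) (sym p≡) (prime>1 pr)))}}}})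
    by : p ∣ q ⊎ p ∣ n → p ∣ n
    by (inj₂ d) = d
    by (inj₁ d) = contradiction (∣⇒≤ {{>-nonZero (s<s⁻¹ (subst (1 <_) (sym p≡) (prime>1 pr)))}} d) (<⇒≱ (subst (q <_) p≡ (n<1+n q)))

  -- With leading entry 1 the left side is p (1 + q h): a factor p cancels, and the same form
  -- remains for the rest of the profile.
  cancel-p : ∀ {h m} → 1 + q * (1 + p * h) ≡ p ^ m → ∃ λ m′ → 1 + q * h ≡ p ^ m′
  cancel-p {h} {zero} e = contradiction (suc-injective e) (≢-nonZero⁻¹ _ {{m*n≢0 q (1 + p * h) {{>-nonZero (s<s⁻¹ (subst (1 <_) (sym p≡) (prime>1 pr)))}}}})
  cancel-p {h} {suc m} e = m , *-cancelˡ-≡ _ _ p (trans (trans (solve 3 (λ q p h → p :* (con 1 :+ q :* h) := p :+ p :* (q :* h)) refl q p h)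
    (trans (cong (_+ p * (q * h)) (sym p≡)) (solve 3 (λ q p h → con 1 :+ q :+ p :* (q :* h) := con 1 :+ q :* (con 1 :+ p :* h)) refl q p h))) e)
    where open +-*-Solver

  -- State after k steps: ⟨a⟩ contains every element of order dividing p ^ k. `size` is the order
  -- formula after the k leading ones of the profile have been cancelled.
  record Stage (k j : ℕ) : Set where
    field
      {a}   : G
      ord-a : ord a ≡ p ^ k
      all   : ∀ {g} → ord g ∣ p ^ k → g ⊑ a
      {m}   : ℕ
      size  : 1 + q * horner p (profile (suc k) j) ≡ p ^ m

  stage₀ : Stage 0 10
  stage₀ = record { m = proj₁ order ; ord-a = ord-ε ; all = λ d → subst (_⊑ ε) (sym (ord≡1⇒ε (∣1⇒≡1 d))) ε⊑
                  ; size = trans (sym (N-horner 10 refl)) (proj₂ order) }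

  module _ {k j} (S : Stage k (suc j)) where
    open Stage S

    contains : ∀ {g i} → ord g ≡ p ^ i → k ≤ i → a ⊑ g
    contains o le = let y , y⊑g , oy = subgroup k o le in
      ⊑-trans (proj₂ (⊑∧ord≡⇒∼ (all (∣-reflexive oy)) (trans oy (sym ord-a)))) y⊑g

    extend : κ (ord≟ (p ^ suc k)) ≡ 1 → Stage (suc k) j
    extend κ≡1′ = record { m = proj₁ smaller ; ord-a = oa′ ; all = λ {g} d → inside g (∣p^⇒ pr (suc k) d) d
                         ; size = proj₂ smaller }
      where
      smaller = cancel-p {m = m} (subst (λ n → 1 + q * (n + p * horner p (profile (suc (suc k)) j)) ≡ p ^ m) κ≡1′ size)
      E? = ord≟ (p ^ suc k)
      E-inv = ord≟-inv (p ^ suc k)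
      top = κ-pos E? E-inv (≤-reflexive (sym κ≡1′))
      a′ = proj₁ top
      oa′ : ord a′ ≡ p ^ suc k
      oa′ = proj₂ top
      inside : ∀ g → (∃ λ i → ord g ≡ p ^ i) → ord g ∣ p ^ suc k → g ⊑ a′
      inside g (i , o) d = case i ≤? k of λ
        { (yes le) → ⊑-trans (all (subst (_∣ p ^ k) (sym o) (^-∣ le))) (contains oa′ (n≤1+n k))
        ; (no gt) → proj₁ (κ≡1 E? E-inv κ≡1′ (trans o (cong (p ^_) (≤-antisym (≮⇒≥ λ k<i →
              contradiction (∣⇒≤ {{p^≢0 pr (suc k)}} (subst (_∣ p ^ suc k) o d)) (<⇒≱ (^-monoʳ-< p (prime>1 pr) k<i))) (≰⇒> gt)))) oa′) }

    exhausted : κ (ord≟ (p ^ suc k)) ≡ 0 → ∀ g → g ⊑ a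
    exhausted z g = via (pow g)
      where
      via : (∃ λ i → ord g ≡ p ^ i) → g ⊑ a
      via (i , o) = case i ≤? k of λ
        { (yes le) → all (subst (_∣ p ^ k) (sym o) (^-∣ le))
        ; (no gt) → let y , _ , oy = subgroup (suc k) o (≰⇒> gt) in contradiction oy (κ≡0 (ord≟ (p ^ suc k)) (ord≟-inv (p ^ suc k)) z) }

    -- Every g either lies in ⟨a⟩ or has a among its powers.
    a-central : ∀ g → Commute a g
    a-central g = via (pow g)
      where
      via : (∃ λ i → ord g ≡ p ^ i) → Commute a g
      via (i , o) = case i ≤? k of λ
        { (yes le) → commute-within ⊑-refl (all (subst (_∣ p ^ k) (sym o) (^-∣ le)))
        ; (no gt) → commute-within (contains o (≰⇒≥ gt)) ⊑-refl }

    -- Two subgroups of order p ^ (k + 1), one of them normal, would contain elements x, y with x ^ p = y ^ p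
    -- and central commutator u of order p, so that x⁻¹ y would have order p (or 4) and lie in ⟨a⟩.
    module _ (big : 2 ≤ k ⊎ (1 ≤ k × p ≢ 2)) {x y} (ox : ord x ≡ p ^ suc k) (oy : ord y ≡ p ^ suc k)
             (x-normal : ∀ g → conj g x ∼ x) where
      private
        k≥1 : 1 ≤ k
        k≥1 = [ (λ h → ≤-trans (s≤s z≤n) h) , proj₁ ]′ big
        ^p⊑a : ∀ {w} → ord w ≡ p ^ suc k → w ↑ p ∼ a
        ^p⊑a ow = let o = ord-↑ p (p ^ k) ow in ⊑∧ord≡⇒∼ (all (∣-reflexive o)) (trans o (sym ord-a))
        -- Both p-th powers generate ⟨a⟩, so some power x′ of x has the same p-th power as y.
        root : y ↑ p ⊑ x ↑ p
        root = ⊑-trans (proj₁ (^p⊑a oy)) (proj₂ (^p⊑a ox))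
        x′ = x ↑ proj₁ root
        x′p : x′ ↑ p ≡ y ↑ p
        x′p = trans (↑-↑ x (proj₁ root) p) (proj₂ root)
        x′⊑x : x′ ⊑ x
        x′⊑x = ⊑-↑ (proj₁ root)
        conj⊑x : conj y x′ ⊑ x
        conj⊑x = ⊑-trans (⊑-conj y x′⊑x) (proj₁ (x-normal y))
        u = conj y x′ ∙ x′ ⁻¹
        u⊑x : u ⊑ x
        u⊑x = ⊑-∙ conj⊑x (⊑-⁻¹ x′⊑x)
        ux′ : conj y x′ ≡ u ∙ x′
        ux′ = word w0 (w0 :∙ neg w1 :∙ w1) (conj y x′ ∷ x′ ∷ x ∷ []) refl
        up : u ↑ p ≡ ε
        up = ∙-cancelʳ (x′ ↑ p) _ _ (begin
          u ↑ p ∙ x′ ↑ p      ≡⟨ ∙-↑ p (commute-within u⊑x x′⊑x) ⟨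
          (u ∙ x′) ↑ p        ≡⟨ cong (_↑ p) ux′ ⟨
          conj y x′ ↑ p       ≡⟨ conj-↑ y x′ p ⟨
          conj y (x′ ↑ p)     ≡⟨ cong (conj y) x′p ⟩
          conj y (y ↑ p)      ≡⟨ conj-commute (commute-↑ p refl) ⟩
          y ↑ p               ≡⟨ x′p ⟨
          x′ ↑ p              ≡⟨ identityˡ _ ⟨
          ε ∙ x′ ↑ p          ∎)
          where open ≡-Reasoning
        p∣p^k : p ∣ p ^ k
        p∣p^k = subst (_∣ p ^ k) (*-identityʳ p) (^-∣ {1} {k} k≥1)
        c = u ⁻¹
        c-central : ∀ g → Commute g c
        c-central g = commute-⁻¹ (commute-⊑ (commute-sym (a-central g)) (all (∣-trans (ord-∣ up) p∣p^k)))
        cp : c ↑ p ≡ ε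
        cp = ∙-cancelʳ (u ↑ p) _ _ (trans (sym (∙-↑ p (commute-sym (commute-⁻¹ refl)))) (trans (trans (cong (_↑ p) (inverseˡ u)) (ε↑ p)) (trans (sym up) (sym (identityˡ _)))))
        w = x′ ⁻¹
        yw : y ∙ w ≡ c ∙ (w ∙ y)
        yw = begin
          y ∙ w                        ≡⟨ word (w0 :∙ neg w1) (neg (w0 :∙ w1 :∙ neg w0) :∙ w0) (y ∷ x′ ∷ x ∷ []) refl ⟩
          conj y x′ ⁻¹ ∙ y             ≡⟨ cong (λ v → v ⁻¹ ∙ y) ux′ ⟩
          (u ∙ x′) ⁻¹ ∙ y              ≡⟨ cong (_∙ y) (⁻¹-anti-homo-∙ u x′) ⟩
          w ∙ c ∙ y                    ≡⟨ cong (_∙ y) (c-central w) ⟩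
          c ∙ w ∙ y                    ≡⟨ assoc _ _ _ ⟩
          c ∙ (w ∙ y)                  ∎
          where open ≡-Reasoning
        slide : ∀ {a b} → Commute a b → ∀ d → a ∙ (b ∙ d) ≡ b ∙ (a ∙ d)
        slide {a} {b} e d = trans (sym (assoc a b d)) (trans (cong (_∙ d) e) (assoc b a d))
        ywⁿ : ∀ n → y ∙ w ↑ n ≡ c ↑ n ∙ (w ↑ n ∙ y)
        ywⁿ zero = trans (identityʳ y) (sym (trans (identityˡ _) (identityˡ y)))
        ywⁿ (suc n) = begin
          y ∙ (w ∙ w ↑ n)                       ≡⟨ assoc _ _ _ ⟨
          y ∙ w ∙ w ↑ n                         ≡⟨ cong (_∙ w ↑ n) yw ⟩
          c ∙ (w ∙ y) ∙ w ↑ n                   ≡⟨ trans (assoc _ _ _) (cong (c ∙_) (assoc _ _ _)) ⟩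
          c ∙ (w ∙ (y ∙ w ↑ n))                 ≡⟨ cong (λ v → c ∙ (w ∙ v)) (ywⁿ n) ⟩
          c ∙ (w ∙ (c ↑ n ∙ (w ↑ n ∙ y)))       ≡⟨ cong (c ∙_) (slide (commute-↑ n (c-central w)) _) ⟩
          c ∙ (c ↑ n ∙ (w ∙ (w ↑ n ∙ y)))       ≡⟨ trans (sym (assoc _ _ _)) (cong (c ∙ c ↑ n ∙_) (sym (assoc _ _ _))) ⟩
          c ∙ c ↑ n ∙ (w ∙ w ↑ n ∙ y)           ∎
          where open ≡-Reasoning
        -- Moving one y past one w costs a central factor c, which adds up to n (n - 1) / 2 factors.
        power : ∀ n → (w ∙ y) ↑ n ≡ c ↑ triangle n ∙ (w ↑ n ∙ y ↑ n)
        power zero = sym (trans (identityˡ _) (identityˡ ε))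
        power (suc n) = begin
          w ∙ y ∙ (w ∙ y) ↑ n                                   ≡⟨ cong (w ∙ y ∙_) (power n) ⟩
          w ∙ y ∙ (c ↑ t ∙ (w ↑ n ∙ y ↑ n))                     ≡⟨ slide (commute-↑ t (c-central (w ∙ y))) _ ⟩
          c ↑ t ∙ (w ∙ y ∙ (w ↑ n ∙ y ↑ n))                     ≡⟨ cong (c ↑ t ∙_) (trans (assoc _ _ _) (cong (w ∙_) (sym (assoc _ _ _)))) ⟩
          c ↑ t ∙ (w ∙ (y ∙ w ↑ n ∙ y ↑ n))                     ≡⟨ cong (λ v → c ↑ t ∙ (w ∙ (v ∙ y ↑ n))) (ywⁿ n) ⟩
          c ↑ t ∙ (w ∙ (c ↑ n ∙ (w ↑ n ∙ y) ∙ y ↑ n))           ≡⟨ cong (λ v → c ↑ t ∙ (w ∙ v)) (trans (assoc _ _ _) (cong (c ↑ n ∙_) (assoc _ _ _))) ⟩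
          c ↑ t ∙ (w ∙ (c ↑ n ∙ (w ↑ n ∙ (y ∙ y ↑ n))))         ≡⟨ cong (c ↑ t ∙_) (slide (commute-↑ n (c-central w)) _) ⟩
          c ↑ t ∙ (c ↑ n ∙ (w ∙ (w ↑ n ∙ (y ∙ y ↑ n))))         ≡⟨ trans (sym (assoc _ _ _)) (cong (c ↑ t ∙ c ↑ n ∙_) (sym (assoc _ _ _))) ⟩
          c ↑ t ∙ c ↑ n ∙ (w ∙ w ↑ n ∙ (y ∙ y ↑ n))             ≡⟨ cong (_∙ (w ∙ w ↑ n ∙ (y ∙ y ↑ n))) (trans (sym (↑-+ c t n)) (cong (c ↑_) (+-comm t n))) ⟩
          c ↑ (n + t) ∙ (w ∙ w ↑ n ∙ (y ∙ y ↑ n))               ∎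
          where
          open ≡-Reasoning
          t = triangle n
        v = w ∙ y
        vp : v ↑ p ≡ c ↑ triangle p
        vp = trans (power p) (trans (cong (c ↑ triangle p ∙_) (trans (cong (w ↑ p ∙_) (sym x′p))
          (trans (sym (∙-↑ p (commute-sym (commute-⁻¹ refl)))) (trans (cong (_↑ p) (inverseˡ x′)) (ε↑ p))))) (identityʳ _))
        c^-ε : ∀ {n} → p ∣ n → c ↑ n ≡ ε
        c^-ε d = ∣⇒↑≡ε (∣-trans (ord-∣ cp) d)
        -- v ↑ p is a power of c, and c ↑ p = ε. So v has order dividing p², which is enough for k ≥
        -- 2; for odd p the exponent p (p - 1) / 2 is a multiple of p, and v has order dividing p.
        v⊑a : v ⊑ a
        v⊑a = [ (λ 2≤k → all (∣-trans (ord-∣ {v} {p * p} (trans (↑-*′ v p p) (trans (cong (_↑ p) vp) (trans (↑-↑ c (triangle p) p) (trans (cong (_↑ triangle p) cp) (ε↑ (triangle p)))))))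
                   (subst (_∣ p ^ k) (cong (p *_) (*-identityʳ p)) (^-∣ {2} {k} 2≤k))))
              , (λ (_ , p≢2) → all (∣-trans (ord-∣ {v} {p} (trans vp (c^-ε (odd p≢2)))) p∣p^k)) ]′ big
          where
          odd : p ≢ 2 → p ∣ triangle p
          odd p≢2 = [ (λ d → contradiction (prime∣prime pr prime[2] d) p≢2) , id ]′
            (euclidsLemma 2 (triangle p) pr (∣m+n∣m⇒∣n {m = p} (subst (p ∣_) (trans (sym (2*triangle p)) (+-comm (2 * triangle p) p)) (m∣m*n p)) ∣-refl))

      same : y ⊑ x
      same = subst (_⊑ x) (word (w0 :∙ (neg w0 :∙ w1)) w1 (x′ ∷ y ∷ y ∷ []) refl)
        (⊑-∙ x′⊑x (⊑-trans v⊑a (contains ox (n≤1+n k))))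

    -- The number is 1 modulo p by `p∣suc`, so one of these subgroups is normal, and by `same` it
    -- contains all the others.
    unique-above : 2 ≤ k ⊎ (1 ≤ k × p ≢ 2) → κ (ord≟ (p ^ suc k)) ≢ 0 → κ (ord≟ (p ^ suc k)) ≡ 1
    unique-above big ne = go (κ E?) refl
      where
      E? = ord≟ (p ^ suc k)
      E-inv = ord≟-inv (p ^ suc k)
      go : ∀ n → κ E? ≡ n → κ E? ≡ 1
      go zero e = contradiction e ne
      go (suc n) e = ≤-antisym (via (normal-member E? E-inv (λ g {x} o → trans (ord-conj g x) o) λ d →
          contradiction (subst Prime (∣1⇒≡1 (∣m+n∣m⇒∣n {m = n} (subst (p ∣_) (trans e (+-comm 1 n)) d) p∣n)) pr) ¬prime[1])) (n≢0⇒n>0 ne)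
        where
        p∣n : p ∣ n
        p∣n = p∣suc {m = m} (subst (λ v → 1 + q * (v + p * horner p (profile (suc (suc k)) j)) ≡ p ^ m) e size)
        via : (∃ λ x → ord x ≡ p ^ suc k × (∀ g → conj g x ∼ x)) → κ E? ≤ 1
        via (x , ox , normal) = κ-≤ E? E-inv (x ∷ []) λ y oy → x , here refl , ⊑∧ord≡⇒∼ (same big ox oy normal) (trans oy (sym ox))

  record Cyclic : Set where
    field
      {k}      : ℕ
      {a}      : G
      ord-a    : ord a ≡ p ^ k
      generate : ∀ g → g ⊑ a

  climb : ∀ j {k} → k + j ≡ 10 → 2 ≤ k ⊎ (1 ≤ k × p ≢ 2) → Stage k j → Cyclic
  climb zero {k} e big S = record { k = k ; ord-a = ord-a ; generate = λ g → via g (pow g) }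
    where
    open Stage S
    via : ∀ g → (∃ λ i → ord g ≡ p ^ i) → g ⊑ a
    via g (i , o) = all (subst (_∣ p ^ k) (sym o) (^-∣ (subst (i ≤_) (trans (sym e) (+-identityʳ k)) (s≤s⁻¹ (exponent<c o)))))
  climb (suc j) {k} e big S = case κ (ord≟ (p ^ suc k)) ≟ 0 of λ
    { (yes z) → record { k = k ; ord-a = Stage.ord-a S ; generate = exhausted S z }
    ; (no nz) → climb j (trans (sym (+-suc k j)) e) ([ (λ h → inj₁ (m≤n⇒m≤1+n h)) , (λ (h , n) → inj₁ (s≤s h)) ]′ big) (extend S (unique-above S big nz)) }

  cyclic-if-odd : p ≢ 2 → κ (ord≟ (p ^ 1)) ≡ 1 → Cyclic
  cyclic-if-odd ne e = climb 9 refl (inj₂ (s≤s z≤n , ne)) (extend stage₀ e)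

  cyclic-if-even : κ (ord≟ (p ^ 1)) ≡ 1 → κ (ord≟ (p ^ 2)) ≡ 1 → Cyclic
  cyclic-if-even e e′ = climb 8 refl (inj₁ (s≤s (s≤s z≤n))) (extend (extend stage₀ e) e′)

  module _ (C : Cyclic) where
    open Cyclic C

    exponent-10 : k ≡ 10
    exponent-10 = ≤-antisym (s≤s⁻¹ (exponent<c ord-a)) (s≤s⁻¹ (subst (11 ≤_) (trans (length-map f (allFin (suc k))) (allFin-length (suc k)))
      (≤-trans (≤-reflexive (trans (κ-compl all?) (trans (cong (κ all? +_) (κ-none (¬? ∘ all?) (λ s n h → n (proj₁ (∼-idx _) )) (λ x n → n (proj₁ (∼-idx x))))) (+-identityʳ _))))
        (κ-≤ all? (λ {x} {y} _ _ → proj₁ (∼-idx y)) (map f (allFin (suc k))) λ x _ → via x (pow x)))))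
      where
      -- A predicate that holds everywhere, so that κ counts all eleven subgroups.
      all? : Decidable (λ x → x ⊑ gen (idx x))
      all? x = yes (proj₁ (∼-idx x))
      sub : (i : Fin (suc k)) → ∃ λ y → y ⊑ a × ord y ≡ p ^ toℕ i
      sub i = subgroup (toℕ i) ord-a (s≤s⁻¹ (Fin.toℕ<n i))
      f : Fin (suc k) → G
      f i = proj₁ (sub i)
      via : ∀ x → (∃ λ i → ord x ≡ p ^ i) → ∃ λ y → y ∈ map f (allFin (suc k)) × x ∼ y
      via x (i , o) = f i′ , ∈-map⁺ f (∈-allFin i′) , ⊑-unique-∼ (generate x) (proj₁ (proj₂ (sub i′)))
          (trans o (trans (cong (p ^_) (sym (Fin.toℕ-fromℕ< i<))) (sym (proj₂ (proj₂ (sub i′))))))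
        where
        i< : i < suc k
        i< = ≰⇒> λ k<i → contradiction (∣⇒≤ {{p^≢0 pr k}} (subst₂ _∣_ o ord-a (⊑-ord (generate x)))) (<⇒≱ (^-monoʳ-< p (prime>1 pr) k<i))
        i′ = fromℕ< i<

-- Enumeration of the possible profiles.

compositions : ℕ → ℕ → List (List ℕ)
compositions f       zero    = [] ∷ []
compositions zero    (suc r) = []
compositions (suc f) (suc r) = concatMap (λ n → map (suc n ∷_) (compositions f (r ∸ n))) (upTo (suc r))

trim : List ℕ → List ℕ
trim []           = []
trim (zero ∷ ns)  = []
trim (suc n ∷ ns) = suc n ∷ trim ns

at : List ℕ → ℕ → ℕ
at []       i       = 0
at (n ∷ ns) zero    = n
at (n ∷ ns) (suc i) = at ns i

-- The first argument of `compositions` bounds the number of parts, here by the length of the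
-- profile.
∈-compositions : ∀ f ns r → sum (trim ns) ≡ r → length ns ≤ f → trim ns ∈ compositions f r
∈-compositions f [] zero e _ = here refl
∈-compositions f (zero ∷ ns) zero e _ = here refl
∈-compositions (suc f) (suc n ∷ ns) (suc r) e (s≤s le) = ∈-concatMap⁺ (λ n → map (suc n ∷_) (compositions f (r ∸ n)))
  (lose (∈-upTo⁺ (s≤s (subst (n ≤_) (suc-injective e) (m≤m+n n (sum (trim ns))))))
    (∈-map⁺ (suc n ∷_) (∈-compositions f ns (r ∸ n) (trans (sym (m+n∸m≡n n (sum (trim ns)))) (cong (_∸ n) (suc-injective e))) le)))

-- A one-sided test with base q + 1: every power passes, and exhausted fuel f also counts as a pass.
-- For a filter that must not lose a profile this direction suffices.
mayBePower : ℕ → ℕ → ℕ → Bool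
mayBePower q zero    n = true
mayBePower q (suc f) n = (n ≡ᵇ 1) ∨ ((n % suc q ≡ᵇ 0) ∧ mayBePower q f (n / suc q))

power-mayBePower : ∀ q f m → mayBePower q f (suc q ^ m) ≡ true
power-mayBePower q zero    m = refl
power-mayBePower q (suc f) zero = refl
power-mayBePower q (suc f) (suc m) = trans (cong (λ b → (suc q ^ suc m ≡ᵇ 1) ∨ b) (cong₂ _∧_
    (cong (_≡ᵇ 0) (n∣m⇒m%n≡0 (suc q ^ suc m) (suc q) (m∣m*n (suc q ^ m))))
    (trans (cong (mayBePower q f) (trans (cong (_/ suc q) (*-comm (suc q) (suc q ^ m))) (m*n/n≡m (suc q ^ m) (suc q)))) (power-mayBePower q f m)))) (∨-zeroʳ _)

-- False for the profiles that the climb settles: one subgroup of order p if p = q + 1 is odd, one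
-- of order 2 and one of order 4 if p = 2.
interesting : ℕ → List ℕ → Bool
interesting q (1 ∷ 1 ∷ _) = false
interesting q (1 ∷ _)     = q ≡ᵇ 1
interesting q _           = true

interesting-true : ∀ q ns → ¬ (at ns 0 ≡ 1 × at ns 1 ≡ 1) → (at ns 0 ≡ 1 → q ≡ 1) → interesting q ns ≡ true
interesting-true q [] _ _ = refl
interesting-true q (0 ∷ _) _ _ = refl
interesting-true q (1 ∷ []) _ h rewrite h refl = refl
interesting-true q (1 ∷ 0 ∷ _) _ h rewrite h refl = refl
interesting-true q (1 ∷ 1 ∷ _) n _ = contradiction (refl , refl) n
interesting-true q (1 ∷ suc (suc _) ∷ _) _ h rewrite h refl = refl
interesting-true q (suc (suc _) ∷ _) _ _ = refl

-- the possible numbers of subgroups of order p, p², … in a p-group with 11 cyclic subgroups, p = q + 1,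
-- except when there is one subgroup of order p (and one of order 4 if p = 2)
profiles : ℕ → List (List ℕ)
profiles q = filterᵇ (λ ns → interesting q ns ∧ mayBePower q 12 (1 + q * horner (suc q) ns)) (compositions 10 10)

profiles-2 : profiles 1 ≡ (1 ∷ 3 ∷ 2 ∷ 2 ∷ 2 ∷ []) ∷ (1 ∷ 3 ∷ 6 ∷ []) ∷ (1 ∷ 5 ∷ 3 ∷ 1 ∷ []) ∷ (3 ∷ 2 ∷ 4 ∷ 1 ∷ []) ∷
                          (3 ∷ 4 ∷ 1 ∷ 2 ∷ []) ∷ (5 ∷ 1 ∷ 2 ∷ 2 ∷ []) ∷ (5 ∷ 5 ∷ []) ∷ (7 ∷ 2 ∷ 1 ∷ []) ∷ []
profiles-2 = refl

profiles-3 : profiles 2 ≡ (4 ∷ 3 ∷ 3 ∷ []) ∷ []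
profiles-3 = refl

profiles-5 : profiles 4 ≡ []
profiles-5 = refl

profiles-7 : profiles 6 ≡ []
profiles-7 = refl

-- Zeros only after the first zero, so that `trim` loses nothing. Profiles have this shape because
-- an element of order p ^ (i + 1) has a power of order p ^ i.
Closed : List ℕ → Set
Closed []           = ⊤
Closed (zero ∷ ns)  = All (_≡ 0) ns
Closed (suc n ∷ ns) = Closed ns

zeros-at : ∀ {ns} → All (_≡ 0) ns → ∀ i → at ns i ≡ 0
zeros-at []        i       = refl
zeros-at (z ∷ zs)  zero    = z
zeros-at (z ∷ zs)  (suc i) = zeros-at zs i

zeros-sum : ∀ {ns} → All (_≡ 0) ns → sum ns ≡ 0
zeros-sum []          = refl
zeros-sum (refl ∷ zs) = zeros-sum zs

zeros-horner : ∀ p {ns} → All (_≡ 0) ns → horner p ns ≡ 0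
zeros-horner p []          = refl
zeros-horner p (refl ∷ zs) = trans (cong (p *_) (zeros-horner p zs)) (*-zeroʳ p)

at-trim : ∀ ns → Closed ns → ∀ i → at (trim ns) i ≡ at ns i
at-trim []           _ i       = refl
at-trim (zero ∷ ns)  c zero    = refl
at-trim (zero ∷ ns)  c (suc i) = sym (zeros-at c i)
at-trim (suc n ∷ ns) c zero    = refl
at-trim (suc n ∷ ns) c (suc i) = at-trim ns c i

sum-trim : ∀ ns → Closed ns → sum (trim ns) ≡ sum ns
sum-trim []           _ = refl
sum-trim (zero ∷ ns)  c = sym (zeros-sum c)
sum-trim (suc n ∷ ns) c = cong (suc n +_) (sum-trim ns c)

horner-trim : ∀ p ns → Closed ns → horner p (trim ns) ≡ horner p ns
horner-trim p []           _ = refl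
horner-trim p (zero ∷ ns)  c = sym (trans (cong (p *_) (zeros-horner p c)) (*-zeroʳ p))
horner-trim p (suc n ∷ ns) c = cong (λ h → suc n + p * h) (horner-trim p ns c)

-- A cyclic subgroup of prime index with a complement.

module Extension (𝔾 : FinGroup) where
  open Powers 𝔾
  open Parts 𝔾

  record Split (m k : ℕ) : Set where
    field
      {a b}   : G
      ord-a   : ord a ≡ m
      ord-b   : ord b ≡ k
      b⋢a     : ¬ b ⊑ a
      order   : N ≡ m * k

  module _ {m k} (S : Split m k) (k-prime : Prime k) where
    open Split S

    ⊑a⇒ε : ∀ {v} → v ⊑ b → v ⊑ a → v ≡ ε
    ⊑a⇒ε {v} v⊑b v⊑a = case v Fin.≟ ε of λ
      { (yes e) → e
      ; (no ne) → case prime⇒irreducible k-prime (subst (ord v ∣_) ord-b (⊑-ord v⊑b)) of λ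
          { (inj₁ o) → ord≡1⇒ε o
          ; (inj₂ o) → contradiction (⊑-trans (proj₂ (⊑∧ord≡⇒∼ v⊑b (trans o (sym ord-b)))) v⊑a) b⋢a } }

    private
      f : Fin m × Fin k → G
      f (i , j) = a ↑ toℕ i ∙ b ↑ toℕ j

      f-injective : ∀ {x y} → f x ≡ f y → x ≡ y
      f-injective {i , j} {i′ , j′} e = cong₂ _,_
          (Fin.toℕ-injective (↑-injective {a} (lt ord-a i) (lt ord-a i′) (∙-cancelʳ (b ↑ toℕ j) _ _ (trans e (cong (a ↑ toℕ i′ ∙_) (cong (b ↑_) (cong toℕ (sym j≡j′))))))))
          j≡j′
        where
        lt : ∀ {x n} → ord x ≡ n → (i : Fin n) → toℕ i < ord x
        lt o i = subst (toℕ i <_) (sym o) (Fin.toℕ<n i)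
        A = a ↑ toℕ i
        A′ = a ↑ toℕ i′
        B = b ↑ toℕ j
        B′ = b ↑ toℕ j′
        v≡ : B ∙ B′ ⁻¹ ≡ A ⁻¹ ∙ A′
        v≡ = ∙-cancelˡ A _ _ (∙-cancelʳ B′ _ _ (trans (word (w0 :∙ (w1 :∙ neg w2) :∙ w2) (w0 :∙ w1) (A ∷ B ∷ B′ ∷ []) refl)
          (trans e (word (w1 :∙ w2) (w0 :∙ (neg w0 :∙ w1) :∙ w2) (A ∷ A′ ∷ B′ ∷ []) refl))))
        v≡ε : B ∙ B′ ⁻¹ ≡ ε
        v≡ε = ⊑a⇒ε (⊑-∙ (⊑-↑ (toℕ j)) (⊑-⁻¹ (⊑-↑ (toℕ j′)))) (subst (_⊑ a) (sym v≡) (⊑-∙ (⊑-⁻¹ (⊑-↑ (toℕ i))) (⊑-↑ (toℕ i′))))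
        j≡j′ : j ≡ j′
        j≡j′ = Fin.toℕ-injective (↑-injective {b} (lt ord-b j) (lt ord-b j′) (∙-cancelʳ (B′ ⁻¹) _ _ (trans v≡ε (sym (inverseʳ B′)))))

    -- The m k products a ↑ i ∙ b ↑ j are distinct since ⟨a⟩ and ⟨b⟩ meet trivially, and N = m k.
    generate : ∀ g → ∃₂ λ i (j : Fin k) → g ≡ a ↑ i ∙ b ↑ toℕ j
    generate g = via (∈-map⁻ f (length-⊆-complete Fin._≟_ (Unique-map⁺ f (λ _ _ → f-injective) (Unique.cartesianProduct⁺ (Unique.allFin⁺ m) (Unique.allFin⁺ k)))
        (λ _ → ∈-allFin _)
        (≤-reflexive (trans (allFin-length N) (trans order (sym (trans (length-map f (cartesianProduct (allFin m) (allFin k)))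
          (trans (length-cartesianProduct (allFin m) (allFin k)) (cong₂ _*_ (allFin-length m) (allFin-length k)))))))) (∈-allFin g)))
      where
      via : (∃ λ ij → ij ∈ cartesianProduct (allFin m) (allFin k) × g ≡ f ij) → ∃₂ λ i (j : Fin k) → g ≡ a ↑ i ∙ b ↑ toℕ j
      via ((i , j) , _ , e) = toℕ i , j , e

  ∙a⊑⇒ : ∀ {a b c} → b ∙ c ⊑ a → c ⊑ a → b ⊑ a
  ∙a⊑⇒ {a} {b} {c} s t = subst (_⊑ a) (word (w0 :∙ w1 :∙ neg w1) w0 (b ∷ c ∷ c ∷ []) refl) (⊑-∙ s (⊑-⁻¹ t))

  -- If conj b a were in the coset of b, then b a = a ↑ i ∙ b² would be a power of a, and so would
  -- b.
  normal₂ : ∀ {m} (S : Split m 2) → let open Split S in conj b a ⊑ a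
  normal₂ S = via (generate S prime[2] (conj b a))
    where
    open Split S
    via : (∃₂ λ i (j : Fin 2) → conj b a ≡ a ↑ i ∙ b ↑ toℕ j) → conj b a ⊑ a
    via (i , Fin.zero , e) = i , sym (trans e (identityʳ _))
    via (i , Fin.suc Fin.zero , e) = contradiction (∙a⊑⇒ (i , sym ba) ⊑-refl) b⋢a
      where
      ba : b ∙ a ≡ a ↑ i
      ba = begin
        b ∙ a                          ≡⟨ word (w0 :∙ w1) (w0 :∙ w1 :∙ neg w0 :∙ w0) (b ∷ a ∷ a ∷ []) refl ⟩
        conj b a ∙ b                   ≡⟨ cong (_∙ b) e ⟩
        a ↑ i ∙ b ↑ 1 ∙ b              ≡⟨ word (w0 :∙ (w1 :∙ one) :∙ w1) (w0 :∙ (w1 :∙ (w1 :∙ one))) (a ↑ i ∷ b ∷ b ∷ []) refl ⟩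
        a ↑ i ∙ b ↑ 2                  ≡⟨ cong (a ↑ i ∙_) (∣⇒↑≡ε (∣-reflexive ord-b)) ⟩
        a ↑ i ∙ ε                      ≡⟨ identityʳ _ ⟩
        a ↑ i                          ∎
        where open ≡-Reasoning

  -- a permutes the three cosets of ⟨a⟩ fixing one; having odd order it fixes all of them.
  normal₃ : ∀ {m} (S : Split m 3) → Coprime 2 m → let open Split S in conj b a ⊑ a
  normal₃ {m} S odd = first (generate S prime[3] (b ∙ a))
    where
    open Split S
    b³ : b ↑ 3 ≡ ε
    b³ = ∣⇒↑≡ε (∣-reflexive ord-b)
    b²⋢a : ¬ b ↑ 2 ⊑ a
    b²⋢a s = b⋢a (⊑-trans (⊑-coprime {b} {2} {3} (prime∤⇒coprime prime[2] (from-yes (¬? (2 ∣? 3)))) b³) s)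
    first : (∃₂ λ i (j : Fin 3) → b ∙ a ≡ a ↑ i ∙ b ↑ toℕ j) → conj b a ⊑ a
    first (i , Fin.zero , e) = contradiction (∙a⊑⇒ (i , sym (trans e (identityʳ _))) ⊑-refl) b⋢a
    first (i , Fin.suc Fin.zero , e) = i , sym (trans (cong (_∙ b ⁻¹) e) (word (w0 :∙ (w1 :∙ one) :∙ neg w1) w0 (a ↑ i ∷ b ∷ b ∷ []) refl))
    first (i , Fin.suc (Fin.suc Fin.zero) , e) = second (generate S prime[3] (b ↑ 2 ∙ a))
      where
      second : (∃₂ λ i (j : Fin 3) → b ↑ 2 ∙ a ≡ a ↑ i ∙ b ↑ toℕ j) → conj b a ⊑ a
      second (i′ , Fin.zero , e′) = contradiction (∙a⊑⇒ (i′ , sym (trans e′ (identityʳ _))) ⊑-refl) b²⋢a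
      second (i′ , Fin.suc (Fin.suc Fin.zero) , e′) = contradiction (subst (_⊑ a) (sym b≡) (⊑-∙ (⊑-↑ i′) (⊑-⁻¹ (⊑-↑ i)))) b⋢a
        where
        b≡ : b ≡ a ↑ i′ ∙ (a ↑ i) ⁻¹
        b≡ = begin
          b                                            ≡⟨ word w0 ((w0 :∙ (w0 :∙ one)) :∙ w1 :∙ neg (w0 :∙ w1)) (b ∷ a ∷ a ∷ []) refl ⟩
          b ↑ 2 ∙ a ∙ (b ∙ a) ⁻¹                       ≡⟨ cong₂ (λ u v → u ∙ v ⁻¹) e′ e ⟩
          a ↑ i′ ∙ b ↑ 2 ∙ (a ↑ i ∙ b ↑ 2) ⁻¹          ≡⟨ word (w0 :∙ w2 :∙ neg (w1 :∙ w2)) (w0 :∙ neg w1) (a ↑ i′ ∷ a ↑ i ∷ b ↑ 2 ∷ []) refl ⟩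
          a ↑ i′ ∙ (a ↑ i) ⁻¹                          ∎
          where open ≡-Reasoning
      second (i′ , Fin.suc Fin.zero , e′) = ⊑-trans (⊑-conj b (⊑-coprime {a} {2} {m} odd (∣⇒↑≡ε (∣-reflexive ord-a)))) (subst (_⊑ a) (sym ba²) (⊑-∙ (⊑-↑ i) (⊑-↑ i′)))
        where
        ba² : conj b (a ↑ 2) ≡ a ↑ i ∙ a ↑ i′
        ba² = begin
          b ∙ a ↑ 2 ∙ b ⁻¹                    ≡⟨ word (w0 :∙ (w1 :∙ (w1 :∙ one)) :∙ neg w0) ((w0 :∙ w1) :∙ w1 :∙ neg w0) (b ∷ a ∷ a ∷ []) refl ⟩
          b ∙ a ∙ a ∙ b ⁻¹                    ≡⟨ cong (λ v → v ∙ a ∙ b ⁻¹) e ⟩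
          a ↑ i ∙ b ↑ 2 ∙ a ∙ b ⁻¹            ≡⟨ cong (_∙ b ⁻¹) (assoc _ _ _) ⟩
          a ↑ i ∙ (b ↑ 2 ∙ a) ∙ b ⁻¹          ≡⟨ cong (λ v → a ↑ i ∙ v ∙ b ⁻¹) e′ ⟩
          a ↑ i ∙ (a ↑ i′ ∙ b ↑ 1) ∙ b ⁻¹     ≡⟨ word (w0 :∙ (w1 :∙ (w2 :∙ one)) :∙ neg w2) (w0 :∙ w1) (a ↑ i ∷ a ↑ i′ ∷ b ∷ []) refl ⟩
          a ↑ i ∙ a ↑ i′                      ∎
          where open ≡-Reasoning

-- The profile of a p-group with eleven cyclic subgroups.

module Profile (𝔾 : FinGroup) (H : HasExactlyCyclicSubgroups (FinGroup.group 𝔾) 11)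
               {p} (pr : Prime p) (pow : ∀ x → ∃ λ k → Powers.ord 𝔾 x ≡ p ^ k) where
  open CyclicPGroup 𝔾 H pr pow public
  open Extension 𝔾 public

  private
    κabove : ℕ → ℕ
    κabove e = κ (λ g → p ^ e ∣? ord g)

    κabove-split : ∀ e → κabove e ≡ κ (ord≟ (p ^ e)) + κabove (suc e)
    κabove-split e = trans (κ-split (λ g → p ^ e ∣? ord g) (ord≟ (p ^ e)))
      (cong₂ _+_ (κ-ext (λ g → (p ^ e ∣? ord g) ×-dec ord≟ (p ^ e) g) (ord≟ (p ^ e)) proj₂ λ o → ∣-reflexive (sym o) , o)
        (κ-ext (λ g → (p ^ e ∣? ord g) ×-dec ¬? (ord≟ (p ^ e) g)) (λ g → p ^ suc e ∣? ord g)
          (λ {g} (d , n) → ∣-next {e} g d n) λ {g} d → ∣-trans (^-∣ (n≤1+n e)) d , ∤-next {e} {g} d))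

    profile-sum : ∀ k e → κabove (e + k) ≡ 0 → sum (profile e k) ≡ κabove e
    profile-sum zero e z = trans (sym z) (cong κabove (+-identityʳ e))
    profile-sum (suc k) e z = trans (cong (κ (ord≟ (p ^ e)) +_) (profile-sum k (suc e) (subst (λ n → κabove n ≡ 0) (+-suc e k) z))) (sym (κabove-split e))

    none-above : ∀ e → κ (ord≟ (p ^ e)) ≡ 0 → ∀ j → κ (ord≟ (p ^ (e + j))) ≡ 0
    none-above e z j = κ-none (ord≟ (p ^ (e + j))) (ord≟-inv _) λ x o → let y , _ , oy = subgroup e o (m≤m+n e j) in κ≡0 (ord≟ (p ^ e)) (ord≟-inv _) z oy

    zeros : ∀ k e → (∀ j → κ (ord≟ (p ^ (e + j))) ≡ 0) → All (_≡ 0) (profile e k)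
    zeros zero e h = []
    zeros (suc k) e h = subst (λ n → κ (ord≟ (p ^ n)) ≡ 0) (+-identityʳ e) (h 0) ∷
      zeros k (suc e) λ j → subst (λ n → κ (ord≟ (p ^ n)) ≡ 0) (+-suc e j) (h (suc j))

    closed : ∀ k e → Closed (profile e k)
    closed zero e = tt
    closed (suc k) e with κ (ord≟ (p ^ e)) in eq
    ... | zero  = zeros k (suc e) λ j → subst (λ n → κ (ord≟ (p ^ n)) ≡ 0) (+-suc e j) (none-above e eq (suc j))
    ... | suc _ = closed k (suc e)

    length-profile : ∀ k e → length (profile e k) ≡ k
    length-profile zero e = refl
    length-profile (suc k) e = cong suc (length-profile k (suc e))

    prof : List ℕ
    prof = profile 1 10

    prof-closed : Closed prof
    prof-closed = closed 10 1

    κ-one : κ (ord≟ 1) ≡ 1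
    κ-one = ≤-antisym (κ-≤ (ord≟ 1) (ord≟-inv 1) (ε ∷ []) λ x o → ε , here refl , subst (_∼ ε) (sym (ord≡1⇒ε o)) ∼-refl) (κ-≥1 (ord≟ 1) (ord≟-inv 1) ord-ε)

    sum-prof : sum prof ≡ 10
    sum-prof = suc-injective (trans (cong₂ _+_ (sym κ-one) (profile-sum 10 1 none)) (trans (sym (κabove-split 0))
        (sym (trans (κ-compl (λ g → 1 ∣? ord g)) (trans (cong (κabove 0 +_) (κ-none (¬? ∘ λ g → 1 ∣? ord g) (ord-Invariant λ n → ¬ 1 ∣ n) λ x n → n (1∣ ord x))) (+-identityʳ _))))))
      where
      none : κabove 11 ≡ 0
      none = κ-none (λ g → p ^ 11 ∣? ord g) (ord-Invariant (p ^ 11 ∣_)) λ g d → absurd g d (pow g)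
        where
        absurd : ∀ g → p ^ 11 ∣ ord g → (∃ λ j → ord g ≡ p ^ j) → ⊥
        absurd g d (j , o) = contradiction (∣⇒≤ {{p^≢0 pr j}} (subst (p ^ 11 ∣_) o d)) (<⇒≱ (^-monoʳ-< p (prime>1 pr) {j} {11} (exponent<c {g} {j} o)))

  module _ {ns} (e : trim (profile 1 10) ≡ ns) where
    κ-at : ∀ i → at ns i ≡ at (profile 1 10) i
    κ-at i = trans (cong (λ l → at l i) (sym e)) (at-trim prof prof-closed i)

    size : N ≡ 1 + pred p * horner p ns
    size = trans (N-horner 10 refl) (cong (λ h → 1 + pred p * h) (trans (sym (horner-trim p prof prof-closed)) (cong (horner p) e)))

  profile∈ : ∀ q → p ≡ suc q → ¬ (κ (ord≟ (p ^ 1)) ≡ 1 × κ (ord≟ (p ^ 2)) ≡ 1) → (κ (ord≟ (p ^ 1)) ≡ 1 → q ≡ 1) → trim (profile 1 10) ∈ profiles q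
  profile∈ q p≡ n h = ∈-filter⁺ (T? ∘ λ ns → interesting q ns ∧ mayBePower q 12 (1 + q * horner (suc q) ns))
      (∈-compositions 10 prof 10 (trans (sum-trim prof prof-closed) sum-prof) (≤-reflexive (length-profile 10 1)))
      (subst (Bool.T) (sym (cong₂ _∧_
        (interesting-true q (trim prof) (λ (a , b) → n (trans (sym (at-trim prof prof-closed 0)) a , trans (sym (at-trim prof prof-closed 1)) b))
          (λ a → h (trans (sym (at-trim prof prof-closed 0)) a)))
        (trans (cong (mayBePower q 12) (trans (cong (1 +_) (cong₂ _*_ (cong pred (sym p≡)) (cong (λ r → horner r (trim prof)) (sym p≡)))) (trans (sym (size refl)) (trans (proj₂ order) (cong (_^ proj₁ order) p≡))))) (power-mayBePower q 12 (proj₁ order))))) tt)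

  -- A cyclic group ⟨a⟩ has only one subgroup of order p, so one of the two or more in G provides b
  -- outside ⟨a⟩.
  split-extension : ∀ k → 1 ≤ κ (ord≟ (p ^ suc k)) → 2 ≤ κ (ord≟ (p ^ 1)) → N ≡ p ^ suc k * p → Split (p ^ suc k) p
  split-extension k one-a two-b size = via (κ-pos (ord≟ (p ^ suc k)) (ord≟-inv _) one-a)
    where
    via : (∃ λ a → ord a ≡ p ^ suc k) → Split (p ^ suc k) p
    via (a , oa) with Fin.any? (λ b → ord≟ (p ^ 1) b ×-dec ¬? (⊑? b a))
    ... | yes (b , ob , n) = record { ord-a = oa ; ord-b = trans ob (*-identityʳ p) ; b⋢a = n ; order = size }
    ... | no none = contradiction (≤-trans two-b (κ-≤ (ord≟ (p ^ 1)) (ord≟-inv _) (z ∷ []) λ b ob → z , here refl ,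
            ⊑-unique-∼ (case ⊑? b a of λ { (yes s) → s ; (no n) → contradiction (b , ob , n) none }) z⊑a (trans ob (sym oz)))) λ { (s≤s ()) }
      where
      Z = subgroup {a} {suc k} 1 oa (s≤s z≤n)
      z = proj₁ Z
      z⊑a = proj₁ (proj₂ Z)
      oz = proj₂ (proj₂ Z)

-- 2-groups with a normal cyclic subgroup of order 4.

module TwoGroup (𝔾 : FinGroup) (H : HasExactlyCyclicSubgroups (FinGroup.group 𝔾) 11)
                (pow : ∀ x → ∃ λ k → Powers.ord 𝔾 x ≡ 2 ^ k) where
  open Profile 𝔾 H prime[2] pow

  module Normal4 {x} (ox : ord x ≡ 4) (normal : ∀ g → conj g x ∼ x) where
    z = x ↑ 2

    oz : ord z ≡ 2
    oz = ord-↑ 2 2 ox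

    C? = commute? x

    sq : ∀ {g} → g ↑ 2 ≡ g ∙ g
    sq {g} = cong (g ∙_) (identityʳ g)

    x⁴ : x ↑ 4 ≡ ε
    x⁴ = ∣⇒↑≡ε (∣-reflexive ox)

    z⊑x : z ⊑ x
    z⊑x = ⊑-↑ 2

    zz : z ∙ z ≡ ε
    zz = invol oz

    inverts : ∀ {e} → ¬ Commute x e → conj e x ≡ x ⁻¹
    inverts {e} n = by r (subst (r <_) ox (m%n<n k (ord x))) (trans (sym (↑-% x k)) (proj₂ (proj₁ (normal e))))
      where
      k = proj₁ (proj₁ (normal e))
      r = k % ord x
      by : ∀ r → r < 4 → x ↑ r ≡ conj e x → conj e x ≡ x ⁻¹
      by 0 _ f = contradiction (subst (λ v → Commute v e) (sym (conj-injective e (trans (sym f) (sym (conj-ε e))))) (commute-sym commute-ε)) n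
      by 1 _ f = contradiction (commute-sym (conj≡⇒commute (trans (sym f) (x↑1 x)))) n
      by 2 _ f = contradiction (trans (sym oz) (trans (cong ord f) (trans (ord-conj e x) ox))) λ ()
      by 3 _ f = trans (sym f) (inverseʳ-unique x (x ↑ 3) x⁴)
      by (suc (suc (suc (suc r)))) (s≤s (s≤s (s≤s (s≤s ())))) f

    square∈C : ∀ {e} → ¬ Commute x e → Commute x (e ↑ 2)
    square∈C {e} n = commute-sym (conj≡⇒commute (begin
      conj (e ↑ 2) x               ≡⟨ word (w0 :∙ (w0 :∙ one) :∙ w1 :∙ neg (w0 :∙ (w0 :∙ one))) (w0 :∙ (w0 :∙ w1 :∙ neg w0) :∙ neg w0) (e ∷ x ∷ x ∷ []) refl ⟩
      conj e (conj e x)            ≡⟨ cong (conj e) (inverts n) ⟩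
      conj e (x ⁻¹)                ≡⟨ word (w0 :∙ neg w1 :∙ neg w0) (neg (w0 :∙ w1 :∙ neg w0)) (e ∷ x ∷ x ∷ []) refl ⟩
      (conj e x) ⁻¹                ≡⟨ cong _⁻¹ (inverts n) ⟩
      x ⁻¹ ⁻¹                      ≡⟨ ⁻¹-involutive x ⟩
      x                            ∎))
      where open ≡-Reasoning

    quotient∈C : ∀ {g h} → ¬ Commute x g → ¬ Commute x h → Commute x (g ⁻¹ ∙ h)
    quotient∈C {g} {h} n m = commute-sym (conj≡⇒commute (trans (sym (conj-conj (g ⁻¹) h x))
      (trans (cong (conj (g ⁻¹)) (trans (inverts m) (sym (inverts n)))) (conj-⁻¹ˡ g x))))

    E? : Decidable (λ g → ¬ Commute x g)
    E? = ¬? ∘ C?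

    N≡ : N ≡ count C? + count E?
    N≡ = count-compl C?

    e∙C : ∀ {e c} → ¬ Commute x e → Commute x c → ¬ Commute x (e ∙ c)
    e∙C {e} {c} n h m = n (subst (Commute x) (word (w0 :∙ w1 :∙ neg w1) w0 (e ∷ c ∷ c ∷ []) refl) (commute-∙ m (commute-⁻¹ h)))

    C≤E : ∀ {e} → ¬ Commute x e → count C? ≤ count E?
    C≤E {e} n = count-mono C? E? (e ∙_) (λ _ _ → ∙-cancelˡ e _ _) (e∙C n)

    E≤C : count E? ≤ count C?
    E≤C = case Fin.any? E? of λ
      { (yes (e , n)) → count-mono E? C? (e ⁻¹ ∙_) (λ _ _ → ∙-cancelˡ (e ⁻¹) _ _) (quotient∈C n)
      ; (no none) → ≤-trans (≤-reflexive (count≡0 E? λ g n → none (g , n))) z≤n }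

    -- y² is an involution of the centraliser, hence equals z = x². Then y x has square ε and lies
    -- in ⟨x⟩, and so does y.
    small∈⟨x⟩ : (∀ {u} → ord u ≡ 2 → Commute x u → u ⊑ x) → ∀ {y} → ord y ≡ 4 → Commute x y → y ⊑ x
    small∈⟨x⟩ only {y} oy c = subst (_⊑ x) (word (w0 :∙ w1 :∙ neg w1) w0 (y ∷ x ∷ x ∷ []) refl) (⊑-∙ yx⊑x (⊑-⁻¹ ⊑-refl))
      where
      oy² : ord (y ↑ 2) ≡ 2
      oy² = ord-↑ 2 2 oy
      y²≡z : y ↑ 2 ≡ z
      y²≡z = ∼-invol oy² oz (⊑-unique-∼ (only oy² (commute-↑ 2 c)) z⊑x (trans oy² (sym oz)))
      v = y ∙ x
      cv : Commute x v
      cv = commute-∙ c refl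
      v² : v ∙ v ≡ ε
      v² = trans (sym sq) (trans (∙-↑ 2 (commute-sym c)) (trans (cong (_∙ z) y²≡z) zz))
      yx⊑x : v ⊑ x
      yx⊑x = case v Fin.≟ ε of λ { (yes e) → subst (_⊑ x) (sym e) ε⊑ ; (no ne) → only (invol-ord v² ne) cv }

  normal4 : ¬ 2 ∣ κ (ord≟ 4) → ∃ λ x → ord x ≡ 4 × (∀ g → conj g x ∼ x)
  normal4 = normal-member (ord≟ 4) (ord≟-inv 4) λ g {x} o → trans (ord-conj g x) o

  count₄ : count (ord≟ 4) ≡ κ (ord≟ 4) * 2
  count₄ = count-ord 1

  count₂ : count (ord≟ 2) ≡ κ (ord≟ 2) * 1
  count₂ = count-ord 0

  -- Everything outside the centraliser of the normal subgroup of order 4 has order 4.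
  quaternion-bound : κ (ord≟ 2) ≡ 1 → ¬ 2 ∣ κ (ord≟ 4) → 2 ≤ κ (ord≟ 4) → N ≤ 4 * κ (ord≟ 4)
  quaternion-bound κ₂ odd two = via (normal4 odd)
    where
    via : (∃ λ x → ord x ≡ 4 × (∀ g → conj g x ∼ x)) → N ≤ 4 * κ (ord≟ 4)
    via (x , ox , normal) = bound
      where
      open Normal4 ox normal
      only : ∀ {u} → ord u ≡ 2 → u ⊑ x
      only ou = ⊑-trans (proj₁ (κ≡1 (ord≟ 2) (ord≟-inv 2) κ₂ ou oz)) z⊑x
      E⇒4 : ∀ {e} → ¬ Commute x e → ord e ≡ 4
      E⇒4 {e} n = by (pow e)
        where
        by : (∃ λ i → ord e ≡ 2 ^ i) → ord e ≡ 4
        by (0 , o) = contradiction (subst (Commute x) (sym (ord≡1⇒ε o)) commute-ε) n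
        by (1 , o) = contradiction (commute-within ⊑-refl (only o)) n
        by (2 , o) = o
        by (suc (suc (suc i)) , o) = contradiction (commute-within x⊑e ⊑-refl) n
          where
          -- If e had order at least 8, its square, which centralises x, would have a power h of
          -- order 4. Then ⟨h⟩ = ⟨x⟩, so x would be a power of e.
          h : ∃ λ h → h ⊑ e ↑ 2 × ord h ≡ 4
          h = subgroup {e ↑ 2} {2 + i} 2 (ord-↑ 2 (2 ^ (2 + i)) o) (s≤s (s≤s z≤n))
          oh = proj₂ (proj₂ h)
          h⊑x : proj₁ h ⊑ x
          h⊑x = small∈⟨x⟩ (λ ou _ → only ou) oh (commute-⊑ (square∈C n) (proj₁ (proj₂ h)))
          x⊑e : x ⊑ e
          x⊑e = ⊑-trans (proj₂ (⊑∧ord≡⇒∼ h⊑x (trans oh (sym ox)))) (⊑-trans (proj₁ (proj₂ h)) (⊑-↑ 2))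
      outside : ∃ λ e → ¬ Commute x e
      outside with Fin.any? E?
      ... | yes h = h
      ... | no none = contradiction (≤-trans two (κ-≤ (ord≟ 4) (ord≟-inv 4) (x ∷ []) λ y oy → x , here refl ,
              ⊑∧ord≡⇒∼ (small∈⟨x⟩ (λ ou _ → only ou) oy (case C? y of λ { (yes c) → c ; (no n) → contradiction (y , n) none })) (trans oy (sym ox)))) λ { (s≤s ()) }
      bound : N ≤ 4 * κ (ord≟ 4)
      bound = begin
        N                                     ≡⟨ N≡ ⟩
        count C? + count E?                   ≤⟨ +-monoˡ-≤ (count E?) (C≤E (proj₂ outside)) ⟩
        count E? + count E?                   ≤⟨ +-mono-≤ E≤4 E≤4 ⟩
        count (ord≟ 4) + count (ord≟ 4)       ≡⟨ cong (λ v → v + v) count₄ ⟩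
        κ (ord≟ 4) * 2 + κ (ord≟ 4) * 2       ≡⟨ solve 1 (λ k → k :* con 2 :+ k :* con 2 := con 4 :* k) refl (κ (ord≟ 4)) ⟩
        4 * κ (ord≟ 4)                        ∎
        where
        open ≤-Reasoning
        open +-*-Solver
        E≤4 : count E? ≤ count (ord≟ 4)
        E≤4 = count-⊆ E? (ord≟ 4) E⇒4

  -- Order 16 with five involutions and ten elements of order 4. The equal numbers hide the
  -- contradiction, which appears when elements are counted inside and outside the centraliser of a
  -- normal ⟨x⟩ of order 4.
  module FiveFive (κ₂ : κ (ord≟ 2) ≡ 5) (κ₄ : κ (ord≟ 4) ≡ 5) (κ₈ : κ (ord≟ 8) ≡ 0) (size : N ≡ 16) where
    cases : ∀ g → ord g ≡ 1 ⊎ ord g ≡ 2 ⊎ ord g ≡ 4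
    cases g = by (pow g)
      where
      by : (∃ λ i → ord g ≡ 2 ^ i) → ord g ≡ 1 ⊎ ord g ≡ 2 ⊎ ord g ≡ 4
      by (0 , o) = inj₁ o
      by (1 , o) = inj₂ (inj₁ o)
      by (2 , o) = inj₂ (inj₂ o)
      by (suc (suc (suc i)) , o) = let y , _ , oy = subgroup {g} {3 + i} 3 o (s≤s (s≤s (s≤s z≤n))) in contradiction oy (κ≡0 (ord≟ 8) (ord≟-inv 8) κ₈)

    module _ {x} (ox : ord x ≡ 4) (normal : ∀ g → conj g x ∼ x) where
      open Normal4 ox normal

      lt4 : ∀ (i : Fin 4) → toℕ i < ord x
      lt4 i = subst (toℕ i <_) (sym ox) (Fin.toℕ<n i)

      x^-injective : ∀ {i j : Fin 4} → x ↑ toℕ i ≡ x ↑ toℕ j → i ≡ j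
      x^-injective {i} {j} e = Fin.toℕ-injective (↑-injective {x} (lt4 i) (lt4 j) e)

      -- Otherwise the centraliser is ⟨x⟩, and N is at most 8.
      involution∈C : ∃ λ u → ord u ≡ 2 × Commute x u × ¬ u ⊑ x
      involution∈C with Fin.any? (λ u → ord≟ 2 u ×-dec C? u ×-dec ¬? (⊑? u x))
      ... | yes h = h
      ... | no none = contradiction (≤-trans (≤-reflexive (sym size)) (≤-trans (≤-reflexive N≡) (+-mono-≤ C≤4 (≤-trans E≤C C≤4)))) (<⇒≱ (m≤m+n 9 7))
        where
        only : ∀ {u} → ord u ≡ 2 → Commute x u → u ⊑ x
        only {u} ou c = case ⊑? u x of λ { (yes s) → s ; (no n) → contradiction (u , ou , c , n) none }
        C⊑x : ∀ {c} → Commute x c → c ⊑ x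
        C⊑x {c} h = case cases c of λ
          { (inj₁ o) → subst (_⊑ x) (sym (ord≡1⇒ε o)) ε⊑ ; (inj₂ (inj₁ o)) → only o h ; (inj₂ (inj₂ o)) → small∈⟨x⟩ only o h }
        C≤4 : count C? ≤ 4
        C≤4 = subst (count C? ≤_) (length-map (λ i → x ↑ toℕ i) (allFin 4)) (count-≤ C? λ c h → let k , e = C⊑x h in
          subst (_∈ map (λ i → x ↑ toℕ i) (allFin 4)) (trans (cong (x ↑_) (Fin.toℕ-fromℕ< (r< k))) (trans (sym (↑-% x k)) e)) (∈-map⁺ (λ i → x ↑ toℕ i) (∈-allFin (fromℕ< (r< k)))))
          where
          r< : ∀ k → k % ord x < 4
          r< k = subst (k % ord x <_) ox (m%n<n k (ord x))

      module _ {u} (ou : ord u ≡ 2) (cu : Commute x u) (u⋢x : ¬ u ⊑ x) where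
        -- an involution outside C comes with its coset by ⟨x⟩
        no-outer-involution : ∀ {e} → ord e ≡ 2 → ¬ ¬ Commute x e
        no-outer-involution {e} oe n = contradiction (subst (6 ≤_) κ₂ (κ-≥-Fin (ord≟ 2) (ord≟-inv 2) f (λ {i} {j} s → f-inj {i} {j} (∼-invol (f-ord i) (f-ord j) s)) f-ord)) (<⇒≱ (n<1+n 5))
          where
          f : Fin 6 → G
          f Fin.zero              = z
          f (Fin.suc Fin.zero)    = u
          f (Fin.suc (Fin.suc i)) = e ∙ x ↑ toℕ i
          out : ∀ i → ¬ Commute x (e ∙ x ↑ i)
          out i = e∙C n (commute-↑ i refl)
          coset : ∀ i → (e ∙ x ↑ i) ∙ (e ∙ x ↑ i) ≡ ε
          coset zero = trans (cong₂ _∙_ (identityʳ e) (identityʳ e)) (invol oe)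
          coset (suc i) = begin
            (e ∙ (x ∙ x ↑ i)) ∙ (e ∙ (x ∙ x ↑ i))      ≡⟨ cong (λ v → (e ∙ v) ∙ (e ∙ v)) (commute-↑ i refl) ⟩
            (e ∙ (x ↑ i ∙ x)) ∙ (e ∙ (x ↑ i ∙ x))      ≡⟨ word (w0 :∙ (w1 :∙ w2) :∙ (w0 :∙ (w1 :∙ w2))) ((w0 :∙ w1) :∙ w2 :∙ neg (w0 :∙ w1) :∙ ((w0 :∙ w1) :∙ (w0 :∙ w1)) :∙ w2) (e ∷ x ↑ i ∷ x ∷ []) refl ⟩
            conj (e ∙ x ↑ i) x ∙ ((e ∙ x ↑ i) ∙ (e ∙ x ↑ i)) ∙ x   ≡⟨ cong₂ (λ a b → a ∙ b ∙ x) (inverts (out i)) (coset i) ⟩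
            x ⁻¹ ∙ ε ∙ x                               ≡⟨ word (neg w0 :∙ one :∙ w0) one (x ∷ x ∷ x ∷ []) refl ⟩
            ε                                          ∎
            where open ≡-Reasoning
          f-ord : ∀ i → ord (f i) ≡ 2
          f-ord Fin.zero              = oz
          f-ord (Fin.suc Fin.zero)    = ou
          f-ord (Fin.suc (Fin.suc i)) = invol-ord (coset (toℕ i)) λ e → out (toℕ i) (subst (Commute x) (sym e) commute-ε)
          f-inj : ∀ {i j} → f i ≡ f j → i ≡ j
          f-inj {Fin.zero} {Fin.zero} _ = refl
          f-inj {Fin.zero} {Fin.suc Fin.zero} e = contradiction (subst (_⊑ x) e z⊑x) u⋢x
          f-inj {Fin.zero} {Fin.suc (Fin.suc j)} e = contradiction (subst (Commute x) e (commute-within ⊑-refl z⊑x)) (out (toℕ j))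
          f-inj {Fin.suc Fin.zero} {Fin.zero} e = contradiction (subst (_⊑ x) (sym e) z⊑x) u⋢x
          f-inj {Fin.suc Fin.zero} {Fin.suc Fin.zero} _ = refl
          f-inj {Fin.suc Fin.zero} {Fin.suc (Fin.suc j)} e = contradiction (subst (Commute x) e cu) (out (toℕ j))
          f-inj {Fin.suc (Fin.suc i)} {Fin.zero} e = contradiction (subst (Commute x) (sym e) (commute-within ⊑-refl z⊑x)) (out (toℕ i))
          f-inj {Fin.suc (Fin.suc i)} {Fin.suc Fin.zero} e = contradiction (subst (Commute x) (sym e) cu) (out (toℕ i))
          f-inj {Fin.suc (Fin.suc i)} {Fin.suc (Fin.suc j)} eq = cong (Fin.suc ∘ Fin.suc) (x^-injective (∙-cancelˡ e _ _ eq))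

        square-z : ∀ {g} → Commute x g → g ↑ 2 ≡ ε → (g ∙ x) ↑ 2 ≡ z
        square-z c e = trans (∙-↑ 2 (commute-sym c)) (trans (cong (_∙ z) e) (identityˡ z))

        ord-4 : ∀ {g} → g ↑ 2 ≡ z → ord g ≡ 4
        ord-4 {g} e = case cases g of λ
          { (inj₁ o) → contradiction (trans (sym e) (∣⇒↑≡ε (subst (_∣ 2) (sym o) (1∣ 2)))) (ord-prime≢ε prime[2] oz)
          ; (inj₂ (inj₁ o)) → contradiction (trans (sym e) (∣⇒↑≡ε (∣-reflexive o))) (ord-prime≢ε prime[2] oz)
          ; (inj₂ (inj₂ o)) → o }

        central : ∀ g → Commute x g
        central e = case C? e of λ { (yes c) → c ; (no n) → contradiction (absurd n) λ () }
          where
          absurd : ¬ Commute x e → ⊥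
          -- At least eight elements of order 4 outside, together with x, x⁻¹ and u x inside, exceed
          -- the ten available.
          absurd n = contradiction (≤-trans (+-mono-≤ three eight) (≤-reflexive (trans (sym (count-split (ord≟ 4) C?)) (trans count₄ (cong (_* 2) κ₄))))) (<⇒≱ (n<1+n 10))
            where
            4C? = λ g → ord≟ 4 g ×-dec C? g
            4E? = λ g → ord≟ 4 g ×-dec ¬? (C? g)
            eight : 8 ≤ count 4E?
            eight = ≤-trans (≮⇒≥ λ lt → contradiction (≤-trans (≤-reflexive (sym size)) (≤-trans (≤-reflexive N≡) (+-mono-≤ (≤-trans (C≤E n) (s≤s⁻¹ lt)) (s≤s⁻¹ lt)))) (<⇒≱ (m≤m+n 15 1)))
              (count-⊆ E? 4E? λ {g} m → (case cases g of λ
                { (inj₁ o) → contradiction (subst (Commute x) (sym (ord≡1⇒ε o)) commute-ε) m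
                ; (inj₂ (inj₁ o)) → contradiction m (no-outer-involution o) ; (inj₂ (inj₂ o)) → o }) , m)
            f : Fin 3 → G
            f Fin.zero = x
            f (Fin.suc Fin.zero) = x ⁻¹
            f (Fin.suc (Fin.suc _)) = u ∙ x
            x≢x⁻¹ : x ≢ x ⁻¹
            x≢x⁻¹ e = ord-prime≢ε prime[2] oz (trans sq (trans (cong (x ∙_) e) (inverseʳ x)))
            ux : ∀ {g} → g ⊑ x → g ≢ u ∙ x
            ux s e = u⋢x (subst (_⊑ x) (word (w0 :∙ w1 :∙ neg w1) w0 (u ∷ x ∷ x ∷ []) refl) (⊑-∙ (subst (_⊑ x) e s) (⊑-⁻¹ ⊑-refl)))
            f-inj : ∀ {i j} → f i ≡ f j → i ≡ j
            f-inj {Fin.zero} {Fin.zero} _ = refl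
            f-inj {Fin.zero} {Fin.suc Fin.zero} e = contradiction e x≢x⁻¹
            f-inj {Fin.zero} {Fin.suc (Fin.suc Fin.zero)} e = contradiction e (ux ⊑-refl)
            f-inj {Fin.suc Fin.zero} {Fin.zero} e = contradiction (sym e) x≢x⁻¹
            f-inj {Fin.suc Fin.zero} {Fin.suc Fin.zero} _ = refl
            f-inj {Fin.suc Fin.zero} {Fin.suc (Fin.suc Fin.zero)} e = contradiction e (ux (⊑-⁻¹ ⊑-refl))
            f-inj {Fin.suc (Fin.suc Fin.zero)} {Fin.zero} e = contradiction (sym e) (ux ⊑-refl)
            f-inj {Fin.suc (Fin.suc Fin.zero)} {Fin.suc Fin.zero} e = contradiction (sym e) (ux (⊑-⁻¹ ⊑-refl))
            f-inj {Fin.suc (Fin.suc Fin.zero)} {Fin.suc (Fin.suc Fin.zero)} _ = refl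
            f4C : ∀ i → ord (f i) ≡ 4 × Commute x (f i)
            f4C Fin.zero = ox , refl
            f4C (Fin.suc Fin.zero) = trans (cong ord (⁻¹-↑ x)) (trans (cong (λ o → ord (x ↑ (o ∸ 1))) ox) (trans (cong ord (inverseʳ-unique x (x ↑ 3) x⁴)) x⁻¹4)) , commute-⁻¹ refl
              where
              x⁻¹4 : ord (x ⁻¹) ≡ 4
              x⁻¹4 = ord-4 (trans (inverseʳ-unique z ((x ⁻¹) ↑ 2) (trans (sym (∙-↑ 2 (commute-⁻¹ refl))) (trans (cong (_↑ 2) (inverseʳ x)) (ε↑ 2)))) (invol-⁻¹ oz))
            f4C (Fin.suc (Fin.suc _)) = ord-4 (square-z cu (trans sq (invol ou))) , commute-∙ cu refl
            three : 3 ≤ count 4C?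
            three = subst (_≤ count 4C?) (allFin-length 3) (count-≥ 4C? f (Unique.allFin⁺ 3) (λ {i} {j} _ _ → f-inj {i} {j}) λ {i} _ → f4C i)

        -- With x central, multiplication by x takes the six solutions of g² = ε to elements with
        -- square z, so at most four elements of order 4 have another square. One such h exists,
        -- since otherwise ten elements would be mapped injectively into six. Then h⁻¹ and the coset
        -- h⟨x⟩ are five.
        contradictory : ⊥
        contradictory = contradiction (subst (_≤ count R?) (allFin-length 5) (count-≥ R? f (Unique.allFin⁺ 5) (λ {i} {j} _ _ → f-inj {i} {j}) λ {i} _ → fR i)) (<⇒≱ (s≤s R≤4))
          where
          Z? = λ g → g ↑ 2 Fin.≟ z
          4Z? = λ g → ord≟ 4 g ×-dec Z? g
          R? = λ g → ord≟ 4 g ×-dec ¬? (Z? g)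
          D? = λ g → ord≟ 1 g ⊎-dec ord≟ 2 g
          D² : ∀ {g} → ord g ≡ 1 ⊎ ord g ≡ 2 → g ↑ 2 ≡ ε
          D² (inj₁ o) = ∣⇒↑≡ε (subst (_∣ 2) (sym o) (1∣ 2))
          D² (inj₂ o) = ∣⇒↑≡ε (∣-reflexive o)
          six : 6 ≤ count D?
          six = ≤-trans (+-mono-≤ (count≢0 (λ g → D? g ×-dec ord≟ 1 g) ε (inj₁ ord-ε , ord-ε))
                  (≤-trans (≤-reflexive (sym (trans count₂ (cong (_* 1) κ₂)))) (count-⊆ (ord≟ 2) (λ g → D? g ×-dec ¬? (ord≟ 1 g)) λ o → inj₂ o , λ o′ → contradiction (trans (sym o) o′) λ ())))
                  (≤-reflexive (sym (count-split D? (ord≟ 1))))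
          4Z≥6 : 6 ≤ count 4Z?
          4Z≥6 = ≤-trans six (count-mono D? 4Z? (_∙ x) (λ _ _ → ∙-cancelʳ x _ _) λ {g} d → let e = square-z (central g) (D² d) in ord-4 e , e)
          R≤4 : count R? ≤ 4
          R≤4 = +-cancelˡ-≤ 6 _ 4 (≤-trans (+-monoˡ-≤ (count R?) 4Z≥6) (≤-reflexive (trans (sym (count-split (ord≟ 4) Z?)) (trans count₄ (cong (_* 2) κ₄)))))
          found : ∃ λ h → ord h ≡ 4 × h ↑ 2 ≢ z
          found with Fin.any? R?
          ... | yes h = h
          ... | no none = contradiction (≤-trans (≤-reflexive (sym (trans count₄ (cong (_* 2) κ₄)))) (≤-trans (count-mono (ord≟ 4) D? (_∙ x) (λ _ _ → ∙-cancelʳ x _ _) shift) D≤6)) (<⇒≱ (m≤m+n 7 3))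
            where
            shift : ∀ {g} → ord g ≡ 4 → ord (g ∙ x) ≡ 1 ⊎ ord (g ∙ x) ≡ 2
            shift {g} o = case (g ∙ x) Fin.≟ ε of λ
              { (yes e) → inj₁ (trans (cong ord e) ord-ε)
              ; (no ne) → inj₂ (ord-prime prime[2] (trans (∙-↑ 2 (commute-sym (central g))) (trans (cong (_∙ z) (case Z? g of λ { (yes e) → e ; (no n) → contradiction (g , o , n) none })) zz)) ne) }
            D≤6 : count D? ≤ 6
            D≤6 = ≤-trans (≤-reflexive (count-split D? (ord≟ 1))) (+-mono-≤
              (count-≤ (λ g → D? g ×-dec ord≟ 1 g) {ys = ε ∷ []} λ g (_ , o) → here (ord≡1⇒ε o))
              (≤-trans (count-⊆ (λ g → D? g ×-dec ¬? (ord≟ 1 g)) (ord≟ 2) λ { (inj₁ o , n) → contradiction o n ; (inj₂ o , _) → o }) (≤-reflexive (trans count₂ (cong (_* 1) κ₂)))))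
          h = proj₁ found
          oh = proj₁ (proj₂ found)
          h²≢z = proj₂ (proj₂ found)
          h²⋢x : ¬ h ↑ 2 ⊑ x
          h²⋢x s = h²≢z (∼-invol (ord-↑ 2 2 oh) oz (⊑-unique-∼ s z⊑x (trans (ord-↑ 2 2 oh) (sym oz))))
          f : Fin 5 → G
          f Fin.zero    = h ⁻¹
          f (Fin.suc i) = h ∙ x ↑ toℕ i
          h⁻¹≢ : ∀ i → h ⁻¹ ≢ h ∙ x ↑ i
          h⁻¹≢ i e = h²⋢x (subst (_⊑ x) (sym (trans sq (trans (word (w0 :∙ w0) (w0 :∙ (w0 :∙ w1) :∙ neg w1) (h ∷ x ↑ i ∷ x ∷ []) refl)
            (trans (cong (λ v → h ∙ v ∙ (x ↑ i) ⁻¹) (sym e)) (word (w0 :∙ neg w0 :∙ neg w1) (neg w1) (h ∷ x ↑ i ∷ x ∷ []) refl))))) (⊑-⁻¹ (⊑-↑ i)))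
          f-inj : ∀ {i j} → f i ≡ f j → i ≡ j
          f-inj {Fin.zero} {Fin.zero} _ = refl
          f-inj {Fin.zero} {Fin.suc j} e = contradiction e (h⁻¹≢ (toℕ j))
          f-inj {Fin.suc i} {Fin.zero} e = contradiction (sym e) (h⁻¹≢ (toℕ i))
          f-inj {Fin.suc i} {Fin.suc j} e = cong Fin.suc (x^-injective (∙-cancelˡ h _ _ e))
          R-when : ∀ {g} → ¬ g ↑ 2 ⊑ x → ord g ≡ 4 × g ↑ 2 ≢ z
          R-when {g} n = (case cases g of λ
            { (inj₁ o) → contradiction (subst (_⊑ x) (sym (D² {g} (inj₁ o))) ε⊑) n
            ; (inj₂ (inj₁ o)) → contradiction (subst (_⊑ x) (sym (D² {g} (inj₂ o))) ε⊑) n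
            ; (inj₂ (inj₂ o)) → o }) , λ e → n (subst (_⊑ x) (sym e) z⊑x)
          fR : ∀ i → ord (f i) ≡ 4 × f i ↑ 2 ≢ z
          fR Fin.zero = R-when λ s → h²⋢x (subst (_⊑ x) (trans (word (neg (neg w0 :∙ (neg w0 :∙ one))) (w0 :∙ (w0 :∙ one)) (h ∷ x ∷ x ∷ []) refl) refl) (⊑-⁻¹ s))
          fR (Fin.suc i) = R-when λ s → h²⋢x (subst (_⊑ x) (word (w0 :∙ w1 :∙ neg w1) w0 (h ↑ 2 ∷ (x ↑ toℕ i) ↑ 2 ∷ x ∷ []) refl)
            (⊑-∙ (subst (_⊑ x) (∙-↑ 2 (commute-↑ (toℕ i) (commute-sym (central h)))) s) (⊑-⁻¹ (⊑-trans (⊑-↑ 2) (⊑-↑ (toℕ i))))))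

    impossible : ⊥
    impossible = let x , ox , normal = normal4 (λ d → from-yes (¬? (2 ∣? 5)) (subst (2 ∣_) κ₄ d))
                     u , ou , cu , n = involution∈C ox normal in contradictory ox normal ou cu n

-- p-groups: the cyclic one, or a cyclic subgroup of index p.

module PGroupClassification (𝔾 : FinGroup) (H : HasExactlyCyclicSubgroups (FinGroup.group 𝔾) 11) where
  open Powers 𝔾 using (G; ord; _⊑_)
  open Extension 𝔾 using (Split)

  Result : ℕ → Set
  Result p = (∃ λ a → ord a ≡ p ^ 10 × (∀ g → g ⊑ a)) ⊎ Split 27 3 ⊎ Split 8 2 ⊎ Split 16 2

  module _ {p} (pr : Prime p) (pow : ∀ x → ∃ λ k → ord x ≡ p ^ k) where
    open CyclicPGroup 𝔾 H pr pow using (Cyclic; exponent-10)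

    from-cyclic : Cyclic → Result p
    from-cyclic C = inj₁ (a , trans ord-a (cong (p ^_) (exponent-10 C)) , generate)
      where open Cyclic C

  -- Of the eight profiles, three have a single involution and violate `quaternion-bound` (64 > 12,
  -- 32 > 12, 32 > 20), four contain an element of order N / 2, and (5, 5) is excluded by
  -- `FiveFive`.
  two : ∀ (pow : ∀ x → ∃ λ k → ord x ≡ 2 ^ k) → Result 2
  two pow = case (κ (ord≟ 2) ≟ 1) ×-dec (κ (ord≟ 4) ≟ 1) of λ
      { (yes (e , e′)) → from-cyclic prime[2] pow (cyclic-if-even e e′)
      ; (no n) → by (subst (trim (profile 1 10) ∈_) profiles-2 (profile∈ 1 refl n λ _ → refl)) }
    where
    open Profile 𝔾 H prime[2] pow using (κ; ord≟; profile; profile∈; κ-at; size; split-extension; cyclic-if-even)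
    open TwoGroup 𝔾 H pow using (quaternion-bound; module FiveFive)
    quaternion : ∀ {ns} → trim (profile 1 10) ≡ ns → at ns 0 ≡ 1 → ¬ 2 ∣ at ns 1 → 2 ≤ at ns 1 → 1 + 1 * horner 2 ns ≤ 4 * at ns 1
    quaternion {ns} e e₀ odd two = subst₂ (λ n k → n ≤ 4 * k) (size e) (sym (κ-at e 1))
      (quaternion-bound (trans (sym (κ-at e 0)) e₀) (subst (λ k → ¬ 2 ∣ k) (κ-at e 1) odd) (subst (2 ≤_) (κ-at e 1) two))
    index2 : ∀ {ns} k → trim (profile 1 10) ≡ ns → 1 ≤ at ns k → 2 ≤ at ns 0 → at (profile 1 10) k ≡ κ (ord≟ (2 ^ suc k)) → 1 + 1 * horner 2 ns ≡ 2 ^ suc k * 2 → Split (2 ^ suc k) 2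
    index2 k e one-a two-b at≡ eq = split-extension k (subst (1 ≤_) (trans (κ-at e k) at≡) one-a) (subst (2 ≤_) (κ-at e 0) two-b) (trans (size e) eq)
    by : trim (profile 1 10) ∈ ((1 ∷ 3 ∷ 2 ∷ 2 ∷ 2 ∷ []) ∷ (1 ∷ 3 ∷ 6 ∷ []) ∷ (1 ∷ 5 ∷ 3 ∷ 1 ∷ []) ∷ (3 ∷ 2 ∷ 4 ∷ 1 ∷ []) ∷
                          (3 ∷ 4 ∷ 1 ∷ 2 ∷ []) ∷ (5 ∷ 1 ∷ 2 ∷ 2 ∷ []) ∷ (5 ∷ 5 ∷ []) ∷ (7 ∷ 2 ∷ 1 ∷ []) ∷ []) → Result 2
    by (here e) = contradiction (quaternion e refl (from-yes (¬? (2 ∣? 3))) (from-yes (2 ≤? 3))) (from-yes (¬? (64 ≤? 12)))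
    by (there (here e)) = contradiction (quaternion e refl (from-yes (¬? (2 ∣? 3))) (from-yes (2 ≤? 3))) (from-yes (¬? (32 ≤? 12)))
    by (there (there (here e))) = contradiction (quaternion e refl (from-yes (¬? (2 ∣? 5))) (from-yes (2 ≤? 5))) (from-yes (¬? (32 ≤? 20)))
    by (there (there (there (here e)))) = inj₂ (inj₂ (inj₂ (index2 3 e (from-yes (1 ≤? 1)) (from-yes (2 ≤? 3)) refl refl)))
    by (there (there (there (there (here e))))) = inj₂ (inj₂ (inj₂ (index2 3 e (from-yes (1 ≤? 2)) (from-yes (2 ≤? 3)) refl refl)))
    by (there (there (there (there (there (here e)))))) = inj₂ (inj₂ (inj₂ (index2 3 e (from-yes (1 ≤? 2)) (from-yes (2 ≤? 5)) refl refl)))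
    by (there (there (there (there (there (there (here e))))))) = ⊥-elim (FiveFive.impossible (sym (κ-at e 0)) (sym (κ-at e 1)) (sym (κ-at e 2)) (size e))
    by (there (there (there (there (there (there (there (here e)))))))) = inj₂ (inj₂ (inj₁ (index2 2 e (from-yes (1 ≤? 1)) (from-yes (2 ≤? 7)) refl refl)))

  module Odd {p} (pr : Prime p) (pow : ∀ x → ∃ λ k → ord x ≡ p ^ k) where
    open Profile 𝔾 H pr pow hiding (G; ord; _⊑_; Split)

    three : p ≡ 3 → κ (ord≟ (p ^ 1)) ≢ 1 → Result p
    three refl ne = by (subst (trim (profile 1 10) ∈_) profiles-3 (profile∈ 2 refl (λ (a , _) → ne a) λ a → contradiction a ne))
      where
      by : trim (profile 1 10) ∈ ((4 ∷ 3 ∷ 3 ∷ []) ∷ []) → Result 3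
      by (here e) = inj₂ (inj₁ (split-extension 2 (subst (1 ≤_) (κ-at e 2) (from-yes (1 ≤? 3))) (subst (2 ≤_) (κ-at e 0) (from-yes (2 ≤? 4))) (size e)))

    none : ∀ q → p ≡ suc q → profiles q ≡ [] → κ (ord≟ (p ^ 1)) ≢ 1 → Result p
    none q p≡ empty ne = contradiction (subst (trim (profile 1 10) ∈_) empty (profile∈ q p≡ (λ (a , _) → ne a) λ a → contradiction a ne)) λ ()

    n₁ = κ (ord≟ (p ^ 1))

    n₁≤10 : n₁ ≤ 10
    n₁≤10 = s≤s⁻¹ (≤-trans (≤-reflexive (+-comm 1 n₁)) (≤-trans (+-monoʳ-≤ n₁ (κ-≥1 (¬? ∘ ord≟ (p ^ 1)) (ord-Invariant λ n → n ≢ p ^ 1)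
        λ e → contradiction (subst Prime (trans (sym (*-identityʳ p)) (trans (sym e) ord-ε)) pr) ¬prime[1])) (≤-reflexive (sym (κ-compl (ord≟ (p ^ 1)))))))

    n₁≢0 : n₁ ≢ 0
    n₁≢0 z = contradiction (≤-trans (≤-reflexive (κ-compl (ord≟ 1))) (+-mono-≤
        (κ-≤ (ord≟ 1) (ord≟-inv 1) (ε ∷ []) λ x o → ε , here refl , subst (_∼ ε) (sym (ord≡1⇒ε o)) ∼-refl)
        (≤-reflexive (κ-none (¬? ∘ ord≟ 1) (ord-Invariant (_≢ 1)) λ x n → absurd x n (pow x))))) (<⇒≱ (m≤m+n 2 9))
      where
      absurd : ∀ x → ord x ≢ 1 → (∃ λ k → ord x ≡ p ^ k) → ⊥
      absurd x n (zero , o) = n o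
      absurd x n (suc k , o) = let y , _ , oy = subgroup {x} {suc k} 1 o (s≤s z≤n) in κ≡0 (ord≟ (p ^ 1)) (ord≟-inv (p ^ 1)) z oy

    -- n₁ is 1 modulo p but neither 0 nor 1, so p ≤ n₁ - 1 ≤ 9.
    p<10 : n₁ ≢ 1 → p < 10
    p<10 ne = go n₁ refl
      where
      go : ∀ n → n₁ ≡ n → p < 10
      go 0 e = contradiction e n₁≢0
      go 1 e = contradiction e ne
      go (suc (suc n)) e = ≤-trans (s≤s (∣⇒≤ (p∣suc {suc n} {horner p (profile 2 9)} {Stage.m stage₀}
        (subst (λ v → 1 + pred p * (v + p * horner p (profile 2 9)) ≡ p ^ Stage.m stage₀) e (Stage.size stage₀))))) (subst (_≤ 10) e n₁≤10)

    odd : p ≢ 2 → Result p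
    odd p≢2 = case n₁ ≟ 1 of λ
      { (yes e) → from-cyclic pr pow (cyclic-if-odd p≢2 e)
      ; (no ne) → by p refl (p<10 ne) ne }
      where
      no-prime : ∀ n → p ≡ n → ¬ Prime n → Result p
      no-prime n e np = contradiction (subst Prime e pr) np
      by : ∀ n → p ≡ n → n < 10 → n₁ ≢ 1 → Result p
      by 0 e _ _ = no-prime 0 e (from-yes (¬? (prime? 0)))
      by 1 e _ _ = no-prime 1 e (from-yes (¬? (prime? 1)))
      by 2 e _ _ = contradiction e p≢2
      by 3 e _ ne = three e ne
      by 4 e _ _ = no-prime 4 e (from-yes (¬? (prime? 4)))
      by 5 e _ ne = none 4 e profiles-5 ne
      by 6 e _ _ = no-prime 6 e (from-yes (¬? (prime? 6)))
      by 7 e _ ne = none 6 e profiles-7 ne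
      by 8 e _ _ = no-prime 8 e (from-yes (¬? (prime? 8)))
      by 9 e _ _ = no-prime 9 e (from-yes (¬? (prime? 9)))
      by (suc (suc (suc (suc (suc (suc (suc (suc (suc (suc n)))))))))) _ lt _ = contradiction (m≤m+n 10 n) (<⇒≱ lt)

  p-group : ∀ {p} → Prime p → (∀ x → ∃ λ k → ord x ≡ p ^ k) → Result p
  p-group {p} pr pow = case p ≟ 2 of λ
    { (yes refl) → two pow
    ; (no ne)    → Odd.odd pr pow ne }

-- Counting the cyclic subgroups of a metacyclic table by evaluation.

Code : Set
Code = ℕ × ℕ

_==_ : Code → Code → Bool
(a , i) == (c , j) = (a ≡ᵇ c) ∧ (i ≡ᵇ j)

==⇒≡ : ∀ x y → (x == y) ≡ true → x ≡ y
==⇒≡ (a , i) (c , j) e with a ≡ᵇ c in e₁ | i ≡ᵇ j in e₂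
... | true | true = cong₂ _,_ (≡ᵇ⇒≡ a c (subst Bool.T (sym e₁) tt)) (≡ᵇ⇒≡ i j (subst Bool.T (sym e₂) tt))

==-refl : ∀ x → (x == x) ≡ true
==-refl (a , i) = cong₂ _∧_ (T⇒true (≡⇒≡ᵇ a a refl)) (T⇒true (≡⇒≡ᵇ i i refl))
  where
  T⇒true : ∀ {b} → Bool.T b → b ≡ true
  T⇒true {true} _ = refl

every : ∀ {A : Set} → (A → Bool) → List A → Bool
every f []       = true
every f (x ∷ xs) = f x ∧ every f xs

some : ∀ {A : Set} → (A → Bool) → List A → Bool
some f []       = false
some f (x ∷ xs) = f x ∨ some f xs

∧-true : ∀ {a b} → a ∧ b ≡ true → a ≡ true × b ≡ true
∧-true {true} e = refl , e

every-∈ : ∀ {A : Set} (f : A → Bool) xs → every f xs ≡ true → ∀ {x} → x ∈ xs → f x ≡ true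
every-∈ f (x ∷ xs) e (here refl) = proj₁ (∧-true e)
every-∈ f (x ∷ xs) e (there q)   = every-∈ f xs (proj₂ (∧-true {f x} e)) q

some-∈ : ∀ {A : Set} (f : A → Bool) xs → some f xs ≡ true → ∃ λ x → x ∈ xs × f x ≡ true
some-∈ f (x ∷ xs) e with f x in eq
... | true  = x , here refl , eq
... | false = let y , q , h = some-∈ f xs e in y , there q , h

∈-some : ∀ {A : Set} (f : A → Bool) xs {x} → x ∈ xs → f x ≡ true → some f xs ≡ true
∈-some f (x ∷ xs) (here refl) h = cong (_∨ some f xs) h
∈-some f (x ∷ xs) (there q)   h = trans (cong (f x ∨_) (∈-some f xs q h)) (∨-zeroʳ (f x))

-- The multiplication of Metacyclic (suc m) (suc k) r s on pairs of natural numbers.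
codeOp : ∀ m k (r s : ℕ) → Code → Code → Code
codeOp m k r s (a , i) (c , j) = (a + r ^ i * c + s * ((i + j) / suc k)) % suc m , (i + j) % suc k

module Check (m k r s : ℕ) where
  elements : List Code
  elements = cartesianProduct (upTo (suc m)) (upTo (suc k))

  infixl 7 _·_
  _·_ : Code → Code → Code
  _·_ = codeOp m k r s

  -- x, x², …, xⁿ, given the previous power w
  powersFrom : ℕ → Code → Code → List Code
  powersFrom zero    x w = []
  powersFrom (suc n) x w = w ∷ powersFrom n x (x · w)

  powers : ℕ → Code → List Code
  powers n x = powersFrom n x x

  last : ℕ → Code → Code → Code
  last zero    x w = w
  last (suc n) x w = last n x (x · w)

  memberOf : List Code → Code → Bool
  memberOf xs x = some (x ==_) xs

  module _ (K : ℕ) (reps : List Code) where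
    table : List (Code × List Code)
    table = map (λ ρ → ρ , powers K ρ) reps

    matches : Code → List Code → Code × List Code → Bool
    matches x px (ρ , pρ) = memberOf px ρ ∧ memberOf pρ x

    covered : Bool
    covered = every (λ x → some (matches x (powers K x)) table) elements

    separated : List (Code × List Code) → Bool
    separated []             = true
    separated ((ρ , pρ) ∷ t) = every (λ e → not (matches ρ pρ e)) t ∧ separated t

    periodic : Bool
    -- `last K ρ ρ` is the power with exponent K + 1, so the test makes K a period of ρ, and
    -- `powers K ρ` lists all of ⟨ρ⟩.
    periodic = every (λ ρ → (last K ρ ρ == ρ) ∧ memberOf elements ρ) reps

    -- For `covered` it is enough that listed powers are powers. For `separated` the lists of the
    -- representatives must also be complete, which `periodic` grants.
    check : Bool
    check = covered ∧ (separated table ∧ periodic)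

  -- A greedy search about which nothing is proved; `check` validates its result.
  representatives : ℕ → List Code
  representatives K = map proj₁ (go elements [])
    where
    go : List Code → List (Code × List Code) → List (Code × List Code)
    go []       t = t
    go (x ∷ xs) t with powers K x
    ... | px with some (matches K [] x px) t
    ...   | true  = go xs t
    ...   | false = go xs ((x , px) ∷ t)

  ∈-elements : ∀ {a i} → a < suc m → i < suc k → (a , i) ∈ elements
  ∈-elements a< i< = ∈-cartesianProduct⁺ (∈-upTo⁺ a<) (∈-upTo⁺ i<)

  ·-∈ : ∀ x y → x · y ∈ elements
  ·-∈ (a , i) (c , j) = ∈-elements (m%n<n (a + r ^ i * c + s * ((i + j) / suc k)) (suc m)) (m%n<n (i + j) (suc k))

  module Sound (𝔾 : FinGroup) (e : Code → Powers.G 𝔾)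
    (homo : ∀ {x y} → x ∈ elements → y ∈ elements → e (x · y) ≡ FinGroup._∙_ 𝔾 (e x) (e y))
    (injective : ∀ {x y} → x ∈ elements → y ∈ elements → e x ≡ e y → x ≡ y)
    (surjective : ∀ g → ∃ λ x → x ∈ elements × e x ≡ g)
    where
    open Powers 𝔾
    open Membership 𝔾

    module _ {x} (x∈ : x ∈ elements) where
      step : ∀ {w j} → w ∈ elements → e w ≡ e x ↑ j → e (x · w) ≡ e x ↑ suc j
      step w∈ ew = trans (homo x∈ w∈) (cong (e x ∙_) ew)

      powers⇒⊑ : ∀ n {w j y} → w ∈ elements → e w ≡ e x ↑ j → y ∈ powersFrom n x w → e y ⊑ e x
      powers⇒⊑ (suc n) {j = j} w∈ ew (here refl) = j , sym ew
      powers⇒⊑ (suc n) {j = j} w∈ ew (there q) = powers⇒⊑ n {j = suc j} (·-∈ x _) (step {j = j} w∈ ew) q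

      power∈ : ∀ n {w j} → w ∈ elements → e w ≡ e x ↑ j → ∀ {i} → i < n → ∃ λ y → y ∈ powersFrom n x w × y ∈ elements × e y ≡ e x ↑ (j + i)
      power∈ (suc n) {w} {j} w∈ ew {zero} _ = w , here refl , w∈ , trans ew (cong (e x ↑_) (sym (+-identityʳ j)))
      power∈ (suc n) {w} {j} w∈ ew {suc i} (s≤s lt) = let y , q , y∈ , ey = power∈ n {j = suc j} (·-∈ x w) (step {j = j} w∈ ew) lt in
        y , there q , y∈ , trans ey (cong (e x ↑_) (sym (+-suc j i)))

      last-power : ∀ n {w j} → w ∈ elements → e w ≡ e x ↑ j → e (last n x w) ≡ e x ↑ (j + n)
      last-power zero {w} {j} _ ew = trans ew (cong (e x ↑_) (sym (+-identityʳ j)))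
      last-power (suc n) {w} {j} w∈ ew = trans (last-power n {j = suc j} (·-∈ x w) (step {j = j} w∈ ew)) (cong (e x ↑_) (sym (+-suc j n)))

      ⊑⇒powers : ∀ K .{{_ : NonZero K}} → last K x x ≡ x → ∀ {y} → y ∈ elements → e y ⊑ e x → y ∈ powers K x
      ⊑⇒powers K per {y} y∈ (t , et) = via (t % K) (m%n<n t K) (trans (sym reduce) et)
        where
        xK : e x ↑ K ≡ ε
        xK = ∙-cancelˡ (e x) _ _ (trans (sym (last-power K {j = 1} x∈ (sym (x↑1 (e x))))) (trans (cong e per) (sym (identityʳ _))))
        reduce : e x ↑ t ≡ e x ↑ (t % K)
        reduce = trans (cong (e x ↑_) (m≡m%n+[m/n]*n t K)) (trans (↑-+ (e x) (t % K) (t / K * K))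
          (trans (cong (e x ↑ (t % K) ∙_) (trans (↑-* (e x) (t / K) K) (trans (cong (_↑ (t / K)) xK) (ε↑ (t / K))))) (identityʳ _)))
        found : ∀ {i} → i < K → e x ↑ suc i ≡ e y → y ∈ powers K x
        found lt f = let w , q , w∈ , ew = power∈ K {j = 1} x∈ (sym (x↑1 (e x))) lt in subst (_∈ powers K x) (injective w∈ y∈ (trans ew f)) q
        via : ∀ r → r < K → e x ↑ r ≡ e y → y ∈ powers K x
        via (suc r) lt f = found (<-trans (n<1+n r) lt) f
        -- The list of powers starts with exponent 1, so ε is found in it under the exponent K.
        via zero lt f = found (subst (pred K <_) (suc-pred K) (n<1+n (pred K))) (trans (cong (e x ↑_) (suc-pred K)) (trans xK f))

    memberOf⇒∈ : ∀ xs y → memberOf xs y ≡ true → y ∈ xs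
    memberOf⇒∈ xs y h = let z , q , f = some-∈ (y ==_) xs h in subst (_∈ xs) (sym (==⇒≡ y z f)) q

    ∈⇒memberOf : ∀ {xs y} → y ∈ xs → memberOf xs y ≡ true
    ∈⇒memberOf {xs} {y} q = ∈-some (y ==_) xs q (==-refl y)

    module _ (K : ℕ) .{{_ : NonZero K}} (reps : List Code) (ok : check K reps ≡ true) where
      private
        cov = proj₁ (∧-true {covered K reps} ok)
        sep = proj₁ (∧-true {separated K reps (table K reps)} (proj₂ (∧-true {covered K reps} ok)))
        per = proj₂ (∧-true {separated K reps (table K reps)} (proj₂ (∧-true {covered K reps} ok)))

        good : ∀ {ρ} → ρ ∈ reps → last K ρ ρ ≡ ρ × ρ ∈ elements
        good {ρ} q = let a , b = ∧-true {last K ρ ρ == ρ} (every-∈ (λ ρ → (last K ρ ρ == ρ) ∧ memberOf elements ρ) reps per q) in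
          ==⇒≡ _ ρ a , memberOf⇒∈ elements ρ b

        x↑1′ : ∀ x → e x ≡ e x ↑ 1
        x↑1′ x = sym (x↑1 (e x))

        matches⇒∼ : ∀ {x ρ} → x ∈ elements → ρ ∈ elements → matches K reps x (powers K x) (ρ , powers K ρ) ≡ true → e x ∼ e ρ
        matches⇒∼ {x} {ρ} x∈ ρ∈ h = let a , b = ∧-true {memberOf (powers K x) ρ} h in
          powers⇒⊑ ρ∈ K {j = 1} ρ∈ (x↑1′ ρ) (memberOf⇒∈ (powers K ρ) x b) , powers⇒⊑ x∈ K {j = 1} x∈ (x↑1′ x) (memberOf⇒∈ (powers K x) ρ a)

        ∼⇒matches : ∀ {x ρ} → x ∈ reps → ρ ∈ reps → e x ∼ e ρ → matches K reps x (powers K x) (ρ , powers K ρ) ≡ true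
        ∼⇒matches x∈ ρ∈ (s , t) = cong₂ _∧_
          (∈⇒memberOf (⊑⇒powers (proj₂ (good x∈)) K (proj₁ (good x∈)) (proj₂ (good ρ∈)) t))
          (∈⇒memberOf (⊑⇒powers (proj₂ (good ρ∈)) K (proj₁ (good ρ∈)) (proj₂ (good x∈)) s))

        generator : Fin (length reps) → G
        generator i = e (List.lookup reps i)

        apart : ∀ rs → (∀ {ρ} → ρ ∈ rs → ρ ∈ reps) → separated K reps (table K rs) ≡ true →
                ∀ {i j : Fin (length rs)} → i Fin.< j → ¬ e (List.lookup rs i) ∼ e (List.lookup rs j)
        apart (ρ ∷ rs) sub h {Fin.zero} {Fin.suc j} _ s = contradiction
          (trans (sym (cong not (∼⇒matches (sub (here refl)) (sub (there (∈-lookup j))) s)))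
            (every-∈ (λ v → not (matches K reps ρ (powers K ρ) v)) (table K rs) (proj₁ (∧-true h)) (∈-map⁺ (λ ρ → ρ , powers K ρ) (∈-lookup j)))) λ ()
        apart (ρ ∷ rs) sub h {Fin.suc i} {Fin.suc j} (s≤s lt) s = apart rs (sub ∘ there) (proj₂ (∧-true {every (λ v → not (matches K reps ρ (powers K ρ) v)) (table K rs)} h)) lt s

        distinct : ∀ i j → generator i ∼ generator j → i ≡ j
        distinct i j s with Fin.<-cmp i j
        ... | tri< lt _ _ = contradiction s (apart reps id sep lt)
        ... | tri≈ _ eq _ = eq
        ... | tri> _ _ gt = contradiction (∼-sym s) (apart reps id sep gt)

        cover : ∀ g → ∃ λ i → g ∼ generator i
        cover g = via (surjective g)
          where
          via : (∃ λ x → x ∈ elements × e x ≡ g) → ∃ λ i → g ∼ generator i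
          via (x , x∈ , refl) = found (some-∈ (matches K reps x (powers K x)) (table K reps) (every-∈ (λ x → some (matches K reps x (powers K x)) (table K reps)) elements cov x∈))
            where
            found : (∃ λ v → v ∈ table K reps × matches K reps x (powers K x) v ≡ true) → ∃ λ i → e x ∼ generator i
            found (v , q , h) = at-index (∈-map⁻ (λ ρ → ρ , powers K ρ) q)
              where
              at-index : (∃ λ ρ → ρ ∈ reps × v ≡ (ρ , powers K ρ)) → ∃ λ i → e x ∼ generator i
              at-index (ρ , q , refl) = Any.index q , subst (λ ρ′ → e x ∼ e ρ′) (lookup-index q) (matches⇒∼ x∈ (proj₂ (good q)) h)

      exactly : HasExactlyCyclicSubgroups group (length reps)
      exactly = generator , (λ i j s → distinct i j (SameCyclic⇒∼ s)) , λ g → let i , s = cover g in i , ∼⇒SameCyclic s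

-- m - 1, k - 1, r, s, exponent and number of cyclic subgroups
record Model : Set where
  constructor model
  field m k r s K n : ℕ

-- A closed statement about plain natural numbers, so that `refl` runs the whole check.
verified : Model → Set
verified (model m k r s K n) = Check.check m k r s K (Check.representatives m k r s K) ≡ true × length (Check.representatives m k r s K) ≡ n

verified₁ : verified (model 26 2 1 0 27 11)
verified₁ = refl , refl

verified₂ : verified (model 26 2 10 0 27 11)
verified₂ = refl , refl

verified₃ : verified (model 13 1 13 7 28 11)
verified₃ = refl , refl

verified₄ : verified (model 6 8 2 0 63 11)
verified₄ = refl , refl

verified₅ : verified (model 2 5 2 0 6 11)
verified₅ = refl , refl

verified₆ : verified (model 4 7 4 0 40 11)
verified₆ = refl , refl

verified₇ : verified (model 2 15 2 0 48 11)
verified₇ = refl , refl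

-- Isomorphisms with multiplication tables.

record Realises (𝔾 : FinGroup) (M : RawMagma 0ℓ 0ℓ) : Set where
  open Powers 𝔾 using (G) renaming (_∙_ to _∙ᴳ_)
  open RawMagma M
  field
    e          : Carrier → G
    e-cong     : ∀ {x y} → x ≈ y → e x ≡ e y
    homo       : ∀ x y → e (x ∙ y) ≡ e x ∙ᴳ e y
    injective  : ∀ {x y} → e x ≡ e y → x ≈ y
    surjective : ∀ g → ∃ λ x → e x ≡ g

MagmaLaws : RawMagma 0ℓ 0ℓ → Set
MagmaLaws M = IsMagma (RawMagma._≈_ M) (RawMagma._∙_ M)

≡-laws : ∀ {A : Set} (_∙_ : Op₂ A) → IsMagma _≡_ _∙_
≡-laws _∙_ = record { isEquivalence = isEquivalence ; ∙-cong = cong₂ _∙_ }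

module _ {𝔾 : FinGroup} {M : RawMagma 0ℓ 0ℓ} where
  open FinGroup 𝔾 using (group)
  open RawMagma M using (Carrier; _≈_; _∙_)

  -- `Realises` maps the table to the group, where normal forms have their values; the isomorphism
  -- wanted is the inverse.
  realises⇒≅ : Realises 𝔾 M → group ≅ M
  realises⇒≅ R = f , record
    { isMagmaMonomorphism = record
      { isMagmaHomomorphism = record
        { isRelHomomorphism = record { cong = λ { refl → injective refl } }
        ; homo = λ g h → injective (trans (ef (g ∙ᴳ h)) (sym (trans (homo (f g) (f h)) (cong₂ _∙ᴳ_ (ef g) (ef h))))) }
      ; injective = λ {g} {h} q → trans (sym (ef g)) (trans (e-cong q) (ef h)) }
    ; surjective = λ y → e y , λ { refl → injective (ef (e y)) } }
    where
    open Realises R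
    open FinGroup 𝔾 using () renaming (_∙_ to _∙ᴳ_)
    f : _ → Carrier
    f g = proj₁ (surjective g)
    ef : ∀ g → e (f g) ≡ g
    ef g = proj₂ (surjective g)

  ≅⇒realises : MagmaLaws M → group ≅ M → Realises 𝔾 M
  ≅⇒realises laws (f , iso) = record
    { e = e
    ; e-cong = λ q → I.injective (L.trans (fe _) (L.trans q (L.sym (fe _))))
    ; homo = λ x y → I.injective (L.trans (fe _) (L.sym (L.trans (I.homo (e x) (e y)) (L.∙-cong (fe x) (fe y)))))
    ; injective = λ {x} {y} q → L.trans (L.sym (fe x)) (L.trans (I.⟦⟧-cong q) (fe y))
    ; surjective = λ g → f g , I.injective (fe (f g)) }
    where
    module L = IsMagma laws
    module I = MagmaMorphisms.IsMagmaIsomorphism iso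
    e : Carrier → _
    e y = proj₁ (I.surjective y)
    fe : ∀ y → f (e y) ≈ y
    fe y = proj₂ (I.surjective y) refl

-- Carries one table of a group to another, so that the direct products can be counted and
-- recognised as metacyclic tables.
record Translation (M M′ : RawMagma 0ℓ 0ℓ) : Set where
  open RawMagma M
  open RawMagma M′ using () renaming (Carrier to Carrier′; _≈_ to _≈′_; _∙_ to _∙′_)
  field
    ψ          : Carrier → Carrier′
    ψ-cong     : ∀ {x y} → x ≈ y → ψ x ≈′ ψ y
    homo       : ∀ x y → ψ (x ∙ y) ≈′ (ψ x ∙′ ψ y)
    injective  : ∀ {x y} → ψ x ≈′ ψ y → x ≈ y
    surjective : ∀ y → ∃ λ x → ψ x ≈′ y

module _ {𝔾 : FinGroup} {M M′ : RawMagma 0ℓ 0ℓ} (T : Translation M M′) where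
  private module T = Translation T

  pull : Realises 𝔾 M′ → Realises 𝔾 M
  pull R = record
    { e = R.e ∘ T.ψ
    ; e-cong = R.e-cong ∘ T.ψ-cong
    ; homo = λ x y → trans (R.e-cong (T.homo x y)) (R.homo (T.ψ x) (T.ψ y))
    ; injective = T.injective ∘ R.injective
    ; surjective = λ g → let y , q = R.surjective g ; x , q′ = T.surjective y in x , trans (R.e-cong q′) q }
    where module R = Realises R

  push-forward : MagmaLaws M′ → Realises 𝔾 M → Realises 𝔾 M′
  push-forward laws R = record
    { e = R.e ∘ φ
    ; e-cong = λ q → R.e-cong (T.injective (L.trans (ψφ _) (L.trans q (L.sym (ψφ _)))))
    ; homo = λ x y → trans (R.e-cong (T.injective (L.trans (ψφ _) (L.trans (L.∙-cong (L.sym (ψφ x)) (L.sym (ψφ y))) (L.sym (T.homo (φ x) (φ y))))))) (R.homo (φ x) (φ y))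
    ; injective = λ {x} {y} q → L.trans (L.sym (ψφ x)) (L.trans (T.ψ-cong (R.injective q)) (ψφ y))
    ; surjective = λ g → let x , q = R.surjective g in T.ψ x , trans (R.e-cong (T.injective (ψφ _))) q }
    where
    module R = Realises R
    module L = IsMagma laws
    φ = λ y → proj₁ (T.surjective y)
    ψφ = λ y → proj₂ (T.surjective y)

toℕ-modF : ∀ m x → toℕ (modF m x) ≡ x % suc m
toℕ-modF m x = Fin.toℕ-fromℕ< (m%n<n x (suc m))

modF-≡ : ∀ m x y → x % suc m ≡ y % suc m → modF m x ≡ modF m y
modF-≡ m x y e = Fin.toℕ-injective (trans (toℕ-modF m x) (trans e (sym (toℕ-modF m y))))

modF-toℕ : ∀ m (i : Fin (suc m)) → modF m (toℕ i) ≡ i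
modF-toℕ m i = Fin.toℕ-injective (trans (toℕ-modF m (toℕ i)) (m<n⇒m%n≡m (Fin.toℕ<n i)))

toℕ-modF-< : ∀ m {x} → x < suc m → toℕ (modF m x) ≡ x
toℕ-modF-< m {x} lt = trans (toℕ-modF m x) (m<n⇒m%n≡m lt)

module _ {𝔾 : FinGroup} where
  realises⇒count : ∀ {m k r s K n} .{{_ : NonZero K}} → verified (model m k r s K n) →
                   Realises 𝔾 (Metacyclic (suc m) (suc k) r s) → HasExactlyCyclicSubgroups (FinGroup.group 𝔾) n
  realises⇒count {m} {k} {r} {s} {K} {n} (ok , len) R = subst (HasExactlyCyclicSubgroups group) len
      (Sound.exactly 𝔾 e′ homo′ inj′ surj′ K (representatives K) ok)
    where
    open Check m k r s
    open FinGroup 𝔾 using (group; _∙_)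
    open Realises R
    dec : Code → Fin (suc m) × Fin (suc k)
    dec (a , i) = modF m a , modF k i
    e′ : Code → Fin (FinGroup.N 𝔾)
    e′ = e ∘ dec
    bounds : ∀ {a i} → (a , i) ∈ elements → a < suc m × i < suc k
    bounds q = let a , i = ∈-cartesianProduct⁻ (upTo (suc m)) (upTo (suc k)) q in ∈-upTo⁻ a , ∈-upTo⁻ i
    homo′ : ∀ {x y} → x ∈ elements → y ∈ elements → e′ (x · y) ≡ e′ x ∙ e′ y
    homo′ {a , i} {c , j} x∈ y∈ = trans (cong e (cong₂ _,_
        (trans (modF-≡ m ((a + r ^ i * c + s * ((i + j) / suc k)) % suc m) (a + r ^ i * c + s * ((i + j) / suc k)) (m%n%n≡m%n (a + r ^ i * c + s * ((i + j) / suc k)) (suc m)))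
          (cong (modF m) (cong₂ _+_ (cong₂ _+_ (sym a≡) (cong₂ _*_ (cong (r ^_) (sym i≡)) (sym c≡))) (cong (λ n → s * (n / suc k)) (cong₂ _+_ (sym i≡) (sym j≡))))))
        (trans (modF-≡ k ((i + j) % suc k) (i + j) (m%n%n≡m%n (i + j) (suc k))) (cong (modF k) (cong₂ _+_ (sym i≡) (sym j≡))))))
      (homo (dec (a , i)) (dec (c , j)))
      where
      a≡ = toℕ-modF-< m (proj₁ (bounds x∈))
      i≡ = toℕ-modF-< k (proj₂ (bounds x∈))
      c≡ = toℕ-modF-< m (proj₁ (bounds y∈))
      j≡ = toℕ-modF-< k (proj₂ (bounds y∈))
    inj′ : ∀ {x y} → x ∈ elements → y ∈ elements → e′ x ≡ e′ y → x ≡ y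
    inj′ {a , i} {c , j} x∈ y∈ q = let f = injective q in cong₂ _,_
      (trans (sym (toℕ-modF-< m (proj₁ (bounds x∈)))) (trans (cong (toℕ ∘ proj₁) f) (toℕ-modF-< m (proj₁ (bounds y∈)))))
      (trans (sym (toℕ-modF-< k (proj₂ (bounds x∈)))) (trans (cong (toℕ ∘ proj₂) f) (toℕ-modF-< k (proj₂ (bounds y∈)))))
    surj′ : ∀ g → ∃ λ x → x ∈ elements × e′ x ≡ g
    surj′ g = let (u , v) , q = surjective g in (toℕ u , toℕ v) , ∈-elements (Fin.toℕ<n u) (Fin.toℕ<n v) ,
      trans (cong e (cong₂ _,_ (modF-toℕ m u) (modF-toℕ k v))) q

-- From generators and relations to tables.

module Presentations (𝔾 : FinGroup) where
  open Powers 𝔾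

  ↑-%′ : ∀ {a n} .{{_ : NonZero n}} → ord a ≡ n → ∀ x → a ↑ x ≡ a ↑ (x % n)
  ↑-%′ {a} refl x = ↑-% a x

  -- `independent` makes k the least positive exponent with b ↑ k in ⟨a⟩; this keeps the m k normal
  -- forms distinct.
  record Presentation (m k r s : ℕ) : Set where
    field
      {a b}       : G
      ord-a       : ord a ≡ m
      b^k         : b ↑ k ≡ a ↑ s
      conj-r      : conj b a ≡ a ↑ r
      independent : ∀ j → j < k → b ↑ j ⊑ a → j ≡ 0
      generate    : ∀ g → ∃₂ λ i j → g ≡ a ↑ i ∙ b ↑ j

  present⇒realises : ∀ {m k r s} → Presentation (suc m) (suc k) r s → Realises 𝔾 (Metacyclic (suc m) (suc k) r s)
  present⇒realises {m} {k} {r} {s} P = record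
    { e = e ; e-cong = cong e ; homo = λ { (i , j) (c , l) → homo i j c l } ; injective = λ { {i , j} {c , l} → inj } ; surjective = surj }
    where
    open Presentation P
    e : Fin (suc m) × Fin (suc k) → G
    e (i , j) = a ↑ toℕ i ∙ b ↑ toℕ j
    a-% : ∀ x → a ↑ x ≡ a ↑ (x % suc m)
    a-% x = ↑-%′ ord-a x
    -- Multiples of k in the exponent of b are carried over to a by b ↑ k = a ↑ s.
    normal : ∀ i j → a ↑ i ∙ b ↑ j ≡ e (modF m (i + s * (j / suc k)) , modF k j)
    normal i j = begin
      a ↑ i ∙ b ↑ j                                                    ≡⟨ cong (λ n → a ↑ i ∙ b ↑ n) (trans (m≡m%n+[m/n]*n j (suc k)) (+-comm (j % suc k) _)) ⟩
      a ↑ i ∙ b ↑ (j / suc k * suc k + j % suc k)                      ≡⟨ cong (a ↑ i ∙_) (↑-+ b (j / suc k * suc k) (j % suc k)) ⟩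
      a ↑ i ∙ (b ↑ (j / suc k * suc k) ∙ b ↑ (j % suc k))              ≡⟨ assoc _ _ _ ⟨
      a ↑ i ∙ b ↑ (j / suc k * suc k) ∙ b ↑ (j % suc k)                ≡⟨ cong (λ v → a ↑ i ∙ v ∙ b ↑ (j % suc k)) (trans (↑-* b (j / suc k) (suc k)) (trans (cong (_↑ (j / suc k)) b^k) (sym (↑-*′ a s (j / suc k))))) ⟩
      a ↑ i ∙ a ↑ (s * (j / suc k)) ∙ b ↑ (j % suc k)                  ≡⟨ cong (_∙ b ↑ (j % suc k)) (sym (↑-+ a i (s * (j / suc k)))) ⟩
      a ↑ (i + s * (j / suc k)) ∙ b ↑ (j % suc k)                      ≡⟨ cong₂ (λ u v → u ∙ b ↑ v) (trans (a-% (i + s * (j / suc k))) (cong (a ↑_) (sym (toℕ-modF m (i + s * (j / suc k)))))) (sym (toℕ-modF k j)) ⟩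
      e (modF m (i + s * (j / suc k)) , modF k j)                      ∎
      where open ≡-Reasoning
    homo : ∀ i j c l → e (metaOp (suc m) (suc k) r s (i , j) (c , l)) ≡ e (i , j) ∙ e (c , l)
    homo i j c l = sym (trans (Twist.twist 𝔾 conj-r (toℕ i) (toℕ j) (toℕ c) (toℕ l)) (normal (toℕ i + r ^ toℕ j * toℕ c) (toℕ j + toℕ l)))
    half : ∀ {i j c l} → e (i , j) ≡ e (c , l) → toℕ j ≤ toℕ l → (i , j) ≡ (c , l)
    half {i} {j} {c} {l} q le = cong₂ _,_ i≡c j≡l
      where
      A = a ↑ toℕ i
      C = a ↑ toℕ c
      d = toℕ l ∸ toℕ j
      bd : b ↑ d ≡ C ⁻¹ ∙ A
      bd = ∙-cancelʳ (b ↑ toℕ j) _ _ (trans (sym (↑-+ b d (toℕ j))) (trans (cong (b ↑_) (m∸n+n≡m le))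
        (trans (word w0 (neg w1 :∙ (w1 :∙ w0)) (b ↑ toℕ l ∷ C ∷ C ∷ []) refl) (trans (cong (C ⁻¹ ∙_) (sym q)) (sym (assoc _ _ _))))))
      j≡l : j ≡ l
      j≡l = Fin.toℕ-injective (≤-antisym le (m∸n≡0⇒m≤n (independent d (≤-<-trans (m∸n≤m (toℕ l) (toℕ j)) (Fin.toℕ<n l))
        (subst (_⊑ a) (sym bd) (⊑-∙ (⊑-⁻¹ (⊑-↑ (toℕ c))) (⊑-↑ (toℕ i)))))))
      i≡c : i ≡ c
      i≡c = Fin.toℕ-injective (↑-injective {a} (lt i) (lt c) (∙-cancelʳ (b ↑ toℕ j) _ _ (trans q (cong (λ v → C ∙ b ↑ toℕ v) (sym j≡l)))))
        where
        lt : (i : Fin (suc m)) → toℕ i < ord a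
        lt i = subst (toℕ i <_) (sym ord-a) (Fin.toℕ<n i)
    inj : ∀ {i j c l} → e (i , j) ≡ e (c , l) → (i , j) ≡ (c , l)
    inj {i} {j} {c} {l} q = [ half q , (λ le → sym (half (sym q) le)) ]′ (≤-total (toℕ j) (toℕ l))
    surj : ∀ g → ∃ λ x → e x ≡ g
    surj g = let i , j , q = generate g in (modF m (i + s * (j / suc k)) , modF k j) , sym (trans q (normal i j))

  cyclic⇒realises : ∀ {n a} → ord a ≡ n → (∀ g → g ⊑ a) → Realises 𝔾 (ℤ/ n)
  cyclic⇒realises {zero} o _ = contradiction o (≢-nonZero⁻¹ _ {{ord-nonZero}})
  cyclic⇒realises {suc n} {a} o gen = record
    { e = λ i → a ↑ toℕ i ; e-cong = cong (λ i → a ↑ toℕ i)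
    ; homo = λ i j → trans (trans (cong (a ↑_) (toℕ-modF n (toℕ i + toℕ j))) (sym (a-% (toℕ i + toℕ j)))) (↑-+ a (toℕ i) (toℕ j))
    ; injective = λ {i} {j} q → Fin.toℕ-injective (↑-injective {a} (lt i) (lt j) q)
    ; surjective = λ g → let k , q = gen g in modF n k , trans (cong (a ↑_) (toℕ-modF n k)) (trans (sym (a-% k)) q) }
    where
    lt : (i : Fin (suc n)) → toℕ i < ord a
    lt i = subst (toℕ i <_) (sym o) (Fin.toℕ<n i)
    a-% : ∀ x → a ↑ x ≡ a ↑ (x % suc n)
    a-% x = ↑-%′ o x

  realises⇒cyclic : ∀ {n} → Realises 𝔾 (ℤ/ (suc n)) → ∃ λ a → ord a ≡ suc n × (∀ g → g ⊑ a)
  realises⇒cyclic {n} R = a , ord-unique a^n (λ {k} q → m%n≡0⇒n∣m k (suc n) (trans (sym (toℕ-modF n k)) (trans (cong toℕ (injective (trans (sym (power k)) (trans q (sym e0))))) (toℕ-modF n 0)))) ,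
      λ g → let u , q = surjective g in toℕ u , trans (power (toℕ u)) (trans (cong e (modF-toℕ n u)) q)
    where
    open Realises R
    a = e (modF n 1)
    e0 : e (modF n 0) ≡ ε
    e0 = ∙-cancelˡ (e (modF n 0)) _ _ (trans (sym (homo (modF n 0) (modF n 0))) (trans (cong e (modF-≡ n (toℕ (modF n 0) + toℕ (modF n 0)) 0 (cong (λ v → (v + v) % suc n) (toℕ-modF n 0)))) (sym (identityʳ _))))
    power : ∀ k → a ↑ k ≡ e (modF n k)
    power zero = sym e0
    power (suc k) = trans (cong (a ∙_) (power k)) (trans (sym (homo (modF n 1) (modF n k))) (cong e (modF-≡ n (toℕ (modF n 1) + toℕ (modF n k)) (suc k)
      (trans (cong₂ (λ u v → (u + v) % suc n) (toℕ-modF n 1) (toℕ-modF n k)) (sym (%-distribˡ-+ 1 k (suc n)))))))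
    a^n : a ↑ suc n ≡ ε
    a^n = trans (power (suc n)) (trans (cong e (modF-≡ n (suc n) 0 (n%n≡0 (suc n)))) e0)

  cyclic⇒count : ∀ {p a} n → Prime p → ord a ≡ p ^ n → (∀ g → g ⊑ a) → HasExactlyCyclicSubgroups group (suc n)
  cyclic⇒count {p} {a} n pr o gen = y ,
      (λ i j s → Fin.toℕ-injective (^-injective pr (trans (sym (y-ord i)) (trans (∼-ord (SameCyclic⇒∼ s)) (y-ord j))))) ,
      λ g → via g (∣p^⇒ pr n (subst (ord g ∣_) o (⊑-ord (gen g))))
    where
    open Membership 𝔾
    instance _ = prime⇒nonZero pr
    y : Fin (suc n) → G
    y i = a ↑ (p ^ (n ∸ toℕ i))
    y-ord : ∀ i → ord (y i) ≡ p ^ toℕ i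
    y-ord i = ord-↑ (p ^ (n ∸ toℕ i)) (p ^ toℕ i) {{p^≢0 pr (n ∸ toℕ i)}} (trans o (trans (cong (p ^_) (sym (m∸n+n≡m (s≤s⁻¹ (Fin.toℕ<n i))))) (^-distribˡ-+-* p (n ∸ toℕ i) (toℕ i))))
    via : ∀ g → (∃ λ j → ord g ≡ p ^ j) → ∃ λ i → SameCyclic group g (y i)
    via g (j , oj) = i , ∼⇒SameCyclic (⊑-unique-∼ (gen g) (⊑-↑ (p ^ (n ∸ toℕ i))) (trans oj (trans (cong (p ^_) (sym (Fin.toℕ-fromℕ< j<))) (sym (y-ord i)))))
      where
      j< : j < suc n
      j< = ≰⇒> λ n<j → contradiction (∣⇒≤ {{p^≢0 pr n}} (subst₂ _∣_ oj o (⊑-ord (gen g)))) (<⇒≱ (^-monoʳ-< p (prime>1 pr) n<j))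
      i = fromℕ< j<

-- The two direct products as metacyclic tables.

ℤ/27×ℤ/3 : Translation (Metacyclic 27 3 1 0) (ℤ/ 27 ×ᴹ ℤ/ 3)
ℤ/27×ℤ/3 = record
  { ψ = id ; ψ-cong = λ { refl → refl , refl }
  ; homo = λ { (a , i) (c , j) → cong (modF 26) (trans (+-identityʳ _) (cong (toℕ a +_) (trans (cong (_* toℕ c) (^-zeroˡ (toℕ i))) (*-identityˡ (toℕ c))))) , refl }
  ; injective = λ { (refl , refl) → refl } ; surjective = λ y → y , refl , refl }

ℤ/27×ℤ/3-laws : MagmaLaws (ℤ/ 27 ×ᴹ ℤ/ 3)
ℤ/27×ℤ/3-laws = record
  { isEquivalence = record { refl = refl , refl ; sym = λ (p , q) → sym p , sym q ; trans = λ (p , q) (p′ , q′) → trans p p′ , trans q q′ }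
  ; ∙-cong = λ { (refl , refl) (refl , refl) → refl , refl } }

ℤ/3×S₃-laws : MagmaLaws (ℤ/ 3 ×ᴹ S₃)
ℤ/3×S₃-laws = record
  { isEquivalence = record { refl = refl , λ _ → refl ; sym = λ (p , q) → sym p , (λ i → sym (q i)) ; trans = λ (p , q) (p′ , q′) → trans p p′ , λ i → trans (q i) (q′ i) }
  ; ∙-cong = λ { {_ , π} {_ , π′} {_ , ρ} {_ , ρ′} (refl , q) (refl , q′) → refl , λ i → trans (q′ (π ⟨$⟩ʳ i)) (cong (ρ′ ⟨$⟩ʳ_) (q i)) } }

-- The normal subgroup of order 3 of S₃ is complemented in ℤ/3 × S₃ by a cyclic group of order 6.
module S₃-table where
  rotation reflection : Permutation′ 3
  rotation   = transpose Fin.zero (Fin.suc Fin.zero) ∘ₚ transpose (Fin.suc Fin.zero) (Fin.suc (Fin.suc Fin.zero))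
  reflection = transpose Fin.zero (Fin.suc Fin.zero)

  _^ₚ_ : Permutation′ 3 → ℕ → Permutation′ 3
  π ^ₚ zero  = Perm.id
  π ^ₚ suc n = π ∘ₚ (π ^ₚ n)

  perm : Fin 3 × Fin 6 → Permutation′ 3
  perm (i , j) = (rotation ^ₚ toℕ i) ∘ₚ (reflection ^ₚ toℕ j)

  ψ : Fin 3 × Fin 6 → Fin 3 × Permutation′ 3
  ψ (i , j) = modF 2 (toℕ j) , perm (i , j)

  infix 4 _≈?_
  _≈?_ : ∀ x y → Dec (RawMagma._≈_ (ℤ/ 3 ×ᴹ S₃) x y)
  (u , π) ≈? (v , ρ) = (u Fin.≟ v) ×-dec Fin.all? λ i → (π ⟨$⟩ʳ i) Fin.≟ (ρ ⟨$⟩ʳ i)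

  all-pairs : {P : Fin 3 × Fin 6 → Set} → Decidable P → Dec (∀ x → P x)
  all-pairs P? = map′ (λ h (i , j) → h i j) (λ h i j → h (i , j)) (Fin.all? λ i → Fin.all? λ j → P? (i , j))

  homo : ∀ x y → RawMagma._≈_ (ℤ/ 3 ×ᴹ S₃) (ψ (metaOp 3 6 2 0 x y)) (RawMagma._∙_ (ℤ/ 3 ×ᴹ S₃) (ψ x) (ψ y))
  homo = toWitness {a? = all-pairs λ x → all-pairs λ y → ψ (metaOp 3 6 2 0 x y) ≈? RawMagma._∙_ (ℤ/ 3 ×ᴹ S₃) (ψ x) (ψ y)} tt

  injective : ∀ x y → RawMagma._≈_ (ℤ/ 3 ×ᴹ S₃) (ψ x) (ψ y) → x ≡ y
  injective = toWitness {a? = all-pairs λ x → all-pairs λ y → (ψ x ≈? ψ y) →-dec ≡-dec x y} tt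
    where
    ≡-dec : ∀ (x y : Fin 3 × Fin 6) → Dec (x ≡ y)
    ≡-dec (i , j) (k , l) = map′ (λ { (refl , refl) → refl }) (λ { refl → refl , refl }) ((i Fin.≟ k) ×-dec (j Fin.≟ l))

  -- Permutations as records of functions are not enumerated; their three values are, so
  -- surjectivity is checked on triples of distinct points.
  Hits : Fin 3 → Fin 3 → Fin 3 → Fin 3 → Set
  Hits u p q r = ∃ λ i → ∃ λ j → modF 2 (toℕ {6} j) ≡ u × perm (i , j) ⟨$⟩ʳ Fin.zero ≡ p ×
                   perm (i , j) ⟨$⟩ʳ Fin.suc Fin.zero ≡ q × perm (i , j) ⟨$⟩ʳ Fin.suc (Fin.suc Fin.zero) ≡ r

  onto : ∀ u p q r → p ≢ q → p ≢ r → q ≢ r → Hits u p q r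
  onto = toWitness {a? = Fin.all? λ u → Fin.all? λ p → Fin.all? λ q → Fin.all? λ r →
    ¬? (p Fin.≟ q) →-dec (¬? (p Fin.≟ r) →-dec (¬? (q Fin.≟ r) →-dec
      Fin.any? λ i → Fin.any? λ j → (modF 2 (toℕ {6} j) Fin.≟ u) ×-dec (perm (i , j) ⟨$⟩ʳ Fin.zero) Fin.≟ p ×-dec
        ((perm (i , j) ⟨$⟩ʳ Fin.suc Fin.zero) Fin.≟ q) ×-dec ((perm (i , j) ⟨$⟩ʳ Fin.suc (Fin.suc Fin.zero)) Fin.≟ r)))} tt

  surjective : ∀ y → ∃ λ x → RawMagma._≈_ (ℤ/ 3 ×ᴹ S₃) (ψ x) y
  surjective (u , π) = let i , j , a , b , c , d = onto u _ _ _ (ne λ ()) (ne λ ()) (ne λ ()) in (i , j) , a , λ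
      { Fin.zero → b ; (Fin.suc Fin.zero) → c ; (Fin.suc (Fin.suc Fin.zero)) → d }
    where
    ne : ∀ {x y} → x ≢ y → π ⟨$⟩ʳ x ≢ π ⟨$⟩ʳ y
    ne n e = n (trans (sym (Perm.inverseˡ π)) (trans (cong (π ⟨$⟩ˡ_) e) (Perm.inverseˡ π)))

  translation : Translation (Metacyclic 3 6 2 0) (ℤ/ 3 ×ᴹ S₃)
  translation = record { ψ = ψ ; ψ-cong = λ { refl → refl , λ _ → refl } ; homo = homo ; injective = λ {x} {y} → injective x y ; surjective = surjective }

-- Recognising the groups by their action exponents.

count-unique : ∀ {𝔾 c c′} → HasExactlyCyclicSubgroups (FinGroup.group 𝔾) c → HasExactlyCyclicSubgroups (FinGroup.group 𝔾) c′ → c ≡ c′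
count-unique {𝔾} H H′ = Fin.cantor-schröder-bernstein
    {f = λ i → C′.idx (C.gen i)} {g = λ i → C.idx (C′.gen i)}
    (λ e → C.gen-injective (C′.idx-∼ e)) (λ e → C′.gen-injective (C.idx-∼ e))
  where
  module C  = Classes 𝔾 H
  module C′ = Classes 𝔾 H′

residue-cong : ∀ {r q p} r′ q′ p′ .{{_ : NonZero p}} .{{_ : NonZero p′}} → r ≡ r′ → q ≡ q′ → p ≡ p′ → r ^ q % p ≡ 1 → r′ ^ q′ % p′ ≡ 1
residue-cong r q p refl refl refl e = e

module Recognition (𝔾 : FinGroup) where
  open Powers 𝔾
  open Parts 𝔾
  open Presentations 𝔾
  open Extension 𝔾 using (Split; ⊑a⇒ε; normal₂; normal₃)
  open Twist 𝔾

  ↑-reduce : ∀ {a n x y} .{{_ : NonZero n}} → ord a ≡ n → x % n ≡ y % n → a ↑ x ≡ a ↑ y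
  ↑-reduce {a} o e = trans (↑-%′ o _) (trans (cong (a ↑_) e) (sym (↑-%′ o _)))

  residue : ∀ {a b m} .{{_ : NonZero m}} → ord a ≡ m → conj b a ⊑ a → ∃ λ r → r < m × conj b a ≡ a ↑ r
  residue {m = m} o (s , e) = s % m , m%n<n s m , trans (sym e) (↑-%′ o s)

  -- Conjugation by b ↑ k is a ↦ a ↑ (r ^ k); when it is trivial, r ^ k is 1 modulo the order of a.
  residue-power : ∀ {a b m r} k .{{_ : NonZero m}} → 1 < m → ord a ≡ m → conj b a ≡ a ↑ r → Commute (b ↑ k) a → r ^ k % m ≡ 1
  residue-power {a} {b} {m} {r} k 1<m o e c = ↑-injective {a} (subst (r ^ k % m <_) (sym o) (m%n<n (r ^ k) m)) (subst (1 <_) (sym o) 1<m)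
    (trans (sym (↑-%′ o (r ^ k))) (trans (sym (conj-twist e k)) (trans (conj-commute c) (sym (x↑1 a)))))

  module _ {m k} (S : Split m k) (k-prime : Prime k) where
    open Split S

    b^k≡ε : b ↑ k ≡ ε
    b^k≡ε = ∣⇒↑≡ε (∣-reflexive ord-b)

    split-present : ∀ {r} → conj b a ≡ a ↑ r → Presentation m k r 0
    split-present e = record
      { ord-a = ord-a ; b^k = b^k≡ε ; conj-r = e
      ; independent = λ j j<k s → ↑-injective {b} (subst (j <_) (sym ord-b) j<k) (subst (0 <_) (sym ord-b) (prime>0 k-prime)) (⊑a⇒ε S k-prime (⊑-↑ j) s)
      ; generate = λ g → let i , j , q = Extension.generate 𝔾 S k-prime g in i , toℕ j , q }

  commute-coprime : ∀ {x y m n} → Coprime m n → Commute x (y ↑ m) → Commute x (y ↑ n) → Commute x y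
  commute-coprime {x} {y} {m} {n} c cm cn = via (coprime-bezout c)
    where
    cancel : ∀ {i j} → Commute x (y ↑ i) → Commute x (y ↑ j) → i ≡ 1 + j → Commute x y
    cancel {i} {j} ci cj refl = subst (Commute x) (word (w0 :∙ w1 :∙ neg w1) w0 (y ∷ y ↑ j ∷ x ∷ []) refl) (commute-∙ ci (commute-⁻¹ cj))
    mult : ∀ u {i} → Commute x (y ↑ i) → Commute x (y ↑ (u * i))
    mult u {i} ci = subst (Commute x) (sym (↑-* y u i)) (commute-↑ u ci)
    via : (∃₂ λ u v → u * m ≡ 1 + v * n ⊎ 1 + u * m ≡ v * n) → Commute x y
    via (u , v , inj₁ e) = cancel (mult u cm) (mult v cn) e
    via (u , v , inj₂ e) = cancel (mult v cn) (mult u cm) (sym e)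

  cube-roots : ∀ (r : Fin 27) → toℕ r ^ 3 % 27 ≡ 1 → toℕ r ≡ 1 ⊎ toℕ r ≡ 10 ⊎ toℕ r ≡ 19
  cube-roots = toWitness {a? = Fin.all? λ r → (toℕ r ^ 3 % 27 ≟ 1) →-dec ((toℕ r ≟ 1) ⊎-dec ((toℕ r ≟ 10) ⊎-dec (toℕ r ≟ 19)))} tt

  square-roots₈ : ∀ (r : Fin 8) → toℕ r ^ 2 % 8 ≡ 1 → toℕ r ≡ 1 ⊎ toℕ r ≡ 3 ⊎ toℕ r ≡ 5 ⊎ toℕ r ≡ 7
  square-roots₈ = toWitness {a? = Fin.all? λ r → (toℕ r ^ 2 % 8 ≟ 1) →-dec ((toℕ r ≟ 1) ⊎-dec ((toℕ r ≟ 3) ⊎-dec ((toℕ r ≟ 5) ⊎-dec (toℕ r ≟ 7))))} tt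

  square-roots₁₆ : ∀ (r : Fin 16) → toℕ r ^ 2 % 16 ≡ 1 → toℕ r ≡ 1 ⊎ toℕ r ≡ 7 ⊎ toℕ r ≡ 9 ⊎ toℕ r ≡ 15
  square-roots₁₆ = toWitness {a? = Fin.all? λ r → (toℕ r ^ 2 % 16 ≟ 1) →-dec ((toℕ r ≟ 1) ⊎-dec ((toℕ r ≟ 7) ⊎-dec ((toℕ r ≟ 9) ⊎-dec (toℕ r ≟ 15))))} tt

  power-residue : ∀ {m k} .{{_ : NonZero m}} (S : Split m k) → Prime k → 1 < m → let open Split S in conj b a ⊑ a →
                  ∃ λ (r : Fin m) → toℕ r ^ k % m ≡ 1 × conj b a ≡ a ↑ toℕ r
  power-residue {m} {k} S pr 1<m n = via (residue (Split.ord-a S) n)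
    where
    open Split S
    via : (∃ λ r → r < m × conj b a ≡ a ↑ r) → ∃ λ (r : Fin m) → toℕ r ^ k % m ≡ 1 × conj b a ≡ a ↑ toℕ r
    via (r , lt , e) = fromℕ< lt , residue-power k 1<m ord-a e′ (subst (λ v → Commute v a) (sym (b^k≡ε S pr)) (commute-sym commute-ε)) , e′
      where
      e′ : conj b a ≡ a ↑ toℕ (fromℕ< lt)
      e′ = trans e (cong (a ↑_) (sym (Fin.toℕ-fromℕ< lt)))

  order-81 : Split 27 3 → Presentation 27 3 1 0 ⊎ Presentation 27 3 10 0
  order-81 S = via (power-residue S prime[3] (s≤s (s≤s z≤n)) (normal₃ S (prime∤⇒coprime prime[2] (from-yes (¬? (2 ∣? 27))))))
    where
    open Split S
    via : (∃ λ (r : Fin 27) → toℕ r ^ 3 % 27 ≡ 1 × conj b a ≡ a ↑ toℕ r) → Presentation 27 3 1 0 ⊎ Presentation 27 3 10 0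
    via (r , c , e) = case cube-roots r c of λ
      { (inj₁ q) → inj₁ (split-present S prime[3] (subst (λ r → conj b a ≡ a ↑ r) q e))
      ; (inj₂ (inj₁ q)) → inj₂ (split-present S prime[3] (subst (λ r → conj b a ≡ a ↑ r) q e))
      -- 19² = 361 is 10 modulo 27, so the generator b² in place of b turns the exponent 19 into 10.
      ; (inj₂ (inj₂ q)) → inj₂ (split-present S² prime[3] (trans (conj-twist {r = 19} (subst (λ r → conj b a ≡ a ↑ r) q e) 2) (↑-reduce {a} {27} {361} {10} ord-a refl))) }
      where
      b⊑b² : b ⊑ b ↑ 2
      b⊑b² = ⊑-coprime {b} {2} {3} (prime∤⇒coprime prime[2] (from-yes (¬? (2 ∣? 3)))) (b^k≡ε S prime[3])
      S² : Split 27 3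
      S² = record { a = a ; b = b ↑ 2 ; ord-a = ord-a ; ord-b = ∣-antisym (subst (ord (b ↑ 2) ∣_) ord-b (⊑-ord (⊑-↑ 2))) (subst (_∣ ord (b ↑ 2)) ord-b (⊑-ord b⊑b²))
                  ; b⋢a = λ s → b⋢a (⊑-trans b⊑b² s) ; order = order }

  module NotEleven (H : HasExactlyCyclicSubgroups group 11) where
    -- The table of a candidate is counted by evaluation, and a group has only one number of cyclic
    -- subgroups.
    refute : ∀ {m k r s K n} .{{_ : NonZero K}} → verified (model m k r s K n) → n ≢ 11 → ¬ Presentation (suc m) (suc k) r s
    refute ok n≢11 P = n≢11 (count-unique {𝔾} (realises⇒count ok (present⇒realises P)) H)

    not-16 : ¬ Split 8 2
    not-16 S = via (power-residue S prime[2] (s≤s (s≤s z≤n)) (normal₂ S))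
      where
      open Split S
      via : (∃ λ (r : Fin 8) → toℕ r ^ 2 % 8 ≡ 1 × conj b a ≡ a ↑ toℕ r) → ⊥
      via (r , c , e) = case square-roots₈ r c of λ
        { (inj₁ q) → refute {7} {1} {1} {0} {8} {8} (refl , refl) (λ ()) (P q)
        ; (inj₂ (inj₁ q)) → refute {7} {1} {3} {0} {8} {10} (refl , refl) (λ ()) (P q)
        ; (inj₂ (inj₂ (inj₁ q))) → refute {7} {1} {5} {0} {8} {8} (refl , refl) (λ ()) (P q)
        ; (inj₂ (inj₂ (inj₂ q))) → refute {7} {1} {7} {0} {8} {12} (refl , refl) (λ ()) (P q) }
        where
        P : ∀ {r′} → toℕ r ≡ r′ → Presentation 8 2 r′ 0
        P q = split-present S prime[2] (subst (λ r → conj b a ≡ a ↑ r) q e)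

    not-32 : ¬ Split 16 2
    not-32 S = via (power-residue S prime[2] (s≤s (s≤s z≤n)) (normal₂ S))
      where
      open Split S
      via : (∃ λ (r : Fin 16) → toℕ r ^ 2 % 16 ≡ 1 × conj b a ≡ a ↑ toℕ r) → ⊥
      via (r , c , e) = case square-roots₁₆ r c of λ
        { (inj₁ q) → refute {15} {1} {1} {0} {16} {10} (refl , refl) (λ ()) (P q)
        ; (inj₂ (inj₁ q)) → refute {15} {1} {7} {0} {16} {17} (refl , refl) (λ ()) (P q)
        ; (inj₂ (inj₂ (inj₁ q))) → refute {15} {1} {9} {0} {16} {10} (refl , refl) (λ ()) (P q)
        ; (inj₂ (inj₂ (inj₂ q))) → refute {15} {1} {15} {0} {16} {21} (refl , refl) (λ ()) (P q) }
        where
        P : ∀ {r′} → toℕ r ≡ r′ → Presentation 16 2 r′ 0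
        P q = split-present S prime[2] (subst (λ r → conj b a ≡ a ↑ r) q e)

  -- The normal ⟨d⟩ is complemented by the cyclic group of b = s t, with b ↑ 3 = t and b ↑ 4 = s;
  -- conjugation by b inverts d.
  present-18 : ℤ₃×S₃ 𝔾 → Presentation 3 6 2 0
  present-18 D = record
    { ord-a = ord-d
    ; b^k = trans (∙-↑ 6 s-t) (trans (cong₂ _∙_ (∣⇒↑≡ε (subst (_∣ 6) (sym ord-s) (divides 2 refl))) (∣⇒↑≡ε (subst (_∣ 6) (sym ord-t) (divides 3 refl)))) (identityˡ ε))
    ; conj-r = trans (sym (conj-conj s t d)) (trans (cong (conj s) inverted) (conj-commute (commute-↑ 2 s-d)))
    ; independent = indep
    ; generate = gen }
    where
    open ℤ₃×S₃ D
    b = s ∙ t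
    b³ : b ↑ 3 ≡ t
    b³ = trans (∙-↑ 3 s-t) (trans (cong₂ _∙_ (∣⇒↑≡ε (∣-reflexive ord-s)) (trans (↑-reduce {t} {2} {3} {1} ord-t refl) (x↑1 t))) (identityˡ t))
    b⁴ : b ↑ 4 ≡ s
    b⁴ = trans (∙-↑ 4 s-t) (trans (cong₂ _∙_ (trans (↑-reduce {s} {3} {4} {1} ord-s refl) (x↑1 s)) (∣⇒↑≡ε (subst (_∣ 4) (sym ord-t) (divides 2 refl)))) (identityʳ s))
    s^⋢ : ∀ j → Coprime j 3 → ¬ b ↑ j ⊑ d
    s^⋢ j c q = independent (⊑-trans (⊑-coprime {s} {j} {3} c (∣⇒↑≡ε (∣-reflexive ord-s)))
      (subst (_⊑ d) (trans (↑-↑ b j 4) (cong (_↑ j) b⁴)) (⊑-trans (⊑-↑ 4) q)))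
    indep : ∀ j → j < 6 → b ↑ j ⊑ d → j ≡ 0
    indep 0 _ _ = refl
    indep 1 _ q = contradiction q (s^⋢ 1 (from-yes (Cop.coprime? 1 3)))
    indep 2 _ q = contradiction q (s^⋢ 2 (from-yes (Cop.coprime? 2 3)))
    indep 3 _ q = contradiction (subst₂ _∣_ ord-t ord-d (⊑-ord (subst (_⊑ d) b³ q))) (from-yes (¬? (2 ∣? 3)))
    indep 4 _ q = contradiction q (s^⋢ 4 (from-yes (Cop.coprime? 4 3)))
    indep 5 _ q = contradiction q (s^⋢ 5 (from-yes (Cop.coprime? 5 3)))
    indep (suc (suc (suc (suc (suc (suc _)))))) (s≤s (s≤s (s≤s (s≤s (s≤s (s≤s ())))))) _
    gen : ∀ g → ∃₂ λ i j → g ≡ d ↑ i ∙ b ↑ j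
    gen g = let i , j , k , q = generate g in j , 4 * i + 3 * k , trans q (begin
      s ↑ i ∙ (d ↑ j ∙ t ↑ k)             ≡⟨ assoc _ _ _ ⟨
      s ↑ i ∙ d ↑ j ∙ t ↑ k               ≡⟨ cong (_∙ t ↑ k) (commute-↑↑ i j s-d) ⟩
      d ↑ j ∙ s ↑ i ∙ t ↑ k               ≡⟨ assoc _ _ _ ⟩
      d ↑ j ∙ (s ↑ i ∙ t ↑ k)             ≡⟨ cong (d ↑ j ∙_) (cong₂ _∙_ (trans (cong (_↑ i) (sym b⁴)) (sym (↑-*′ b 4 i))) (trans (cong (_↑ k) (sym b³)) (sym (↑-*′ b 3 k)))) ⟩
      d ↑ j ∙ (b ↑ (4 * i) ∙ b ↑ (3 * k)) ≡⟨ cong (d ↑ j ∙_) (sym (↑-+ b (4 * i) (3 * k))) ⟩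
      d ↑ j ∙ b ↑ (4 * i + 3 * k)         ∎)
      where open ≡-Reasoning

  module FromSplitMetacyclic (D : SplitMetacyclic 𝔾) where
    open SplitMetacyclic D

    private instance _ = prime⇒nonZero p-prime

    ⊑z⇒ε : ∀ {v} → v ⊑ y → v ⊑ z → v ≡ ε
    ⊑z⇒ε {v} v⊑y v⊑z = ord≡1⇒ε (prime∤⇒coprime p-prime p∤ord-y (subst (ord v ∣_) ord-z (⊑-ord v⊑z) , ⊑-ord v⊑y))

    -- w is a generator of ⟨y⟩ chosen so that the exponent becomes the one of the listed table.
    present : ∀ {w n r} → ord w ≡ n → w ∼ y → conj w z ≡ z ↑ r → Presentation p n r 0
    present {w} {n} ow (w⊑y , s , sy) e = record
      { ord-a = ord-z ; b^k = ∣⇒↑≡ε (∣-reflexive ow) ; conj-r = e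
      ; independent = λ j j<n v → ↑-injective {w} (subst (j <_) (sym ow) j<n) ord>0 (⊑z⇒ε (⊑-trans (⊑-↑ j) w⊑y) v)
      ; generate = λ g → let i , j , q = generate g in i , s * j , trans q (cong (z ↑ i ∙_) (trans (cong (_↑ j) (sym sy)) (sym (↑-*′ w s j)))) }

    r^q : r ^ q % p ≡ 1
    r^q = residue-power q (prime>1 p-prime) ord-z conj-r (commute-sym conj-yq)

    r-power⇒commute : ∀ o → r ^ o % p ≡ 1 → Commute z (y ↑ o)
    r-power⇒commute o e = commute-sym (conj≡⇒commute (trans (conj-twist conj-r o) (trans (↑-%′ ord-z (r ^ o)) (trans (cong (z ↑_) e) (x↑1 z)))))

    -- Otherwise z would commute with two powers of y with coprime exponents, hence with y.
    not-coprime : ∀ o → r ^ o % p ≡ 1 → ¬ Coprime q o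
    not-coprime o e c = noncommuting (commute-coprime c conj-yq (r-power⇒commute o e))

    q-is : ∀ o → Prime o → r ^ o % p ≡ 1 → q ≡ o
    q-is o or e = case q ≟ o of λ { (yes h) → h ; (no n) → ⊥-elim (not-coprime o e (prime∤⇒coprime q-prime λ d → n (prime∣prime q-prime or d))) }

    r≢0 : r ≢ 0
    r≢0 e = ¬prime[1] (subst Prime (trans (sym ord-z) (trans (cong ord (conj-injective y (trans conj-r (trans (cong (z ↑_) e) (sym (conj-ε y)))))) ord-ε)) p-prime)

    r≢1 : r ≢ 1
    r≢1 e = noncommuting (commute-sym (conj≡⇒commute (trans conj-r (trans (cong (z ↑_) e) (x↑1 z)))))

    ord-y′ : ∀ {q′ b′ n} → q ≡ q′ → b ≡ b′ → q′ ^ b′ ≡ n → ord y ≡ n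
    ord-y′ refl refl e = trans ord-y e

  Result : Set
  Result = Presentation 14 2 13 7 ⊎ Presentation 7 9 2 0 ⊎ Presentation 5 8 4 0 ⊎ Presentation 3 16 2 0

  -- 11 = p + 2 b leaves (p, b) = (7, 2), (5, 3) and (3, 4), since 9 is not prime. Modulo p the
  -- exponent r has prime order q, so each value of r determines q, and with it the table up to the
  -- choice of a generator of ⟨y⟩.
  from-split-metacyclic : SplitMetacyclic 𝔾 → Result
  from-split-metacyclic D = by b refl
    where
    open SplitMetacyclic D
    open FromSplitMetacyclic D
    three : p ≡ 3 → b ≡ 4 → Result
    three p≡ b≡ = go r refl (subst (r <_) p≡ r<p)
      where
      instance _ = prime⇒nonZero p-prime
      go : ∀ n → r ≡ n → n < 3 → Result
      go 0 e _ = contradiction e r≢0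
      go 1 e _ = contradiction e r≢1
      go 2 e _ = inj₂ (inj₂ (inj₂ (subst (λ p → Presentation p 16 2 0) p≡
        (present (ord-y′ (q-is 2 prime[2] (mod e)) b≡ refl) ∼-refl (subst (λ r → conj y z ≡ z ↑ r) e conj-r)))))
        where
        mod : r ≡ 2 → r ^ 2 % p ≡ 1
        mod e = residue-cong {2} {2} {3} r 2 p (sym e) refl (sym p≡) refl
      go (suc (suc (suc _))) _ (s≤s (s≤s (s≤s ())))
    five : p ≡ 5 → b ≡ 3 → Result
    five p≡ b≡ = go r refl (subst (r <_) p≡ r<p)
      where
      instance _ = prime⇒nonZero p-prime
      mod : ∀ n o → n ^ o % 5 ≡ 1 → r ≡ n → r ^ o % p ≡ 1
      mod n o h e = residue-cong r o p (sym e) refl (sym p≡) h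
      -- 2 and 3 are primitive roots modulo 5: r ^ 4 = 1 forces q = 2, yet r ^ 2 is not 1.
      bad : ∀ n → n ^ 4 % 5 ≡ 1 → n ^ 2 % 5 ≢ 1 → r ≡ n → Result
      bad n e₄ e₂ e = case q ≟ 2 of λ
        { (yes h) → contradiction (residue-cong n 2 5 e h p≡ r^q) e₂
        ; (no h) → ⊥-elim (not-coprime 4 (mod n 4 e₄ e) (prime∤⇒coprime q-prime λ d → h ([ prime∣prime q-prime prime[2] , prime∣prime q-prime prime[2] ]′ (euclidsLemma 2 2 q-prime d)))) }
      go : ∀ n → r ≡ n → n < 5 → Result
      go 0 e _ = contradiction e r≢0
      go 1 e _ = contradiction e r≢1
      go 2 e _ = bad 2 refl (λ ()) e
      go 3 e _ = bad 3 refl (λ ()) e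
      go 4 e _ = inj₂ (inj₂ (inj₁ (subst (λ p → Presentation p 8 4 0) p≡
        (present (ord-y′ (q-is 2 prime[2] (mod 4 2 refl e)) b≡ refl) ∼-refl (subst (λ r → conj y z ≡ z ↑ r) e conj-r)))))
      go (suc (suc (suc (suc (suc _))))) _ (s≤s (s≤s (s≤s (s≤s (s≤s ())))))
    seven : p ≡ 7 → b ≡ 2 → Result
    seven p≡ b≡ = go r refl (subst (r <_) p≡ r<p)
      where
      instance _ = prime⇒nonZero p-prime
      oz : ord z ≡ 7
      oz = trans ord-z p≡
      mod : ∀ n o → n ^ o % 7 ≡ 1 → r ≡ n → r ^ o % p ≡ 1
      mod n o h e = residue-cong r o p (sym e) refl (sym p≡) h
      -- 3 and 5 are primitive roots modulo 7: r ^ 6 = 1 forces q = 2 or q = 3, yet neither power of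
      -- r is 1.
      bad : ∀ n → n ^ 6 % 7 ≡ 1 → n ^ 2 % 7 ≢ 1 → n ^ 3 % 7 ≢ 1 → r ≡ n → Result
      bad n e₆ e₂ e₃ e = case q ∣? 6 of λ
        { (yes d) → [ (λ d₂ → contradiction (with-q (prime∣prime q-prime prime[2] d₂)) e₂) , (λ d₃ → contradiction (with-q (prime∣prime q-prime prime[3] d₃)) e₃) ]′ (euclidsLemma 2 3 q-prime d)
        ; (no q∤6) → ⊥-elim (not-coprime 6 (mod n 6 e₆ e) (prime∤⇒coprime q-prime q∤6)) }
        where
        with-q : ∀ {o} → q ≡ o → n ^ o % 7 ≡ 1
        with-q h = residue-cong n _ 7 e h p≡ r^q
      frobenius : ∀ {w} → ord w ≡ 9 → w ∼ y → conj w z ≡ z ↑ 2 → Result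
      frobenius ow s e = inj₂ (inj₁ (subst (λ p → Presentation p 9 2 0) p≡ (present ow s e)))
      -- y² has order 2 and commutes with z, so x = z y² has order 14, with x ↑ 7 = y² and x ↑ 8 =
      -- z. Conjugation by y gives z⁶ y² = x ↑ 13.
      dicyclic : ord y ≡ 4 → conj y z ≡ z ↑ 6 → Commute z (y ↑ 2) → Presentation 14 2 13 7
      dicyclic oy e c = record { ord-a = trans (ord-∙ c cop) (cong₂ _*_ oz ou) ; b^k = sym x⁷ ; conj-r = conj-x ; independent = indep ; generate = gen }
        where
        u = y ↑ 2
        ou : ord u ≡ 2
        ou = ord-↑ 2 2 oy
        cop : Coprime (ord z) (ord u)
        cop = subst₂ Coprime (sym oz) (sym ou) (from-yes (Cop.coprime? 7 2))
        x = z ∙ u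
        x^ : ∀ n i j → n % 7 ≡ i % 7 → n % 2 ≡ j % 2 → x ↑ n ≡ z ↑ i ∙ u ↑ j
        x^ n i j a b = trans (∙-↑ n c) (cong₂ _∙_ (↑-reduce {z} {7} {n} {i} oz a) (↑-reduce {u} {2} {n} {j} ou b))
        x⁷ : x ↑ 7 ≡ y ↑ 2
        x⁷ = trans (x^ 7 0 1 refl refl) (trans (identityˡ _) (x↑1 u))
        conj-x : conj y x ≡ x ↑ 13
        conj-x = trans (conj-∙ y z u) (trans (cong₂ _∙_ e (trans (conj-commute (commute-↑ 2 refl)) (sym (x↑1 u)))) (sym (x^ 13 6 1 refl refl)))
        indep : ∀ j → j < 2 → y ↑ j ⊑ x → j ≡ 0
        indep 0 _ _ = refl
        indep 1 _ s = contradiction (commute-⊑ (commute-∙ refl c) (subst (_⊑ x) (x↑1 y) s)) noncommuting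
        indep (suc (suc _)) (s≤s (s≤s ())) _
        gen : ∀ g → ∃₂ λ i j → g ≡ x ↑ i ∙ y ↑ j
        gen g = let i , j , q = generate g in 8 * i , j , trans q (cong (_∙ y ↑ j) (trans (cong (_↑ i) (sym (trans (x^ 8 1 0 refl refl) (trans (identityʳ _) (x↑1 z))))) (sym (↑-*′ x 8 i))))
      go : ∀ n → r ≡ n → n < 7 → Result
      go 0 e _ = contradiction e r≢0
      go 1 e _ = contradiction e r≢1
      go 2 e _ = frobenius (ord-y′ (q-is 3 prime[3] (mod 2 3 refl e)) b≡ refl) ∼-refl (subst (λ r → conj y z ≡ z ↑ r) e conj-r)
      go 3 e _ = bad 3 refl (λ ()) (λ ()) e
      -- 4² = 16 is 2 modulo 7, so y² replaces y as generator.
      go 4 e _ = frobenius (trans (∼-ord y²∼y) oy) y²∼y (trans (conj-twist {r = 4} (subst (λ r → conj y z ≡ z ↑ r) e conj-r) 2) (↑-reduce {z} {7} {16} {2} oz refl))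
        where
        oy : ord y ≡ 9
        oy = ord-y′ (q-is 3 prime[3] (mod 4 3 refl e)) b≡ refl
        y²∼y : y ↑ 2 ∼ y
        y²∼y = ⊑-↑ 2 , ⊑-coprime {y} {2} {9} (prime∤⇒coprime prime[2] (from-yes (¬? (2 ∣? 9)))) (∣⇒↑≡ε (∣-reflexive oy))
      go 5 e _ = bad 5 refl (λ ()) (λ ()) e
      go 6 e _ = inj₁ (dicyclic (ord-y′ q≡2 b≡ refl) (subst (λ r → conj y z ≡ z ↑ r) e conj-r) (subst (λ q → Commute z (y ↑ q)) q≡2 conj-yq))
        where
        q≡2 : q ≡ 2
        q≡2 = q-is 2 prime[2] (mod 6 2 refl e)
      go (suc (suc (suc (suc (suc (suc (suc _))))))) _ (s≤s (s≤s (s≤s (s≤s (s≤s (s≤s (s≤s ())))))))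
    total : ∀ {n} → b ≡ n → 11 ≡ p + (n + n)
    total refl = subgroups
    by : ∀ n → b ≡ n → Result
    by 0 e = contradiction (subst (Commute z) (sym (ord≡1⇒ε (trans ord-y (cong (q ^_) e)))) commute-ε) noncommuting
    by 1 e = contradiction (subst Prime (sym (+-cancelʳ-≡ 2 9 p (total e))) p-prime) (from-yes (¬? (prime? 9)))
    by 2 e = seven (sym (+-cancelʳ-≡ 4 7 p (total e))) e
    by 3 e = five (sym (+-cancelʳ-≡ 6 5 p (total e))) e
    by 4 e = three (sym (+-cancelʳ-≡ 8 3 p (total e))) e
    by (suc (suc (suc (suc (suc n))))) e = contradiction (≤-trans (+-mono-≤ p≥3 (+-mono-≤ (m≤m+n 5 n) (m≤m+n 5 n))) (≤-reflexive (sym (total e)))) (<⇒≱ (m≤m+n 12 1))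

-- The classification on `Fin N`.

module _ (𝔾 : FinGroup) where
  open Powers 𝔾 using (ord; _⊑_)
  open Presentations 𝔾

  Outcome : Set
  Outcome = (∃ λ p → Prime p × ∃ λ a → ord a ≡ p ^ 10 × (∀ g → g ⊑ a))
          ⊎ Presentation 27 3 1 0 ⊎ Presentation 27 3 10 0 ⊎ Presentation 14 2 13 7 ⊎ Presentation 7 9 2 0
          ⊎ Presentation 3 6 2 0 ⊎ Presentation 5 8 4 0 ⊎ Presentation 3 16 2 0

module Classification (𝔾 : FinGroup) (H : HasExactlyCyclicSubgroups (FinGroup.group 𝔾) 11) where
  open Powers 𝔾
  open Parts 𝔾
  open Presentations 𝔾
  open Recognition 𝔾
  open NotEleven H
  open Classes 𝔾 H using (gen-injective)

  -- Without elements of prime order every element would be ε, and two of the eleven subgroups would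
  -- coincide.
  nontrivial : ∃ λ z → Prime (ord z)
  nontrivial = case Fin.any? (λ z → prime? (ord z)) of λ
    { (yes h) → h
    ; (no n) → contradiction (gen-injective {Fin.zero} {Fin.suc Fin.zero} (subst₂ _∼_ (sym (trivial n _)) (sym (trivial n _)) ∼-refl)) λ () }
    where
    trivial : ¬ (∃ λ z → Prime (ord z)) → ∀ x → x ≡ ε
    trivial n x = case ord x ≟ 1 of λ
      { (yes o) → ord≡1⇒ε o
      ; (no o≢1) → let q , pr , d = primeDivisor (ord x) (≤∧≢⇒< ord>0 (o≢1 ∘ sym)) ; v , _ , ov = power-⊑ d in
          contradiction (v , subst Prime (sym ov) pr) n }

  from-p-group : ∀ {p} → Prime p → (∀ x → IsPower p (ord x)) → Outcome 𝔾
  from-p-group {p} pr pow = via (PGroupClassification.p-group 𝔾 H pr pow)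
    where
    via : PGroupClassification.Result 𝔾 H p → Outcome 𝔾
    via (inj₁ C)                      = inj₁ (p , pr , C)
    via (inj₂ (inj₁ S))               = inj₂ ([ inj₁ , inj₂ ∘ inj₁ ]′ (order-81 S))
    via (inj₂ (inj₂ (inj₁ S)))        = contradiction S not-16
    via (inj₂ (inj₂ (inj₂ S)))        = contradiction S not-32

  from-two-primes : ∀ {p q a b} → Prime p → Prime q → p ≢ q → ord a ≡ p → ord b ≡ q → Outcome 𝔾
  from-two-primes {p} {q} pr qr ne oa ob = via (case <-cmp p q of λ
      { (tri< lt _ _) → NonPGroup.classify 𝔾 H pr qr lt oa ob
      ; (tri≈ _ e _)  → contradiction e ne
      ; (tri> _ _ gt) → NonPGroup.classify 𝔾 H qr pr gt ob oa })
    where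
    via : SplitMetacyclic 𝔾 ⊎ ℤ₃×S₃ 𝔾 → Outcome 𝔾
    via (inj₁ D) = [ inj₂ ∘ inj₂ ∘ inj₂ ∘ inj₁ , [ inj₂ ∘ inj₂ ∘ inj₂ ∘ inj₂ ∘ inj₁ ,
      inj₂ ∘ inj₂ ∘ inj₂ ∘ inj₂ ∘ inj₂ ∘ inj₂ ]′ ]′ (from-split-metacyclic D)
    via (inj₂ D) = inj₂ (inj₂ (inj₂ (inj₂ (inj₂ (inj₁ (present-18 D))))))

  classify : Outcome 𝔾
  classify = from nontrivial
    where
    from : (∃ λ z → Prime (ord z)) → Outcome 𝔾
    from (z , pr) = case Fin.all? (λ x → isPower? pr (ord x)) of λ
      { (yes pow) → from-p-group pr pow
      ; (no n)    → mixed (Fin.¬∀⟶∃¬ _ _ (λ x → isPower? pr (ord x)) n) }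
      where
      mixed : (∃ λ x → ¬ IsPower (ord z) (ord x)) → Outcome 𝔾
      mixed (x , n) = case Fin.any? (λ v → prime? (ord v) ×-dec ¬? (ord z ≟ ord v)) of λ
        { (yes (v , vp , ne)) → from-two-primes pr vp ne refl refl
        ; (no none) → contradiction (only-prime⇒power (ord z) (ord x) {{ord-nonZero}} λ {q} qr d → unique none qr d) n }
        where
        unique : ¬ (∃ λ v → Prime (ord v) × ord z ≢ ord v) → ∀ {q} → Prime q → q ∣ ord x → q ≡ ord z
        unique none {q} qr d = case q ≟ ord z of λ
          { (yes e) → e
          ; (no q≢z) → let v , _ , ov = power-⊑ d in contradiction (v , subst Prime (sym ov) qr , λ e → q≢z (trans (sym ov) (sym e))) none }

-- Transfer between a finite group and its table.

module _ {c ℓ} (A : Group c ℓ) where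
  open Group A using (_≈_; ∙-cong; ⁻¹-cong) renaming (refl to ≈-refl; trans to ≈-trans; sym to ≈-sym)

  powℕ-cong : ∀ {x y} → x ≈ y → ∀ n → powℕ A x n ≈ powℕ A y n
  powℕ-cong e zero    = ≈-refl
  powℕ-cong e (suc n) = ∙-cong e (powℕ-cong e n)

  powℤ-cong : ∀ {x y} → x ≈ y → ∀ z → powℤ A x z ≈ powℤ A y z
  powℤ-cong e (ℤ.+ n)      = powℕ-cong e n
  powℤ-cong e (ℤ.-[1+ n ]) = ⁻¹-cong (powℕ-cong e (suc n))

  ∈⟨⟩-cong : ∀ {x x′ y y′} → x ≈ x′ → y ≈ y′ → _∈⟨_⟩ A x y → _∈⟨_⟩ A x′ y′
  ∈⟨⟩-cong e f (z , q) = z , ≈-trans (≈-sym e) (≈-trans q (powℤ-cong f z))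

module _ {a ℓ b m} {A : Group a ℓ} {B : Group b m} where
  private
    module A = Group A
    module B = Group B
  open GroupMorphisms A.rawGroup B.rawGroup using (IsGroupHomomorphism)

  module _ {f} (h : IsGroupHomomorphism f) where
    private module h = IsGroupHomomorphism h

    powℕ-homo : ∀ x n → f (powℕ A x n) B.≈ powℕ B (f x) n
    powℕ-homo x zero    = h.ε-homo
    powℕ-homo x (suc n) = B.trans (h.homo x _) (B.∙-congˡ (powℕ-homo x n))

    powℤ-homo : ∀ x z → f (powℤ A x z) B.≈ powℤ B (f x) z
    powℤ-homo x (ℤ.+ n)      = powℕ-homo x n
    powℤ-homo x (ℤ.-[1+ n ]) = B.trans (h.⁻¹-homo _) (B.⁻¹-cong (powℕ-homo x (suc n)))

    ∈⟨⟩-map : ∀ {x y} → _∈⟨_⟩ A x y → _∈⟨_⟩ B (f x) (f y)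
    ∈⟨⟩-map (z , e) = z , B.trans (h.⟦⟧-cong e) (powℤ-homo _ z)

module _ {a ℓ b m} {A : Group a ℓ} {B : Group b m} where
  private
    module A = Group A
    module B = Group B
    module A→B = GroupMorphisms A.rawGroup B.rawGroup
    module B→A = GroupMorphisms B.rawGroup A.rawGroup

  -- Both homomorphisms preserve membership in cyclic subgroups; being mutually inverse, they also
  -- reflect it.
  transport-count : ∀ {f g n} → A→B.IsGroupHomomorphism f → B→A.IsGroupHomomorphism g →
                    (∀ x → f (g x) B.≈ x) → (∀ x → g (f x) A.≈ x) →
                    HasExactlyCyclicSubgroups A n → HasExactlyCyclicSubgroups B n
  transport-count {f} {g} hf hg fg gf (gen , distinct , cover) =
      (λ i → f (gen i)) , (λ i j s → distinct i j λ k → reflect (λ q → proj₁ (s (f k)) q) , reflect (λ q → proj₂ (s (f k)) q)) ,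
      λ y → let i , s = cover (g y) in i , λ k →
        (λ q → ∈⟨⟩-cong B (fg k) B.refl (∈⟨⟩-map {A = A} {B} hf (proj₁ (s (g k)) (∈⟨⟩-map {A = B} {A} hg q)))) ,
        (λ q → ∈⟨⟩-cong B (fg k) (fg y) (∈⟨⟩-map {A = A} {B} hf (proj₂ (s (g k)) (∈⟨⟩-cong A A.refl (gf _) (∈⟨⟩-map {A = B} {A} hg q)))))
    where
    reflect : ∀ {k x y} → (_∈⟨_⟩ B (f k) (f x) → _∈⟨_⟩ B (f k) (f y)) → _∈⟨_⟩ A k x → _∈⟨_⟩ A k y
    reflect s q = ∈⟨⟩-cong A (gf _) (gf _) (∈⟨⟩-map {A = B} {A} hg (s (∈⟨⟩-map {A = A} {B} hf q)))

-- On `Fin N` with propositional equality every quantifier over the group becomes a decidable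
-- search, which the case distinctions rely on.
module Table {c ℓ} (G : Group c ℓ) (finite : IsFiniteGroup G) where
  open Group G renaming (refl to ≈-refl; sym to ≈-sym; trans to ≈-trans; reflexive to ≈-reflexive)
  open Inverse (proj₂ finite) using (to; from; from-cong; strictlyInverseˡ; strictlyInverseʳ)

  𝔾 : FinGroup
  𝔾 = record
    { N = proj₁ finite ; _∙_ = λ i j → from (to i ∙ to j) ; ε = from ε ; _⁻¹ = λ i → from (to i ⁻¹)
    ; isGroup = record
      { isMonoid = record
        { isSemigroup = record
          { isMagma = ≡-laws _
          ; assoc = λ i j k → from-cong (≈-trans (∙-congʳ (strictlyInverseˡ _)) (≈-trans (assoc _ _ _) (≈-sym (∙-congˡ (strictlyInverseˡ _))))) }
        ; identity = (λ i → trans (from-cong (≈-trans (∙-congʳ (strictlyInverseˡ _)) (identityˡ _))) (strictlyInverseʳ i))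
                   , (λ i → trans (from-cong (≈-trans (∙-congˡ (strictlyInverseˡ _)) (identityʳ _))) (strictlyInverseʳ i)) }
      ; inverse = (λ i → from-cong (≈-trans (∙-congʳ (strictlyInverseˡ _)) (inverseˡ _)))
                , (λ i → from-cong (≈-trans (∙-congˡ (strictlyInverseˡ _)) (inverseʳ _)))
      ; ⁻¹-cong = cong λ i → from (to i ⁻¹) } }

  open FinGroup 𝔾 using () renaming (group to table)

  to-homo : GroupMorphisms.IsGroupHomomorphism (Group.rawGroup table) rawGroup to
  to-homo = record
    { isMonoidHomomorphism = record
      { isMagmaHomomorphism = record
        { isRelHomomorphism = record { cong = λ { refl → ≈-refl } }
        ; homo = λ i j → strictlyInverseˡ _ }
      ; ε-homo = strictlyInverseˡ _ }
    ; ⁻¹-homo = λ i → strictlyInverseˡ _ }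

  from-homo : GroupMorphisms.IsGroupHomomorphism rawGroup (Group.rawGroup table) from
  from-homo = record
    { isMonoidHomomorphism = record
      { isMagmaHomomorphism = record
        { isRelHomomorphism = record { cong = from-cong }
        ; homo = λ x y → from-cong (≈-sym (∙-cong (strictlyInverseˡ x) (strictlyInverseˡ y))) }
      ; ε-homo = refl }
    ; ⁻¹-homo = λ x → from-cong (≈-sym (⁻¹-cong (strictlyInverseˡ x))) }

  to-iso : MagmaMorphisms.IsMagmaIsomorphism (Group.rawMagma table) rawMagma to
  to-iso = record
    { isMagmaMonomorphism = record
      { isMagmaHomomorphism = GroupMorphisms.IsGroupHomomorphism.isMagmaHomomorphism to-homo
      ; injective = λ {i} {j} e → trans (sym (strictlyInverseʳ i)) (trans (from-cong e) (strictlyInverseʳ j)) }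
    ; surjective = λ x → from x , λ { refl → strictlyInverseˡ x } }

  from-iso : MagmaMorphisms.IsMagmaIsomorphism rawMagma (Group.rawMagma table) from
  from-iso = record
    { isMagmaMonomorphism = record
      { isMagmaHomomorphism = GroupMorphisms.IsGroupHomomorphism.isMagmaHomomorphism from-homo
      ; injective = λ {x} {y} e → ≈-trans (≈-sym (strictlyInverseˡ x)) (≈-trans (≈-reflexive (cong to e)) (strictlyInverseˡ y)) }
    ; surjective = λ i → to i , λ e → trans (from-cong e) (strictlyInverseʳ i) }

  count⇒ : ∀ {n} → HasExactlyCyclicSubgroups G n → HasExactlyCyclicSubgroups table n
  count⇒ = transport-count {A = G} {table} from-homo to-homo strictlyInverseʳ strictlyInverseˡ

  count⇐ : ∀ {n} → HasExactlyCyclicSubgroups table n → HasExactlyCyclicSubgroups G n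
  count⇐ = transport-count {A = table} {G} to-homo from-homo strictlyInverseˡ strictlyInverseʳ

  module _ {M : RawMagma 0ℓ 0ℓ} (laws : MagmaLaws M) where
    ≅⇒ : G ≅ M → Realises 𝔾 M
    ≅⇒ (φ , iso) = ≅⇒realises laws (_ , Composition.isMagmaIsomorphism (IsMagma.trans laws) to-iso iso)

    ≅⇐ : Realises 𝔾 M → G ≅ M
    ≅⇐ R = let φ , iso = realises⇒≅ R in _ , Composition.isMagmaIsomorphism (IsMagma.trans laws) from-iso iso

theorem1p1 : ∀ {c ℓ : Level} (G : Group c ℓ) → IsFiniteGroup G →
    (HasExactlyCyclicSubgroups G 11 ⇔
    ((Σ ℕ λ p → Prime p × (G ≅ ℤ/ (p ^ 10)))
    ⊎ (G ≅ (ℤ/ 27 ×ᴹ ℤ/ 3))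
    ⊎ (G ≅ Semidirect 27 3 10)
    ⊎ (G ≅ Dic 7)
    ⊎ (G ≅ Semidirect 7 9 2)
    ⊎ (G ≅ (ℤ/ 3 ×ᴹ S₃))
    ⊎ (G ≅ Semidirect 5 8 4)
    ⊎ (G ≅ Semidirect 3 16 2)))
theorem1p1 G finite = mk⇔ (λ H → forward (Classification.classify 𝔾 (count⇒ H))) backward
  where
  open Table G finite
  open Presentations 𝔾
  Listed : Set _
  Listed = (Σ ℕ λ p → Prime p × (G ≅ ℤ/ (p ^ 10)))
    ⊎ (G ≅ (ℤ/ 27 ×ᴹ ℤ/ 3))
    ⊎ (G ≅ Semidirect 27 3 10)
    ⊎ (G ≅ Dic 7)
    ⊎ (G ≅ Semidirect 7 9 2)
    ⊎ (G ≅ (ℤ/ 3 ×ᴹ S₃))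
    ⊎ (G ≅ Semidirect 5 8 4)
    ⊎ (G ≅ Semidirect 3 16 2)
  forward : Outcome 𝔾 → Listed
  forward (inj₁ (p , pr , a , oa , gen)) = inj₁ (p , pr , ≅⇐ (≡-laws _) (cyclic⇒realises oa gen))
  forward (inj₂ (inj₁ P)) = inj₂ (inj₁ (≅⇐ ℤ/27×ℤ/3-laws (push-forward ℤ/27×ℤ/3 ℤ/27×ℤ/3-laws (present⇒realises P))))
  forward (inj₂ (inj₂ (inj₁ P))) = inj₂ (inj₂ (inj₁ (≅⇐ (≡-laws _) (present⇒realises P))))
  forward (inj₂ (inj₂ (inj₂ (inj₁ P)))) = inj₂ (inj₂ (inj₂ (inj₁ (≅⇐ (≡-laws _) (present⇒realises P)))))
  forward (inj₂ (inj₂ (inj₂ (inj₂ (inj₁ P))))) = inj₂ (inj₂ (inj₂ (inj₂ (inj₁ (≅⇐ (≡-laws _) (present⇒realises P))))))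
  forward (inj₂ (inj₂ (inj₂ (inj₂ (inj₂ (inj₁ P)))))) = inj₂ (inj₂ (inj₂ (inj₂ (inj₂ (inj₁ (≅⇐ ℤ/3×S₃-laws (push-forward S₃-table.translation ℤ/3×S₃-laws (present⇒realises P))))))))
  forward (inj₂ (inj₂ (inj₂ (inj₂ (inj₂ (inj₂ (inj₁ P))))))) = inj₂ (inj₂ (inj₂ (inj₂ (inj₂ (inj₂ (inj₁ (≅⇐ (≡-laws _) (present⇒realises P))))))))
  forward (inj₂ (inj₂ (inj₂ (inj₂ (inj₂ (inj₂ (inj₂ P))))))) = inj₂ (inj₂ (inj₂ (inj₂ (inj₂ (inj₂ (inj₂ (≅⇐ (≡-laws _) (present⇒realises P))))))))
  -- p ^ 10 does not match a successor, so the modulus is a variable m equal to it.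
  cyclic : ∀ {m p} → Prime p → m ≡ p ^ 10 → Realises 𝔾 (ℤ/ m) → HasExactlyCyclicSubgroups G 11
  cyclic {zero} {p} pr e _ = contradiction (sym e) (≢-nonZero⁻¹ (p ^ 10) {{p^≢0 pr 10}})
  cyclic {suc m} pr e R = let a , oa , gen = realises⇒cyclic R in count⇐ (cyclic⇒count 10 pr (trans oa e) gen)
  backward : Listed → HasExactlyCyclicSubgroups G 11
  backward (inj₁ (p , pr , iso)) = cyclic pr refl (≅⇒ (≡-laws _) iso)
  backward (inj₂ (inj₁ iso)) = count⇐ (realises⇒count {m = 26} {2} {1} {0} {27} verified₁ (pull ℤ/27×ℤ/3 (≅⇒ ℤ/27×ℤ/3-laws iso)))
  backward (inj₂ (inj₂ (inj₁ iso))) = count⇐ (realises⇒count {m = 26} {2} {10} {0} {27} verified₂ (≅⇒ (≡-laws _) iso))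
  backward (inj₂ (inj₂ (inj₂ (inj₁ iso)))) = count⇐ (realises⇒count {m = 13} {1} {13} {7} {28} verified₃ (≅⇒ (≡-laws _) iso))
  backward (inj₂ (inj₂ (inj₂ (inj₂ (inj₁ iso))))) = count⇐ (realises⇒count {m = 6} {8} {2} {0} {63} verified₄ (≅⇒ (≡-laws _) iso))
  backward (inj₂ (inj₂ (inj₂ (inj₂ (inj₂ (inj₁ iso)))))) = count⇐ (realises⇒count {m = 2} {5} {2} {0} {6} verified₅ (pull S₃-table.translation (≅⇒ ℤ/3×S₃-laws iso)))
  backward (inj₂ (inj₂ (inj₂ (inj₂ (inj₂ (inj₂ (inj₁ iso))))))) = count⇐ (realises⇒count {m = 4} {7} {4} {0} {40} verified₆ (≅⇒ (≡-laws _) iso))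
  backward (inj₂ (inj₂ (inj₂ (inj₂ (inj₂ (inj₂ (inj₂ iso))))))) = count⇐ (realises⇒count {m = 2} {15} {2} {0} {48} verified₇ (≅⇒ (≡-laws _) iso))
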